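{- Let $m \in \{3,5,7,11\}$, and let $k_m = 5$ if $m=3$ and $k_m = m-2$ if $m>3$. Let $\ell$ be an odd prime such that $\ell^{k_m-2} \equiv -1 \pmod m$. Then $$\overline{p}\left(m \ell^3 n\right) \equiv 0 \pmod m$$ for every positive integer $n$ prime to $\ell$.
   Context: $\overline{p}(n)$ denotes the number of overpartitions of $n$; its generating function is $\sum_{n\ge0}\overline{p}(n)q^n=\prod_{n\ge1}\frac{1+q^n}{1-q^n}$. -}

module Defs where

open import Data.Nat using (ℕ; zero; suc; _+_; _∸_; _<ᵇ_)
open import Data.Bool using (if_then_else_)

Series : Set
Series = ℕ → ℕ

one : Series
one zero    = 1
one (suc _) = 0

mul1+ : ℕ → Series → Series
mul1+ k a j = if j <ᵇ k then a j else a j + a (j ∸ k)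

-- Multiply a series by 1/(1 - q^k) = Σ_{i≥0} q^{ik}, for k ≥ 1 (here k = suc k'):
-- coefficient j becomes Σ_{i ≥ 0, ik ≤ j} a(j - ik).  Defined with a fuel bound j.
geomSum : ℕ → ℕ → Series → ℕ → ℕ
geomSum k zero     a j = a j
geomSum k (suc f)  a j = if j <ᵇ k then a j else a j + geomSum k f a (j ∸ k)

mul1/1- : ℕ → Series → Series
mul1/1- k a j = geomSum k j a j

partialProd : ℕ → Series
partialProd zero    = one
partialProd (suc N) = mul1/1- (suc N) (mul1+ (suc N) (partialProd N))

-- Number of overpartitions of n: the coefficient of q^n in
-- ∏_{k≥1} (1+q^k)/(1-q^k); factors with k > n do not affect it.
overpartition : ℕ → ℕ
overpartition n = partialProd n n

kOf : ℕ → ℕ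
kOf 3 = 5
kOf m = m ∸ 2

{-# OPTIONS --safe #-}
module Submission where

-- Let h(q) = Σ (-1)^n p̄(n) q^n, so that h = 1/φ for φ = Σ q^(b²) by Gauss, and let U send Σ x(n) q^n to
-- Σ x(mn) q^n. Modulo m one has φ U(h) = U(φ^(m-1)), and U is a Cartier operator on the ring of theta
-- functions generated by u = φ² and c = φ(q)⁴ - φ(-q)⁴: it is computed on monomials by exactness of
-- q d/dq, after inserting powers of the Hasse invariant of the Legendre family (which is 1 modulo m) and
-- of b = φ(-q)⁴. This yields U(h) ≡ φ⁵, φ³, φ(φ⁴ + 5c), φ(8 E₄(q) + 4 E₄(q⁴)) for m = 3, 5, 7, 11.
--
-- Each of these is φ times a combination of divisor sums, so for nonsquare N its coefficient is a
-- combination of the sums Σ ω(a) over indefinite forms aX² + bXY - cY², a, c > 0, of discriminant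
-- D = 4N or D = N, with ω(a) = a, a³ or χ₋₄(a). For ω homogeneous the sum Z satisfies
-- Z(ℓ²D) = (1 + ℓκ) Z(D) when ℓ divides D exactly once, with 1 + ℓκ = 1 + ℓ³, 1 + ℓ⁷ or 1 + ℓ: forms of
-- discriminant ℓ²D are split according to the sublattice of index ℓ they come from, and each part is evaluated
-- by counting with weight the forms that cross the segments of a Euclidean algorithm in Conway's topograph.
-- With N = ℓ³n this factor is divisible by m.

-- Classically, φ times an Eisenstein series is a Hecke eigenform of half-integral weight. Its
-- coefficients are the sums of Cohen and Zagier over indefinite forms, and the eigenvalue rests on
-- period polynomials: for nonsquare D and Q = aX² + bXY - cY² with a, c > 0, the sum of
-- Q(x,-y)^(k-1) is, up to a multiple of x^(2k-2) - y^(2k-2), the even period polynomial of a cusp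
-- form of weight 2k. Level one has no cusp forms of weight 4 or 8, so for the exponents 1 and 3
-- only that multiple is left; it is the origin of κ. Square discriminants are the obstacle: there a
-- form can vanish at a rational point and a boundary term survives. At N = ℓ³n none does, since ℓ
-- occurs to an odd power. At squares the boundary term matches the coefficient 2 of φ, so the same
-- identities also prove Jacobi's formulas for two and four squares. Identities between theta
-- functions are proved by descent along q ↦ q²: the defect of an identity is related to its own
-- value at q², which forces its coefficients to vanish one after the other.

import Data.Integer
open import Data.Nat using (ℕ)
open import Data.Nat.Coprimality using (Coprime)
open import Data.Nat.Primality using (Prime)
open import Defs using (one; mul1+; geomSum; mul1/1-; partialProd; overpartition)
open import Relation.Binary.PropositionalEquality using (_≡_; _≢_)

-- Finite sums indexed by predicates

module FiniteSums where
  open import Data.Integer using (ℤ; 0ℤ; _+_; _*_)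
  import Data.Integer.Properties as ℤ
  open import Data.Integer.Tactic.RingSolver using (solve-∀)
  open import Data.List using (List; []; _∷_; map; filter; deduplicate; _++_)
  open import Data.List.Membership.Propositional using (_∈_)
  open import Data.List.Membership.Propositional.Properties
    using (∈-filter⁺; ∈-filter⁻; ∈-map⁺; ∈-map⁻; ∈-deduplicate⁺; ∈-++⁺ˡ; ∈-++⁺ʳ; ∈-++⁻)
  open import Data.List.Membership.Propositional.Properties.WithK using (unique∧set⇒bag)
  open import Data.List.Relation.Binary.BagAndSetEquality using (∼bag⇒↭)
  open import Data.List.Relation.Binary.Permutation.Propositional
    using (_↭_; prep; swap)
  open import Data.List.Relation.Unary.All as All using (All; []; _∷_)
  import Data.List.Relation.Unary.All.Properties as All
  open import Data.List.Relation.Unary.AllPairs using ([]; _∷_)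
  open import Data.List.Relation.Unary.Any using (here; there)
  open import Data.List.Relation.Unary.Unique.Propositional using (Unique)
  import Data.List.Relation.Unary.Unique.Propositional.Properties as Unique
  import Data.List.Relation.Unary.Unique.DecPropositional.Properties as DecUnique
  open import Data.Product using (_×_; _,_; proj₁; proj₂)
  open import Data.Sum using (inj₁; inj₂)
  open import Function using (_∘_; id)
  open import Function.Bundles using (mk⇔)
  open import Relation.Binary.Definitions using (DecidableEquality)
  open import Relation.Binary.PropositionalEquality
    using (_≡_; refl; sym; trans; cong; cong₂; subst; module ≡-Reasoning)
  open import Relation.Nullary using (¬_; yes; no)
  open import Relation.Nullary.Decidable using (¬?)
  open import Relation.Unary using (Decidable)

  private variable
    A B : Set
    P Q R : A → Set

  sumL : List A → (A → ℤ) → ℤ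
  sumL [] F = 0ℤ
  sumL (x ∷ xs) F = F x + sumL xs F

  sumL-↭ : ∀ {xs ys : List A} (F : A → ℤ) → xs ↭ ys → sumL xs F ≡ sumL ys F
  sumL-↭ F _↭_.refl = refl
  sumL-↭ F (prep x p) = cong (F x +_) (sumL-↭ F p)
  sumL-↭ F (swap x y p) rewrite sumL-↭ F p = lemma (F x) (F y) _
    where
    lemma : ∀ i j k → i + (j + k) ≡ j + (i + k)
    lemma = solve-∀
  sumL-↭ F (_↭_.trans p q) = trans (sumL-↭ F p) (sumL-↭ F q)

  sumL-map : (f : A → B) (G : B → ℤ) (xs : List A) → sumL (map f xs) G ≡ sumL xs (G ∘ f)
  sumL-map f G [] = refl
  sumL-map f G (x ∷ xs) = cong (G (f x) +_) (sumL-map f G xs)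

  sumL-cong : ∀ {F G : A → ℤ} xs → (∀ {x} → x ∈ xs → F x ≡ G x) → sumL xs F ≡ sumL xs G
  sumL-cong [] _ = refl
  sumL-cong (x ∷ xs) eq = cong₂ _+_ (eq (here refl)) (sumL-cong xs (eq ∘ there))

  sumL-++ : (F : A → ℤ) (xs ys : List A) → sumL (xs ++ ys) F ≡ sumL xs F + sumL ys F
  sumL-++ F [] ys = sym (ℤ.+-identityˡ _)
  sumL-++ F (x ∷ xs) ys = trans (cong (F x +_) (sumL-++ F xs ys)) (sym (ℤ.+-assoc (F x) _ _))

  sumL-+ : (F G : A → ℤ) (xs : List A) → sumL xs (λ x → F x + G x) ≡ sumL xs F + sumL xs G
  sumL-+ F G [] = refl
  sumL-+ F G (x ∷ xs) rewrite sumL-+ F G xs = lemma (F x) (G x) _ _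
    where
    lemma : ∀ i j k l → i + j + (k + l) ≡ i + k + (j + l)
    lemma = solve-∀

  sumL-* : ∀ k (F : A → ℤ) xs → sumL xs (λ x → k * F x) ≡ k * sumL xs F
  sumL-* k F [] = sym (ℤ.*-zeroʳ k)
  sumL-* k F (x ∷ xs) rewrite sumL-* k F xs = sym (ℤ.*-distribˡ-+ k _ _)

  sumL-0 : (xs : List A) → sumL xs (λ _ → 0ℤ) ≡ 0ℤ
  sumL-0 [] = refl
  sumL-0 (x ∷ xs) = trans (ℤ.+-identityˡ _) (sumL-0 xs)

  sumL-swap : (xs : List A) (ys : List B) (F : A → B → ℤ) →
    sumL xs (λ x → sumL ys (F x)) ≡ sumL ys (λ y → sumL xs (λ x → F x y))
  sumL-swap [] ys F = sym (sumL-0 ys)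
  sumL-swap (x ∷ xs) ys F = trans (cong (sumL ys (F x) +_) (sumL-swap xs ys F)) (sym (sumL-+ (F x) _ ys))

  sumL-split : (R? : Decidable R) (F : A → ℤ) (xs : List A) →
    sumL xs F ≡ sumL (filter R? xs) F + sumL (filter (¬? ∘ R?) xs) F
  sumL-split R? F [] = refl
  sumL-split R? F (x ∷ xs) with R? x
  ... | yes _ = trans (cong (F x +_) (sumL-split R? F xs)) (sym (ℤ.+-assoc (F x) _ _))
  ... | no _ = trans (cong (F x +_) (sumL-split R? F xs)) (lemma (F x) (sumL (filter R? xs) F) _)
    where
    lemma : ∀ i j k → i + (j + k) ≡ j + (i + k)
    lemma = solve-∀

  -- The enumeration is packaged with its predicate, so that a sum depends on the predicate alone:
  -- enumerations of equivalent predicates give the same value (`∑-same`).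
  record Finite {A : Set} (P : A → Set) : Set where
    constructor finite
    field
      elems : List A
      unique : Unique elems
      sound : ∀ {x} → x ∈ elems → P x
      complete : ∀ {x} → P x → x ∈ elems
  open Finite public

  ∑ : Finite P → (_ → ℤ) → ℤ
  ∑ S F = sumL (elems S) F

  ∑-cong : (S : Finite P) {F G : _ → ℤ} → (∀ {x} → P x → F x ≡ G x) → ∑ S F ≡ ∑ S G
  ∑-cong S eq = sumL-cong (elems S) (eq ∘ sound S)

  ∑-zero : (S : Finite P) {F : _ → ℤ} → (∀ {x} → P x → F x ≡ 0ℤ) → ∑ S F ≡ 0ℤ
  ∑-zero S eq = trans (∑-cong S eq) (sumL-0 (elems S))

  unique-map : ∀ {f : A → B} xs →
    (∀ {x y} → x ∈ xs → y ∈ xs → f x ≡ f y → x ≡ y) → Unique xs → Unique (map f xs)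
  unique-map [] inj [] = []
  unique-map (x ∷ xs) inj (x≢ ∷ u) =
    All.map⁺ (All.tabulate λ y∈ fx≡fy → All.lookup x≢ y∈ (inj (here refl) (there y∈) fx≡fy))
    ∷ unique-map xs (λ p q → inj (there p) (there q)) u

  -- Duplicate-free lists with the same members are permutations of each other. The inverse laws are
  -- required on members only, because the maps used later (`half`, `quot`) are meaningful only
  -- there.
  sumL-reindex : (xs : List A) (ys : List B) (f : A → B) (g : B → A) {F : A → ℤ} {G : B → ℤ} →
    Unique xs → Unique ys →
    (∀ {x} → x ∈ xs → f x ∈ ys) → (∀ {y} → y ∈ ys → g y ∈ xs) →
    (∀ {x} → x ∈ xs → g (f x) ≡ x) → (∀ {y} → y ∈ ys → f (g y) ≡ y) →
    (∀ {x} → x ∈ xs → F x ≡ G (f x)) → sumL xs F ≡ sumL ys G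
  sumL-reindex xs ys f g {F} {G} ux uy f∈ g∈ gf fg eq = begin
    sumL xs F             ≡⟨ sumL-cong xs eq ⟩
    sumL xs (G ∘ f)       ≡⟨ sumL-map f G xs ⟨
    sumL (map f xs) G     ≡⟨ sumL-↭ G (∼bag⇒↭ (unique∧set⇒bag umap uy (mk⇔ to from))) ⟩
    sumL ys G             ∎
    where
    open ≡-Reasoning
    umap : Unique (map f xs)
    umap = unique-map xs (λ p q e → trans (sym (gf p)) (trans (cong g e) (gf q))) ux
    to : ∀ {y} → y ∈ map f xs → y ∈ ys
    to y∈ with x , x∈ , refl ← ∈-map⁻ f y∈ = f∈ x∈
    from : ∀ {y} → y ∈ ys → y ∈ map f xs
    from {y} y∈ = subst (_∈ map f xs) (fg y∈) (∈-map⁺ f (g∈ y∈))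

  ∑-reindex : {P : A → Set} {Q : B → Set} (S : Finite P) (T : Finite Q)
    (f : A → B) (g : B → A) {F : A → ℤ} {G : B → ℤ} →
    (∀ {x} → P x → Q (f x)) → (∀ {y} → Q y → P (g y)) →
    (∀ {x} → P x → g (f x) ≡ x) → (∀ {y} → Q y → f (g y) ≡ y) →
    (∀ {x} → P x → F x ≡ G (f x)) → ∑ S F ≡ ∑ T G
  ∑-reindex S T f g f∈ g∈ gf fg eq = sumL-reindex (elems S) (elems T) f g (unique S) (unique T)
    (complete T ∘ f∈ ∘ sound S) (complete S ∘ g∈ ∘ sound T)
    (gf ∘ sound S) (fg ∘ sound T) (eq ∘ sound S)

  ∑-same : (S : Finite P) (T : Finite Q) {F : _ → ℤ} →
    (∀ {x} → P x → Q x) → (∀ {x} → Q x → P x) → ∑ S F ≡ ∑ T F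
  ∑-same S T to from = ∑-reindex S T id id to from (λ _ → refl) (λ _ → refl) (λ _ → refl)

  restrict : Finite P → Decidable R → Finite (λ x → P x × R x)
  restrict S R? = finite (filter R? (elems S)) (Unique.filter⁺ R? (unique S))
    (λ x∈ → let p , r = ∈-filter⁻ R? x∈ in sound S p , r)
    (λ (p , r) → ∈-filter⁺ R? (complete S p) r)

  ∑-split : (S : Finite P) (R? : Decidable R) (F : _ → ℤ) →
    ∑ S F ≡ ∑ (restrict S R?) F + ∑ (restrict S (¬? ∘ R?)) F
  ∑-split S R? F = sumL-split R? F (elems S)

  -- A crude bounding box suffices for `xs`: it may contain repetitions and elements outside `P`.
  fromList : DecidableEquality A → (xs : List A) → Decidable P → (∀ {x} → P x → x ∈ xs) → Finite P
  fromList _≟_ xs P? cover = finite (filter P? (deduplicate _≟_ xs))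
    (Unique.filter⁺ P? (DecUnique.deduplicate-! _≟_ xs))
    (λ x∈ → proj₂ (∈-filter⁻ P? {xs = deduplicate _≟_ xs} x∈))
    (λ p → ∈-filter⁺ P? (∈-deduplicate⁺ _≟_ (cover p)) p)

  module _ {P : A → Set} {Q : A → B → Set} (T : ∀ x → Finite (Q x)) where
    pairs : List A → List (A × B)
    pairs [] = []
    pairs (x ∷ xs) = map (x ,_) (elems (T x)) ++ pairs xs

    ∈-pairs⁻ : ∀ xs {x y} → (x , y) ∈ pairs xs → x ∈ xs × Q x y
    ∈-pairs⁻ (z ∷ xs) p with ∈-++⁻ (map (z ,_) (elems (T z))) p
    ... | inj₁ q with _ , y∈ , refl ← ∈-map⁻ (z ,_) q = here refl , sound (T z) y∈
    ... | inj₂ q = let r , s = ∈-pairs⁻ xs q in there r , s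

    ∈-pairs⁺ : ∀ {xs x y} → x ∈ xs → Q x y → (x , y) ∈ pairs xs
    ∈-pairs⁺ {x = x} (here refl) q =
      ∈-++⁺ˡ (∈-map⁺ (x ,_) (complete (T x) q))
    ∈-pairs⁺ {z ∷ xs} (there p) q =
      ∈-++⁺ʳ (map (z ,_) (elems (T z))) (∈-pairs⁺ p q)

    pairs-unique : ∀ {xs} → Unique xs → Unique (pairs xs)
    pairs-unique [] = []
    pairs-unique {x ∷ xs} (x≢ ∷ u) = Unique.++⁺
      (unique-map (elems (T x)) (λ _ _ e → cong proj₂ e) (unique (T x)))
      (pairs-unique u)
      λ (p , q) → disjoint p q
      where
      disjoint : ∀ {z} → z ∈ map (x ,_) (elems (T x)) → ¬ z ∈ pairs xs
      disjoint p q with _ , _ , refl ← ∈-map⁻ (x ,_) p = All.lookup x≢ (proj₁ (∈-pairs⁻ xs q)) refl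

    sumL-pairs : ∀ F xs → sumL (pairs xs) F ≡ sumL xs (λ x → ∑ (T x) (λ y → F (x , y)))
    sumL-pairs F [] = refl
    sumL-pairs F (x ∷ xs) = trans (sumL-++ F (map (x ,_) (elems (T x))) _)
      (cong₂ _+_ (sumL-map (x ,_) F (elems (T x))) (sumL-pairs F xs))

    sigma : Finite P → Finite (λ (z : A × B) → P (proj₁ z) × Q (proj₁ z) (proj₂ z))
    sigma S = finite (pairs (elems S)) (pairs-unique (unique S))
      (λ p → let q , r = ∈-pairs⁻ (elems S) p in sound S q , r)
      (λ (p , q) → ∈-pairs⁺ (complete S p) q)

    ∑-sigma : (S : Finite P) (F : A × B → ℤ) → ∑ (sigma S) F ≡ ∑ S (λ x → ∑ (T x) (λ y → F (x , y)))
    ∑-sigma S F = sumL-pairs F (elems S)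

-- Formal power series and congruences between them

module PowerSeries where
  open import Algebra.Bundles using (CommutativeRing)
  open import Data.Integer using (ℤ; 0ℤ; 1ℤ; _+_; _*_; -_; _-_)
  import Data.Integer as ℤ
  import Data.Integer.Properties as ℤ
  open import Data.Integer.Divisibility.Signed using (_∣_; divides; ∣m∣n⇒∣m+n; ∣m⇒∣m*n; ∣m⇒∣-m)
  open import Data.Integer.Tactic.RingSolver using (solve-∀)
  open import Data.Maybe using (Maybe; just; nothing)
  open import Data.Nat as ℕ using (ℕ; zero; suc; NonZero)
  import Data.Nat.DivMod as ℕ
  import Data.Nat.Properties as ℕ
  open import Data.Product using (_,_)
  open import Function using (_∘_)
  open import Level using (0ℓ)
  open import Relation.Binary.PropositionalEquality
    using (_≡_; refl; sym; trans; cong; cong₂; module ≡-Reasoning)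
  open import Relation.Nullary using (yes; no)

  private
    Fun : Set
    Fun = ℕ → ℤ

  tailF : Fun → Fun
  tailF x n = x (suc n)

  -- The Cauchy product, recursing on the degree by peeling off the constant term of the left
  -- factor; the ring laws then go by induction on the degree, generalised over the left factor.
  mulF : Fun → Fun → Fun
  mulF x y zero = x 0 * y 0
  mulF x y (suc n) = x 0 * y (suc n) + mulF (tailF x) y n

  mulF-cong : ∀ {x x′ y y′ : Fun} n → (∀ i → i ℕ.≤ n → x i ≡ x′ i) → (∀ i → i ℕ.≤ n → y i ≡ y′ i) →
    mulF x y n ≡ mulF x′ y′ n
  mulF-cong zero p q = cong₂ _*_ (p 0 ℕ.z≤n) (q 0 ℕ.z≤n)
  mulF-cong (suc n) p q = cong₂ _+_ (cong₂ _*_ (p 0 ℕ.z≤n) (q (suc n) ℕ.≤-refl))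
    (mulF-cong n (λ i i≤n → p (suc i) (ℕ.s≤s i≤n)) (λ i i≤n → q i (ℕ.m≤n⇒m≤1+n i≤n)))

  mulF-distribʳ : ∀ (x y z : Fun) n → mulF (λ i → x i + y i) z n ≡ mulF x z n + mulF y z n
  mulF-distribʳ x y z zero = ℤ.*-distribʳ-+ (z 0) (x 0) (y 0)
  mulF-distribʳ x y z (suc n) rewrite mulF-distribʳ (tailF x) (tailF y) z n =
    lemma (x 0) (y 0) (z (suc n)) _ _
    where
    lemma : ∀ a b c d e → (a + b) * c + (d + e) ≡ a * c + d + (b * c + e)
    lemma = solve-∀

  mulF-scaleˡ : ∀ k (x y : Fun) n → mulF (λ i → k * x i) y n ≡ k * mulF x y n
  mulF-scaleˡ k x y zero = ℤ.*-assoc k (x 0) (y 0)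
  mulF-scaleˡ k x y (suc n) rewrite mulF-scaleˡ k (tailF x) y n = lemma k (x 0) (y (suc n)) _
    where
    lemma : ∀ a b c d → a * b * c + a * d ≡ a * (b * c + d)
    lemma = solve-∀

  mulF-sucʳ : ∀ (x y : Fun) n → mulF x y (suc n) ≡ x (suc n) * y 0 + mulF x (tailF y) n
  mulF-sucʳ x y zero = ℤ.+-comm (x 0 * y 1) (x 1 * y 0)
  mulF-sucʳ x y (suc n) rewrite mulF-sucʳ (tailF x) y n = lemma (x 0 * y (suc (suc n))) (x (suc (suc n)) * y 0) (mulF (tailF x) (tailF y) n)
    where
    lemma : ∀ a b c → a + (b + c) ≡ b + (a + c)
    lemma = solve-∀

  mulF-comm : ∀ (x y : Fun) n → mulF x y n ≡ mulF y x n
  mulF-comm x y zero = ℤ.*-comm (x 0) (y 0)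
  mulF-comm x y (suc n) rewrite mulF-comm (tailF x) y n | mulF-sucʳ y x n =
    cong (_+ mulF y (tailF x) n) (ℤ.*-comm (x 0) (y (suc n)))

  mulF-assoc : ∀ (x y z : Fun) n → mulF (mulF x y) z n ≡ mulF x (mulF y z) n
  mulF-assoc x y z zero = ℤ.*-assoc (x 0) (y 0) (z 0)
  mulF-assoc x y z (suc n) = begin
    x 0 * y 0 * z (suc n) + mulF (λ i → x 0 * tailF y i + mulF (tailF x) y i) z n
      ≡⟨ cong (x 0 * y 0 * z (suc n) +_) (trans (mulF-distribʳ (λ i → x 0 * tailF y i) _ z n)
           (cong₂ _+_ (mulF-scaleˡ (x 0) (tailF y) z n) (mulF-assoc (tailF x) y z n))) ⟩
    x 0 * y 0 * z (suc n) + (x 0 * mulF (tailF y) z n + mulF (tailF x) (mulF y z) n)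
      ≡⟨ lemma (x 0) (y 0) (z (suc n)) _ _ ⟩
    x 0 * (y 0 * z (suc n) + mulF (tailF y) z n) + mulF (tailF x) (mulF y z) n ∎
    where
    open ≡-Reasoning
    lemma : ∀ a b c d e → a * b * c + (a * d + e) ≡ a * (b * c + d) + e
    lemma = solve-∀

  mulF-zeroˡ : ∀ (y : Fun) n → mulF (λ _ → 0ℤ) y n ≡ 0ℤ
  mulF-zeroˡ y zero = ℤ.*-zeroˡ (y 0)
  mulF-zeroˡ y (suc n) = trans (cong₂ _+_ (ℤ.*-zeroˡ (y (suc n))) (mulF-zeroˡ y n)) refl

  constF : ℤ → Fun
  constF k zero = k
  constF k (suc _) = 0ℤ

  mulF-const : ∀ k (y : Fun) n → mulF (constF k) y n ≡ k * y n
  mulF-const k y zero = refl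
  mulF-const k y (suc n) = trans (cong (k * y (suc n) +_) (mulF-zeroˡ y n)) (ℤ.+-identityʳ _)

  mulF-∣ : ∀ m {x : Fun} (y : Fun) → (∀ n → m ∣ x n) → ∀ n → m ∣ mulF x y n
  mulF-∣ m y d zero = ∣m⇒∣m*n (y 0) (d 0)
  mulF-∣ m y d (suc n) = ∣m∣n⇒∣m+n (∣m⇒∣m*n (y (suc n)) (d 0)) (mulF-∣ m y (d ∘ suc) n)

  record PS : Set where
    no-eta-equality
    constructor series
    infixl 9 _!_
    field _!_ : ℕ → ℤ
  open PS public

  infixl 6 _⊕_
  infixl 7 _⊗_
  infix 8 ⊝_
  _⊕_ _⊗_ : PS → PS → PS
  (x ⊕ y) ! n = x ! n + y ! n
  (x ⊗ y) ! n = mulF (x !_) (y !_) n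
  ⊝_ : PS → PS
  (⊝ x) ! n = - (x ! n)
  const : ℤ → PS
  const k ! n = constF k n
  shift : PS → PS
  shift x ! zero = 0ℤ
  shift x ! suc n = x ! n
  tail : PS → PS
  tail x ! n = x ! suc n
  -- q d/dq
  D : PS → PS
  D x ! n = ℤ.+ n * x ! n
  sign : ℕ → ℤ
  sign zero = 1ℤ
  sign (suc n) = - sign n
  -- q ↦ -q
  twist : PS → PS
  twist x ! n = sign n * x ! n
  shiftBy : ℕ → PS → PS
  shiftBy zero x = x
  shiftBy (suc k) x = shift (shiftBy k x)
  -- q ↦ q^k
  expand : ∀ k .{{_ : NonZero k}} → PS → PS
  expand k x ! n = pick (n ℕ.% k) (n ℕ./ k)
    where
    pick : ℕ → ℕ → ℤ
    pick zero i = x ! i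
    pick (suc _) _ = 0ℤ
  dissect : ℕ → PS → PS
  dissect k x ! n = x ! (n ℕ.* k)

  module Mod (m : ℕ) where
    infix 4 _≈_
    -- Divisibility by 0 is vanishing, so `Mod 0` is the ring of integral series up to equality:
    -- identities are proved there and transported to every modulus by `exact`.
    record _≈_ (x y : PS) : Set where
      no-eta-equality
      constructor mk≈
      field at : ∀ n → ℤ.+ m ∣ x ! n - y ! n
    open _≈_ public

    ≡⇒∣ : ∀ {i j} → i ≡ j → ℤ.+ m ∣ i - j
    ≡⇒∣ {i} refl = divides 0ℤ (ℤ.+-inverseʳ i)

    pointwise : ∀ {x y} → (∀ n → x ! n ≡ y ! n) → x ≈ y
    pointwise eq = mk≈ λ n → ≡⇒∣ (eq n)

    private
      ∣-resp : ∀ {k i j} → i ≡ j → k ∣ i → k ∣ j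
      ∣-resp refl d = d

    ≈-refl : ∀ {x} → x ≈ x
    ≈-refl = pointwise λ _ → refl
    ≈-sym : ∀ {x y} → x ≈ y → y ≈ x
    ≈-sym {x} {y} p = mk≈ λ n → ∣-resp (lemma (x ! n) (y ! n)) (∣m⇒∣-m (at p n))
      where
      lemma : ∀ i j → - (i - j) ≡ j - i
      lemma = solve-∀
    ≈-trans : ∀ {x y z} → x ≈ y → y ≈ z → x ≈ z
    ≈-trans {x} {y} {z} p q = mk≈ λ n → ∣-resp (lemma (x ! n) (y ! n) (z ! n)) (∣m∣n⇒∣m+n (at p n) (at q n))
      where
      lemma : ∀ i j k → i - j + (j - k) ≡ i - k
      lemma = solve-∀

    ⊕-cong : ∀ {x x′ y y′} → x ≈ x′ → y ≈ y′ → x ⊕ y ≈ x′ ⊕ y′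
    ⊕-cong {x} {x′} {y} {y′} p q = mk≈ λ n →
      ∣-resp (lemma (x ! n) (x′ ! n) (y ! n) (y′ ! n)) (∣m∣n⇒∣m+n (at p n) (at q n))
      where
      lemma : ∀ i j k l → i - j + (k - l) ≡ i + k - (j + l)
      lemma = solve-∀

    ⊝-cong : ∀ {x x′} → x ≈ x′ → ⊝ x ≈ ⊝ x′
    ⊝-cong {x} {x′} p = mk≈ λ n → ∣-resp (lemma (x ! n) (x′ ! n)) (∣m⇒∣-m (at p n))
      where
      lemma : ∀ i j → - (i - j) ≡ - i - - j
      lemma = solve-∀

    ⊗-congˡ : ∀ {x x′} y → x ≈ x′ → x ⊗ y ≈ x′ ⊗ y
    ⊗-congˡ {x} {x′} y p = mk≈ λ n → ∣-resp (eq n) (mulF-∣ (ℤ.+ m) (y !_) (at p) n)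
      where
      eq : ∀ n → mulF (λ i → x ! i - x′ ! i) (y !_) n ≡ (x ⊗ y) ! n - (x′ ⊗ y) ! n
      eq n = trans (mulF-distribʳ (x !_) (λ i → - (x′ ! i)) (y !_) n) (cong ((x ⊗ y) ! n +_)
        (trans (mulF-cong {y = y !_} n (λ i _ → sym (ℤ.-1*i≡-i (x′ ! i))) (λ _ _ → refl))
          (trans (mulF-scaleˡ (- 1ℤ) (x′ !_) (y !_) n) (ℤ.-1*i≡-i _))))

    ⊗-comm : ∀ x y → x ⊗ y ≈ y ⊗ x
    ⊗-comm x y = pointwise (mulF-comm (x !_) (y !_))

    ⊗-cong : ∀ {x x′ y y′} → x ≈ x′ → y ≈ y′ → x ⊗ y ≈ x′ ⊗ y′
    ⊗-cong {x} {x′} {y} {y′} p q = ≈-trans (⊗-congˡ y p)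
      (≈-trans (⊗-comm x′ y) (≈-trans (⊗-congˡ x′ q) (⊗-comm y′ x′)))

    ring : CommutativeRing 0ℓ 0ℓ
    ring = record
      { Carrier = PS ; _≈_ = _≈_ ; _+_ = _⊕_ ; _*_ = _⊗_ ; -_ = ⊝_
      ; 0# = const 0ℤ ; 1# = const 1ℤ
      ; isCommutativeRing = record
        { isRing = record
          { +-isAbelianGroup = record
            { isGroup = record
              { isMonoid = record
                { isSemigroup = record
                  { isMagma = record
                    { isEquivalence = record { refl = ≈-refl ; sym = ≈-sym ; trans = ≈-trans }
                    ; ∙-cong = ⊕-cong }
                  ; assoc = λ x y z → pointwise λ n → ℤ.+-assoc (x ! n) (y ! n) (z ! n) }
                ; identity =
                    (λ x → pointwise λ { zero → ℤ.+-identityˡ _ ; (suc n) → ℤ.+-identityˡ _ })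
                  , (λ x → pointwise λ { zero → ℤ.+-identityʳ _ ; (suc n) → ℤ.+-identityʳ _ }) }
              ; inverse =
                  (λ x → pointwise λ { zero → ℤ.+-inverseˡ (x ! 0) ; (suc n) → ℤ.+-inverseˡ (x ! suc n) })
                , (λ x → pointwise λ { zero → ℤ.+-inverseʳ (x ! 0) ; (suc n) → ℤ.+-inverseʳ (x ! suc n) })
              ; ⁻¹-cong = ⊝-cong }
            ; comm = λ x y → pointwise λ n → ℤ.+-comm (x ! n) (y ! n) }
          ; *-cong = ⊗-cong
          ; *-assoc = λ x y z → pointwise (mulF-assoc (x !_) (y !_) (z !_))
          ; *-identity = identityˡ , λ x → ≈-trans (⊗-comm x (const 1ℤ)) (identityˡ x)
          ; distrib =
              (λ x y z → ≈-trans (⊗-comm x (y ⊕ z))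
                (≈-trans (distribʳ x y z) (⊕-cong (⊗-comm y x) (⊗-comm z x))))
            , distribʳ }
        ; *-comm = ⊗-comm } }
      where
      identityˡ : ∀ x → const 1ℤ ⊗ x ≈ x
      identityˡ x = pointwise λ n → trans (mulF-const 1ℤ (x !_) n) (ℤ.*-identityˡ _)
      distribʳ : ∀ x y z → (y ⊕ z) ⊗ x ≈ y ⊗ x ⊕ z ⊗ x
      distribʳ x y z = pointwise (mulF-distribʳ (y !_) (z !_) (x !_))

    open CommutativeRing ring public using (setoid; semiring)
    open import Algebra.Properties.Semiring.Exp semiring public using (_^_; ^-congˡ)

    import Algebra.Solver.Ring.AlmostCommutativeRing as ACR
    import Algebra.Solver.Ring as Solver

    private
      constHom : ACR._-Raw-AlmostCommutative⟶_ ℤ.+-*-rawRing (ACR.fromCommutativeRing ring)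
      constHom = record
        { ⟦_⟧ = const
        ; +-homo = λ i j → pointwise λ { zero → refl ; (suc _) → refl }
        ; *-homo = λ i j → pointwise λ { zero → refl ; (suc n) → sym (trans (mulF-const i _ (suc n)) (ℤ.*-zeroʳ i)) }
        ; -‿homo = λ i → pointwise λ { zero → refl ; (suc _) → refl }
        ; 0-homo = ≈-refl
        ; 1-homo = ≈-refl }

      const-≟ : ∀ i j → Maybe (const i ≈ const j)
      const-≟ i j with i ℤ.≟ j
      ... | yes refl = just ≈-refl
      ... | no _ = nothing

    open Solver ℤ.+-*-rawRing (ACR.fromCommutativeRing ring) constHom const-≟ public
      using (con; _:+_; _:*_; _:-_; :-_; _:^_; _:=_; solve)

    scale : ∀ k x n → (const k ⊗ x) ! n ≡ k * x ! n
    scale k x n = mulF-const k (x !_) n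

-- Derivation, twist, expansion and dissection of series

module SeriesMaps where
  open PowerSeries
  open import Data.Integer using (ℤ; 0ℤ; 1ℤ; _+_; _*_; -_; _-_)
  import Data.Integer as ℤ
  import Data.Integer.Properties as ℤ
  open import Data.Integer.Tactic.RingSolver using (solve-∀)
  open import Data.Nat as ℕ using (ℕ; zero; suc; NonZero)
  import Data.Nat.DivMod as ℕ
  import Data.Nat.Properties as ℕ
  open import Data.Nat.Induction using (<-rec)
  open import Data.Product using (_,_)
  open import Relation.Binary.PropositionalEquality
    using (_≡_; refl; sym; trans; cong; cong₂; module ≡-Reasoning)
  open import Relation.Nullary using (yes; no)

  private
    infix 4 _≐_
    _≐_ : PS → PS → Set
    x ≐ y = ∀ n → x ! n ≡ y ! n

  split-head : ∀ x → x ≐ const (x ! 0) ⊕ shift (tail x)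
  split-head x zero = sym (ℤ.+-identityʳ _)
  split-head x (suc n) = sym (ℤ.+-identityˡ _)

  shift-⊗ : ∀ x y → shift x ⊗ y ≐ shift (x ⊗ y)
  shift-⊗ x y zero = ℤ.*-zeroˡ (y ! 0)
  shift-⊗ x y (suc n) = trans (cong (_+ mulF (x !_) (y !_) n) (ℤ.*-zeroˡ (y ! suc n))) (ℤ.+-identityˡ _)

  shift-cong : ∀ {x y} → x ≐ y → shift x ≐ shift y
  shift-cong p zero = refl
  shift-cong p (suc n) = p n

  shiftBy-⊗ : ∀ k x y → shiftBy k x ⊗ y ≐ shiftBy k (x ⊗ y)
  shiftBy-⊗ zero x y n = refl
  shiftBy-⊗ (suc k) x y n = trans (shift-⊗ (shiftBy k x) y n) (shift-cong {shiftBy k x ⊗ y} (shiftBy-⊗ k x y) n)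

  shiftBy-< : ∀ {k n} x → n ℕ.< k → shiftBy k x ! n ≡ 0ℤ
  shiftBy-< {suc k} {zero} x _ = refl
  shiftBy-< {suc k} {suc n} x (ℕ.s≤s n<k) = shiftBy-< x n<k

  shiftBy-+ : ∀ k n x → shiftBy k x ! (k ℕ.+ n) ≡ x ! n
  shiftBy-+ zero n x = refl
  shiftBy-+ (suc k) n x = shiftBy-+ k n x

  D-⊗ : ∀ x y → D (x ⊗ y) ≐ D x ⊗ y ⊕ x ⊗ D y
  D-⊗ x y zero = lemma (x ! 0) (y ! 0)
    where
    lemma : ∀ a b → 0ℤ * (a * b) ≡ 0ℤ * a * b + a * (0ℤ * b)
    lemma = solve-∀
  D-⊗ x y (suc n) = begin
    ℤ.+ suc n * (x ! 0 * y ! suc n + t)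
      ≡⟨ cong (_* (x ! 0 * y ! suc n + t)) (ℤ.pos-+ 1 n) ⟩
    (1ℤ + ℤ.+ n) * (x ! 0 * y ! suc n + t)
      ≡⟨ lemma (ℤ.+ n) (x ! 0) (y ! suc n) t ⟩
    0ℤ * x ! 0 * y ! suc n + (t + ℤ.+ n * t) + x ! 0 * ((1ℤ + ℤ.+ n) * y ! suc n)
      ≡⟨ cong₂ (λ i j → 0ℤ * x ! 0 * y ! suc n + (t + i) + x ! 0 * (j * y ! suc n)) (D-⊗ (tail x) y n) (sym (ℤ.pos-+ 1 n)) ⟩
    0ℤ * x ! 0 * y ! suc n + (t + (mulF (D (tail x) !_) (y !_) n + s)) + x ! 0 * (ℤ.+ suc n * y ! suc n)
      ≡⟨ lemma₂ (0ℤ * x ! 0 * y ! suc n) t _ s _ ⟩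
    0ℤ * x ! 0 * y ! suc n + (t + mulF (D (tail x) !_) (y !_) n) + (x ! 0 * (ℤ.+ suc n * y ! suc n) + s)
      ≡⟨ cong (λ i → 0ℤ * x ! 0 * y ! suc n + i + (x ! 0 * (ℤ.+ suc n * y ! suc n) + s))
           (trans (sym (mulF-distribʳ (tail x !_) (D (tail x) !_) (y !_) n))
             (mulF-cong {y = y !_} n (λ i _ → trans (lemma₃ (x ! suc i) (ℤ.+ i))
               (cong (_* x ! suc i) (sym (ℤ.pos-+ 1 i)))) (λ _ _ → refl))) ⟩
    0ℤ * x ! 0 * y ! suc n + mulF (tail (D x) !_) (y !_) n + (x ! 0 * (ℤ.+ suc n * y ! suc n) + s) ∎
    where
    open ≡-Reasoning
    t s : ℤ
    t = mulF (tail x !_) (y !_) n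
    s = mulF (tail x !_) (D y !_) n
    lemma : ∀ n a b c → (1ℤ + n) * (a * b + c) ≡ 0ℤ * a * b + (c + n * c) + a * ((1ℤ + n) * b)
    lemma = solve-∀
    lemma₂ : ∀ z t u s w → z + (t + (u + s)) + w ≡ z + (t + u) + (w + s)
    lemma₂ = solve-∀
    lemma₃ : ∀ x i → x + i * x ≡ (1ℤ + i) * x
    lemma₃ = solve-∀

  twist-⊗ : ∀ x y → twist (x ⊗ y) ≐ twist x ⊗ twist y
  twist-⊗ x y zero = lemma (x ! 0) (y ! 0)
    where
    lemma : ∀ a b → 1ℤ * (a * b) ≡ 1ℤ * a * (1ℤ * b)
    lemma = solve-∀
  twist-⊗ x y (suc n) = begin
    - sign n * (x ! 0 * y ! suc n + mulF (tail x !_) (y !_) n)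
      ≡⟨ lemma (sign n) (x ! 0) (y ! suc n) _ ⟩
    1ℤ * x ! 0 * (- sign n * y ! suc n) + - 1ℤ * (sign n * mulF (tail x !_) (y !_) n)
      ≡⟨ cong (λ i → 1ℤ * x ! 0 * (- sign n * y ! suc n) + - 1ℤ * i) (twist-⊗ (tail x) y n) ⟩
    1ℤ * x ! 0 * (- sign n * y ! suc n) + - 1ℤ * mulF (twist (tail x) !_) (twist y !_) n
      ≡⟨ cong (1ℤ * x ! 0 * (- sign n * y ! suc n) +_)
           (trans (sym (mulF-scaleˡ (- 1ℤ) (twist (tail x) !_) (twist y !_) n))
             (mulF-cong {y = twist y !_} n (λ i _ → lemma₂ (sign i) (x ! suc i)) (λ _ _ → refl))) ⟩
    1ℤ * x ! 0 * (- sign n * y ! suc n) + mulF (tail (twist x) !_) (twist y !_) n ∎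
    where
    open ≡-Reasoning
    lemma : ∀ s a b c → - s * (a * b + c) ≡ 1ℤ * a * (- s * b) + - 1ℤ * (s * c)
    lemma = solve-∀
    lemma₂ : ∀ s a → - 1ℤ * (s * a) ≡ - s * a
    lemma₂ = solve-∀

  sign² : ∀ n → sign n * sign n ≡ 1ℤ
  sign² zero = refl
  sign² (suc n) = trans (lemma (sign n)) (sign² n)
    where
    lemma : ∀ s → - s * - s ≡ s * s
    lemma = solve-∀

  twist-twist : ∀ x → twist (twist x) ≐ x
  twist-twist x n = trans (sym (ℤ.*-assoc (sign n) (sign n) (x ! n)))
    (trans (cong (_* x ! n) (sign² n)) (ℤ.*-identityˡ _))

  module _ (k : ℕ) .{{nz : NonZero k}} where
    expand-< : ∀ x {n} → suc n ℕ.< k → expand k x ! suc n ≡ 0ℤ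
    expand-< x {n} n<k rewrite ℕ.m<n⇒m%n≡m n<k = refl

    expand-0 : ∀ x → expand k x ! 0 ≡ x ! 0
    expand-0 x rewrite ℕ.m<n⇒m%n≡m (ℕ.>-nonZero⁻¹ k) | ℕ.m<n⇒m/n≡0 (ℕ.>-nonZero⁻¹ k) = refl

    expand-+ : ∀ x n → expand k x ! (k ℕ.+ n) ≡ expand k (tail x) ! n
    expand-+ x n rewrite ℕ.+-comm k n | ℕ.[m+n]%n≡m%n n k {{nz}}
      | ℕ.m/n≡1+[m∸n]/n {n ℕ.+ k} {k} {{nz}} (ℕ.m≤n+m k n) | ℕ.m+n∸n≡m n k with n ℕ.% k
    ... | zero = refl
    ... | suc _ = refl

    expand-* : ∀ x n → expand k x ! (n ℕ.* k) ≡ x ! n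
    expand-* x zero = expand-0 x
    expand-* x (suc n) = trans (expand-+ x (n ℕ.* k)) (expand-* (tail x) n)

    -- Takes the place of reasoning with remainders: each use lowers the degree by k > 0, which is
    -- the induction behind `expand-⊗`, `dissect-expand` and `frobenius`.
    expand-head : ∀ x → expand k x ≐ const (x ! 0) ⊕ shiftBy k (expand k (tail x))
    expand-head x n with n ℕ.<? k
    expand-head x zero | yes p = trans (expand-0 x) (sym (trans (cong (x ! 0 +_) (shiftBy-< _ p)) (ℤ.+-identityʳ _)))
    expand-head x (suc n) | yes p = trans (expand-< x p) (sym (trans (ℤ.+-identityˡ _) (shiftBy-< _ p)))
    expand-head x n | no n≮k with ℕ.m≤n⇒∃[o]m+o≡n (ℕ.≮⇒≥ n≮k)
    ... | o , refl = trans (expand-+ x o) (sym (trans (cong₂ _+_ (const-0 k o) (shiftBy-+ k o _)) (ℤ.+-identityˡ _)))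
      where
      const-0 : ∀ k .{{_ : NonZero k}} o → constF (x ! 0) (k ℕ.+ o) ≡ 0ℤ
      const-0 (suc k) o = refl

    expand-cong : ∀ {x y} → x ≐ y → expand k x ≐ expand k y
    expand-cong p n with n ℕ.% k
    ... | zero = p (n ℕ./ k)
    ... | suc _ = refl

    expand-⊕ : ∀ x y → expand k (x ⊕ y) ≐ expand k x ⊕ expand k y
    expand-⊕ x y n with n ℕ.% k
    ... | zero = refl
    ... | suc _ = refl

    expand-scale : ∀ c x n → expand k (const c ⊗ x) ! n ≡ c * expand k x ! n
    expand-scale c x n with n ℕ.% k
    ... | zero = mulF-const c (x !_) (n ℕ./ k)
    ... | suc _ = sym (ℤ.*-zeroʳ c)

    expand-const : ∀ c → expand k (const c) ≐ const c
    expand-const c n = trans (expand-head (const c) n)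
      (trans (cong (const c ! n +_) (zeros n)) (ℤ.+-identityʳ _))
      where
      zeros : ∀ n → shiftBy k (expand k (tail (const c))) ! n ≡ 0ℤ
      zeros n with n ℕ.<? k
      ... | yes p = shiftBy-< _ p
      ... | no n≮k with o , refl ← ℕ.m≤n⇒∃[o]m+o≡n (ℕ.≮⇒≥ n≮k) = trans (shiftBy-+ k o _) (z o)
        where
        z : ∀ o → expand k (tail (const c)) ! o ≡ 0ℤ
        z o with o ℕ.% k
        ... | zero = refl
        ... | suc _ = refl

    expand-⊗ : ∀ x y → expand k (x ⊗ y) ≐ expand k x ⊗ expand k y
    expand-⊗ x y n = <-rec (λ n → ∀ x → expand k (x ⊗ y) ! n ≡ (expand k x ⊗ expand k y) ! n) step n x
      where
      open ≡-Reasoning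
      k>0 : 0 ℕ.< k
      k>0 = ℕ.>-nonZero⁻¹ k
      shiftBy-cong : ∀ {x y} n → (∀ i → i ℕ.< n → x ! i ≡ y ! i) → shiftBy k x ! n ≡ shiftBy k y ! n
      shiftBy-cong {x} {y} n p with n ℕ.<? k
      ... | yes n<k = trans (shiftBy-< x n<k) (sym (shiftBy-< y n<k))
      ... | no n≮k with o , refl ← ℕ.m≤n⇒∃[o]m+o≡n (ℕ.≮⇒≥ n≮k) =
        trans (shiftBy-+ k o x) (trans (p o (ℕ.m<n+m o k>0)) (sym (shiftBy-+ k o y)))
      step : ∀ n → (∀ {i} → i ℕ.< n → ∀ x → expand k (x ⊗ y) ! i ≡ (expand k x ⊗ expand k y) ! i) →
        ∀ x → expand k (x ⊗ y) ! n ≡ (expand k x ⊗ expand k y) ! n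
      step n ih x = begin
        expand k (x ⊗ y) ! n
          ≡⟨ expand-cong {x ⊗ y} {const (x ! 0) ⊗ y ⊕ shift (tail x ⊗ y)} eq n ⟩
        expand k (const (x ! 0) ⊗ y ⊕ shift (tail x ⊗ y)) ! n
          ≡⟨ expand-⊕ (const (x ! 0) ⊗ y) (shift (tail x ⊗ y)) n ⟩
        expand k (const (x ! 0) ⊗ y) ! n + expand k (shift (tail x ⊗ y)) ! n
          ≡⟨ cong₂ _+_ (expand-scale (x ! 0) y n) (trans (expand-shift (tail x ⊗ y) n) (shiftBy-cong n (λ i i<n → ih i<n (tail x)))) ⟩
        x ! 0 * expand k y ! n + shiftBy k (expand k (tail x) ⊗ expand k y) ! n
          ≡⟨ cong₂ _+_ (mulF-const (x ! 0) (expand k y !_) n) (shiftBy-⊗ k (expand k (tail x)) (expand k y) n) ⟨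
        (const (x ! 0) ⊗ expand k y) ! n + (shiftBy k (expand k (tail x)) ⊗ expand k y) ! n
          ≡⟨ mulF-distribʳ (const (x ! 0) !_) (shiftBy k (expand k (tail x)) !_) (expand k y !_) n ⟨
        ((const (x ! 0) ⊕ shiftBy k (expand k (tail x))) ⊗ expand k y) ! n
          ≡⟨ mulF-cong {y = expand k y !_} n (λ i _ → sym (expand-head x i)) (λ _ _ → refl) ⟩
        (expand k x ⊗ expand k y) ! n ∎
        where
        eq : x ⊗ y ≐ const (x ! 0) ⊗ y ⊕ shift (tail x ⊗ y)
        eq zero = sym (ℤ.+-identityʳ _)
        eq (suc i) = cong (_+ mulF (tail x !_) (y !_) i) (sym (mulF-const (x ! 0) (y !_) (suc i)))
        expand-shift : ∀ z → expand k (shift z) ≐ shiftBy k (expand k z)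
        expand-shift z i = trans (expand-head (shift z) i) (trans
          (cong₂ _+_ (const0 i) (shiftBy-cong i (λ j _ → expand-cong {tail (shift z)} {z} (λ _ → refl) j))) (ℤ.+-identityˡ _))
          where
          const0 : ∀ i → const 0ℤ ! i ≡ 0ℤ
          const0 zero = refl
          const0 (suc _) = refl

    dissect-shiftBy : ∀ x n → dissect k (shiftBy k x) ! n ≡ shift (dissect k x) ! n
    dissect-shiftBy x zero = shiftBy-< x (ℕ.>-nonZero⁻¹ k)
    dissect-shiftBy x (suc n) = shiftBy-+ k (n ℕ.* k) x

    -- Peeling one term off x moves the product by k places, which dissection sees as a shift by
    -- one. This is the projection formula of the Cartier operator.
    dissect-expand : ∀ x y → dissect k (expand k x ⊗ y) ≐ x ⊗ dissect k y
    dissect-expand x y n = trans eq (rec n)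
      where
      eq : (expand k x ⊗ y) ! (n ℕ.* k) ≡ x ! 0 * y ! (n ℕ.* k) + dissect k (shiftBy k (expand k (tail x) ⊗ y)) ! n
      eq = trans (mulF-cong {y = y !_} (n ℕ.* k) (λ i _ → expand-head x i) (λ _ _ → refl))
        (trans (mulF-distribʳ (const (x ! 0) !_) _ (y !_) (n ℕ.* k))
          (cong₂ _+_ (mulF-const (x ! 0) (y !_) (n ℕ.* k)) (shiftBy-⊗ k (expand k (tail x)) y (n ℕ.* k))))
      rec : ∀ n → x ! 0 * y ! (n ℕ.* k) + dissect k (shiftBy k (expand k (tail x) ⊗ y)) ! n ≡ (x ⊗ dissect k y) ! n
      rec zero = trans (cong (x ! 0 * y ! 0 +_) (dissect-shiftBy (expand k (tail x) ⊗ y) 0)) (ℤ.+-identityʳ _)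
      rec (suc n) = cong (x ! 0 * y ! (suc n ℕ.* k) +_)
        (trans (dissect-shiftBy (expand k (tail x) ⊗ y) (suc n)) (dissect-expand (tail x) y n))

-- Binary forms modulo p, compared by computing coefficients

module Homogeneous (p : Data.Nat.ℕ) {{_ : Data.Nat.NonZero p}} where
  open PowerSeries
  open Mod p
  import Data.Integer as ℤ
  import Data.Integer.Properties as ℤ
  open import Data.Integer.Divisibility.Signed using (divides)
  open import Data.Integer.Tactic.RingSolver using (solve-∀)
  open import Data.Nat using (ℕ; zero; suc; _+_; _*_; _%_; _/_)
  import Data.Nat.DivMod as ℕ
  open import Data.Vec using (Vec; []; _∷_; map; zipWith; _∷ʳ_)
  open import Relation.Binary.PropositionalEquality using (_≡_; refl; cong; trans; sym)
  open import Relation.Binary.Reasoning.Setoid setoid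

  infixl 6 _⊞_
  infixl 7 _⊠_
  infixr 8 _⊠^_
  -- Syntax for homogeneous polynomials with natural coefficients, indexed by the degree.
  -- Homogeneity makes a plain coefficient vector a normal form, so that polynomial identities
  -- modulo p are settled by `refl`.
  data Form : ℕ → Set where
    cst : ℕ → Form 0
    X Y : Form 1
    _⊞_ : ∀ {d} → Form d → Form d → Form d
    _⊠_ : ∀ {d e} → Form d → Form e → Form (d + e)
    _⊠^_ : ∀ {d} → Form d → (n : ℕ) → Form (n * d)

  ⟪_⟫ : ∀ {d} → Form d → PS → PS → PS
  ⟪ cst k ⟫ x y = const (ℤ.+ k)
  ⟪ X ⟫ x y = x
  ⟪ Y ⟫ x y = y
  ⟪ e ⊞ f ⟫ x y = ⟪ e ⟫ x y ⊕ ⟪ f ⟫ x y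
  ⟪ e ⊠ f ⟫ x y = ⟪ e ⟫ x y ⊗ ⟪ f ⟫ x y
  ⟪ e ⊠^ n ⟫ x y = ⟪ e ⟫ x y ^ n

  -- k₀ ∷ k₁ ∷ … represents Σ kᵢ x^(d-i) y^i with coefficients reduced modulo p.
  Coeffs : ℕ → Set
  Coeffs d = Vec ℕ (suc d)

  eval : ∀ {d} → Coeffs d → PS → PS → PS
  eval {zero} (k ∷ []) x y = const (ℤ.+ k)
  eval {suc d} (k ∷ ks) x y = const (ℤ.+ k) ⊗ x ^ suc d ⊕ y ⊗ eval ks x y

  add : ∀ {n} → Vec ℕ n → Vec ℕ n → Vec ℕ n
  add = zipWith λ k l → (k + l) % p

  scaleV : ∀ {n} → ℕ → Vec ℕ n → Vec ℕ n
  scaleV k = map λ l → k * l % p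

  -- Multiplication by x^j: the new zeros are the coefficients of the highest powers of y, which
  -- stand at the end.
  pad : ∀ {e} j → Coeffs e → Coeffs (j + e)
  pad zero ks = ks
  pad (suc j) ks = pad j ks ∷ʳ 0

  mul : ∀ {d e} → Coeffs d → Coeffs e → Coeffs (d + e)
  mul {zero} (k ∷ []) ls = scaleV k ls
  mul {suc d} (k ∷ ks) ls = add (pad (suc d) (scaleV k ls)) (0 ∷ mul ks ls)

  pow : ∀ {d} n → Coeffs d → Coeffs (n * d)
  pow zero ks = 1 ∷ []
  pow (suc n) ks = mul ks (pow n ks)

  coeffs : ∀ {d} → Form d → Coeffs d
  coeffs (cst k) = k ∷ []
  coeffs X = 1 ∷ 0 ∷ []
  coeffs Y = 0 ∷ 1 ∷ []
  coeffs (e ⊞ f) = add (coeffs e) (coeffs f)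
  coeffs (e ⊠ f) = mul (coeffs e) (coeffs f)
  coeffs (e ⊠^ n) = pow n (coeffs e)

  compose : ∀ {n d} → Coeffs n → Form d → Form d → Form (n * d)
  compose {zero} (k ∷ []) e f = cst k
  compose {suc n} (k ∷ ks) e f = cst k ⊠ e ⊠^ suc n ⊞ f ⊠ compose ks e f

  const-% : ∀ k → const (ℤ.+ (k % p)) ≈ const (ℤ.+ k)
  const-% k = mk≈ λ { zero → divides (ℤ.- (ℤ.+ (k / p))) eq ; (suc _) → divides ℤ.0ℤ refl }
    where
    lemma : ∀ r q m → r ℤ.- (r ℤ.+ q ℤ.* m) ≡ ℤ.- q ℤ.* m
    lemma = solve-∀
    eq : ℤ.+ (k % p) ℤ.- ℤ.+ k ≡ ℤ.- (ℤ.+ (k / p)) ℤ.* ℤ.+ p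
    eq = trans (cong (λ i → ℤ.+ (k % p) ℤ.- i) (trans (cong ℤ.+_ (ℕ.m≡m%n+[m/n]*n k p))
      (trans (ℤ.pos-+ (k % p) _) (cong (λ i → ℤ.+ (k % p) ℤ.+ i) (ℤ.pos-* (k / p) p)))))
      (lemma (ℤ.+ (k % p)) (ℤ.+ (k / p)) (ℤ.+ p))

  const-+ : ∀ k l → const (ℤ.+ ((k + l) % p)) ≈ const (ℤ.+ k) ⊕ const (ℤ.+ l)
  const-+ k l = ≈-trans (const-% (k + l)) (pointwise λ { zero → ℤ.pos-+ k l ; (suc _) → refl })

  const-* : ∀ k l → const (ℤ.+ (k * l % p)) ≈ const (ℤ.+ k) ⊗ const (ℤ.+ l)
  const-* k l = ≈-trans (const-% (k * l)) (pointwise λ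
    { zero → ℤ.pos-* k l
    ; (suc n) → sym (trans (mulF-const (ℤ.+ k) _ (suc n)) (ℤ.*-zeroʳ (ℤ.+ k))) })

  eval-add : ∀ {d} (ks ls : Coeffs d) x y → eval (add ks ls) x y ≈ eval ks x y ⊕ eval ls x y
  eval-add {zero} (k ∷ []) (l ∷ []) x y = const-+ k l
  eval-add {suc d} (k ∷ ks) (l ∷ ls) x y = ≈-trans
    (⊕-cong (⊗-cong (const-+ k l) ≈-refl) (⊗-cong ≈-refl (eval-add ks ls x y)))
    (solve 6 (λ k l z y s t → (k :+ l) :* z :+ y :* (s :+ t) := k :* z :+ y :* s :+ (l :* z :+ y :* t)) ≈-refl
      (const (ℤ.+ k)) (const (ℤ.+ l)) (x ^ suc d) y (eval ks x y) (eval ls x y))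

  eval-scale : ∀ {d} k (ls : Coeffs d) x y → eval (scaleV k ls) x y ≈ const (ℤ.+ k) ⊗ eval ls x y
  eval-scale {zero} k (l ∷ []) x y = const-* k l
  eval-scale {suc d} k (l ∷ ls) x y = ≈-trans
    (⊕-cong (⊗-cong (const-* k l) ≈-refl) (⊗-cong ≈-refl (eval-scale k ls x y)))
    (solve 5 (λ k l z y t → k :* l :* z :+ y :* (k :* t) := k :* (l :* z :+ y :* t)) ≈-refl
      (const (ℤ.+ k)) (const (ℤ.+ l)) (x ^ suc d) y (eval ls x y))

  eval-∷ʳ : ∀ {d} (ks : Coeffs d) x y → eval (ks ∷ʳ 0) x y ≈ x ⊗ eval ks x y
  eval-∷ʳ {zero} (k ∷ []) x y = solve 3 (λ k x y → k :* (x :* con ℤ.1ℤ) :+ y :* con ℤ.0ℤ := x :* k) ≈-refl (const (ℤ.+ k)) x y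
  eval-∷ʳ {suc d} (k ∷ ks) x y = ≈-trans (⊕-cong ≈-refl (⊗-cong ≈-refl (eval-∷ʳ ks x y)))
    (solve 5 (λ k x z y t → k :* (x :* z) :+ y :* (x :* t) := x :* (k :* z :+ y :* t)) ≈-refl
      (const (ℤ.+ k)) x (x ^ suc d) y (eval ks x y))

  eval-pad : ∀ {e} j (ks : Coeffs e) x y → eval (pad j ks) x y ≈ x ^ j ⊗ eval ks x y
  eval-pad zero ks x y = solve 1 (λ t → t := con ℤ.1ℤ :* t) ≈-refl (eval ks x y)
  eval-pad (suc j) ks x y = ≈-trans (eval-∷ʳ (pad j ks) x y) (≈-trans (⊗-cong ≈-refl (eval-pad j ks x y))
    (solve 3 (λ x z t → x :* (z :* t) := x :* z :* t) ≈-refl x (x ^ j) (eval ks x y)))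

  eval-0∷ : ∀ {d} (ks : Coeffs d) x y → eval (0 ∷ ks) x y ≈ y ⊗ eval ks x y
  eval-0∷ {d} ks x y = solve 2 (λ z t → con ℤ.0ℤ :* z :+ t := t) ≈-refl (x ^ suc d) (y ⊗ eval ks x y)

  eval-mul : ∀ {d e} (ks : Coeffs d) (ls : Coeffs e) x y → eval (mul ks ls) x y ≈ eval ks x y ⊗ eval ls x y
  eval-mul {zero} (k ∷ []) ls x y = eval-scale k ls x y
  eval-mul {suc d} (k ∷ ks) ls x y = ≈-trans (eval-add (pad (suc d) (scaleV k ls)) (0 ∷ mul ks ls) x y)
    (≈-trans (⊕-cong (≈-trans (eval-pad (suc d) (scaleV k ls) x y) (⊗-cong ≈-refl (eval-scale k ls x y)))
                     (≈-trans (eval-0∷ (mul ks ls) x y) (⊗-cong ≈-refl (eval-mul ks ls x y))))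
      (solve 5 (λ k z y s t → z :* (k :* t) :+ y :* (s :* t) := (k :* z :+ y :* s) :* t) ≈-refl
        (const (ℤ.+ k)) (x ^ suc d) y (eval ks x y) (eval ls x y)))

  eval-pow : ∀ {d} n (ks : Coeffs d) x y → eval (pow n ks) x y ≈ eval ks x y ^ n
  eval-pow zero ks x y = ≈-refl
  eval-pow (suc n) ks x y = ≈-trans (eval-mul ks (pow n ks) x y) (⊗-cong ≈-refl (eval-pow n ks x y))

  eval-coeffs : ∀ {d} (e : Form d) x y → ⟪ e ⟫ x y ≈ eval (coeffs e) x y
  eval-coeffs (cst k) x y = ≈-refl
  eval-coeffs X x y = solve 2 (λ x y → x := con ℤ.1ℤ :* (x :* con ℤ.1ℤ) :+ y :* con ℤ.0ℤ) ≈-refl x y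
  eval-coeffs Y x y = solve 2 (λ x y → y := con ℤ.0ℤ :* (x :* con ℤ.1ℤ) :+ y :* con ℤ.1ℤ) ≈-refl x y
  eval-coeffs (e ⊞ f) x y = ≈-trans (⊕-cong (eval-coeffs e x y) (eval-coeffs f x y)) (≈-sym (eval-add (coeffs e) (coeffs f) x y))
  eval-coeffs (e ⊠ f) x y = ≈-trans (⊗-cong (eval-coeffs e x y) (eval-coeffs f x y)) (≈-sym (eval-mul (coeffs e) (coeffs f) x y))
  eval-coeffs (e ⊠^ n) x y = ≈-trans (^-congˡ n (eval-coeffs e x y)) (≈-sym (eval-pow n (coeffs e) x y))

  form-≈ : ∀ {d} (e f : Form d) x y → coeffs e ≡ coeffs f → ⟪ e ⟫ x y ≈ ⟪ f ⟫ x y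
  form-≈ e f x y eq = ≈-trans (eval-coeffs e x y)
    (≈-trans (≡⇒≈ eq) (≈-sym (eval-coeffs f x y)))
    where
    ≡⇒≈ : ∀ {ks ls} → ks ≡ ls → eval ks x y ≈ eval ls x y
    ≡⇒≈ refl = ≈-refl

  eval-compose : ∀ {n d} (ks : Coeffs n) (e f : Form d) x y →
    ⟪ compose ks e f ⟫ x y ≡ eval ks (⟪ e ⟫ x y) (⟪ f ⟫ x y)
  eval-compose {zero} (k ∷ []) e f x y = refl
  eval-compose {suc n} (k ∷ ks) e f x y rewrite eval-compose ks e f x y = refl

  -- Checked by evaluation for each of the four primes, in place of an argument about binomial
  -- coefficients.
  Freshman : Set
  Freshman = coeffs ((X ⊞ Y) ⊠^ p) ≡ coeffs (X ⊠^ p ⊞ Y ⊠^ p)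

-- Indefinite forms and sums along the river of the topograph

module IndefiniteForms where
  open FiniteSums
  open import Data.Empty using (⊥-elim)
  open import Data.Integer using (ℤ; 0ℤ; 1ℤ; _+_; _*_; -_; _-_; _<_; -[1+_]; ∣_∣; +<+)
  import Data.Integer as ℤ
  import Data.Integer.Properties as ℤ
  open import Data.Integer.Tactic.RingSolver using (solve-∀)
  open import Data.List using (List; map; upTo; _++_; cartesianProduct)
  open import Data.List.Membership.Propositional using (_∈_)
  open import Data.List.Membership.Propositional.Properties
    using (∈-upTo⁺; ∈-map⁺; ∈-++⁺ˡ; ∈-++⁺ʳ; ∈-cartesianProduct⁺)
  open import Data.Nat as ℕ using (ℕ; zero; suc)
  import Data.Nat.Properties as ℕ
  open import Data.Product using (_×_; _,_; proj₁; proj₂)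
  open import Data.Product.Properties using (≡-dec)
  open import Function using (_∘_)
  open import Relation.Binary.Definitions using (tri<; tri≈; tri>)
  open import Relation.Binary.PropositionalEquality
    using (_≡_; _≢_; refl; sym; trans; cong; cong₂; subst; module ≡-Reasoning)
  open import Relation.Nullary using (¬_)
  open import Relation.Nullary.Decidable using (_×-dec_; ¬?; map′)

  integers : ℕ → List ℤ
  integers K = map ℤ.+_ (upTo (suc K)) ++ map -[1+_] (upTo K)

  ∈-integers : ∀ {K} i → ∣ i ∣ ℕ.≤ K → i ∈ integers K
  ∈-integers (ℤ.+ n) n≤K = ∈-++⁺ˡ (∈-map⁺ ℤ.+_ (∈-upTo⁺ (ℕ.s≤s n≤K)))
  ∈-integers {K} -[1+ n ] n<K = ∈-++⁺ʳ (map ℤ.+_ (upTo (suc K))) (∈-map⁺ -[1+_] (∈-upTo⁺ n<K))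

  Triple : Set
  Triple = ℤ × ℤ × ℤ

  -- The triple (a , b , c) stands for the form aX² + bXY − cY² of discriminant D.
  record V (D : ℤ) (v : Triple) : Set where
    constructor form
    field
      a>0 : 0ℤ < proj₁ v
      c>0 : 0ℤ < proj₂ (proj₂ v)
      disc : proj₁ (proj₂ v) * proj₁ (proj₂ v) + ℤ.+ 4 * (proj₁ v * proj₂ (proj₂ v)) ≡ D
  open V public

  square-∣∣ : ∀ b → b * b ≡ ℤ.+ (∣ b ∣ ℕ.* ∣ b ∣)
  square-∣∣ (ℤ.+ n) = sym (ℤ.pos-* n n)
  square-∣∣ -[1+ n ] = refl

  -- Positivity of a and c makes the discriminant a sum of nonnegative terms; this bounds all three
  -- coefficients, and the forms of given discriminant are finite in number.
  V-norm : ∀ {D a b c} → V D (a , b , c) → ∣ D ∣ ≡ ∣ b ∣ ℕ.* ∣ b ∣ ℕ.+ 4 ℕ.* (∣ a ∣ ℕ.* ∣ c ∣)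
  V-norm {b = b} (form (+<+ {n = suc x} _) (+<+ {n = suc y} _) refl) = cong ∣_∣ (begin
    b * b + ℤ.+ 4 * (ℤ.+ suc x * ℤ.+ suc y)
      ≡⟨ cong₂ _+_ (square-∣∣ b) (trans (cong (ℤ.+ 4 *_) (sym (ℤ.pos-* (suc x) (suc y)))) (sym (ℤ.pos-* 4 (suc x ℕ.* suc y)))) ⟩
    ℤ.+ (∣ b ∣ ℕ.* ∣ b ∣) + ℤ.+ (4 ℕ.* (suc x ℕ.* suc y))
      ≡⟨ ℤ.pos-+ (∣ b ∣ ℕ.* ∣ b ∣) _ ⟨
    ℤ.+ (∣ b ∣ ℕ.* ∣ b ∣ ℕ.+ 4 ℕ.* (suc x ℕ.* suc y)) ∎)
    where open ≡-Reasoning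

  private
    n≤n*n : ∀ n → n ℕ.≤ n ℕ.* n
    n≤n*n zero = ℕ.z≤n
    n≤n*n (suc n) = ℕ.m≤m+n (suc n) (n ℕ.* suc n)

  V-bounds : ∀ {D a b c} → V D (a , b , c) → ∣ a ∣ ℕ.≤ ∣ D ∣ × ∣ b ∣ ℕ.≤ ∣ D ∣ × ∣ c ∣ ℕ.≤ ∣ D ∣
  V-bounds {D} {a} {b} {c} v@(form (+<+ {n = suc x} _) (+<+ {n = suc y} _) _) rewrite V-norm v =
      ℕ.≤-trans (ℕ.≤-trans (ℕ.m≤m*n (suc x) (suc y)) (ℕ.m≤n*m (suc x ℕ.* suc y) 4)) (ℕ.m≤n+m _ (∣ b ∣ ℕ.* ∣ b ∣))
    , ℕ.≤-trans (n≤n*n ∣ b ∣) (ℕ.m≤m+n _ _)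
    , ℕ.≤-trans (ℕ.≤-trans (ℕ.m≤n*m (suc y) (suc x)) (ℕ.m≤n*m (suc x ℕ.* suc y) 4)) (ℕ.m≤n+m _ (∣ b ∣ ℕ.* ∣ b ∣))

  forms : ∀ D → Finite (V D)
  forms D = fromList (≡-dec ℤ._≟_ (≡-dec ℤ._≟_ ℤ._≟_))
    (cartesianProduct (integers ∣ D ∣) (cartesianProduct (integers ∣ D ∣) (integers ∣ D ∣)))
    (λ (a , b , c) → map′ (λ (p , q , r) → form p q r) (λ v → a>0 v , c>0 v , disc v)
      ((0ℤ ℤ.<? a) ×-dec (0ℤ ℤ.<? c) ×-dec (b * b + ℤ.+ 4 * (a * c) ℤ.≟ D)))
    (λ {v} p → let p₁ , p₂ , p₃ = V-bounds p in
      ∈-cartesianProduct⁺ (∈-integers (proj₁ v) p₁)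
        (∈-cartesianProduct⁺ (∈-integers (proj₁ (proj₂ v)) p₂) (∈-integers (proj₂ (proj₂ v)) p₃)))

  i≡-i⇒i≡0 : ∀ {i} → i ≡ - i → i ≡ 0ℤ
  i≡-i⇒i≡0 {ℤ.+ zero} _ = refl

  mid : Triple → ℤ
  mid (a , b , c) = a + b - c

  -- For Q = aX² + bXY - cY² these are -Q(Y,X), Q(X,-Y) and Q(X,X-Y), while `mid` is Q(1,1). All
  -- three keep the discriminant; `ι` keeps a, c > 0 exactly when Q(1,1) is positive.
  flip conj ι : Triple → Triple
  flip (a , b , c) = c , - b , a
  conj (a , b , c) = a , - b , c
  ι (a , b , c) = a + b - c , ℤ.+ 2 * c - b , c

  module _ (D : ℤ) where
    positiveMid : Finite (λ v → V D v × 0ℤ < mid v)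
    positiveMid = restrict (forms D) (λ v → 0ℤ ℤ.<? mid v)
    zeroMid : Finite (λ v → (V D v × ¬ 0ℤ < mid v) × mid v ≡ 0ℤ)
    zeroMid = restrict (restrict (forms D) (λ v → ¬? (0ℤ ℤ.<? mid v))) (λ v → mid v ℤ.≟ 0ℤ)
    negativeMid : Finite (λ v → (V D v × ¬ 0ℤ < mid v) × mid v ≢ 0ℤ)
    negativeMid = restrict (restrict (forms D) (λ v → ¬? (0ℤ ℤ.<? mid v))) (λ v → ¬? (mid v ℤ.≟ 0ℤ))

    V-conj : ∀ {v} → V D v → V D (conj v)
    V-conj {a , b , c} (form p q refl) = form p q (lemma a b c)
      where
      lemma : ∀ a b c → - b * - b + ℤ.+ 4 * (a * c) ≡ b * b + ℤ.+ 4 * (a * c)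
      lemma = solve-∀

    V-flip : ∀ {v} → V D v → V D (flip v)
    V-flip {a , b , c} (form p q refl) = form q p (lemma a b c)
      where
      lemma : ∀ a b c → - b * - b + ℤ.+ 4 * (c * a) ≡ b * b + ℤ.+ 4 * (a * c)
      lemma = solve-∀

    flip-flip : ∀ v → flip (flip v) ≡ v
    flip-flip (a , b , c) = cong (λ z → a , z , c) (ℤ.neg-involutive b)

    ι-ι : ∀ v → ι (ι v) ≡ v
    ι-ι (a , b , c) = cong₂ (λ x y → x , y , c) (lemma a b c) (lemma₂ b c)
      where
      lemma : ∀ a b c → a + b - c + (ℤ.+ 2 * c - b) - c ≡ a
      lemma = solve-∀
      lemma₂ : ∀ b c → ℤ.+ 2 * c - (ℤ.+ 2 * c - b) ≡ b
      lemma₂ = solve-∀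

    V-ι : ∀ {v} → V D v × 0ℤ < mid v → V D (ι v) × 0ℤ < mid (ι v)
    V-ι {a , b , c} (form p q refl , r) = form r q (lemma a b c) , subst (0ℤ <_) (sym (cong proj₁ (ι-ι (a , b , c)))) p
      where
      lemma : ∀ a b c → (ℤ.+ 2 * c - b) * (ℤ.+ 2 * c - b) + ℤ.+ 4 * ((a + b - c) * c) ≡ b * b + ℤ.+ 4 * (a * c)
      lemma = solve-∀

    mid-flip : ∀ v → mid (flip v) ≡ - mid v
    mid-flip (a , b , c) = lemma a b c
      where
      lemma : ∀ a b c → c + - b - a ≡ - (a + b - c)
      lemma = solve-∀

    neg⇒flip-pos : ∀ {v} → (V D v × ¬ 0ℤ < mid v) × mid v ≢ 0ℤ → V D (flip v) × 0ℤ < mid (flip v)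
    neg⇒flip-pos {v} ((p , q) , r) = V-flip p , subst (0ℤ <_) (sym (mid-flip v)) (pos (ℤ.<-cmp 0ℤ (mid v)))
      where
      pos : _ → 0ℤ < - mid v
      pos (tri< m _ _) = ⊥-elim (q m)
      pos (tri≈ _ m _) = ⊥-elim (r (sym m))
      pos (tri> _ _ m) = ℤ.neg-mono-< m

    pos⇒flip-neg : ∀ {v} → V D v × 0ℤ < mid v → (V D (flip v) × ¬ 0ℤ < mid (flip v)) × mid (flip v) ≢ 0ℤ
    pos⇒flip-neg {v} (p , q) = (V-flip p , λ r → ℤ.<-asym m<0 r) , λ e → ℤ.<-irrefl e m<0
      where
      m<0 : mid (flip v) < 0ℤ
      m<0 = subst (_< 0ℤ) (sym (mid-flip v)) (ℤ.neg-mono-< q)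

    ∑-odd : (F : Triple → ℤ) → (∀ {v} → V D v → F (conj v) ≡ - F v) → ∑ (forms D) F ≡ 0ℤ
    ∑-odd F odd = i≡-i⇒i≡0 (begin
      ∑ (forms D) F                    ≡⟨ ∑-reindex (forms D) (forms D) conj conj V-conj V-conj inv inv eq ⟩
      ∑ (forms D) (λ v → - 1ℤ * F v)   ≡⟨ sumL-* (- 1ℤ) F (elems (forms D)) ⟩
      - 1ℤ * ∑ (forms D) F             ≡⟨ ℤ.-1*i≡-i _ ⟩
      - ∑ (forms D) F                  ∎)
      where
      open ≡-Reasoning
      inv : ∀ {v} → V D v → conj (conj v) ≡ v
      inv {a , b , c} _ = cong (λ z → a , z , c) (ℤ.neg-involutive b)
      eq : ∀ {v} → V D v → F v ≡ - 1ℤ * F (conj v)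
      eq {v} p = trans (sym (ℤ.neg-involutive (F v))) (trans (cong -_ (sym (odd p))) (sym (ℤ.-1*i≡-i _)))

    -- Forms whose value at (1,1) is nonzero cross exactly one of the two further sides of the
    -- triangle (1,0), (0,1), (1,1) of the topograph; ι exchanges the two crossed sides.
    river : (W F : Triple → ℤ) → (∀ {v} → V D v → F (conj v) ≡ - F v) →
      let X = λ v → W v + F v + (W (flip v) + F (flip v)) in
      (∀ {v} → V D v → X (ι v) ≡ - X v) →
      ∑ (forms D) W ≡ ∑ zeroMid (λ v → W v + F v)
    river W F odd anti = begin
      ∑ (forms D) W                     ≡⟨ ℤ.+-identityʳ _ ⟨
      ∑ (forms D) W + 0ℤ                ≡⟨ cong (∑ (forms D) W +_) (∑-odd F odd) ⟨
      ∑ (forms D) W + ∑ (forms D) F     ≡⟨ sumL-+ W F (elems (forms D)) ⟨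
      ∑ (forms D) G                     ≡⟨ ∑-split (forms D) _ G ⟩
      ∑ positiveMid G + ∑ (restrict (forms D) (λ v → ¬? (0ℤ ℤ.<? mid v))) G
        ≡⟨ cong (∑ positiveMid G +_) (∑-split (restrict (forms D) _) (λ v → mid v ℤ.≟ 0ℤ) G) ⟩
      ∑ positiveMid G + (∑ zeroMid G + ∑ negativeMid G)
        ≡⟨ cong (λ z → ∑ positiveMid G + (∑ zeroMid G + z)) negative ⟩
      ∑ positiveMid G + (∑ zeroMid G + ∑ positiveMid (G ∘ flip))
        ≡⟨ lemma (∑ positiveMid G) (∑ zeroMid G) (∑ positiveMid (G ∘ flip)) ⟩
      ∑ positiveMid G + ∑ positiveMid (G ∘ flip) + ∑ zeroMid G
        ≡⟨ cong (_+ ∑ zeroMid G) (trans (sym (sumL-+ G (G ∘ flip) (elems positiveMid))) vanish) ⟩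
      0ℤ + ∑ zeroMid G                  ≡⟨ ℤ.+-identityˡ _ ⟩
      ∑ zeroMid G                       ∎
      where
      open ≡-Reasoning
      G X : Triple → ℤ
      G v = W v + F v
      X v = G v + G (flip v)
      lemma : ∀ x y z → x + (y + z) ≡ x + z + y
      lemma = solve-∀
      negative : ∑ negativeMid G ≡ ∑ positiveMid (G ∘ flip)
      negative = ∑-reindex negativeMid positiveMid flip flip neg⇒flip-pos pos⇒flip-neg
        (λ {v} _ → flip-flip v) (λ {v} _ → flip-flip v) (λ {v} _ → cong G (sym (flip-flip v)))
      vanish : ∑ positiveMid X ≡ 0ℤ
      vanish = i≡-i⇒i≡0 (begin
        ∑ positiveMid X                   ≡⟨ ∑-reindex positiveMid positiveMid ι ι V-ι V-ι
                                               (λ {v} _ → ι-ι v) (λ {v} _ → ι-ι v)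
                                               (λ {v} (p , _) → trans (sym (ℤ.neg-involutive (X v)))
                                                 (trans (cong -_ (sym (anti p))) (sym (ℤ.-1*i≡-i _)))) ⟩
        ∑ positiveMid (λ v → - 1ℤ * X v)  ≡⟨ sumL-* (- 1ℤ) X (elems positiveMid) ⟩
        - 1ℤ * ∑ positiveMid X            ≡⟨ ℤ.-1*i≡-i _ ⟩
        - ∑ positiveMid X                 ∎)

    -- A form with Q(1,1) = 0 has a rational linear factor, so its discriminant is a square; for
    -- every other D the boundary term of `river` is empty.
    zeroMid-square : ∀ {a b c} → V D (a , b , c) → mid (a , b , c) ≡ 0ℤ →
      D ≡ (a + c) * (a + c) × b ≡ c - a
    zeroMid-square {a} {b} {c} (form _ _ refl) e = trans (cong (λ z → z * z + ℤ.+ 4 * (a * c)) b≡) (lemma₂ a c) , b≡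
      where
      lemma : ∀ a b c → b ≡ a + b - c + (c - a)
      lemma = solve-∀
      lemma₂ : ∀ a c → (c - a) * (c - a) + ℤ.+ 4 * (a * c) ≡ (a + c) * (a + c)
      lemma₂ = solve-∀
      b≡ : b ≡ c - a
      b≡ = trans (lemma a b c) (trans (cong (_+ (c - a)) e) (ℤ.+-identityˡ _))

    ∑-zeroMid-nonsquare : (∀ k → D ≢ k * k) → ∀ F → ∑ zeroMid F ≡ 0ℤ
    ∑-zeroMid-nonsquare ns F = ∑-zero zeroMid λ {v} ((p , _) , e) → ⊥-elim (ns (proj₁ v + proj₂ (proj₂ v)) (proj₁ (zeroMid-square p e)))

-- Weights whose sum over the river is computable

module RiverIdentities where
  open FiniteSums
  open IndefiniteForms
  open import Data.Empty using (⊥-elim)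
  open import Data.Integer using (ℤ; 0ℤ; 1ℤ; _+_; _*_; -_; _-_; _<_; -[1+_]; ∣_∣; +<+)
  import Data.Integer as ℤ
  import Data.Integer.Properties as ℤ
  open import Data.Integer.Tactic.RingSolver using (solve-∀)
  open import Data.List using (downFrom)
  open import Data.List.Membership.Propositional.Properties using (∈-downFrom⁺; ∈-downFrom⁻)
  import Data.List.Relation.Unary.Unique.Propositional.Properties as Unique
  open import Data.Nat as ℕ using (ℕ; zero; suc)
  import Data.Nat.Properties as ℕ
  open import Data.Product using (∃; _×_; _,_; proj₁)
  open import Data.Sum using (_⊎_; inj₁; inj₂)
  open import Function using (_∘_)
  open import Relation.Binary.Definitions using (tri<; tri≈; tri>)
  open import Relation.Binary.PropositionalEquality
    using (_≡_; _≢_; refl; sym; trans; cong; cong₂; subst; module ≡-Reasoning)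
  open import Relation.Nullary using (¬_)
  open import Relation.Nullary.Decidable using (¬?)

  parityℕ : ∀ n → ∃ λ k → ℤ.+ n ≡ ℤ.+ 2 * k ⊎ ℤ.+ n ≡ ℤ.+ 2 * k + 1ℤ
  parityℕ zero = 0ℤ , inj₁ refl
  parityℕ (suc n) with parityℕ n
  ... | k , inj₁ eq = k , inj₂ (trans (ℤ.pos-+ 1 n) (trans (cong (1ℤ +_) eq) (ℤ.+-comm 1ℤ (ℤ.+ 2 * k))))
  ... | k , inj₂ eq = k + 1ℤ , inj₁ (trans (ℤ.pos-+ 1 n) (trans (cong (1ℤ +_) eq) (lemma k)))
    where
    lemma : ∀ k → 1ℤ + (ℤ.+ 2 * k + 1ℤ) ≡ ℤ.+ 2 * (k + 1ℤ)
    lemma = solve-∀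

  parity : ∀ i → ∃ λ k → i ≡ ℤ.+ 2 * k ⊎ i ≡ ℤ.+ 2 * k + 1ℤ
  parity (ℤ.+ n) = parityℕ n
  parity -[1+ n ] with parityℕ (suc n)
  ... | k , inj₁ eq = - k , inj₁ (trans (cong -_ eq) (lemma k))
    where
    lemma : ∀ k → - (ℤ.+ 2 * k) ≡ ℤ.+ 2 * - k
    lemma = solve-∀
  ... | k , inj₂ eq = - k - 1ℤ , inj₂ (trans (cong -_ eq) (lemma k))
    where
    lemma : ∀ k → - (ℤ.+ 2 * k + 1ℤ) ≡ ℤ.+ 2 * (- k - 1ℤ) + 1ℤ
    lemma = solve-∀

  2i≢1 : ∀ i → ℤ.+ 2 * i ≢ 1ℤ
  2i≢1 i eq = ℕ.1+n≢0 (sym (2n≢1 ∣ i ∣ (trans (sym (ℤ.abs-* (ℤ.+ 2) i)) (cong ∣_∣ eq))))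
    where
    2n≢1 : ∀ n → 2 ℕ.* n ≡ 1 → 0 ≡ 1
    2n≢1 (suc n) eq = ⊥-elim (ℕ.1+n≢0 (ℕ.suc-injective (trans (sym (ℕ.+-suc (suc n) (n ℕ.+ 0))) eq)))

  even-of-square : ∀ {b n} → b * b ≡ ℤ.+ 2 * n → ∃ λ β → b ≡ ℤ.+ 2 * β
  even-of-square {b} {n} eq with parity b
  ... | k , inj₁ e = k , e
  ... | k , inj₂ refl = ⊥-elim (2i≢1 (n - ℤ.+ 2 * k * k - ℤ.+ 2 * k)
        (trans (lemma n k) (trans (cong (_- (ℤ.+ 4 * k * k + ℤ.+ 4 * k)) (sym eq)) (lemma₂ k))))
    where
    lemma : ∀ n k → ℤ.+ 2 * (n - ℤ.+ 2 * k * k - ℤ.+ 2 * k) ≡ ℤ.+ 2 * n - (ℤ.+ 4 * k * k + ℤ.+ 4 * k)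
    lemma = solve-∀
    lemma₂ : ∀ k → (ℤ.+ 2 * k + 1ℤ) * (ℤ.+ 2 * k + 1ℤ) - (ℤ.+ 4 * k * k + ℤ.+ 4 * k) ≡ 1ℤ
    lemma₂ = solve-∀

  V-even : ∀ {n a b c} → V (ℤ.+ 4 * n) (a , b , c) → ∃ λ β → b ≡ ℤ.+ 2 * β
  V-even {n} {a} {b} {c} (form _ _ d) = even-of-square {b} {ℤ.+ 2 * (n - a * c)}
    (trans (lemma b a c) (trans (cong (_- ℤ.+ 4 * (a * c)) d) (lemma₂ n (a * c))))
    where
    lemma : ∀ b a c → b * b ≡ b * b + ℤ.+ 4 * (a * c) - ℤ.+ 4 * (a * c)
    lemma = solve-∀
    lemma₂ : ∀ n t → ℤ.+ 4 * n - ℤ.+ 4 * t ≡ ℤ.+ 2 * (ℤ.+ 2 * (n - t))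
    lemma₂ = solve-∀

  nonsquare-4* : ∀ {n} → (∀ k → n ≢ k * k) → ∀ k → ℤ.+ 4 * n ≢ k * k
  nonsquare-4* {n} ns k eq with even-of-square {k} {ℤ.+ 2 * n} (trans (sym eq) (ℤ.*-assoc (ℤ.+ 2) (ℤ.+ 2) n))
  ... | j , refl = ns j (ℤ.*-cancelˡ-≡ (ℤ.+ 4) n (j * j) (trans eq (lemma j)))
    where
    lemma : ∀ j → ℤ.+ 2 * j * (ℤ.+ 2 * j) ≡ ℤ.+ 4 * (j * j)
    lemma = solve-∀

  χℕ oddℕ : ℕ → ℤ
  χℕ 0 = 0ℤ
  χℕ 1 = 1ℤ
  χℕ (suc (suc n)) = - χℕ n
  oddℕ 0 = 0ℤ
  oddℕ 1 = 1ℤ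
  oddℕ (suc (suc n)) = oddℕ n

  -- The nontrivial Dirichlet character modulo 4 and the indicator of odd integers.
  χ odd : ℤ → ℤ
  χ (ℤ.+ n) = χℕ n
  χ -[1+ n ] = - χℕ (suc n)
  odd i = oddℕ ∣ i ∣

  χ-neg : ∀ i → χ (- i) ≡ - χ i
  χ-neg (ℤ.+ zero) = refl
  χ-neg (ℤ.+ suc n) = refl
  χ-neg -[1+ n ] = sym (ℤ.neg-involutive _)

  χ-+2 : ∀ i → χ (i + ℤ.+ 2) ≡ - χ i
  χ-+2 (ℤ.+ n) rewrite ℕ.+-comm n 2 = refl
  χ-+2 -[1+ 0 ] = refl
  χ-+2 -[1+ 1 ] = refl
  χ-+2 -[1+ suc (suc n) ] = sym (ℤ.neg-involutive _)

  χ-+4 : ∀ i → χ (i + ℤ.+ 4) ≡ χ i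
  χ-+4 i = trans (cong χ (lemma i)) (trans (χ-+2 (i + ℤ.+ 2)) (trans (cong -_ (χ-+2 i)) (ℤ.neg-involutive _)))
    where
    lemma : ∀ i → i + ℤ.+ 4 ≡ i + ℤ.+ 2 + ℤ.+ 2
    lemma = solve-∀

  odd-+2 : ∀ i → odd (i + ℤ.+ 2) ≡ odd i
  odd-+2 (ℤ.+ n) rewrite ℕ.+-comm n 2 = refl
  odd-+2 -[1+ 0 ] = refl
  odd-+2 -[1+ 1 ] = refl
  odd-+2 -[1+ suc (suc n) ] = refl

  private
    periodicℕ : ∀ (f : ℤ → ℤ) p → (∀ i → f (i + p) ≡ f i) → ∀ i n → f (i + p * ℤ.+ n) ≡ f i
    periodicℕ f p per i zero = cong f (trans (cong (i +_) (ℤ.*-zeroʳ p)) (ℤ.+-identityʳ i))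
    periodicℕ f p per i (suc n) = trans (cong f (trans (cong (λ z → i + p * z) (ℤ.pos-+ 1 n)) (lemma i p (ℤ.+ n))))
      (trans (per (i + p * ℤ.+ n)) (periodicℕ f p per i n))
      where
      lemma : ∀ i p n → i + p * (1ℤ + n) ≡ i + p * n + p
      lemma = solve-∀

    periodic : ∀ (f : ℤ → ℤ) p → (∀ i → f (i + p) ≡ f i) → ∀ i k → f (i + p * k) ≡ f i
    periodic f p per i (ℤ.+ n) = periodicℕ f p per i n
    periodic f p per i -[1+ n ] = trans (sym (periodicℕ f p per (i + p * -[1+ n ]) (suc n)))
      (cong f (trans (lemma i p -[1+ n ] (ℤ.+ suc n)) (trans (cong (λ z → i + p * z) (ℤ.+-inverseˡ (ℤ.+ suc n)))
        (trans (cong (i +_) (ℤ.*-zeroʳ p)) (ℤ.+-identityʳ i)))))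
      where
      lemma : ∀ i p m n → i + p * m + p * n ≡ i + p * (m + n)
      lemma = solve-∀

  χ-mod : ∀ i k → χ (i + ℤ.+ 4 * k) ≡ χ i
  χ-mod = periodic χ (ℤ.+ 4) χ-+4

  odd-mod : ∀ i k → odd (i + ℤ.+ 2 * k) ≡ odd i
  odd-mod = periodic odd (ℤ.+ 2) odd-+2

  odd-even : ∀ k → odd (ℤ.+ 2 * k) ≡ 0ℤ
  odd-even k = trans (cong odd (sym (ℤ.+-identityˡ (ℤ.+ 2 * k)))) (odd-mod 0ℤ k)

  odd-odd : ∀ k → odd (ℤ.+ 2 * k + 1ℤ) ≡ 1ℤ
  odd-odd k = trans (cong odd (ℤ.+-comm (ℤ.+ 2 * k) 1ℤ)) (odd-mod 1ℤ k)

  V0-point : ℤ → ℤ → Triple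
  V0-point k i = i , k - ℤ.+ 2 * i , k - i

  -- Degenerate forms of discriminant K² satisfy a + c = K and b = c - a, so that a, running over 1,
  -- ..., K - 1, is the only parameter. The range on the right also contains a = 0, which gives no
  -- form; the hypothesis on `F` makes this extra value 0 and keeps the closed formulas simple.
  ∑-zeroMid-square : ∀ K (F : Triple → ℤ) → F (V0-point (ℤ.+ K) 0ℤ) ≡ 0ℤ →
    ∑ (zeroMid (ℤ.+ K * ℤ.+ K)) F ≡ sumL (downFrom K) (λ i → F (V0-point (ℤ.+ K) (ℤ.+ i)))
  ∑-zeroMid-square K F F0 = begin
    ∑ (zeroMid (ℤ.+ K * ℤ.+ K)) F
      ≡⟨ ∑-reindex (zeroMid _) (restrict below nonzero?) (λ v → ∣ proj₁ v ∣) (λ i → V0-point (ℤ.+ K) (ℤ.+ i))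
           to from inv₁ (λ _ → refl) (λ {v} p → cong F (sym (inv₁ {v} p))) ⟩
    ∑ (restrict below nonzero?) G
      ≡⟨ ℤ.+-identityʳ _ ⟨
    ∑ (restrict below nonzero?) G + 0ℤ
      ≡⟨ cong (∑ (restrict below nonzero?) G +_) (∑-zero (restrict below (¬? ∘ nonzero?)) zeros) ⟨
    ∑ (restrict below nonzero?) G + ∑ (restrict below (¬? ∘ nonzero?)) G
      ≡⟨ ∑-split below nonzero? G ⟨
    sumL (downFrom K) G ∎
    where
    open ≡-Reasoning
    G : ℕ → ℤ
    G i = F (V0-point (ℤ.+ K) (ℤ.+ i))
    below : Finite (ℕ._< K)
    below = finite (downFrom K) (Unique.downFrom⁺ K) ∈-downFrom⁻ ∈-downFrom⁺
    nonzero? = λ i → 0 ℕ.<? i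
    zeros : ∀ {i} → i ℕ.< K × ¬ 0 ℕ.< i → G i ≡ 0ℤ
    zeros {zero} _ = F0
    zeros {suc i} (_ , p) = ⊥-elim (p (ℕ.s≤s ℕ.z≤n))
    Z : Triple → Set
    Z v = (V (ℤ.+ K * ℤ.+ K) v × ¬ 0ℤ < mid v) × mid v ≡ 0ℤ
    square-injective : ∀ m n → m ℕ.* m ≡ n ℕ.* n → m ≡ n
    square-injective m n eq with ℕ.<-cmp m n
    ... | tri< m<n _ _ = ⊥-elim (ℕ.<-irrefl eq (ℕ.*-mono-< m<n m<n))
    ... | tri≈ _ m≡n _ = m≡n
    ... | tri> _ _ n<m = ⊥-elim (ℕ.<-irrefl (sym eq) (ℕ.*-mono-< n<m n<m))
    sum≡K : ∀ {x y} → ℤ.+ K * ℤ.+ K ≡ (ℤ.+ x + ℤ.+ y) * (ℤ.+ x + ℤ.+ y) → K ≡ x ℕ.+ y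
    sum≡K {x} {y} eq = square-injective K (x ℕ.+ y) (ℤ.+-injective (trans (ℤ.pos-* K K) (trans eq (sym (ℤ.pos-* (x ℕ.+ y) (x ℕ.+ y))))))
    to : ∀ {v} → Z v → ∣ proj₁ v ∣ ℕ.< K × 0 ℕ.< ∣ proj₁ v ∣
    to {ℤ.+ suc x , b , ℤ.+ suc y} ((p , _) , e) =
      subst (suc x ℕ.<_) (sym (sum≡K {suc x} {suc y} (proj₁ (zeroMid-square (ℤ.+ K * ℤ.+ K) p e)))) (ℕ.m<m+n (suc x) (ℕ.s≤s ℕ.z≤n)) , ℕ.s≤s ℕ.z≤n
    to {ℤ.+ suc x , b , ℤ.+ zero} ((form _ (+<+ ()) _ , _) , e)
    to {ℤ.+ zero , b , _} ((form (+<+ ()) _ _ , _) , e)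
    inv₁ : ∀ {v} → Z v → V0-point (ℤ.+ K) (ℤ.+ ∣ proj₁ v ∣) ≡ v
    inv₁ {ℤ.+ suc x , b , ℤ.+ suc y} ((p , _) , e) with zeroMid-square (ℤ.+ K * ℤ.+ K) p e
    ... | sq , refl rewrite sum≡K {suc x} {suc y} sq | ℤ.pos-+ (suc x) (suc y) =
      cong₂ (λ s t → ℤ.+ suc x , s , t) (lemma (ℤ.+ suc x) (ℤ.+ suc y)) (lemma₂ (ℤ.+ suc x) (ℤ.+ suc y))
      where
      lemma : ∀ x y → x + y - ℤ.+ 2 * x ≡ y - x
      lemma = solve-∀
      lemma₂ : ∀ x y → x + y - x ≡ y
      lemma₂ = solve-∀
    inv₁ {ℤ.+ suc x , b , ℤ.+ zero} ((form _ (+<+ ()) _ , _) , e)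
    inv₁ {ℤ.+ zero , b , _} ((form (+<+ ()) _ _ , _) , e)
    from : ∀ {i} → i ℕ.< K × 0 ℕ.< i → Z (V0-point (ℤ.+ K) (ℤ.+ i))
    from {i} (i<K , 0<i) = (form (+<+ 0<i) c>0′ (lemma (ℤ.+ K) (ℤ.+ i)) , λ p → ℤ.<-irrefl (sym m≡0) p) , m≡0
      where
      lemma : ∀ k i → (k - ℤ.+ 2 * i) * (k - ℤ.+ 2 * i) + ℤ.+ 4 * (i * (k - i)) ≡ k * k
      lemma = solve-∀
      lemma₂ : ∀ k i → i + (k - ℤ.+ 2 * i) - (k - i) ≡ 0ℤ
      lemma₂ = solve-∀
      m≡0 : mid (V0-point (ℤ.+ K) (ℤ.+ i)) ≡ 0ℤ
      m≡0 = lemma₂ (ℤ.+ K) (ℤ.+ i)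
      c>0′ : 0ℤ < ℤ.+ K - ℤ.+ i
      c>0′ = subst (_< ℤ.+ K - ℤ.+ i) (ℤ.+-inverseʳ (ℤ.+ i)) (ℤ.+-monoˡ-< (- ℤ.+ i) (+<+ i<K))

  -- The weight a(b² - ac) has two origins. Three times it is the coefficient of x⁴y² in Q(x,-y)³;
  -- and, up to a factor, it is what the Euler operator of φ⁴ puts on a form, through 5ac - 4n with
  -- 4n = b² + 4ac. `cubicF`, odd in b, is the correction that makes the sum over a form and its
  -- flip antisymmetric under `ι`.
  cubicW cubicF : Triple → ℤ
  cubicW (a , b , c) = a * (b * b - a * c)
  cubicF (a , b , c) = a * a * b

  cubic-river : ∀ D → ∑ (forms D) cubicW ≡ ∑ (zeroMid D) (λ v → cubicW v + cubicF v)
  cubic-river D = river D cubicW cubicF (λ {(a , b , c)} _ → lemma a b) (λ {(a , b , c)} _ → lemma₂ a b c)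
    where
    lemma : ∀ a b → a * a * - b ≡ - (a * a * b)
    lemma = solve-∀
    lemma₂ : ∀ a b c →
      (a + b - c) * ((ℤ.+ 2 * c - b) * (ℤ.+ 2 * c - b) - (a + b - c) * c)
        + (a + b - c) * (a + b - c) * (ℤ.+ 2 * c - b)
        + (c * (- (ℤ.+ 2 * c - b) * - (ℤ.+ 2 * c - b) - c * (a + b - c)) + c * c * - (ℤ.+ 2 * c - b))
      ≡ - (a * (b * b - a * c) + a * a * b + (c * (- b * - b - c * a) + c * c * - b))
    lemma₂ = solve-∀

  cubic-nonsquare : ∀ D → (∀ k → D ≢ k * k) → ∑ (forms D) cubicW ≡ 0ℤ
  cubic-nonsquare D ns = trans (cubic-river D) (∑-zeroMid-nonsquare D ns _)

  cubic-square : ∀ K → let k = ℤ.+ K in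
    ℤ.+ 12 * ∑ (forms (k * k)) cubicW ≡ k * k - k * k * (k * k)
  cubic-square K = begin
    ℤ.+ 12 * ∑ (forms (k * k)) cubicW
      ≡⟨ cong (ℤ.+ 12 *_) (trans (cubic-river (k * k)) (∑-zeroMid-square K _ refl)) ⟩
    ℤ.+ 12 * sumL (downFrom K) (λ i → G (ℤ.+ i))
      ≡⟨ closed K ⟩
    ℤ.+ 6 * (k * k) * k * (k - 1ℤ) - ℤ.+ 8 * k * k * (k - 1ℤ) * (ℤ.+ 2 * k - 1ℤ) + ℤ.+ 9 * k * k * (k - 1ℤ) * (k - 1ℤ)
      ≡⟨ lemma k ⟩
    k * k - k * k * (k * k) ∎
    where
    open ≡-Reasoning
    k = ℤ.+ K
    G : ℤ → ℤ
    G i = i * ((k - ℤ.+ 2 * i) * (k - ℤ.+ 2 * i) - i * (k - i)) + i * i * (k - ℤ.+ 2 * i)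
    lemma : ∀ k → ℤ.+ 6 * (k * k) * k * (k - 1ℤ) - ℤ.+ 8 * k * k * (k - 1ℤ) * (ℤ.+ 2 * k - 1ℤ) + ℤ.+ 9 * k * k * (k - 1ℤ) * (k - 1ℤ)
      ≡ k * k - k * k * (k * k)
    lemma = solve-∀
    step : ∀ k i → ℤ.+ 12 * (i * ((k - ℤ.+ 2 * i) * (k - ℤ.+ 2 * i) - i * (k - i)) + i * i * (k - ℤ.+ 2 * i))
      + (ℤ.+ 6 * (k * k) * i * (i - 1ℤ) - ℤ.+ 8 * k * i * (i - 1ℤ) * (ℤ.+ 2 * i - 1ℤ) + ℤ.+ 9 * i * i * (i - 1ℤ) * (i - 1ℤ))
      ≡ ℤ.+ 6 * (k * k) * (1ℤ + i) * (1ℤ + i - 1ℤ) - ℤ.+ 8 * k * (1ℤ + i) * (1ℤ + i - 1ℤ) * (ℤ.+ 2 * (1ℤ + i) - 1ℤ)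
        + ℤ.+ 9 * (1ℤ + i) * (1ℤ + i) * (1ℤ + i - 1ℤ) * (1ℤ + i - 1ℤ)
    step = solve-∀
    -- The upper limit N varies while k is fixed, so that the summand stays the same during the
    -- induction; the claim is the case N = K. The summand simplifies to k²i - 4ki² + 3i³, whence
    -- the three power sums.
    closed : ∀ N → let n = ℤ.+ N in ℤ.+ 12 * sumL (downFrom N) (λ i → G (ℤ.+ i)) ≡
      ℤ.+ 6 * (k * k) * n * (n - 1ℤ) - ℤ.+ 8 * k * n * (n - 1ℤ) * (ℤ.+ 2 * n - 1ℤ) + ℤ.+ 9 * n * n * (n - 1ℤ) * (n - 1ℤ)
    closed zero = sym (lemma₀ k)
      where
      lemma₀ : ∀ k → ℤ.+ 6 * (k * k) * 0ℤ * (0ℤ - 1ℤ) - ℤ.+ 8 * k * 0ℤ * (0ℤ - 1ℤ) * (ℤ.+ 2 * 0ℤ - 1ℤ) + ℤ.+ 9 * 0ℤ * 0ℤ * (0ℤ - 1ℤ) * (0ℤ - 1ℤ) ≡ 0ℤ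
      lemma₀ = solve-∀
    closed (suc N) rewrite ℤ.pos-+ 1 N = trans (ℤ.*-distribˡ-+ (ℤ.+ 12) (G (ℤ.+ N)) _)
      (trans (cong (ℤ.+ 12 * G (ℤ.+ N) +_) (closed N)) (step k (ℤ.+ N)))

  -- -χ(a)(b² - 2ac) is twice what the Euler operator of φ² puts on a form of discriminant 4n. The
  -- second summand of `χF` is odd in b because b is even, so that a + b - c and a - b - c agree
  -- modulo 4.
  χW χF : Triple → ℤ
  χW (a , b , c) = χ a * (b * b - ℤ.+ 2 * (a * c))
  χF (a , b , c) = χ a * (a - ℤ.+ 2 * c) * b + χ (a + b - c) * (a * b)

  χ-river : ∀ n → ∑ (forms (ℤ.+ 4 * n)) χW ≡ ∑ (zeroMid (ℤ.+ 4 * n)) (λ v → χW v + χF v)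
  χ-river n = river D χW χF oddness antisymmetry
    where
    D = ℤ.+ 4 * n
    oddness : ∀ {v} → V D v → χF (conj v) ≡ - χF v
    oddness {a , b , c} p with β , refl ← V-even {n} p = trans
      (cong (λ z → χ a * (a - ℤ.+ 2 * c) * - (ℤ.+ 2 * β) + z * (a * - (ℤ.+ 2 * β)))
        (trans (cong χ (shift a β c)) (χ-mod (a + ℤ.+ 2 * β - c) (- β))))
      (lemma (χ a) (χ (a + ℤ.+ 2 * β - c)) a (ℤ.+ 2 * β) c)
      where
      shift : ∀ a β c → a + - (ℤ.+ 2 * β) - c ≡ a + ℤ.+ 2 * β - c + ℤ.+ 4 * - β
      shift = solve-∀
      lemma : ∀ x y a b c → x * (a - ℤ.+ 2 * c) * - b + y * (a * - b) ≡ - (x * (a - ℤ.+ 2 * c) * b + y * (a * b))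
      lemma = solve-∀
    e₁ : ∀ a b c → c + - (ℤ.+ 2 * c - b) - (a + b - c) ≡ - a
    e₁ = solve-∀
    e₂ : ∀ a b c → c + - b - a ≡ - (a + b - c)
    e₂ = solve-∀
    antisymmetry : ∀ {v} → V D v →
      χW (ι v) + χF (ι v) + (χW (flip (ι v)) + χF (flip (ι v))) ≡ - (χW v + χF v + (χW (flip v) + χF (flip v)))
    antisymmetry {a , b , c} p
      rewrite cong proj₁ (ι-ι D (a , b , c))
        | trans (cong χ (e₁ a b c)) (χ-neg a)
        | trans (cong χ (e₂ a b c)) (χ-neg (a + b - c)) =
      lemma (χ a) (χ (a + b - c)) (χ c) a b c
      where
      lemma : ∀ x y z a b c →
        y * ((ℤ.+ 2 * c - b) * (ℤ.+ 2 * c - b) - ℤ.+ 2 * ((a + b - c) * c))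
          + (y * (a + b - c - ℤ.+ 2 * c) * (ℤ.+ 2 * c - b) + x * ((a + b - c) * (ℤ.+ 2 * c - b)))
          + (z * (- (ℤ.+ 2 * c - b) * - (ℤ.+ 2 * c - b) - ℤ.+ 2 * (c * (a + b - c)))
            + (z * (c - ℤ.+ 2 * (a + b - c)) * - (ℤ.+ 2 * c - b) + - x * (c * - (ℤ.+ 2 * c - b))))
        ≡ - (x * (b * b - ℤ.+ 2 * (a * c)) + (x * (a - ℤ.+ 2 * c) * b + y * (a * b))
          + (z * (- b * - b - ℤ.+ 2 * (c * a)) + (z * (c - ℤ.+ 2 * a) * - b + - y * (c * - b))))
      lemma = solve-∀

  χ-nonsquare : ∀ n → (∀ k → n ≢ k * k) → ∑ (forms (ℤ.+ 4 * n)) χW ≡ 0ℤ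
  χ-nonsquare n ns = trans (χ-river n) (∑-zeroMid-nonsquare (ℤ.+ 4 * n) (nonsquare-4* ns) _)

  χ-square : ∀ K → let k = ℤ.+ K in ∑ (forms (ℤ.+ 4 * (k * k))) χW ≡ - (ℤ.+ 2 * (k * k))
  χ-square K = begin
    ∑ (forms (ℤ.+ 4 * (k * k))) χW
      ≡⟨ cong (λ D → ∑ (forms D) χW) 4kk ⟩
    ∑ (forms (L * L)) χW
      ≡⟨ subst (λ D → ∑ (forms D) χW ≡ ∑ (zeroMid D) (λ v → χW v + χF v)) 4kk (χ-river (k * k)) ⟩
    ∑ (zeroMid (L * L)) (λ v → χW v + χF v)
      ≡⟨ ∑-zeroMid-square (2 ℕ.* K) _ (lemma₀ L) ⟩
    sumL (downFrom (2 ℕ.* K)) (λ i → χW (V0-point L (ℤ.+ i)) + χF (V0-point L (ℤ.+ i)))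
      -- On degenerate forms Q(1,1) = 0, where `χ` vanishes; the second character drops out and the
      -- rest factors.
      ≡⟨ sumL-cong (downFrom (2 ℕ.* K)) (λ {i} _ → trans
           (cong (λ z → χW (V0-point L (ℤ.+ i)) + (χ (ℤ.+ i) * (ℤ.+ i - ℤ.+ 2 * (L - ℤ.+ i)) * (L - ℤ.+ 2 * ℤ.+ i) + z * (ℤ.+ i * (L - ℤ.+ 2 * ℤ.+ i)))) (cong χ (lemma₁ L (ℤ.+ i))))
           (lemma₂ (χ (ℤ.+ i)) L (ℤ.+ i))) ⟩
    sumL (downFrom (2 ℕ.* K)) (λ i → - L * (χ (ℤ.+ i) * (L - ℤ.+ i)))
      ≡⟨ sumL-* (- L) (λ i → χ (ℤ.+ i) * (L - ℤ.+ i)) (downFrom (2 ℕ.* K)) ⟩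
    - L * sumL (downFrom (2 ℕ.* K)) (λ i → χ (ℤ.+ i) * (L - ℤ.+ i))
      ≡⟨ cong (- L *_) (partial K) ⟩
    - L * k
      ≡⟨ trans (cong (λ z → - z * k) (ℤ.pos-* 2 K)) (lemma₃ k) ⟩
    - (ℤ.+ 2 * (k * k)) ∎
    where
    open ≡-Reasoning
    k = ℤ.+ K
    L = ℤ.+ (2 ℕ.* K)
    4kk : ℤ.+ 4 * (k * k) ≡ L * L
    4kk = trans (lemma k) (cong₂ _*_ (sym (ℤ.pos-* 2 K)) (sym (ℤ.pos-* 2 K)))
      where
      lemma : ∀ k → ℤ.+ 4 * (k * k) ≡ ℤ.+ 2 * k * (ℤ.+ 2 * k)
      lemma = solve-∀
    lemma₀ : ∀ L → 0ℤ * ((L - 0ℤ) * (L - 0ℤ) - ℤ.+ 2 * (0ℤ * (L - 0ℤ))) + (0ℤ * (0ℤ - ℤ.+ 2 * (L - 0ℤ)) * (L - 0ℤ) + χ (0ℤ + (L - 0ℤ) - (L - 0ℤ)) * (0ℤ * (L - 0ℤ))) ≡ 0ℤ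
    lemma₀ L = cong₂ _+_ (ℤ.*-zeroˡ ((L - 0ℤ) * (L - 0ℤ) - ℤ.+ 2 * (0ℤ * (L - 0ℤ)))) (cong₂ _+_ (trans (cong (_* (L - 0ℤ)) (ℤ.*-zeroˡ (0ℤ - ℤ.+ 2 * (L - 0ℤ)))) (ℤ.*-zeroˡ (L - 0ℤ)))
      (trans (cong (χ (0ℤ + (L - 0ℤ) - (L - 0ℤ)) *_) (ℤ.*-zeroˡ (L - 0ℤ))) (ℤ.*-zeroʳ (χ (0ℤ + (L - 0ℤ) - (L - 0ℤ))))))
    lemma₁ : ∀ k i → i + (k - ℤ.+ 2 * i) - (k - i) ≡ 0ℤ
    lemma₁ = solve-∀
    lemma₂ : ∀ x k i → x * ((k - ℤ.+ 2 * i) * (k - ℤ.+ 2 * i) - ℤ.+ 2 * (i * (k - i))) + (x * (i - ℤ.+ 2 * (k - i)) * (k - ℤ.+ 2 * i) + 0ℤ * (i * (k - ℤ.+ 2 * i)))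
      ≡ - k * (x * (k - i))
    lemma₂ = solve-∀
    lemma₃ : ∀ k → - (ℤ.+ 2 * k) * k ≡ - (ℤ.+ 2 * (k * k))
    lemma₃ = solve-∀
    S : ℤ → ℕ → ℤ
    S x n = sumL (downFrom n) (λ i → χ (ℤ.+ i) * (x - ℤ.+ i))
    four : ∀ j → χ (ℤ.+ (j ℕ.* 4)) ≡ 0ℤ
    four zero = refl
    four (suc j) = trans (ℤ.neg-involutive _) (four j)
    first : ∀ j → χℕ (suc (j ℕ.* 4)) ≡ 1ℤ
    first zero = refl
    first (suc j) = trans (ℤ.neg-involutive _) (first j)
    -- A block i, ..., i + 3 with 4 dividing i contributes (x - i - 1) - (x - i - 3) = 2, whatever x
    -- is.
    full : ∀ x j → S x (j ℕ.* 4) ≡ ℤ.+ (j ℕ.* 2)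
    full x zero = refl
    full x (suc j) rewrite full x j | four j | first j = trans (lemma x (ℤ.+ (j ℕ.* 4)) (ℤ.+ (j ℕ.* 2))) (sym (ℤ.pos-+ 2 (j ℕ.* 2)))
      where
      lemma : ∀ x i s → - 1ℤ * (x - (ℤ.+ 3 + i)) + (- 0ℤ * (x - (ℤ.+ 2 + i)) + (1ℤ * (x - (1ℤ + i)) + (0ℤ * (x - i) + s))) ≡ ℤ.+ 2 + s
      lemma = solve-∀
    halves : ∀ K → ∃ λ j → K ≡ j ℕ.* 2 ⊎ K ≡ suc (j ℕ.* 2)
    halves zero = 0 , inj₁ refl
    halves (suc K) with halves K
    ... | j , inj₁ refl = j , inj₂ refl
    ... | j , inj₂ refl = suc j , inj₁ refl
    partial : ∀ K → S (ℤ.+ (2 ℕ.* K)) (2 ℕ.* K) ≡ ℤ.+ K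
    partial K with halves K
    ... | j , inj₁ refl = trans (cong (S (ℤ.+ (2 ℕ.* (j ℕ.* 2)))) (eq j)) (full (ℤ.+ (2 ℕ.* (j ℕ.* 2))) j)
      where
      eq : ∀ j → 2 ℕ.* (j ℕ.* 2) ≡ j ℕ.* 4
      eq j = trans (ℕ.*-comm 2 (j ℕ.* 2)) (ℕ.*-assoc j 2 2)
    ... | j , inj₂ refl = trans (cong₂ S (trans (cong ℤ.+_ (eq j)) (ℤ.pos-+ 2 (j ℕ.* 4))) (eq j))
            (trans (cong₂ (λ s t → s * (ℤ.+ 2 + ℤ.+ (j ℕ.* 4) - ℤ.+ suc (j ℕ.* 4)) + t) (first j)
              (cong₂ (λ s t → s * (ℤ.+ 2 + ℤ.+ (j ℕ.* 4) - ℤ.+ (j ℕ.* 4)) + t) (four j) (full (ℤ.+ 2 + ℤ.+ (j ℕ.* 4)) j)))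
              (trans (cong (λ z → 1ℤ * (ℤ.+ 2 + ℤ.+ (j ℕ.* 4) - z) + (0ℤ * (ℤ.+ 2 + ℤ.+ (j ℕ.* 4) - ℤ.+ (j ℕ.* 4)) + ℤ.+ (j ℕ.* 2))) (ℤ.pos-+ 1 (j ℕ.* 4)))
                (trans (lemma (ℤ.+ (j ℕ.* 4)) (ℤ.+ (j ℕ.* 2))) (sym (ℤ.pos-+ 1 (j ℕ.* 2))))))
      where
      eq : ∀ j → 2 ℕ.* suc (j ℕ.* 2) ≡ suc (suc (j ℕ.* 4))
      eq j = trans (ℕ.*-comm 2 (suc (j ℕ.* 2))) (cong (2 ℕ.+_) (ℕ.*-assoc j 2 2))
      lemma : ∀ i s → 1ℤ * (ℤ.+ 2 + i - (1ℤ + i)) + (0ℤ * (ℤ.+ 2 + i - i) + s) ≡ 1ℤ + s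
      lemma = solve-∀

  parityW parityF : Triple → ℤ
  parityW (a , b , c) = odd c * (1ℤ - ℤ.+ 2 * odd a) * a
  parityF (a , b , c) = (1ℤ - odd a) * odd c * b

  -- Since b is even, the parities of a and c determine that of Q(1,1), and the antisymmetry can be
  -- checked on the four classes of (a, c). The purpose is a balance: among the forms with c odd,
  -- even and odd a have the same total.
  parity-sum : ∀ n → (∀ k → n ≢ k * k) → ∑ (forms (ℤ.+ 4 * n)) parityW ≡ 0ℤ
  parity-sum n ns = trans (river D parityW parityF (λ {(a , b , c)} _ → lemma₀ (odd a) (odd c) b) anti)
    (∑-zeroMid-nonsquare D (nonsquare-4* ns) _)
    where
    D = ℤ.+ 4 * n
    lemma₀ : ∀ x y b → (1ℤ - x) * y * - b ≡ - ((1ℤ - x) * y * b)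
    lemma₀ = solve-∀
    odd-mid : ∀ a β c → odd (a + ℤ.+ 2 * β - c) ≡ odd a + odd c - ℤ.+ 2 * (odd a * odd c)
    odd-mid a β c with parity a | parity c
    ... | i , inj₁ refl | j , inj₁ refl rewrite odd-even i | odd-even j = trans (cong odd (lemma i β j)) (odd-even (i + β - j))
      where
      lemma : ∀ i β j → ℤ.+ 2 * i + ℤ.+ 2 * β - ℤ.+ 2 * j ≡ ℤ.+ 2 * (i + β - j)
      lemma = solve-∀
    ... | i , inj₂ refl | j , inj₁ refl rewrite odd-odd i | odd-even j = trans (cong odd (lemma i β j)) (odd-odd (i + β - j))
      where
      lemma : ∀ i β j → ℤ.+ 2 * i + 1ℤ + ℤ.+ 2 * β - ℤ.+ 2 * j ≡ ℤ.+ 2 * (i + β - j) + 1ℤ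
      lemma = solve-∀
    ... | i , inj₁ refl | j , inj₂ refl rewrite odd-even i | odd-odd j = trans (cong odd (lemma i β j)) (odd-odd (i + β - j - 1ℤ))
      where
      lemma : ∀ i β j → ℤ.+ 2 * i + ℤ.+ 2 * β - (ℤ.+ 2 * j + 1ℤ) ≡ ℤ.+ 2 * (i + β - j - 1ℤ) + 1ℤ
      lemma = solve-∀
    ... | i , inj₂ refl | j , inj₂ refl rewrite odd-odd i | odd-odd j = trans (cong odd (lemma i β j)) (odd-even (i + β - j))
      where
      lemma : ∀ i β j → ℤ.+ 2 * i + 1ℤ + ℤ.+ 2 * β - (ℤ.+ 2 * j + 1ℤ) ≡ ℤ.+ 2 * (i + β - j)
      lemma = solve-∀
    bit : ∀ i → odd i ≡ 0ℤ ⊎ odd i ≡ 1ℤ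
    bit i with parity i
    ... | k , inj₁ refl = inj₁ (odd-even k)
    ... | k , inj₂ refl = inj₂ (odd-odd k)
    E₁ E₂ : ℤ → ℤ → ℤ → ℤ → ℤ → ℤ
    E₁ m y a b c = y * (1ℤ - ℤ.+ 2 * m) * (a + b - c) + (1ℤ - m) * y * (ℤ.+ 2 * c - b)
      + (m * (1ℤ - ℤ.+ 2 * y) * c + (1ℤ - y) * m * - (ℤ.+ 2 * c - b))
    E₂ x y a b c = y * (1ℤ - ℤ.+ 2 * x) * a + (1ℤ - x) * y * b
      + (x * (1ℤ - ℤ.+ 2 * y) * c + (1ℤ - y) * x * - b)
    cases : ∀ {x y m} → x ≡ 0ℤ ⊎ x ≡ 1ℤ → y ≡ 0ℤ ⊎ y ≡ 1ℤ → m ≡ x + y - ℤ.+ 2 * (x * y) →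
      ∀ a b c → E₁ m y a b c ≡ - E₂ x y a b c
    cases (inj₁ refl) (inj₁ refl) refl = lemma
      where
      lemma : ∀ a b c → 0ℤ * (1ℤ - ℤ.+ 2 * 0ℤ) * (a + b - c) + (1ℤ - 0ℤ) * 0ℤ * (ℤ.+ 2 * c - b)
        + (0ℤ * (1ℤ - ℤ.+ 2 * 0ℤ) * c + (1ℤ - 0ℤ) * 0ℤ * - (ℤ.+ 2 * c - b))
        ≡ - (0ℤ * (1ℤ - ℤ.+ 2 * 0ℤ) * a + (1ℤ - 0ℤ) * 0ℤ * b + (0ℤ * (1ℤ - ℤ.+ 2 * 0ℤ) * c + (1ℤ - 0ℤ) * 0ℤ * - b))
      lemma = solve-∀
    cases (inj₁ refl) (inj₂ refl) refl = lemma
      where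
      lemma : ∀ a b c → 1ℤ * (1ℤ - ℤ.+ 2 * 1ℤ) * (a + b - c) + (1ℤ - 1ℤ) * 1ℤ * (ℤ.+ 2 * c - b)
        + (1ℤ * (1ℤ - ℤ.+ 2 * 1ℤ) * c + (1ℤ - 1ℤ) * 1ℤ * - (ℤ.+ 2 * c - b))
        ≡ - (1ℤ * (1ℤ - ℤ.+ 2 * 0ℤ) * a + (1ℤ - 0ℤ) * 1ℤ * b + (0ℤ * (1ℤ - ℤ.+ 2 * 1ℤ) * c + (1ℤ - 1ℤ) * 0ℤ * - b))
      lemma = solve-∀
    cases (inj₂ refl) (inj₁ refl) refl = lemma
      where
      lemma : ∀ a b c → 0ℤ * (1ℤ - ℤ.+ 2 * 1ℤ) * (a + b - c) + (1ℤ - 1ℤ) * 0ℤ * (ℤ.+ 2 * c - b)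
        + (1ℤ * (1ℤ - ℤ.+ 2 * 0ℤ) * c + (1ℤ - 0ℤ) * 1ℤ * - (ℤ.+ 2 * c - b))
        ≡ - (0ℤ * (1ℤ - ℤ.+ 2 * 1ℤ) * a + (1ℤ - 1ℤ) * 0ℤ * b + (1ℤ * (1ℤ - ℤ.+ 2 * 0ℤ) * c + (1ℤ - 0ℤ) * 1ℤ * - b))
      lemma = solve-∀
    cases (inj₂ refl) (inj₂ refl) refl = lemma
      where
      lemma : ∀ a b c → 1ℤ * (1ℤ - ℤ.+ 2 * 0ℤ) * (a + b - c) + (1ℤ - 0ℤ) * 1ℤ * (ℤ.+ 2 * c - b)
        + (0ℤ * (1ℤ - ℤ.+ 2 * 1ℤ) * c + (1ℤ - 1ℤ) * 0ℤ * - (ℤ.+ 2 * c - b))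
        ≡ - (1ℤ * (1ℤ - ℤ.+ 2 * 1ℤ) * a + (1ℤ - 1ℤ) * 1ℤ * b + (1ℤ * (1ℤ - ℤ.+ 2 * 1ℤ) * c + (1ℤ - 1ℤ) * 1ℤ * - b))
      lemma = solve-∀
    anti : ∀ {v} → V D v → parityW (ι v) + parityF (ι v) + (parityW (flip (ι v)) + parityF (flip (ι v)))
      ≡ - (parityW v + parityF v + (parityW (flip v) + parityF (flip v)))
    anti {a , b , c} p with β , refl ← V-even {n} p = cases (bit a) (bit c) (odd-mid a β c) a (ℤ.+ 2 * β) c

-- Counting the forms that separate two vectors

module Crossings
  (D : Data.Integer.ℤ) (ω : Data.Integer.ℤ → Data.Integer.ℤ)
  where
  open FiniteSums
  open IndefiniteForms hiding (flip)
  open import Data.Empty using (⊥-elim)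
  open import Data.Integer using (ℤ; 0ℤ; 1ℤ; _+_; _*_; -_; _-_; _<_; -[1+_]; ∣_∣; +<+)
  import Data.Integer as ℤ
  import Data.Integer.DivMod as ℤ
  import Data.Integer.Properties as ℤ
  open import Data.Integer.Tactic.RingSolver using (solve-∀)
  open import Data.List using (List; map; _++_; []; deduplicate)
  open import Data.List.Membership.Propositional using (_∈_)
  open import Data.List.Membership.Propositional.Properties using (∈-map⁺; ∈-map⁻; ∈-++⁺ˡ; ∈-++⁺ʳ; ∈-++⁻; ∈-deduplicate⁺; ∈-deduplicate⁻)
  open import Data.List.Relation.Unary.Unique.DecPropositional.Properties using (deduplicate-!)
  open import Data.List.Relation.Unary.Unique.Propositional using (Unique)
  open import Data.Nat as ℕ using (ℕ; zero; suc)
  open import Data.Nat.Induction using (<-rec)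
  import Data.Nat.Properties as ℕ
  open import Data.Product using (_×_; _,_; proj₁; proj₂)
  open import Data.Product.Properties using (≡-dec)
  open import Data.Sum using (inj₁; inj₂; [_,_])
  open import Function using (_∘_; id)
  open import Relation.Binary.Definitions using (tri<; tri≈; tri>)
  open import Relation.Binary.PropositionalEquality
    using (_≡_; _≢_; refl; sym; trans; cong; cong₂; subst; module ≡-Reasoning)
  open import Relation.Nullary using (¬_; Dec)
  open import Relation.Nullary.Decidable using (_×-dec_; ¬?)

  Vector : Set
  Vector = ℤ × ℤ

  -- In this part a triple stands for aX² + bXY + cY², so the sign of c is opposite to the
  -- convention of `V`. Accordingly `Disc` is b² - 4ac, and `polar` is Q(r + s) - Q(r) - Q(s).
  val : Triple → Vector → ℤ
  val (a , b , c) (x , y) = a * (x * x) + b * (x * y) + c * (y * y)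

  polar : Triple → Vector → Vector → ℤ
  polar (a , b , c) (x , y) (u , w) = ℤ.+ 2 * (a * (x * u)) + b * (x * w + y * u) + ℤ.+ 2 * (c * (y * w))

  record Disc (Q : Triple) : Set where
    constructor discriminant
    field disc′ : proj₁ (proj₂ Q) * proj₁ (proj₂ Q) - ℤ.+ 4 * (proj₁ Q * proj₂ (proj₂ Q)) ≡ D
  open Disc public

  neg : Triple → Triple
  neg (a , b , c) = - a , - b , - c

  neg-neg : ∀ Q → neg (neg Q) ≡ Q
  neg-neg (a , b , c) = cong₂ _,_ (ℤ.neg-involutive a) (cong₂ _,_ (ℤ.neg-involutive b) (ℤ.neg-involutive c))

  Disc-neg : ∀ {Q} → Disc Q → Disc (neg Q)
  Disc-neg {a , b , c} (discriminant eq) = discriminant (trans (lemma a b c) eq)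
    where
    lemma : ∀ a b c → - b * - b - ℤ.+ 4 * (- a * - c) ≡ b * b - ℤ.+ 4 * (a * c)
    lemma = solve-∀

  val-neg : ∀ Q r → val (neg Q) r ≡ - val Q r
  val-neg (a , b , c) (x , y) = lemma a b c (x * x) (x * y) (y * y)
    where
    lemma : ∀ a b c s t u → - a * s + - b * t + - c * u ≡ - (a * s + b * t + c * u)
    lemma = solve-∀

  pos : ℤ → ℤ
  pos (ℤ.+ zero) = 0ℤ
  pos (ℤ.+ suc _) = 1ℤ
  pos -[1+ _ ] = 0ℤ

  pos-> : ∀ {i} → 0ℤ < i → pos i ≡ 1ℤ
  pos-> {ℤ.+ suc _} _ = refl
  pos-> {ℤ.+ zero} (+<+ ())

  pos-< : ∀ {i} → i < 0ℤ → pos i ≡ 0ℤ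
  pos-< { -[1+ _ ]} _ = refl
  pos-< {ℤ.+ _} (+<+ ())

  e₁ : Vector
  e₁ = 1ℤ , 0ℤ

  val-e₁ : ∀ Q → val Q e₁ ≡ proj₁ Q
  val-e₁ (a , b , c) = lemma a b c
    where
    lemma : ∀ a b c → a * (1ℤ * 1ℤ) + b * (1ℤ * 0ℤ) + c * (0ℤ * 0ℤ) ≡ a
    lemma = solve-∀

  -- The signed count of the forms that are positive at exactly one of r and s, weighted by
  -- ω(Q(1,0)). As a difference of indicators it telescopes along a path. Either indicator alone
  -- would range over infinitely many forms, which is why a finite list `L` is carried along.
  T : List Triple → Vector → Vector → ℤ
  T L r s = sumL L (λ Q → (pos (val Q r) - pos (val Q s)) * ω (proj₁ Q))

  -- The forms of discriminant D crossing a given segment are finite in number, so every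
  -- statement about finitely many segments holds for all sufficiently large finite sets of forms.
  record Eventually (P : List Triple → Set) : Set where
    constructor eventually
    field
      support : List Triple
      support-disc : ∀ {Q} → Q ∈ support → Disc Q
      holds : ∀ L → Unique L → (∀ {Q} → Q ∈ L → Disc Q) → (∀ {Q} → Q ∈ support → Q ∈ L) → P L
  open Eventually

  eventually-map₂ : ∀ {P R S} → (∀ {L} → P L → R L → S L) → Eventually P → Eventually R → Eventually S
  eventually-map₂ f (eventually xs dx p) (eventually ys dy r) = eventually (xs ++ ys)
    (λ Q∈ → [ dx , dy ] (∈-++⁻ xs Q∈))
    (λ L u d sub → f (p L u d (sub ∘ ∈-++⁺ˡ)) (r L u d (sub ∘ ∈-++⁺ʳ xs)))

  -- The support itself, freed of repetitions, is a sufficiently large list.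
  eventually-const : ∀ {P : Set} → Eventually (λ _ → P) → P
  eventually-const (eventually xs dx p) = p (deduplicate _≟_ xs) (deduplicate-! _≟_ xs)
    (dx ∘ ∈-deduplicate⁻ _≟_ xs) (∈-deduplicate⁺ _≟_)
    where
    _≟_ = ≡-dec ℤ._≟_ (≡-dec ℤ._≟_ ℤ._≟_)

  module Crossing
    (r s : Vector)
    (nonzero-r : ∀ {Q} → Disc Q → val Q r ≢ 0ℤ) (nonzero-s : ∀ {Q} → Disc Q → val Q s ≢ 0ℤ)
    {W : Triple → Set} (ws : Finite W) (to from : Triple → Triple)
    (to∈ : ∀ {Q} → Disc Q → 0ℤ < val Q r → val Q s < 0ℤ → W (to Q))
    (from-disc : ∀ {w} → W w → Disc (from w))
    (from-r : ∀ {w} → W w → 0ℤ < val (from w) r)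
    (from-s : ∀ {w} → W w → val (from w) s < 0ℤ)
    (to-from : ∀ {w} → W w → to (from w) ≡ w)
    (from-to : ∀ {Q} → Disc Q → 0ℤ < val Q r → val Q s < 0ℤ → from (to Q) ≡ Q)
    (ω-odd : ∀ i → ω (- i) ≡ - ω i)
    where

    private
      Down Up : Triple → Set
      Down Q = 0ℤ < val Q r × val Q s < 0ℤ
      Up Q = val Q r < 0ℤ × 0ℤ < val Q s
      down? : ∀ Q → Dec (Down Q)
      down? Q = (0ℤ ℤ.<? val Q r) ×-dec (val Q s ℤ.<? 0ℤ)
      up? : ∀ Q → Dec (Up Q)
      up? Q = (val Q r ℤ.<? 0ℤ) ×-dec (0ℤ ℤ.<? val Q s)

      down-up : ∀ {Q} → Down Q → Up (neg Q)
      down-up {Q} (p , q) = subst (_< 0ℤ) (sym (val-neg Q r)) (ℤ.neg-mono-< p)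
                          , subst (0ℤ <_) (sym (val-neg Q s)) (ℤ.neg-mono-< q)
      up-down : ∀ {Q} → Up Q → Down (neg Q)
      up-down {Q} (p , q) = subst (0ℤ <_) (sym (val-neg Q r)) (ℤ.neg-mono-< p)
                          , subst (_< 0ℤ) (sym (val-neg Q s)) (ℤ.neg-mono-< q)

      xs : List Triple
      xs = map from (elems ws) ++ map (neg ∘ from) (elems ws)

      xs-disc : ∀ {Q} → Q ∈ xs → Disc Q
      xs-disc Q∈ with ∈-++⁻ (map from (elems ws)) Q∈
      ... | inj₁ p with w , w∈ , refl ← ∈-map⁻ from p = from-disc (sound ws w∈)
      ... | inj₂ p with w , w∈ , refl ← ∈-map⁻ (neg ∘ from) p = Disc-neg (from-disc (sound ws w∈))

    -- Equal signs at the two ends cancel. Negation exchanges the forms that fall from r to s with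
    -- those that rise, and it reverses both the difference of indicators and `ω`; the two kinds
    -- contribute equally, whence the factor 2.
    crossing : Eventually (λ L → T L r s ≡ ℤ.+ 2 * ∑ ws (ω ∘ proj₁ ∘ from))
    crossing = eventually xs xs-disc holds′
      where
      open ≡-Reasoning
      holds′ : ∀ L → Unique L → (∀ {Q} → Q ∈ L → Disc Q) → (∀ {Q} → Q ∈ xs → Q ∈ L) →
        T L r s ≡ ℤ.+ 2 * ∑ ws (ω ∘ proj₁ ∘ from)
      holds′ L u d sub = begin
        ∑ all F                               ≡⟨ ∑-split all down? F ⟩
        ∑ downs F + ∑ rest F                  ≡⟨ cong (∑ downs F +_) (∑-split rest up? F) ⟩
        ∑ downs F + (∑ ups F + ∑ (restrict rest (¬? ∘ up?)) F)
          ≡⟨ cong₂ _+_ downs≡ (cong₂ _+_ ups≡ (∑-zero (restrict rest (¬? ∘ up?)) neither)) ⟩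
        S + (S + 0ℤ)                          ≡⟨ lemma S ⟩
        ℤ.+ 2 * S                             ∎
        where
        F : Triple → ℤ
        F Q = (pos (val Q r) - pos (val Q s)) * ω (proj₁ Q)
        S = ∑ ws (ω ∘ proj₁ ∘ from)
        lemma : ∀ x → x + (x + 0ℤ) ≡ ℤ.+ 2 * x
        lemma = solve-∀
        all : Finite (_∈ L)
        all = finite L u id id
        downs = restrict all down?
        rest = restrict all (¬? ∘ down?)
        ups = restrict rest up?
        downs≡ : ∑ downs F ≡ S
        downs≡ = ∑-reindex downs ws to from (λ (Q∈ , p , q) → to∈ (d Q∈) p q)
          (λ w → sub (∈-++⁺ˡ (∈-map⁺ from (complete ws w))) , from-r w , from-s w)
          (λ (Q∈ , p , q) → from-to (d Q∈) p q) to-from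
          (λ {Q} (Q∈ , p , q) → trans (cong₂ (λ i j → (i - j) * ω (proj₁ Q)) (pos-> p) (pos-< q))
            (trans (ℤ.*-identityˡ _) (cong (ω ∘ proj₁) (sym (from-to (d Q∈) p q)))))
        ups≡ : ∑ ups F ≡ S
        ups≡ = ∑-reindex ups ws (to ∘ neg) (neg ∘ from)
          (λ {Q} ((Q∈ , _) , p) → let q₁ , q₂ = up-down {Q} p in to∈ (Disc-neg (d Q∈)) q₁ q₂)
          (λ {w} w∈ → let p = down-up {from w} (from-r w∈ , from-s w∈) in
            (sub (∈-++⁺ʳ (map from (elems ws)) (∈-map⁺ (neg ∘ from) (complete ws w∈)))
            , λ (q , _) → ℤ.<-asym q (proj₁ p)) , p)
          (λ {Q} ((Q∈ , _) , p) → let q₁ , q₂ = up-down {Q} p in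
            trans (cong neg (from-to (Disc-neg (d Q∈)) q₁ q₂)) (neg-neg Q))
          (λ {w} w∈ → trans (cong to (neg-neg (from w))) (to-from w∈))
          (λ {Q} ((Q∈ , _) , p) → let q₁ , q₂ = up-down {Q} p in
            trans (cong₂ (λ i j → (i - j) * ω (proj₁ Q)) (pos-< (proj₁ p)) (pos-> (proj₂ p)))
              (trans (ℤ.-1*i≡-i _) (trans (sym (ω-odd (proj₁ Q)))
                (cong (ω ∘ proj₁) (sym (from-to (Disc-neg (d Q∈)) q₁ q₂))))))
        neither : ∀ {Q} → (Q ∈ L × ¬ Down Q) × ¬ Up Q → F Q ≡ 0ℤ
        neither {Q} ((Q∈ , ¬down) , ¬up) = trans (cong (_* ω (proj₁ Q)) difference) (ℤ.*-zeroˡ (ω (proj₁ Q)))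
          where
          difference : pos (val Q r) - pos (val Q s) ≡ 0ℤ
          difference with ℤ.<-cmp 0ℤ (val Q r) | ℤ.<-cmp 0ℤ (val Q s)
          ... | tri≈ _ e _ | _ = ⊥-elim (nonzero-r (d Q∈) (sym e))
          ... | _ | tri≈ _ e _ = ⊥-elim (nonzero-s (d Q∈) (sym e))
          ... | tri< p _ _ | tri< q _ _ rewrite pos-> p | pos-> q = refl
          ... | tri> _ _ p | tri> _ _ q rewrite pos-< p | pos-< q = refl
          ... | tri< p _ _ | tri> _ _ q = ⊥-elim (¬down (p , q))
          ... | tri> _ _ p | tri< q _ _ = ⊥-elim (¬up (p , q))

  module _ (D-nonsquare : ∀ k → D ≢ k * k) where

    -- (y, -x) completes (p, q) to a unimodular basis, and in that basis a form vanishing at (p, q)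
    -- has the square of its middle coefficient as discriminant.
    nonzero-unimodular : ∀ {p q} x y → x * p + y * q ≡ 1ℤ → ∀ {Q} → Disc Q → val Q (p , q) ≢ 0ℤ
    nonzero-unimodular {p} {q} x y xy {a , b , c} (discriminant eq) v≡0 = D-nonsquare k (begin
      D                                               ≡⟨ eq ⟨
      d                                               ≡⟨ lemma₁ d ⟩
      d * (1ℤ * 1ℤ)                                   ≡⟨ cong (λ z → d * (z * z)) xy ⟨
      d * ((x * p + y * q) * (x * p + y * q))         ≡⟨ lemma a b c x y p q ⟩
      k * k - ℤ.+ 4 * (val (a , b , c) (y , - x) * val (a , b , c) (p , q))
        ≡⟨ cong (λ z → k * k - ℤ.+ 4 * (val (a , b , c) (y , - x) * z)) v≡0 ⟩
      k * k - ℤ.+ 4 * (val (a , b , c) (y , - x) * 0ℤ) ≡⟨ lemma₂ (k * k) (val (a , b , c) (y , - x)) ⟩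
      k * k                                           ∎)
      where
      open ≡-Reasoning
      d = b * b - ℤ.+ 4 * (a * c)
      k = polar (a , b , c) (y , - x) (p , q)
      lemma₁ : ∀ d → d ≡ d * (1ℤ * 1ℤ)
      lemma₁ = solve-∀
      lemma₂ : ∀ k z → k - ℤ.+ 4 * (z * 0ℤ) ≡ k
      lemma₂ = solve-∀
      lemma : ∀ a b c x y p q → (b * b - ℤ.+ 4 * (a * c)) * ((x * p + y * q) * (x * p + y * q)) ≡
        (ℤ.+ 2 * (a * (y * p)) + b * (y * q + - x * p) + ℤ.+ 2 * (c * (- x * q))) *
        (ℤ.+ 2 * (a * (y * p)) + b * (y * q + - x * p) + ℤ.+ 2 * (c * (- x * q)))
        - ℤ.+ 4 * ((a * (y * y) + b * (y * - x) + c * (- x * - x)) * (a * (p * p) + b * (p * q) + c * (q * q)))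
      lemma = solve-∀

    -- `star` is the period relation for the values ω(Q(x,-y)). Its right side is a difference of
    -- values of a single function κ, and this is what makes contributions telescope along a path.
    module _
      (ω-odd : ∀ i → ω (- i) ≡ - ω i) (κ : ℤ → ℤ) (κ-zero : κ 0ℤ ≡ 0ℤ)
      (star : ∀ x y u w → x * u + y * w ≡ 1ℤ →
        ∑ (forms D) (λ (a , b , c) → ω (a * (x * x) - b * (x * y) - c * (y * y))) ≡ ∑ (forms D) (ω ∘ proj₁) * (κ x - κ y))
      where
      private
        S = ∑ (forms D) (ω ∘ proj₁)

      -- In the basis r = (p′,q′), s = (p,q), the forms with Q(r) > 0 > Q(s) become exactly the
      -- triples of `V D`. The weight looks at Q(1,0), and (1,0) = q r - q′ s, so `star` is applied
      -- with x = q and y = q′.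
      adjacent : ∀ p′ q′ p q → p′ * q - q′ * p ≡ 1ℤ →
        Eventually (λ L → T L (p′ , q′) (p , q) ≡ ℤ.+ 2 * (S * (κ q - κ q′)))
      adjacent p′ q′ p q det = eventually-map₂ (λ {L} c _ → trans c (cong (ℤ.+ 2 *_) (trans
          (sumL-cong (elems (forms D)) (λ {(a , b , c)} _ → cong ω (lemmaA a b c q q′)))
          (star q q′ p′ (- p) (trans (lemmaD q p′ q′ p) det))))) C.crossing C.crossing
        where
        lemmaA : ∀ a b c q q′ → a * (q * q) + b * (q * - q′) + - c * (- q′ * - q′) ≡ a * (q * q) - b * (q * q′) - c * (q′ * q′)
        lemmaA = solve-∀
        lemmaD : ∀ q p′ q′ p → q * p′ + q′ * - p ≡ p′ * q - q′ * p
        lemmaD = solve-∀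
        to from : Triple → Triple
        to Q = val Q (p′ , q′) , polar Q (p′ , q′) (p , q) , - val Q (p , q)
        from (a , b , c) = val (a , b , - c) (q , - q′) , polar (a , b , - c) (q , - q′) (- p , p′) , val (a , b , - c) (- p , p′)
        det² : ∀ x → x * ((p′ * q - q′ * p) * (p′ * q - q′ * p)) ≡ x
        det² x = trans (cong (λ z → x * (z * z)) det) (ℤ.*-identityʳ x)
        from-r≡ : ∀ w → val (from w) (p′ , q′) ≡ proj₁ w
        from-r≡ (a , b , c) = trans (lemma a b c p′ q′ p q) (det² a)
          where
          lemma : ∀ a b c p′ q′ p q →
            (a * (q * q) + b * (q * - q′) + - c * (- q′ * - q′)) * (p′ * p′)
            + (ℤ.+ 2 * (a * (q * - p)) + b * (q * p′ + - q′ * - p) + ℤ.+ 2 * (- c * (- q′ * p′))) * (p′ * q′)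
            + (a * (- p * - p) + b * (- p * p′) + - c * (p′ * p′)) * (q′ * q′)
            ≡ a * ((p′ * q - q′ * p) * (p′ * q - q′ * p))
          lemma = solve-∀
        from-s≡ : ∀ w → val (from w) (p , q) ≡ - proj₂ (proj₂ w)
        from-s≡ (a , b , c) = trans (lemma a b c p′ q′ p q) (det² (- c))
          where
          lemma : ∀ a b c p′ q′ p q →
            (a * (q * q) + b * (q * - q′) + - c * (- q′ * - q′)) * (p * p)
            + (ℤ.+ 2 * (a * (q * - p)) + b * (q * p′ + - q′ * - p) + ℤ.+ 2 * (- c * (- q′ * p′))) * (p * q)
            + (a * (- p * - p) + b * (- p * p′) + - c * (p′ * p′)) * (q * q)
            ≡ - c * ((p′ * q - q′ * p) * (p′ * q - q′ * p))
          lemma = solve-∀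
        from-polar≡ : ∀ w → polar (from w) (p′ , q′) (p , q) ≡ proj₁ (proj₂ w)
        from-polar≡ (a , b , c) = trans (lemma a b c p′ q′ p q) (det² b)
          where
          lemma : ∀ a b c p′ q′ p q →
            ℤ.+ 2 * ((a * (q * q) + b * (q * - q′) + - c * (- q′ * - q′)) * (p′ * p))
            + (ℤ.+ 2 * (a * (q * - p)) + b * (q * p′ + - q′ * - p) + ℤ.+ 2 * (- c * (- q′ * p′))) * (p′ * q + q′ * p)
            + ℤ.+ 2 * ((a * (- p * - p) + b * (- p * p′) + - c * (p′ * p′)) * (q′ * q))
            ≡ b * ((p′ * q - q′ * p) * (p′ * q - q′ * p))
          lemma = solve-∀
        disc-to : ∀ {a b c} → Disc (a , b , c) →
          let v = to (a , b , c) in proj₁ (proj₂ v) * proj₁ (proj₂ v) + ℤ.+ 4 * (proj₁ v * proj₂ (proj₂ v)) ≡ D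
        disc-to {a} {b} {c} (discriminant eq) = trans (lemma a b c p′ q′ p q) (trans (det² _) eq)
          where
          lemma : ∀ a b c p′ q′ p q →
            (ℤ.+ 2 * (a * (p′ * p)) + b * (p′ * q + q′ * p) + ℤ.+ 2 * (c * (q′ * q))) *
            (ℤ.+ 2 * (a * (p′ * p)) + b * (p′ * q + q′ * p) + ℤ.+ 2 * (c * (q′ * q)))
            + ℤ.+ 4 * ((a * (p′ * p′) + b * (p′ * q′) + c * (q′ * q′)) * - (a * (p * p) + b * (p * q) + c * (q * q)))
            ≡ (b * b - ℤ.+ 4 * (a * c)) * ((p′ * q - q′ * p) * (p′ * q - q′ * p))
          lemma = solve-∀
        disc-from : ∀ {w} → V D w → Disc (from w)
        disc-from {a , b , c} (form _ _ eq) = discriminant (trans (lemma a b c p′ q′ p q) (trans (det² _) eq))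
          where
          lemma : ∀ a b c p′ q′ p q →
            (ℤ.+ 2 * (a * (q * - p)) + b * (q * p′ + - q′ * - p) + ℤ.+ 2 * (- c * (- q′ * p′))) *
            (ℤ.+ 2 * (a * (q * - p)) + b * (q * p′ + - q′ * - p) + ℤ.+ 2 * (- c * (- q′ * p′)))
            - ℤ.+ 4 * ((a * (q * q) + b * (q * - q′) + - c * (- q′ * - q′)) * (a * (- p * - p) + b * (- p * p′) + - c * (p′ * p′)))
            ≡ (b * b + ℤ.+ 4 * (a * c)) * ((p′ * q - q′ * p) * (p′ * q - q′ * p))
          lemma = solve-∀
        from-to : ∀ Q → from (to Q) ≡ Q
        from-to (a , b , c) = cong₂ _,_ (trans (lemma₁ a b c p′ q′ p q) (det² a))
          (cong₂ _,_ (trans (lemma₂ a b c p′ q′ p q) (det² b)) (trans (lemma₃ a b c p′ q′ p q) (det² c)))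
          where
          lemma₁ : ∀ a b c p′ q′ p q →
            (a * (p′ * p′) + b * (p′ * q′) + c * (q′ * q′)) * (q * q)
            + (ℤ.+ 2 * (a * (p′ * p)) + b * (p′ * q + q′ * p) + ℤ.+ 2 * (c * (q′ * q))) * (q * - q′)
            + - - (a * (p * p) + b * (p * q) + c * (q * q)) * (- q′ * - q′)
            ≡ a * ((p′ * q - q′ * p) * (p′ * q - q′ * p))
          lemma₁ = solve-∀
          lemma₂ : ∀ a b c p′ q′ p q →
            ℤ.+ 2 * ((a * (p′ * p′) + b * (p′ * q′) + c * (q′ * q′)) * (q * - p))
            + (ℤ.+ 2 * (a * (p′ * p)) + b * (p′ * q + q′ * p) + ℤ.+ 2 * (c * (q′ * q))) * (q * p′ + - q′ * - p)
            + ℤ.+ 2 * (- - (a * (p * p) + b * (p * q) + c * (q * q)) * (- q′ * p′))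
            ≡ b * ((p′ * q - q′ * p) * (p′ * q - q′ * p))
          lemma₂ = solve-∀
          lemma₃ : ∀ a b c p′ q′ p q →
            (a * (p′ * p′) + b * (p′ * q′) + c * (q′ * q′)) * (- p * - p)
            + (ℤ.+ 2 * (a * (p′ * p)) + b * (p′ * q + q′ * p) + ℤ.+ 2 * (c * (q′ * q))) * (- p * p′)
            + - - (a * (p * p) + b * (p * q) + c * (q * q)) * (p′ * p′)
            ≡ c * ((p′ * q - q′ * p) * (p′ * q - q′ * p))
          lemma₃ = solve-∀
        lemmaE : ∀ q p′ p q′ → q * p′ + - p * q′ ≡ p′ * q - q′ * p
        lemmaE = solve-∀
        lemmaE′ : ∀ q′ p p′ q → - q′ * p + p′ * q ≡ p′ * q - q′ * p
        lemmaE′ = solve-∀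
        module C = Crossing (p′ , q′) (p , q)
          (nonzero-unimodular q (- p) (trans (lemmaE q p′ p q′) det))
          (nonzero-unimodular (- q′) p′ (trans (lemmaE′ q′ p p′ q) det))
          (forms D) to from
          (λ {Q} d p q → form p (ℤ.neg-mono-< q) (disc-to d))
          disc-from
          (λ {w} w∈ → subst (0ℤ <_) (sym (from-r≡ w)) (a>0 w∈))
          (λ {w} w∈ → subst (_< 0ℤ) (sym (from-s≡ w)) (ℤ.neg-mono-< (c>0 w∈)))
          (λ {w} _ → cong₂ _,_ (from-r≡ w) (cong₂ _,_ (from-polar≡ w)
            (trans (cong -_ (from-s≡ w)) (ℤ.neg-involutive _))))
          (λ {Q} _ _ _ → from-to Q)
          ω-odd

      -- Euclid's algorithm joins (1,0) to (p,q) by unimodular segments, and κ telescopes along them.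
      segment : ∀ q p x y → x * p + y * ℤ.+ q ≡ 1ℤ →
        Eventually (λ L → T L e₁ (p , ℤ.+ q) ≡ ℤ.+ 2 * (S * κ (ℤ.+ q)))
      segment = <-rec _ step
        where
        Goal : ℕ → Set
        Goal q = ∀ p x y → x * p + y * ℤ.+ q ≡ 1ℤ →
          Eventually (λ L → T L e₁ (p , ℤ.+ q) ≡ ℤ.+ 2 * (S * κ (ℤ.+ q)))
        telescope : ∀ L r s → T L e₁ s ≡ T L e₁ r + T L r s
        telescope L r s = trans (sumL-cong L (λ {Q} _ → lemma (pos (val Q e₁)) (pos (val Q r)) (pos (val Q s)) (ω (proj₁ Q))))
          (sumL-+ _ _ L)
          where
          lemma : ∀ i j k w → (i - k) * w ≡ (i - j) * w + (j - k) * w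
          lemma = solve-∀
        step : ∀ q → (∀ {q′} → q′ ℕ.< q → Goal q′) → Goal q
        step zero _ p x y eq = eventually [] (λ ()) λ L _ _ _ →
          trans (sumL-cong L λ {Q} _ → trans (cong (λ z → (pos (val Q e₁) - pos z) * ω (proj₁ Q)) (same Q))
              (trans (cong (_* ω (proj₁ Q)) (ℤ.+-inverseʳ (pos (val Q e₁)))) (ℤ.*-zeroˡ (ω (proj₁ Q)))))
            (trans (sumL-0 L) (sym (trans (cong (λ z → ℤ.+ 2 * (S * z)) κ-zero) (lemma S))))
          where
          lemma : ∀ s → ℤ.+ 2 * (s * 0ℤ) ≡ 0ℤ
          lemma = solve-∀
          lemma₁ : ∀ x p y → x * p ≡ x * p + y * 0ℤ
          lemma₁ = solve-∀
          unit : ∀ i j → i * j ≡ 1ℤ → j * j ≡ 1ℤ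
          unit i j e = trans (IndefiniteForms.square-∣∣ j) (cong (λ n → ℤ.+ (n ℕ.* n)) (ℕ.m*n≡1⇒n≡1 ∣ i ∣ ∣ j ∣ (trans (sym (ℤ.abs-* i j)) (cong ∣_∣ e))))
          same : ∀ Q → val Q (p , 0ℤ) ≡ val Q e₁
          same (a , b , c) = trans (lemma₂ a b c p) (trans (cong (a *_) (unit x p (trans (lemma₁ x p y) eq))) (lemma₃ a b c))
            where
            lemma₂ : ∀ a b c p → a * (p * p) + b * (p * 0ℤ) + c * (0ℤ * 0ℤ) ≡ a * (p * p)
            lemma₂ = solve-∀
            lemma₃ : ∀ a b c → a * 1ℤ ≡ a * (1ℤ * 1ℤ) + b * (1ℤ * 0ℤ) + c * (0ℤ * 0ℤ)
            lemma₃ = solve-∀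
        step q@(suc _) ih p x y eq = eventually-map₂
          (λ {L} A B → trans (telescope L (p′ , ℤ.+ q′) (p , ℤ.+ q)) (trans (cong₂ _+_ A B) (lemma S (κ (ℤ.+ q′)) (κ (ℤ.+ q)))))
          (ih (ℤ.n%ℕd<d (- x) q) p′ (ℤ.+ q) (- p) (trans (lemma₁ (ℤ.+ q) p p′ (ℤ.+ q′)) det))
          (adjacent p′ (ℤ.+ q′) p (ℤ.+ q) det)
          where
          q′ = - x ℤ.%ℕ q
          k = - x ℤ./ℕ q
          p′ = y - k * p
          lemma : ∀ s i j → ℤ.+ 2 * (s * i) + ℤ.+ 2 * (s * (j - i)) ≡ ℤ.+ 2 * (s * j)
          lemma = solve-∀
          lemma₁ : ∀ q p p′ q′ → q * p′ + - p * q′ ≡ p′ * q - q′ * p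
          lemma₁ = solve-∀
          lemma₂ : ∀ y k p q r → (y - k * p) * q - r * p ≡ - (r + k * q) * p + y * q
          lemma₂ = solve-∀
          det : p′ * ℤ.+ q - ℤ.+ q′ * p ≡ 1ℤ
          det = trans (lemma₂ y k p (ℤ.+ q) (ℤ.+ q′)) (trans (cong (λ z → - z * p + y * ℤ.+ q) (sym (ℤ.a≡a%ℕn+[a/ℕn]*n (- x) q)))
            (trans (cong (λ z → z * p + y * ℤ.+ q) (ℤ.neg-involutive x)) eq))

-- Sublattices of index ℓ

module Cosets
  (ℓ : Data.Nat.ℕ) (ℓ-prime : Data.Nat.Primality.Prime ℓ) (ℓ≢2 : ℓ Relation.Binary.PropositionalEquality.≢ 2)
  where
  open FiniteSums
  open IndefiniteForms hiding (flip)
  open import Data.Empty using (⊥-elim)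
  open import Data.Integer using (ℤ; 0ℤ; 1ℤ; _+_; _*_; -_; _-_; _<_; -[1+_]; +<+)
  import Data.Integer as ℤ
  import Data.Integer.DivMod as ℤ
  open import Data.Integer.Divisibility.Signed
    using (_∣_; _∣?_; divides; ∣⇒∣ᵤ; ∣ᵤ⇒∣; ∣m∣n⇒∣m-n)
  import Data.Integer.Properties as ℤ
  open import Data.Integer.Tactic.RingSolver using (solve-∀)
  open import Data.List using (List; _∷_)
  open import Data.List.Relation.Unary.All as All using ()
  open import Data.List.Relation.Unary.AllPairs using (_∷_)
  open import Data.Nat as ℕ using (ℕ; zero; suc)
  import Data.Nat.Coprimality as ℕ
  import Data.Nat.Divisibility as ℕ
  open import Data.Nat.GCD using (module Bézout)
  open import Data.Nat.Primality using (Prime; euclidsLemma; prime⇒irreducible; prime⇒nonZero; prime⇒nonTrivial)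
  import Data.Nat.Properties as ℕ
  open import Data.Product using (∃; _×_; _,_; proj₁; proj₂)
  open import Data.Sum using (_⊎_; inj₁; inj₂; [_,_])
  open import Function using (_∘_)
  open import Relation.Binary.Definitions using (tri<; tri≈; tri>)
  open import Relation.Binary.PropositionalEquality
    using (_≡_; _≢_; refl; sym; trans; cong; cong₂; subst; module ≡-Reasoning)
  open import Relation.Nullary using (¬_; Dec; yes; no)
  open import Relation.Nullary.Decidable using (_×-dec_)

  private
    L = ℤ.+ ℓ

  instance
    ℓ≢0 : ℕ.NonZero ℓ
    ℓ≢0 = prime⇒nonZero ℓ-prime

  0<L : 0ℤ < L
  0<L = +<+ (ℕ.>-nonZero⁻¹ ℓ)

  euclid : ∀ i j → L ∣ i * j → L ∣ i ⊎ L ∣ j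
  euclid i j d with euclidsLemma ℤ.∣ i ∣ ℤ.∣ j ∣ ℓ-prime (subst (ℓ ℕ.∣_) (ℤ.abs-* i j) (∣⇒∣ᵤ d))
  ... | inj₁ p = inj₁ (∣ᵤ⇒∣ p)
  ... | inj₂ p = inj₂ (∣ᵤ⇒∣ p)

  ∤2 : ¬ L ∣ ℤ.+ 2
  ∤2 d = ℓ≢2 (ℕ.≤-antisym (ℕ.∣⇒≤ (∣⇒∣ᵤ d)) (ℕ.nonTrivial⇒n>1 ℓ {{prime⇒nonTrivial ℓ-prime}}))

  euclid-odd : ∀ i → L ∣ ℤ.+ 2 * i → L ∣ i
  euclid-odd i d = [ (λ p → ⊥-elim (∤2 p)) , (λ p → p) ] (euclid (ℤ.+ 2) i d)

  euclid-square : ∀ i → L ∣ i * i → L ∣ i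
  euclid-square i d = [ (λ p → p) , (λ p → p) ] (euclid i i d)

  bezoutℕ : ∀ n → ¬ ℓ ℕ.∣ n → ∃ λ u → ∃ λ w → u * ℤ.+ n + w * L ≡ 1ℤ
  bezoutℕ n ℓ∤n with ℕ.coprime-Bézout {n} {ℓ} (λ {d} (d∣n , d∣ℓ) →
      [ (λ p → p) , (λ { refl → ⊥-elim (ℓ∤n d∣n) }) ] (prime⇒irreducible ℓ-prime d∣ℓ))
  ... | Bézout.+- x y eq = ℤ.+ x , - ℤ.+ y , trans (cong (_+ - ℤ.+ y * L) (trans (sym (ℤ.pos-* x n)) (trans (cong ℤ.+_ (sym eq))
          (trans (ℤ.pos-+ 1 (y ℕ.* ℓ)) (cong (1ℤ +_) (ℤ.pos-* y ℓ)))))) (lemma (ℤ.+ y) L)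
    where
    lemma : ∀ y l → 1ℤ + y * l + - y * l ≡ 1ℤ
    lemma = solve-∀
  ... | Bézout.-+ x y eq = - ℤ.+ x , ℤ.+ y , trans (cong (- ℤ.+ x * ℤ.+ n +_) (trans (sym (ℤ.pos-* y ℓ)) (trans (cong ℤ.+_ (sym eq))
          (trans (ℤ.pos-+ 1 (x ℕ.* n)) (cong (1ℤ +_) (ℤ.pos-* x n)))))) (lemma (ℤ.+ x) (ℤ.+ n))
    where
    lemma : ∀ y l → - y * l + (1ℤ + y * l) ≡ 1ℤ
    lemma = solve-∀

  bezout : ∀ i → ¬ L ∣ i → ∃ λ u → ∃ λ w → u * i + w * L ≡ 1ℤ
  bezout (ℤ.+ n) L∤i = bezoutℕ n (L∤i ∘ ∣ᵤ⇒∣)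
  bezout -[1+ n ] L∤i with bezoutℕ (suc n) (L∤i ∘ ∣ᵤ⇒∣)
  ... | u , w , eq = - u , w , trans (lemma u (ℤ.+ suc n) w L) eq
    where
    lemma : ∀ u n w l → - u * - n + w * l ≡ u * n + w * l
    lemma = solve-∀

  solve-congruence : ∀ a b → ¬ L ∣ a → ∃ λ p → p ℕ.< ℓ × L ∣ b - ℤ.+ 2 * (a * ℤ.+ p)
  solve-congruence a b L∤a with bezout (ℤ.+ 2 * a) (L∤a ∘ euclid-odd a)
  ... | u , w , eq = (u * b) ℤ.%ℕ ℓ , ℤ.n%ℕd<d (u * b) ℓ , divides (b * w + ℤ.+ 2 * (a * k)) (begin
      b - ℤ.+ 2 * (a * r)               ≡⟨ lemma b a r k L ⟩
      b * 1ℤ - ℤ.+ 2 * a * (r + k * L) + ℤ.+ 2 * (a * k) * L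
        ≡⟨ cong₂ (λ i j → b * i - ℤ.+ 2 * a * j + ℤ.+ 2 * (a * k) * L) (sym eq) (sym (ℤ.a≡a%ℕn+[a/ℕn]*n (u * b) ℓ)) ⟩
      b * (u * (ℤ.+ 2 * a) + w * L) - ℤ.+ 2 * a * (u * b) + ℤ.+ 2 * (a * k) * L
        ≡⟨ lemma₂ b a u w k L ⟩
      (b * w + ℤ.+ 2 * (a * k)) * L     ∎)
    where
    open ≡-Reasoning
    r = ℤ.+ ((u * b) ℤ.%ℕ ℓ)
    k = (u * b) ℤ./ℕ ℓ
    lemma : ∀ b a r k l → b - ℤ.+ 2 * (a * r) ≡ b * 1ℤ - ℤ.+ 2 * a * (r + k * l) + ℤ.+ 2 * (a * k) * l
    lemma = solve-∀
    lemma₂ : ∀ b a u w k l → b * (u * (ℤ.+ 2 * a) + w * l) - ℤ.+ 2 * a * (u * b) + ℤ.+ 2 * (a * k) * l ≡ (b * w + ℤ.+ 2 * (a * k)) * l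
    lemma₂ = solve-∀

  congruent⇒≡ : ∀ {p p′} → p ℕ.< ℓ → p′ ℕ.< ℓ → L ∣ ℤ.+ p - ℤ.+ p′ → p ≡ p′
  congruent⇒≡ {p} {p′} p< p′< d with ℕ.<-cmp p p′
  ... | tri≈ _ e _ = e
  ... | tri< p<p′ _ _ = ⊥-elim (ℕ.>⇒∤ {{ℕ.>-nonZero (ℕ.m<n⇒0<n∸m p<p′)}} (ℕ.≤-<-trans (ℕ.m∸n≤m p′ p) p′<)
          (subst (ℓ ℕ.∣_) (trans (cong ℤ.∣_∣ (ℤ.m-n≡m⊖n p p′)) (ℤ.∣⊖∣-< p<p′)) (∣⇒∣ᵤ d)))
  ... | tri> _ _ p′<p = ⊥-elim (ℕ.>⇒∤ {{ℕ.>-nonZero (ℕ.m<n⇒0<n∸m p′<p)}} (ℕ.≤-<-trans (ℕ.m∸n≤m p p′) p<)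
          (subst (ℓ ℕ.∣_) (trans (cong ℤ.∣_∣ (ℤ.m-n≡m⊖n p p′)) (cong ℤ.∣_∣ (ℤ.⊖-≥ (ℕ.<⇒≤ p′<p)))) (∣⇒∣ᵤ d)))

  cancelL : ∀ {i j} → i * L ≡ j * L → i ≡ j
  cancelL {i} {j} = ℤ.*-cancelʳ-≡ i j L

  -- Total division with default value 0; it enters the reindexings only where k divides i.
  quot : ℤ → ℤ → ℤ
  quot k i with k ∣? i
  ... | yes (divides q _) = q
  ... | no _ = 0ℤ

  quot-∣ : ∀ {k i} → k ∣ i → i ≡ quot k i * k
  quot-∣ {k} {i} d with k ∣? i
  ... | yes (divides q eq) = eq
  ... | no ¬d = ⊥-elim (¬d d)

  quot-* : ∀ k x .{{_ : ℤ.NonZero k}} → quot k (x * k) ≡ x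
  quot-* k x = sym (ℤ.*-cancelʳ-≡ x (quot k (x * k)) k (quot-∣ (divides x refl)))

  instance
    L≢0 : ℤ.NonZero L
    L≢0 = ℓ≢0
    LL≢0 : ℤ.NonZero (L * L)
    LL≢0 = ℤ.i*j≢0 L L

  0<-* : ∀ {i k} → 0ℤ < k → 0ℤ < i → 0ℤ < i * k
  0<-* {ℤ.+ suc i} {ℤ.+ suc k} _ _ = +<+ (ℕ.s≤s ℕ.z≤n)
  0<-* {ℤ.+ zero} _ (+<+ ())
  0<-* {ℤ.+ suc i} {ℤ.+ zero} (+<+ ()) _

  0<-cancel : ∀ {i k} → 0ℤ < k → 0ℤ < i * k → 0ℤ < i
  0<-cancel {ℤ.+ suc i} _ _ = +<+ (ℕ.s≤s ℕ.z≤n)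
  0<-cancel {ℤ.+ zero} {k} _ p = ⊥-elim (ℤ.<-irrefl refl p)
  0<-cancel { -[1+ i ]} {ℤ.+ suc k} _ ()
  0<-cancel { -[1+ i ]} {ℤ.+ zero} (+<+ ()) _

  0<LL : 0ℤ < L * L
  0<LL = 0<-* 0<L 0<L

  module _ (M : ℤ) (L∤M : ¬ L ∣ M) where
    private
      D = L * M
      D′ = L * L * D

    D-nonsquare : ∀ k → D ≢ k * k
    D-nonsquare k eq with euclid-square k (divides M (trans (sym eq) (ℤ.*-comm L M)))
    ... | divides j refl = L∤M (divides (j * j) (cancelL {M} {j * j * L} (trans (ℤ.*-comm M L) (trans eq (lemma j L)))))
      where
      lemma : ∀ j l → j * l * (j * l) ≡ j * j * l * l
      lemma = solve-∀

    -- The last two coefficients of Q(X - pY, Y) are b - 2ap and `residue p`. So `Coset p` says that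
    -- Q(X - pY, Y) is of the form Q′(X, ℓY) with Q′ integral, of discriminant D.
    residue : ℤ → Triple → ℤ
    residue p (a , b , c) = - c - p * b + a * p * p

    -- Sublattices of index ℓ: a form of discriminant ℓ²D comes from discriminant D through exactly one of them.
    Coset∞ : Triple → Set
    Coset∞ (a , b , c) = L * L ∣ a × L ∣ b

    Coset : ℕ → Triple → Set
    Coset p (a , b , c) = L ∣ b - ℤ.+ 2 * (a * ℤ.+ p) × L * L ∣ residue (ℤ.+ p) (a , b , c)

    coset∞? : ∀ v → Dec (Coset∞ v)
    coset∞? (a , b , c) = (L * L ∣? a) ×-dec (L ∣? b)

    coset? : ∀ p v → Dec (Coset p v)
    coset? p v@(a , b , c) = (L ∣? (b - ℤ.+ 2 * (a * ℤ.+ p))) ×-dec (L * L ∣? residue (ℤ.+ p) v)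

    private
      complete-square : ∀ a b c p → b * b + ℤ.+ 4 * (a * c) ≡ D′ →
        ℤ.+ 2 * (ℤ.+ 2 * (a * (- c - p * b + a * p * p))) ≡ (b - ℤ.+ 2 * (a * p)) * (b - ℤ.+ 2 * (a * p)) - D′
      complete-square a b c p eq = trans (lemma a b c p) (cong (λ z → (b - ℤ.+ 2 * (a * p)) * (b - ℤ.+ 2 * (a * p)) - z) eq)
        where
        lemma : ∀ a b c p → ℤ.+ 2 * (ℤ.+ 2 * (a * (- c - p * b + a * p * p))) ≡
          (b - ℤ.+ 2 * (a * p)) * (b - ℤ.+ 2 * (a * p)) - (b * b + ℤ.+ 4 * (a * c))
        lemma = solve-∀

      -- The forms with ℓ ∣ a: dividing out, b₁² + 4a₁c₁ = ℓM.
      record Reduced (v : Triple) : Set where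
        field
          a₁ b₁ c₁ : ℤ
          a≡ : proj₁ v ≡ a₁ * L
          b≡ : proj₁ (proj₂ v) ≡ b₁ * L
          c≡ : proj₂ (proj₂ v) ≡ c₁ * L
          disc₁ : b₁ * b₁ + ℤ.+ 4 * (a₁ * c₁) ≡ D
          L∤a₁ : ¬ L ∣ a₁

      -- ℓ | a gives ℓ | b² and hence ℓ | b; then ℓ² divides 4ac. Outside `Coset∞` the quotient a/ℓ
      -- is prime to ℓ, which leaves ℓ | c.
      reduced : ∀ {v} → V D′ v → ¬ Coset∞ v → L ∣ proj₁ v → Reduced v
      reduced {a , b , c} (form _ _ eq) ∉∞ (divides a₁ refl) with euclid-square b (divides (L * D - ℤ.+ 4 * (a₁ * c)) (trans (lemma b a₁ c L) (trans (cong (_- ℤ.+ 4 * (a₁ * c) * L) eq) (lemma₂ L D (a₁ * c)))))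
        where
        lemma : ∀ b a c l → b * b ≡ b * b + ℤ.+ 4 * (a * l * c) - ℤ.+ 4 * (a * c) * l
        lemma = solve-∀
        lemma₂ : ∀ l d t → l * l * d - ℤ.+ 4 * t * l ≡ (l * d - ℤ.+ 4 * t) * l
        lemma₂ = solve-∀
      ... | divides b₁ refl = go (euclid a₁ c (euclid-odd (a₁ * c) (euclid-odd (ℤ.+ 2 * (a₁ * c)) (divides (D - b₁ * b₁) (cancelL {ℤ.+ 2 * (ℤ.+ 2 * (a₁ * c))} {(D - b₁ * b₁) * L} (trans (lemma b₁ a₁ c L) (trans (cong (_- b₁ * b₁ * L * L) eq) (lemma₂ L D b₁))))))))
        where
        lemma : ∀ b a c l → ℤ.+ 2 * (ℤ.+ 2 * (a * c)) * l ≡ b * l * (b * l) + ℤ.+ 4 * (a * l * c) - b * b * l * l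
        lemma = solve-∀
        lemma₂ : ∀ l d b → l * l * d - b * b * l * l ≡ (d - b * b) * l * l
        lemma₂ = solve-∀
        L∤a₁ : ¬ L ∣ a₁
        L∤a₁ (divides a₂ e) = ∉∞ (divides a₂ (trans (cong (_* L) e) (ℤ.*-assoc a₂ L L)) , divides b₁ refl)
        go : L ∣ a₁ ⊎ L ∣ c → Reduced _
        go (inj₁ d) = ⊥-elim (L∤a₁ d)
        go (inj₂ (divides c₁ refl)) = record
          { a₁ = a₁ ; b₁ = b₁ ; c₁ = c₁ ; a≡ = refl ; b≡ = refl ; c≡ = refl ; L∤a₁ = L∤a₁
          ; disc₁ = ℤ.*-cancelʳ-≡ (b₁ * b₁ + ℤ.+ 4 * (a₁ * c₁)) D (L * L) (trans (lemma₃ b₁ a₁ c₁ L) (trans eq (ℤ.*-comm (L * L) D))) }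
          where
          lemma₃ : ∀ b a c l → (b * b + ℤ.+ 4 * (a * c)) * (l * l) ≡ b * l * (b * l) + ℤ.+ 4 * (a * l * (c * l))
          lemma₃ = solve-∀

      residue-reduced : ∀ a b c p → residue p (a * L , b * L , c * L) ≡ (- c - p * b + a * p * p) * L
      residue-reduced a b c p = lemma a b c p L
        where
        lemma : ∀ a b c p l → - (c * l) - p * (b * l) + a * l * p * p ≡ (- c - p * b + a * p * p) * l
        lemma = solve-∀

    private
      strip : ∀ a Y → ¬ L ∣ a → L ∣ ℤ.+ 2 * (ℤ.+ 2 * (a * Y)) → L ∣ Y
      strip a Y L∤a d = [ (λ p → ⊥-elim (L∤a p)) , (λ p → p) ] (euclid a Y (euclid-odd (a * Y) (euclid-odd (ℤ.+ 2 * (a * Y)) d)))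

      strip² : ∀ a X z → ¬ L ∣ a → ℤ.+ 2 * (ℤ.+ 2 * (a * X)) ≡ z * L * L → L * L ∣ X
      strip² a X z L∤a eq = first (strip a X L∤a (divides (z * L) eq))
        where
        lemma : ∀ a y l → ℤ.+ 2 * (ℤ.+ 2 * (a * y)) * l ≡ ℤ.+ 2 * (ℤ.+ 2 * (a * (y * l)))
        lemma = solve-∀
        second : ∀ Y → X ≡ Y * L → L ∣ Y → L * L ∣ X
        second Y e (divides Z e′) = divides Z (trans e (trans (cong (_* L) e′) (ℤ.*-assoc Z L L)))
        first : L ∣ X → L * L ∣ X
        first (divides Y e) = second Y e (strip a Y L∤a (divides z
          (cancelL {ℤ.+ 2 * (ℤ.+ 2 * (a * Y))} {z * L} (trans (lemma a Y L) (trans (cong (λ t → ℤ.+ 2 * (ℤ.+ 2 * (a * t))) (sym e)) eq)))))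

      residue-∣ : ∀ a b c p → ¬ L ∣ a → b * b + ℤ.+ 4 * (a * c) ≡ D′ → L ∣ b - ℤ.+ 2 * (a * p) → L * L ∣ residue p (a , b , c)
      residue-∣ a b c p L∤a eq (divides q e) = strip² a (residue p (a , b , c)) (q * q - D) L∤a
        (trans (complete-square a b c p eq) (trans (cong (λ z → z * z - D′) e) (lemma q L D)))
        where
        lemma : ∀ q l d → q * l * (q * l) - l * l * d ≡ (q * q - d) * l * l
        lemma = solve-∀

      residue-∣₁ : ∀ a b c p → ¬ L ∣ a → b * b + ℤ.+ 4 * (a * c) ≡ D → L ∣ b - ℤ.+ 2 * (a * p) → L ∣ - c - p * b + a * p * p
      residue-∣₁ a b c p L∤a eq (divides q e) = strip a (- c - p * b + a * p * p) L∤a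
        (divides (q * q * L - M) (trans (lemma a b c p) (trans (cong₂ (λ y z → y * y - z) e eq) (lemma₂ q L M))))
        where
        lemma : ∀ a b c p → ℤ.+ 2 * (ℤ.+ 2 * (a * (- c - p * b + a * p * p))) ≡
          (b - ℤ.+ 2 * (a * p)) * (b - ℤ.+ 2 * (a * p)) - (b * b + ℤ.+ 4 * (a * c))
        lemma = solve-∀
        lemma₂ : ∀ q l m → q * l * (q * l) - l * m ≡ (q * q * l - m) * l
        lemma₂ = solve-∀

      ∣-residue-reduced : ∀ a b c p → L ∣ - c - p * b + a * p * p → L * L ∣ residue p (a * L , b * L , c * L)
      ∣-residue-reduced a b c p (divides Y e) =
        divides Y (trans (residue-reduced a b c p) (trans (cong (_* L) e) (ℤ.*-assoc Y L L)))

      reduced-exists : ∀ {v} → Reduced v → ∃ λ p → p ℕ.< ℓ × Coset p v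
      reduced-exists {a , b , c} record { a₁ = a₁ ; b₁ = b₁ ; c₁ = c₁ ; a≡ = refl ; b≡ = refl ; c≡ = refl ; disc₁ = disc₁ ; L∤a₁ = L∤a₁ } =
        let p , p<ℓ , d = solve-congruence a₁ b₁ L∤a₁ in
        p , p<ℓ , divides (b₁ - ℤ.+ 2 * (a₁ * ℤ.+ p)) (lemma a₁ b₁ (ℤ.+ p) L)
          , ∣-residue-reduced a₁ b₁ c₁ (ℤ.+ p) (residue-∣₁ a₁ b₁ c₁ (ℤ.+ p) L∤a₁ disc₁ d)
        where
        lemma : ∀ a b p l → b * l - ℤ.+ 2 * (a * l * p) ≡ (b - ℤ.+ 2 * (a * p)) * l
        lemma = solve-∀

      difference : ∀ a b p p′ → ¬ L ∣ a → L ∣ b - ℤ.+ 2 * (a * p) → L ∣ b - ℤ.+ 2 * (a * p′) → L ∣ p - p′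
      difference a b p p′ L∤a d d′ = [ (λ z → ⊥-elim (L∤a z)) , (λ z → z) ] (euclid a (p - p′) (euclid-odd (a * (p - p′))
        (subst (L ∣_) (lemma a b p p′) (∣m∣n⇒∣m-n d′ d))))
        where
        lemma : ∀ a b p p′ → b - ℤ.+ 2 * (a * p′) - (b - ℤ.+ 2 * (a * p)) ≡ ℤ.+ 2 * (a * (p - p′))
        lemma = solve-∀

      -- Modulo ℓ the discriminant D vanishes, so the quadratic equation for p has a double root:
      -- 4a·Q(-p,1) is congruent to (b - 2ap)². This is how ℓ | D makes a form divisible by ℓ lie in
      -- exactly one coset, instead of none or two.
      root : ∀ a b c p → b * b + ℤ.+ 4 * (a * c) ≡ D → L * L ∣ residue p (a * L , b * L , c * L) → L ∣ b - ℤ.+ 2 * (a * p)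
      root a b c p eq (divides q e) = euclid-square (b - ℤ.+ 2 * (a * p)) (divides (ℤ.+ 4 * (a * q) + M)
        (trans (lemma₁ a b c p) (trans (cong₂ (λ y z → ℤ.+ 4 * (a * y) + z) X≡ eq) (lemma₂ a q L M))))
        where
        X≡ : - c - p * b + a * p * p ≡ q * L
        X≡ = cancelL { - c - p * b + a * p * p} {q * L} (trans (sym (residue-reduced a b c p)) (trans e (sym (ℤ.*-assoc q L L))))
        lemma₁ : ∀ a b c p → (b - ℤ.+ 2 * (a * p)) * (b - ℤ.+ 2 * (a * p)) ≡
          ℤ.+ 4 * (a * (- c - p * b + a * p * p)) + (b * b + ℤ.+ 4 * (a * c))
        lemma₁ = solve-∀
        lemma₂ : ∀ a q l m → ℤ.+ 4 * (a * (q * l)) + l * m ≡ (ℤ.+ 4 * (a * q) + m) * l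
        lemma₂ = solve-∀

      reduced-unique : ∀ {v p p′} → Reduced v → p ℕ.< ℓ → p′ ℕ.< ℓ → Coset p v → Coset p′ v → p ≡ p′
      reduced-unique {v} {p} {p′} record { a₁ = a₁ ; b₁ = b₁ ; c₁ = c₁ ; a≡ = refl ; b≡ = refl ; c≡ = refl ; disc₁ = disc₁ ; L∤a₁ = L∤a₁ }
        p< p′< (_ , r) (_ , r′) = congruent⇒≡ p< p′<
          (difference a₁ b₁ (ℤ.+ p) (ℤ.+ p′) L∤a₁ (root a₁ b₁ c₁ (ℤ.+ p) disc₁ r) (root a₁ b₁ c₁ (ℤ.+ p′) disc₁ r′))

    coset-exists : ∀ {v} → V D′ v → ¬ Coset∞ v → ∃ λ p → p ℕ.< ℓ × Coset p v
    coset-exists {a , b , c} w ∉∞ = cases (L ∣? a)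
      where
      cases : Dec (L ∣ a) → ∃ λ p → p ℕ.< ℓ × Coset p (a , b , c)
      cases (yes L∣a) = reduced-exists (reduced w ∉∞ L∣a)
      cases (no L∤a) = let p , p<ℓ , d = solve-congruence a b L∤a in
        p , p<ℓ , d , residue-∣ a b c (ℤ.+ p) L∤a (disc w) d

    coset-unique : ∀ {v p p′} → V D′ v → ¬ Coset∞ v → p ℕ.< ℓ → p′ ℕ.< ℓ → Coset p v → Coset p′ v → p ≡ p′
    coset-unique {a , b , c} {p} {p′} w ∉∞ p< p′< (d , r) (d′ , r′) = cases (L ∣? a)
      where
      cases : Dec (L ∣ a) → p ≡ p′
      cases (yes L∣a) = reduced-unique (reduced w ∉∞ L∣a) p< p′< (d , r) (d′ , r′)
      cases (no L∤a) = congruent⇒≡ p< p′< (difference a b (ℤ.+ p) (ℤ.+ p′) L∤a d d′)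

    -- The two conditions together force ℓ | c. Dividing the discriminant by ℓ² then shows first
    -- that b is divisible by ℓ², then c too, so that ℓ² would divide D = ℓM.
    coset∞-disjoint : ∀ {v p} → V D′ v → Coset∞ v → ¬ Coset p v
    coset∞-disjoint {a , b , c} {p} (form _ _ eq) (divides x refl , divides y refl) (_ , divides z e) =
      L∤M (go (euclid-square y (divides (M - ℤ.+ 4 * (x * k)) y²)))
      where
      k = x * ℤ.+ p * ℤ.+ p * L - ℤ.+ p * y - z * L
      lemma : ∀ x y p z l c → c ≡ (x * p * p * l - p * y - z * l) * l - (- c - p * (y * l) + x * (l * l) * p * p) + z * (l * l)
      lemma = solve-∀
      c≡ : c ≡ k * L
      c≡ = trans (lemma x y (ℤ.+ p) z L c) (trans (cong (λ t → k * L - t + z * (L * L)) e) (lemma₁ (k * L) (z * (L * L))))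
        where
        lemma₁ : ∀ i j → i - j + j ≡ i
        lemma₁ = solve-∀
      disc₁ : y * y + ℤ.+ 4 * (x * (k * L)) ≡ D
      disc₁ = ℤ.*-cancelʳ-≡ (y * y + ℤ.+ 4 * (x * (k * L))) D (L * L) (trans (lemma₂ y x (k * L) L) (trans (cong (λ t → y * L * (y * L) + ℤ.+ 4 * (x * (L * L) * t)) (sym c≡)) (trans eq (ℤ.*-comm (L * L) D))))
        where
        lemma₂ : ∀ y x c l → (y * y + ℤ.+ 4 * (x * c)) * (l * l) ≡ y * l * (y * l) + ℤ.+ 4 * (x * (l * l) * c)
        lemma₂ = solve-∀
      y² : y * y ≡ (M - ℤ.+ 4 * (x * k)) * L
      y² = trans (lemma₃ y x k L) (trans (cong (_- ℤ.+ 4 * (x * (k * L))) disc₁) (lemma₄ M x k L))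
        where
        lemma₃ : ∀ y x k l → y * y ≡ y * y + ℤ.+ 4 * (x * (k * l)) - ℤ.+ 4 * (x * (k * l))
        lemma₃ = solve-∀
        lemma₄ : ∀ m x k l → l * m - ℤ.+ 4 * (x * (k * l)) ≡ (m - ℤ.+ 4 * (x * k)) * l
        lemma₄ = solve-∀
      go : L ∣ y → L ∣ M
      go (divides y₁ refl) = divides (y₁ * y₁ + ℤ.+ 4 * (x * (x * ℤ.+ p * ℤ.+ p - ℤ.+ p * y₁ - z)))
        (trans (lemma₅ M x k) (trans (cong (_+ ℤ.+ 4 * (x * k)) (cancelL {M - ℤ.+ 4 * (x * k)} {y₁ * y₁ * L} (trans (sym y²) (lemma₆ y₁ L)))) (lemma₇ y₁ x (ℤ.+ p) z L)))
        where
        lemma₅ : ∀ m x k → m ≡ m - ℤ.+ 4 * (x * k) + ℤ.+ 4 * (x * k)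
        lemma₅ = solve-∀
        lemma₆ : ∀ y l → y * l * (y * l) ≡ y * y * l * l
        lemma₆ = solve-∀
        lemma₇ : ∀ y x p z l → y * y * l + ℤ.+ 4 * (x * (x * p * p * l - p * (y * l) - z * l))
          ≡ (y * y + ℤ.+ 4 * (x * (x * p * p - p * y - z))) * l
        lemma₇ = solve-∀

-- The Hecke relation for sums over forms

module Hecke
  (ℓ : Data.Nat.ℕ) (ℓ-prime : Data.Nat.Primality.Prime ℓ) (ℓ≢2 : ℓ Relation.Binary.PropositionalEquality.≢ 2)
  where
  open FiniteSums
  open IndefiniteForms hiding (flip)
  open Cosets ℓ ℓ-prime ℓ≢2
  open import Data.Empty using (⊥-elim)
  open import Data.Integer using (ℤ; 0ℤ; 1ℤ; _+_; _*_; -_; _-_; _<_; -[1+_]; +<+)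
  import Data.Integer as ℤ
  open import Data.Integer.Divisibility.Signed using (_∣_; divides; ∣⇒∣ᵤ)
  import Data.Integer.Properties as ℤ
  open import Data.Integer.Tactic.RingSolver using (solve-∀)
  open import Data.List using (List; _∷_; upTo; applyUpTo)
  open import Data.List.Membership.Propositional using (_∈_)
  open import Data.List.Membership.Propositional.Properties using (∈-upTo⁺; ∈-upTo⁻)
  import Data.List.Relation.Unary.All as All
  open import Data.List.Relation.Unary.AllPairs using (_∷_)
  open import Data.List.Relation.Unary.Any using (here; there)
  open import Data.List.Relation.Unary.Unique.Propositional using (Unique)
  import Data.List.Relation.Unary.Unique.Propositional.Properties as Unique
  open import Data.Nat as ℕ using (ℕ; zero; suc)
  import Data.Nat.Divisibility as ℕ
  import Data.Nat.Properties as ℕ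
  open import Data.Product using (∃; _×_; _,_; proj₁; proj₂)
  open import Function using (_∘_)
  open import Relation.Binary.PropositionalEquality
    using (_≡_; _≢_; refl; sym; trans; cong; cong₂; subst; module ≡-Reasoning)
  open import Relation.Nullary using (¬_; Dec; yes; no)
  open import Relation.Nullary.Decidable using (¬?)

  private
    L = ℤ.+ ℓ

  when : ∀ {P : Set} → Dec P → ℤ → ℤ
  when (yes _) x = x
  when (no _) x = 0ℤ

  when-yes : ∀ {P : Set} (d : Dec P) {x} → P → when d x ≡ x
  when-yes (yes _) p = refl
  when-yes (no ¬p) p = ⊥-elim (¬p p)

  when-no : ∀ {P : Set} (d : Dec P) {x} → ¬ P → when d x ≡ 0ℤ
  when-no (yes p) ¬p = ⊥-elim (¬p p)
  when-no (no _) ¬p = refl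

  ∑-restrict : ∀ {A : Set} {P R : A → Set} (S : Finite P) (R? : ∀ x → Dec (R x)) (F : A → ℤ) →
    ∑ (restrict S R?) F ≡ ∑ S (λ x → when (R? x) (F x))
  ∑-restrict S R? F = sym (begin
    ∑ S G                                                       ≡⟨ ∑-split S R? G ⟩
    ∑ (restrict S R?) G + ∑ (restrict S (¬? ∘ R?)) G
      ≡⟨ cong₂ _+_ (∑-cong (restrict S R?) (λ {x} (_ , r) → when-yes (R? x) r))
                   (∑-zero (restrict S (¬? ∘ R?)) (λ {x} (_ , r) → when-no (R? x) r)) ⟩
    ∑ (restrict S R?) F + 0ℤ                                    ≡⟨ ℤ.+-identityʳ _ ⟩
    ∑ (restrict S R?) F                                         ∎)
    where
    open ≡-Reasoning
    G = λ x → when (R? x) (F x)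

  one-hot : ∀ {A : Set} {xs : List A} (F : A → ℤ) {x z} → Unique xs → x ∈ xs →
    F x ≡ z → (∀ {y} → y ∈ xs → y ≢ x → F y ≡ 0ℤ) → sumL xs F ≡ z
  one-hot {xs = x ∷ xs} F (x≢ ∷ u) (here refl) eq rest = trans (cong₂ _+_ eq
    (trans (sumL-cong xs (λ y∈ → rest (there y∈) (λ e → All.lookup x≢ y∈ (sym e)))) (sumL-0 xs))) (ℤ.+-identityʳ _)
  one-hot {xs = y ∷ xs} F (y≢ ∷ u) (there x∈) eq rest = trans (cong₂ _+_ (rest (here refl) (All.lookup y≢ x∈))
    (one-hot F u x∈ eq (rest ∘ there))) (ℤ.+-identityˡ _)

  module _ (M : ℤ) (L∤M : ¬ L ∣ M)
    (ω : ℤ → ℤ) (ω-odd : ∀ i → ω (- i) ≡ - ω i)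
    (κ : ℤ → ℤ) (κ-zero : κ 0ℤ ≡ 0ℤ) (κ-one : κ 1ℤ ≡ 1ℤ) (ω-scale : ∀ i → ω (i * (L * L)) ≡ κ L * ω i)
    (star : ∀ x y u w → x * u + y * w ≡ 1ℤ →
      ∑ (forms (L * M)) (λ (a , b , c) → ω (a * (x * x) - b * (x * y) - c * (y * y))) ≡ ∑ (forms (L * M)) (ω ∘ proj₁) * (κ x - κ y))
    where
    private
      D = L * M
      D′ = L * L * D
    open Crossings D ω
    private
      S = ∑ (forms D) (ω ∘ proj₁)
      G : Triple → ℤ
      G = ω ∘ proj₁

    -- Every form of discriminant ℓ²D lies in `Coset∞` or else in exactly one `Coset p`, so the
    -- indicators of the cosets add up to 1.
    partition : ∑ (forms D′) G ≡
      ∑ (restrict (forms D′) (coset∞? M L∤M)) G + sumL (upTo ℓ) (λ p → ∑ (restrict (forms D′) (coset? M L∤M p)) G)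
    partition = begin
      ∑ (forms D′) G
        ≡⟨ ∑-cong (forms D′) (λ {v} w → sym (pointwise v w (coset∞? M L∤M v))) ⟩
      ∑ (forms D′) (λ v → when (coset∞? M L∤M v) (G v) + sumL (upTo ℓ) (λ p → when (coset? M L∤M p v) (G v)))
        ≡⟨ sumL-+ (λ v → when (coset∞? M L∤M v) (G v)) (λ v → sumL (upTo ℓ) (λ p → when (coset? M L∤M p v) (G v))) (elems (forms D′)) ⟩
      ∑ (forms D′) (λ v → when (coset∞? M L∤M v) (G v)) + ∑ (forms D′) (λ v → sumL (upTo ℓ) (λ p → when (coset? M L∤M p v) (G v)))
        ≡⟨ cong₂ _+_ (sym (∑-restrict (forms D′) (coset∞? M L∤M) G))
             (trans (sumL-swap (elems (forms D′)) (upTo ℓ) (λ v p → when (coset? M L∤M p v) (G v)))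
               (sumL-cong (upTo ℓ) (λ {p} _ → sym (∑-restrict (forms D′) (coset? M L∤M p) G)))) ⟩
      ∑ (restrict (forms D′) (coset∞? M L∤M)) G + sumL (upTo ℓ) (λ p → ∑ (restrict (forms D′) (coset? M L∤M p)) G) ∎
      where
      open ≡-Reasoning
      pointwise : ∀ v → V D′ v → (d : Dec (Coset∞ M L∤M v)) →
        when d (G v) + sumL (upTo ℓ) (λ p → when (coset? M L∤M p v) (G v)) ≡ G v
      pointwise v w (yes q) = trans (cong (G v +_) (trans
        (sumL-cong (upTo ℓ) (λ {p} _ → when-no (coset? M L∤M p v) (coset∞-disjoint M L∤M {p = p} w q))) (sumL-0 (upTo ℓ)))) (ℤ.+-identityʳ _)
      pointwise v w (no ¬q) = let p , p<ℓ , r = coset-exists M L∤M w ¬q in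
        trans (ℤ.+-identityˡ _) (one-hot _ (Unique.upTo⁺ ℓ) (∈-upTo⁺ p<ℓ) (when-yes (coset? M L∤M p v) r)
          (λ {p′} p′∈ p′≢p → when-no (coset? M L∤M p′ v) (λ r′ → p′≢p (coset-unique M L∤M {v} w ¬q (∈-upTo⁻ p′∈) p<ℓ r′ r))))

    -- These are the forms Q(ℓX, Y) with Q of discriminant D, whose leading coefficient is
    -- multiplied by ℓ².
    coset∞-sum : ∑ (restrict (forms D′) (coset∞? M L∤M)) G ≡ κ L * S
    coset∞-sum = trans (∑-reindex (restrict (forms D′) (coset∞? M L∤M)) (forms D) to from to∈ from∈ from-to to-from eq)
      (sumL-* (κ L) G (elems (forms D)))
      where
      to from : Triple → Triple
      to (a , b , c) = quot (L * L) a , quot L b , c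
      from (a , b , c) = a * (L * L) , b * L , c
      disc-eq : ∀ a b c → b * L * (b * L) + ℤ.+ 4 * (a * (L * L) * c) ≡ (b * b + ℤ.+ 4 * (a * c)) * (L * L)
      disc-eq a b c = lemma a b c L
        where
        lemma : ∀ a b c l → b * l * (b * l) + ℤ.+ 4 * (a * (l * l) * c) ≡ (b * b + ℤ.+ 4 * (a * c)) * (l * l)
        lemma = solve-∀
      to∈ : ∀ {v} → V D′ v × Coset∞ M L∤M v → V D (to v)
      to∈ {a , b , c} (form p q e , d , d′) = form (0<-cancel {quot (L * L) a} 0<LL (subst (0ℤ <_) (quot-∣ d) p)) q
        (ℤ.*-cancelʳ-≡ (quot L b * quot L b + ℤ.+ 4 * (quot (L * L) a * c)) D (L * L)
          (trans (sym (disc-eq (quot (L * L) a) (quot L b) c))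
          (trans (cong₂ (λ x y → x * x + ℤ.+ 4 * (y * c)) (sym (quot-∣ d′)) (sym (quot-∣ d))) (trans e (ℤ.*-comm (L * L) D)))))
      from∈ : ∀ {v} → V D v → V D′ (from v) × Coset∞ M L∤M (from v)
      from∈ {a , b , c} (form p q e) = form (0<-* {a} 0<LL p) q (trans (disc-eq a b c) (trans (cong (_* (L * L)) e) (ℤ.*-comm D (L * L))))
        , divides a refl , divides b refl
      from-to : ∀ {v} → V D′ v × Coset∞ M L∤M v → from (to v) ≡ v
      from-to {a , b , c} (_ , d , d′) = cong₂ (λ x y → x , y , c) (sym (quot-∣ d)) (sym (quot-∣ d′))
      to-from : ∀ {v} → V D v → to (from v) ≡ v
      to-from {a , b , c} _ = cong₂ (λ x y → x , y , c) (quot-* (L * L) a) (quot-* L b)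
      eq : ∀ {v} → V D′ v × Coset∞ M L∤M v → G v ≡ κ L * G (to v)
      eq {a , b , c} (_ , d , _) = trans (cong ω (quot-∣ d)) (ω-scale (quot (L * L) a))

    private
      nonsq : ∀ k → D ≢ k * k
      nonsq = D-nonsquare M L∤M

    module _ (p : ℕ) (nonzero-s : ∀ {Q} → Disc Q → val Q (ℤ.+ p , L) ≢ 0ℤ) where
      private
        P = ℤ.+ p
        to from : Triple → Triple
        to Q@(a , b , c) = a , ℤ.+ 2 * (a * P) + b * L , - val Q (P , L)
        from (a , b , c) = a , quot L (b - ℤ.+ 2 * (a * P)) , quot (L * L) (- c - P * b + a * P * P)
        W : Triple → Set
        W w = V D′ w × Coset M L∤M p w
        disc-eq : ∀ a b c → (ℤ.+ 2 * (a * P) + b * L) * (ℤ.+ 2 * (a * P) + b * L) + ℤ.+ 4 * (a * - val (a , b , c) (P , L))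
          ≡ (b * b - ℤ.+ 4 * (a * c)) * (L * L)
        disc-eq a b c = lemma a b c P L
          where
          lemma : ∀ a b c p l → (ℤ.+ 2 * (a * p) + b * l) * (ℤ.+ 2 * (a * p) + b * l)
            + ℤ.+ 4 * (a * - (a * (p * p) + b * (p * l) + c * (l * l))) ≡ (b * b - ℤ.+ 4 * (a * c)) * (l * l)
          lemma = solve-∀
        mid-eq : ∀ a b → ℤ.+ 2 * (a * P) + b * L - ℤ.+ 2 * (a * P) ≡ b * L
        mid-eq a b = lemma (ℤ.+ 2 * (a * P)) (b * L)
          where
          lemma : ∀ i j → i + j - i ≡ j
          lemma = solve-∀
        last-eq : ∀ a b c → - - val (a , b , c) (P , L) - P * (ℤ.+ 2 * (a * P) + b * L) + a * P * P ≡ c * (L * L)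
        last-eq a b c = lemma a b c P L
          where
          lemma : ∀ a b c p l → - - (a * (p * p) + b * (p * l) + c * (l * l)) - p * (ℤ.+ 2 * (a * p) + b * l) + a * p * p ≡ c * (l * l)
          lemma = solve-∀
        to∈ : ∀ {Q} → Disc Q → 0ℤ < val Q e₁ → val Q (P , L) < 0ℤ → W (to Q)
        to∈ {Q@(a , b , c)} (discriminant e) q r = form (subst (0ℤ <_) (val-e₁ Q) q) (ℤ.neg-mono-< r)
            (trans (disc-eq a b c) (trans (cong (_* (L * L)) e) (ℤ.*-comm D (L * L))))
          , divides b (mid-eq a b) , divides c (last-eq a b c)
        from-disc : ∀ {w} → W w → Disc (from w)
        from-disc {a , b , c} (form _ _ e , d , d′) = discriminant (ℤ.*-cancelʳ-≡ (x * x - ℤ.+ 4 * (a * y)) D (L * L)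
          (trans (lemma x a y L) (trans (cong₂ (λ s t → s * s - ℤ.+ 4 * (a * t)) (sym (quot-∣ d)) (sym (quot-∣ d′)))
            (trans (lemma₂ a b c P) (trans e (ℤ.*-comm (L * L) D))))))
          where
          x = quot L (b - ℤ.+ 2 * (a * P))
          y = quot (L * L) (- c - P * b + a * P * P)
          lemma : ∀ x a y l → (x * x - ℤ.+ 4 * (a * y)) * (l * l) ≡ x * l * (x * l) - ℤ.+ 4 * (a * (y * (l * l)))
          lemma = solve-∀
          lemma₂ : ∀ a b c p → (b - ℤ.+ 2 * (a * p)) * (b - ℤ.+ 2 * (a * p)) - ℤ.+ 4 * (a * (- c - p * b + a * p * p)) ≡ b * b + ℤ.+ 4 * (a * c)
          lemma₂ = solve-∀
        val-from : ∀ {w} → W w → val (from w) (P , L) ≡ - proj₂ (proj₂ w)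
        val-from {a , b , c} (_ , d , d′) = trans (lemma a x y P L)
          (trans (cong₂ (λ s t → a * (P * P) + s * P + t) (sym (quot-∣ d)) (sym (quot-∣ d′))) (lemma₂ a b c P))
          where
          x = quot L (b - ℤ.+ 2 * (a * P))
          y = quot (L * L) (- c - P * b + a * P * P)
          lemma : ∀ a x y p l → a * (p * p) + x * (p * l) + y * (l * l) ≡ a * (p * p) + x * l * p + y * (l * l)
          lemma = solve-∀
          lemma₂ : ∀ a b c p → a * (p * p) + (b - ℤ.+ 2 * (a * p)) * p + (- c - p * b + a * p * p) ≡ - c
          lemma₂ = solve-∀
        to-from : ∀ {w} → W w → to (from w) ≡ w
        to-from {a , b , c} w∈@(_ , d , d′) = cong (a ,_) (cong₂ _,_
          (trans (cong (ℤ.+ 2 * (a * P) +_) (sym (quot-∣ d))) (lemma (ℤ.+ 2 * (a * P)) b))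
          (trans (cong -_ (val-from w∈)) (ℤ.neg-involutive c)))
          where
          lemma : ∀ i j → i + (j - i) ≡ j
          lemma = solve-∀
        from-to : ∀ {Q} → Disc Q → 0ℤ < val Q e₁ → val Q (P , L) < 0ℤ → from (to Q) ≡ Q
        from-to {Q@(a , b , c)} _ _ _ = cong (a ,_) (cong₂ _,_
          (trans (cong (quot L) (mid-eq a b)) (quot-* L b))
          (trans (cong (quot (L * L)) (last-eq a b c)) (quot-* (L * L) c)))
        module C = Crossing e₁ (P , L) (nonzero-unimodular nonsq {1ℤ} {0ℤ} 1ℤ 0ℤ refl) nonzero-s
          (restrict (forms D′) (coset? M L∤M p)) to from to∈ from-disc
          (λ {w} (w∈ , _) → subst (0ℤ <_) (sym (val-e₁ (from w))) (a>0 w∈))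
          (λ {w} w∈ → subst (_< 0ℤ) (sym (val-from w∈)) (ℤ.neg-mono-< (c>0 (proj₁ w∈))))
          to-from from-to ω-odd

      -- Restricting Q to the sublattice spanned by (1,0) and (p,ℓ) yields the forms of the coset,
      -- and a, c > 0 says that Q falls from positive to negative between these two vectors. That Q
      -- does not vanish at (p,ℓ) is kept as a hypothesis because the vector fails to be primitive
      -- for p = 0.
      coset-crossing : Eventually (λ Q → T Q e₁ (ℤ.+ p , L) ≡ ℤ.+ 2 * ∑ (restrict (forms D′) (coset? M L∤M p)) G)
      coset-crossing = C.crossing

    private
      compare : ∀ {s X Y} → Eventually (λ Q → T Q e₁ s ≡ ℤ.+ 2 * X) → Eventually (λ Q → T Q e₁ s ≡ ℤ.+ 2 * Y) → X ≡ Y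
      compare {s} {X} {Y} A B = eventually-const (eventually-map₂ (λ a b → ℤ.*-cancelˡ-≡ (ℤ.+ 2) X Y (trans (sym a) b)) A B)

    -- For 0 < p < ℓ the vector (p,ℓ) is primitive, so Euclid's path reaches it, and the value found
    -- at its end involves only its second coordinate ℓ.
    coset-sum : ∀ p → suc p ℕ.< ℓ → ∑ (restrict (forms D′) (coset? M L∤M (suc p))) G ≡ S * κ L
    coset-sum p p<ℓ = let u , w , eq = bezout (ℤ.+ suc p) (λ d → ℕ.>⇒∤ p<ℓ (∣⇒∣ᵤ d)) in
      compare {ℤ.+ suc p , L} (coset-crossing (suc p) (nonzero-unimodular nonsq {ℤ.+ suc p} {L} u w eq))
        (segment nonsq ω-odd κ κ-zero star ℓ (ℤ.+ suc p) u w eq)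

    -- (0,ℓ) is a positive multiple of (0,1), where every form has the same sign; hence the path
    -- ends at second coordinate 1, and κ(1) = 1 takes the place of κ(ℓ).
    coset-sum-0 : ∑ (restrict (forms D′) (coset? M L∤M 0)) G ≡ S
    coset-sum-0 = trans (compare {0ℤ , L} (coset-crossing 0 nonzero)
        (eventually-map₂ (λ {Q} a _ → trans (sumL-cong Q (λ {q} _ → cong (λ z → (pos (val q e₁) - z) * ω (proj₁ q)) (same q))) a) seg seg))
      (trans (cong (S *_) κ-one) (ℤ.*-identityʳ S))
      where
      seg = segment nonsq ω-odd κ κ-zero star 1 0ℤ 0ℤ 1ℤ refl
      scale : ∀ q → val q (0ℤ , L) ≡ val q (0ℤ , 1ℤ) * (L * L)
      scale (a , b , c) = lemma a b c L
        where
        lemma : ∀ a b c l → a * (0ℤ * 0ℤ) + b * (0ℤ * l) + c * (l * l) ≡ (a * (0ℤ * 0ℤ) + b * (0ℤ * 1ℤ) + c * (1ℤ * 1ℤ)) * (l * l)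
        lemma = solve-∀
      pos-* : ∀ i k → 0ℤ < k → pos (i * k) ≡ pos i
      pos-* (ℤ.+ zero) k _ = refl
      pos-* (ℤ.+ suc i) (ℤ.+ suc k) _ = refl
      pos-* -[1+ i ] (ℤ.+ suc k) _ = refl
      pos-* (ℤ.+ suc i) (ℤ.+ zero) (+<+ ())
      pos-* -[1+ i ] (ℤ.+ zero) (+<+ ())
      same : ∀ q → pos (val q (0ℤ , L)) ≡ pos (val q (0ℤ , 1ℤ))
      same q = trans (cong pos (scale q)) (pos-* (val q (0ℤ , 1ℤ)) (L * L) 0<LL)
      nonzero : ∀ {Q} → Disc Q → val Q (0ℤ , L) ≢ 0ℤ
      nonzero {Q} d e = nonzero-unimodular nonsq {0ℤ} {1ℤ} 0ℤ 1ℤ refl {Q} d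
        (ℤ.*-cancelʳ-≡ (val Q (0ℤ , 1ℤ)) 0ℤ (L * L) (trans (sym (scale Q)) e))

    -- The coset at infinity and the ℓ - 1 cosets with p > 0 contribute κ(ℓ) S each; the coset p = 0
    -- contributes S.
    hecke : ∑ (forms D′) G ≡ (1ℤ + L * κ L) * S
    hecke = begin
      ∑ (forms D′) G                          ≡⟨ partition ⟩
      ∑ (restrict (forms D′) (coset∞? M L∤M)) G + sumL (upTo ℓ) sums
        ≡⟨ cong₂ _+_ coset∞-sum (total ℓ (λ p p<ℓ → p<ℓ)) ⟩
      κ L * S + ((L - 1ℤ) * (S * κ L) + S)    ≡⟨ lemma L (κ L) S ⟩
      (1ℤ + L * κ L) * S                      ∎
      where
      open ≡-Reasoning
      sums : ℕ → ℤ
      sums p = ∑ (restrict (forms D′) (coset? M L∤M p)) G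
      lemma : ∀ l k s → k * s + ((l - 1ℤ) * (s * k) + s) ≡ (1ℤ + l * k) * s
      lemma = solve-∀
      constant : ∀ (f : ℕ → ℕ) n → (∀ i → i ℕ.< n → ∃ λ p → f i ≡ suc p × suc p ℕ.< ℓ) →
        sumL (applyUpTo f n) sums ≡ ℤ.+ n * (S * κ L)
      constant f zero h = sym (ℤ.*-zeroˡ (S * κ L))
      constant f (suc n) h = let p , e , p< = h 0 (ℕ.s≤s ℕ.z≤n) in
        trans (cong₂ _+_ (trans (cong sums e) (coset-sum p p<)) (constant (f ∘ suc) n (λ i i<n → h (suc i) (ℕ.s≤s i<n))))
          (trans (lemma₁ (S * κ L) (ℤ.+ n)) (cong (_* (S * κ L)) (sym (ℤ.pos-+ 1 n))))
        where
        lemma₁ : ∀ s n → s + n * s ≡ (1ℤ + n) * s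
        lemma₁ = solve-∀
      total : ∀ n → (∀ p → p ℕ.< n → p ℕ.< ℓ) → .{{_ : ℕ.NonZero n}} → sumL (upTo n) sums ≡ (ℤ.+ n - 1ℤ) * (S * κ L) + S
      total (suc n) h = trans (cong₂ _+_ coset-sum-0 (constant suc n (λ i i<n → i , refl , h (suc i) (ℕ.s≤s i<n))))
        (trans (ℤ.+-comm S _) (cong (λ z → z * (S * κ L) + S) (trans (lemma₁ (ℤ.+ n)) (cong (_- 1ℤ) (sym (ℤ.pos-+ 1 n))))))
        where
        lemma₁ : ∀ n → n ≡ 1ℤ + n - 1ℤ
        lemma₁ = solve-∀

-- Hecke relations for the weights a, a³ and χ₋₄(a)

module HeckeRelations where
  open FiniteSums
  open IndefiniteForms
  open RiverIdentities
  open import Data.Empty using (⊥-elim)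
  open import Data.Integer using (ℤ; 0ℤ; 1ℤ; _+_; _*_; -_; _-_)
  import Data.Integer as ℤ
  open import Data.Integer.Divisibility.Signed using (_∣_; divides; ∣⇒∣ᵤ)
  import Data.Integer.Properties as ℤ
  open import Data.Integer.Tactic.RingSolver using (solve-∀)
  open import Data.Nat as ℕ using (ℕ)
  open import Data.Nat.Primality using (Prime; prime⇒irreducible)
  open import Data.Product using (∃; _,_; proj₁; proj₂)
  open import Data.Sum using (inj₁; inj₂; [_,_]′)
  open import Function using (_∘_)
  open import Relation.Binary.PropositionalEquality
    using (_≡_; _≢_; refl; sym; trans; cong; cong₂; subst; module ≡-Reasoning)
  open import Relation.Nullary using (¬_)

  ∑-flip : ∀ D (F : Triple → ℤ) → ∑ (forms D) (F ∘ flip) ≡ ∑ (forms D) F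
  ∑-flip D F = ∑-reindex (forms D) (forms D) flip flip (V-flip D) (V-flip D)
    (λ {v} _ → flip-flip D v) (λ {v} _ → flip-flip D v) (λ _ → refl)

  ∑-linear : ∀ D i j (F G : Triple → ℤ) →
    ∑ (forms D) (λ v → i * F v + j * G v) ≡ i * ∑ (forms D) F + j * ∑ (forms D) G
  ∑-linear D i j F G = trans (sumL-+ (λ v → i * F v) (λ v → j * G v) (elems (forms D)))
    (cong₂ _+_ (sumL-* i F (elems (forms D))) (sumL-* j G (elems (forms D))))

  cube : ℤ → ℤ
  cube i = i * i * i

  Z₁ Z₃ Zχ : ℤ → ℤ
  Z₁ D = ∑ (forms D) proj₁
  Z₃ D = ∑ (forms D) (cube ∘ proj₁)
  Zχ D = ∑ (forms D) (χ ∘ proj₁)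

  module _ (D : ℤ) where
    -- The cross term is odd in b and cancels; `flip` exchanges a and c, so both have the total
    -- `Z₁ D`.
    star₁ : ∀ x y → ∑ (forms D) (λ (a , b , c) → a * (x * x) - b * (x * y) - c * (y * y)) ≡ Z₁ D * (x * x - y * y)
    star₁ x y = begin
      ∑ (forms D) (λ (a , b , c) → a * (x * x) - b * (x * y) - c * (y * y))
        ≡⟨ ∑-cong (forms D) (λ {(a , b , c)} _ → lemma a b c x y) ⟩
      ∑ (forms D) (λ v → 1ℤ * odd-part v + 1ℤ * (x * x * proj₁ v + - (y * y) * proj₁ (flip v)))
        ≡⟨ ∑-linear D 1ℤ 1ℤ odd-part _ ⟩
      1ℤ * ∑ (forms D) odd-part + 1ℤ * ∑ (forms D) (λ v → x * x * proj₁ v + - (y * y) * proj₁ (flip v))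
        ≡⟨ cong₂ (λ i j → 1ℤ * i + 1ℤ * j) (∑-odd D odd-part (λ {(a , b , c)} _ → lemma₂ b x y))
             (trans (∑-linear D (x * x) (- (y * y)) proj₁ (proj₁ ∘ flip)) (cong (λ z → x * x * Z₁ D + - (y * y) * z) (∑-flip D proj₁))) ⟩
      1ℤ * 0ℤ + 1ℤ * (x * x * Z₁ D + - (y * y) * Z₁ D)
        ≡⟨ lemma₃ x y (Z₁ D) ⟩
      Z₁ D * (x * x - y * y) ∎
      where
      open ≡-Reasoning
      odd-part : Triple → ℤ
      odd-part (a , b , c) = - (b * (x * y))
      lemma : ∀ a b c x y → a * (x * x) - b * (x * y) - c * (y * y) ≡ 1ℤ * - (b * (x * y)) + 1ℤ * (x * x * a + - (y * y) * c)
      lemma = solve-∀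
      lemma₂ : ∀ b x y → - (- b * (x * y)) ≡ - - (b * (x * y))
      lemma₂ = solve-∀
      lemma₃ : ∀ x y z → 1ℤ * 0ℤ + 1ℤ * (x * x * z + - (y * y) * z) ≡ z * (x * x - y * y)
      lemma₃ = solve-∀

    -- Apart from the outer terms, the part of Q(x,-y)³ that is even in b is a combination of
    -- `cubicW` and its flip, and these sum to 0 for nonsquare D. Here the absence of cusp forms of
    -- weight 8 makes itself felt.
    star₃ : (∀ k → D ≢ k * k) → ∀ x y →
      ∑ (forms D) (λ (a , b , c) → cube (a * (x * x) - b * (x * y) - c * (y * y))) ≡ Z₃ D * (cube x * cube x - cube y * cube y)
    star₃ ns x y = begin
      ∑ (forms D) (λ (a , b , c) → cube (a * (x * x) - b * (x * y) - c * (y * y)))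
        ≡⟨ ∑-cong (forms D) (λ {(a , b , c)} _ → lemma a b c x y) ⟩
      ∑ (forms D) (λ v → 1ℤ * odd-part v + 1ℤ * (1ℤ * outer v + 1ℤ * middle v))
        ≡⟨ ∑-linear D 1ℤ 1ℤ odd-part _ ⟩
      1ℤ * ∑ (forms D) odd-part + 1ℤ * ∑ (forms D) (λ v → 1ℤ * outer v + 1ℤ * middle v)
        ≡⟨ cong₂ (λ i j → 1ℤ * i + 1ℤ * j) (∑-odd D odd-part (λ {(a , b , c)} _ → lemma₂ a b c x y)) (∑-linear D 1ℤ 1ℤ outer middle) ⟩
      1ℤ * 0ℤ + 1ℤ * (1ℤ * ∑ (forms D) outer + 1ℤ * ∑ (forms D) middle)
        ≡⟨ cong₂ (λ i j → 1ℤ * 0ℤ + 1ℤ * (1ℤ * i + 1ℤ * j))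
             (trans (∑-linear D (cube x * cube x) (- (cube y * cube y)) (cube ∘ proj₁) (cube ∘ proj₁ ∘ flip))
               (cong (λ z → cube x * cube x * Z₃ D + - (cube y * cube y) * z) (∑-flip D (cube ∘ proj₁))))
             (trans (∑-linear D (ℤ.+ 3 * (x * x * x * x * (y * y))) (- (ℤ.+ 3 * (x * x * (y * y * y * y)))) cubicW (cubicW ∘ flip))
               (cong₂ (λ i j → ℤ.+ 3 * (x * x * x * x * (y * y)) * i + - (ℤ.+ 3 * (x * x * (y * y * y * y))) * j)
                 (cubic-nonsquare D ns) (trans (∑-flip D cubicW) (cubic-nonsquare D ns)))) ⟩
      1ℤ * 0ℤ + 1ℤ * (1ℤ * (cube x * cube x * Z₃ D + - (cube y * cube y) * Z₃ D)
        + 1ℤ * (ℤ.+ 3 * (x * x * x * x * (y * y)) * 0ℤ + - (ℤ.+ 3 * (x * x * (y * y * y * y))) * 0ℤ))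
        ≡⟨ lemma₃ (cube x) (cube y) (Z₃ D) (ℤ.+ 3 * (x * x * x * x * (y * y))) (- (ℤ.+ 3 * (x * x * (y * y * y * y)))) ⟩
      Z₃ D * (cube x * cube x - cube y * cube y) ∎
      where
      open ≡-Reasoning
      odd-part outer middle : Triple → ℤ
      odd-part (a , b , c) = b * (x * y) * (- (ℤ.+ 3 * (a * a * (x * x * x * x))) - b * b * (x * x * (y * y))
        + ℤ.+ 6 * (a * c * (x * x * (y * y))) - ℤ.+ 3 * (c * c * (y * y * y * y)))
      outer v = cube x * cube x * cube (proj₁ v) + - (cube y * cube y) * cube (proj₁ (flip v))
      middle v = ℤ.+ 3 * (x * x * x * x * (y * y)) * cubicW v + - (ℤ.+ 3 * (x * x * (y * y * y * y))) * cubicW (flip v)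
      lemma : ∀ a b c x y →
        (a * (x * x) - b * (x * y) - c * (y * y)) * (a * (x * x) - b * (x * y) - c * (y * y)) * (a * (x * x) - b * (x * y) - c * (y * y)) ≡
        1ℤ * (b * (x * y) * (- (ℤ.+ 3 * (a * a * (x * x * x * x))) - b * b * (x * x * (y * y))
          + ℤ.+ 6 * (a * c * (x * x * (y * y))) - ℤ.+ 3 * (c * c * (y * y * y * y))))
        + 1ℤ * (1ℤ * (x * x * x * (x * x * x) * (a * a * a) + - (y * y * y * (y * y * y)) * (c * c * c))
          + 1ℤ * (ℤ.+ 3 * (x * x * x * x * (y * y)) * (a * (b * b - a * c))
            + - (ℤ.+ 3 * (x * x * (y * y * y * y))) * (c * (- b * - b - c * a))))
      lemma = solve-∀
      lemma₂ : ∀ a b c x y → - b * (x * y) * (- (ℤ.+ 3 * (a * a * (x * x * x * x))) - - b * - b * (x * x * (y * y))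
        + ℤ.+ 6 * (a * c * (x * x * (y * y))) - ℤ.+ 3 * (c * c * (y * y * y * y))) ≡
        - (b * (x * y) * (- (ℤ.+ 3 * (a * a * (x * x * x * x))) - b * b * (x * x * (y * y))
        + ℤ.+ 6 * (a * c * (x * x * (y * y))) - ℤ.+ 3 * (c * c * (y * y * y * y))))
      lemma₂ = solve-∀
      lemma₃ : ∀ x y z i j → 1ℤ * 0ℤ + 1ℤ * (1ℤ * (x * x * z + - (y * y) * z) + 1ℤ * (i * 0ℤ + j * 0ℤ)) ≡ z * (x * x - y * y)
      lemma₃ = solve-∀

  -- As b is even, Q(x,-y) modulo 4 depends on the parities of x and y only: it is a, -c or a - b -
  -- c. Coprimality excludes two even arguments, and for two odd ones `flip` changes the sign of a -
  -- b - c, so that the sum vanishes. Hence κ is the indicator of odd integers.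
  starχ : ∀ n x y u w → x * u + y * w ≡ 1ℤ →
    ∑ (forms (ℤ.+ 4 * n)) (λ (a , b , c) → χ (a * (x * x) - b * (x * y) - c * (y * y))) ≡ Zχ (ℤ.+ 4 * n) * (odd x - odd y)
  starχ n x y u w eq = cases (parity x) (parity y)
    where
    D = ℤ.+ 4 * n
    F : Triple → ℤ
    F (a , b , c) = χ (a * (x * x) - b * (x * y) - c * (y * y))
    close : ∀ {t} i j → odd x ≡ i → odd y ≡ j → t ≡ Zχ D * (i - j) → t ≡ Zχ D * (odd x - odd y)
    close i j refl refl e = e
    cases : _ → _ → ∑ (forms D) F ≡ Zχ D * (odd x - odd y)
    cases (s , inj₁ refl) (t , inj₁ refl) = ⊥-elim (2i≢1 (s * u + t * w) (trans (lemma s t u w) eq))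
      where
      lemma : ∀ s t u w → ℤ.+ 2 * (s * u + t * w) ≡ ℤ.+ 2 * s * u + ℤ.+ 2 * t * w
      lemma = solve-∀
    cases (s , inj₂ refl) (t , inj₁ refl) = close 1ℤ 0ℤ (odd-odd s) (odd-even t)
      (trans (∑-cong (forms D) same) (sym (ℤ.*-identityʳ (Zχ D))))
      where
      lemma : ∀ a β c s t → a * ((ℤ.+ 2 * s + 1ℤ) * (ℤ.+ 2 * s + 1ℤ)) - ℤ.+ 2 * β * ((ℤ.+ 2 * s + 1ℤ) * (ℤ.+ 2 * t)) - c * (ℤ.+ 2 * t * (ℤ.+ 2 * t))
        ≡ a + ℤ.+ 4 * (a * (s * s + s) - β * ((ℤ.+ 2 * s + 1ℤ) * t) - c * (t * t))
      lemma = solve-∀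
      same : ∀ {v} → V D v → F v ≡ χ (proj₁ v)
      same {a , b , c} v with β , refl ← V-even {n} v = trans (cong χ (lemma a β c s t))
        (χ-mod a (a * (s * s + s) - β * ((ℤ.+ 2 * s + 1ℤ) * t) - c * (t * t)))
    cases (s , inj₁ refl) (t , inj₂ refl) = close 0ℤ 1ℤ (odd-even s) (odd-odd t)
      (trans (∑-cong (forms D) same) (trans (sumL-* (- 1ℤ) (χ ∘ proj₁ ∘ flip) (elems (forms D)))
        (trans (cong (- 1ℤ *_) (∑-flip D (χ ∘ proj₁))) (ℤ.*-comm (- 1ℤ) (Zχ D)))))
      where
      lemma : ∀ a β c s t → a * (ℤ.+ 2 * s * (ℤ.+ 2 * s)) - ℤ.+ 2 * β * (ℤ.+ 2 * s * (ℤ.+ 2 * t + 1ℤ)) - c * ((ℤ.+ 2 * t + 1ℤ) * (ℤ.+ 2 * t + 1ℤ))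
        ≡ - c + ℤ.+ 4 * (a * (s * s) - β * (s * (ℤ.+ 2 * t + 1ℤ)) - c * (t * t + t))
      lemma = solve-∀
      same : ∀ {v} → V D v → F v ≡ - 1ℤ * χ (proj₁ (flip v))
      same {a , b , c} v with β , refl ← V-even {n} v = trans (cong χ (lemma a β c s t))
        (trans (χ-mod (- c) (a * (s * s) - β * (s * (ℤ.+ 2 * t + 1ℤ)) - c * (t * t + t)))
          (trans (χ-neg c) (sym (ℤ.-1*i≡-i (χ c)))))
    cases (s , inj₂ refl) (t , inj₂ refl) = close 1ℤ 1ℤ (odd-odd s) (odd-odd t)
      (trans (∑-cong (forms D) same) (trans vanish (sym (ℤ.*-zeroʳ (Zχ D)))))
      where
      M : Triple → ℤ
      M (a , b , c) = χ (a - b - c)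
      lemma : ∀ a β c s t → a * ((ℤ.+ 2 * s + 1ℤ) * (ℤ.+ 2 * s + 1ℤ)) - ℤ.+ 2 * β * ((ℤ.+ 2 * s + 1ℤ) * (ℤ.+ 2 * t + 1ℤ)) - c * ((ℤ.+ 2 * t + 1ℤ) * (ℤ.+ 2 * t + 1ℤ))
        ≡ a - ℤ.+ 2 * β - c + ℤ.+ 4 * (a * (s * s + s) - β * (ℤ.+ 2 * (s * t) + s + t) - c * (t * t + t))
      lemma = solve-∀
      same : ∀ {v} → V D v → F v ≡ M v
      same {a , b , c} v with β , refl ← V-even {n} v = trans (cong χ (lemma a β c s t))
        (χ-mod (a - ℤ.+ 2 * β - c) (a * (s * s + s) - β * (ℤ.+ 2 * (s * t) + s + t) - c * (t * t + t)))
      lemma₂ : ∀ a b c → c - - b - a ≡ - (a - b - c)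
      lemma₂ = solve-∀
      vanish : ∑ (forms D) M ≡ 0ℤ
      vanish = i≡-i⇒i≡0 (trans (sym (∑-flip D M)) (trans
        (∑-cong (forms D) (λ {(a , b , c)} _ → trans (cong χ (lemma₂ a b c)) (trans (χ-neg (a - b - c)) (sym (ℤ.-1*i≡-i (M (a , b , c)))))))
        (trans (sumL-* (- 1ℤ) M (elems (forms D))) (ℤ.-1*i≡-i _))))

  module _ (ℓ : ℕ) (ℓ-prime : Prime ℓ) (ℓ≢2 : ℓ ≢ 2) where
    private
      L = ℤ.+ ℓ
    open Cosets ℓ ℓ-prime ℓ≢2
    open Hecke ℓ ℓ-prime ℓ≢2

    hecke₁ : ∀ M → ¬ L ∣ M → Z₁ (L * L * (L * M)) ≡ (1ℤ + cube L) * Z₁ (L * M)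
    hecke₁ M L∤M = trans (hecke M L∤M (λ i → i) (λ _ → refl) (λ x → x * x) refl refl (λ i → ℤ.*-comm i (L * L))
      (λ x y _ _ _ → star₁ (L * M) x y)) (cong (λ z → (1ℤ + z) * Z₁ (L * M)) (sym (ℤ.*-assoc L L L)))

    hecke₃ : ∀ M → ¬ L ∣ M → Z₃ (L * L * (L * M)) ≡ (1ℤ + L * (cube L * cube L)) * Z₃ (L * M)
    hecke₃ M L∤M = hecke M L∤M cube lemma (λ x → cube x * cube x) refl refl (λ i → lemma₂ i L)
      (λ x y _ _ _ → star₃ (L * M) (D-nonsquare M L∤M) x y)
      where
      lemma : ∀ i → - i * - i * - i ≡ - (i * i * i)
      lemma = solve-∀
      lemma₂ : ∀ i l → i * (l * l) * (i * (l * l)) * (i * (l * l)) ≡ l * l * l * (l * l * l) * (i * i * i)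
      lemma₂ = solve-∀

    L-odd : ∃ λ k → L ≡ ℤ.+ 2 * k + 1ℤ
    L-odd = cases (parity L)
      where
      cases : _ → _
      cases (k , inj₂ e) = k , e
      cases (k , inj₁ e) = ⊥-elim ([ (λ ()) , ℓ≢2 ∘ sym ]′ (prime⇒irreducible ℓ-prime
        (∣⇒∣ᵤ (divides k (trans e (ℤ.*-comm (ℤ.+ 2) k))))))

    odd-L : odd L ≡ 1ℤ
    odd-L = trans (cong odd (proj₂ L-odd)) (odd-odd (proj₁ L-odd))

    -- The square of an odd ℓ is 1 modulo 4, so `χ` does not notice the factor ℓ², and κ(ℓ) = 1
    -- turns the Hecke factor into 1 + ℓ.
    heckeχ : ∀ n → ¬ L ∣ ℤ.+ 4 * n → Zχ (L * L * (L * (ℤ.+ 4 * n))) ≡ (1ℤ + L) * Zχ (L * (ℤ.+ 4 * n))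
    heckeχ n L∤M = trans (hecke (ℤ.+ 4 * n) L∤M χ χ-neg odd refl refl scaling
      (subst (λ D → ∀ x y u w → x * u + y * w ≡ 1ℤ →
        ∑ (forms D) (λ (a , b , c) → χ (a * (x * x) - b * (x * y) - c * (y * y))) ≡ Zχ D * (odd x - odd y))
        (lemma L n) (starχ (L * n))))
      (cong (λ z → (1ℤ + z) * Zχ (L * (ℤ.+ 4 * n))) (trans (cong (L *_) odd-L) (ℤ.*-identityʳ L)))
      where
      lemma : ∀ l n → ℤ.+ 4 * (l * n) ≡ l * (ℤ.+ 4 * n)
      lemma = solve-∀
      scaling : ∀ i → χ (i * (L * L)) ≡ odd L * χ i
      scaling i = trans (trans (cong χ (trans (cong (λ z → i * (z * z)) (proj₂ L-odd)) (lemma₂ i k))) (χ-mod i (i * (k * k + k))))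
        (sym (trans (cong (_* χ i) odd-L) (ℤ.*-identityˡ (χ i))))
        where
        k = proj₁ L-odd
        lemma₂ : ∀ i k → i * ((ℤ.+ 2 * k + 1ℤ) * (ℤ.+ 2 * k + 1ℤ)) ≡ i + ℤ.+ 4 * (i * (k * k + k))
        lemma₂ = solve-∀

-- Theta series, Lambert series and their product

module ThetaAndDivisorSums where
  open FiniteSums
  open PowerSeries
  open SeriesMaps
  open IndefiniteForms
  open RiverIdentities
  open HeckeRelations
  open import Data.Empty using (⊥-elim)
  open import Data.Integer using (ℤ; 0ℤ; 1ℤ; _+_; _*_; _<_; -[1+_]; ∣_∣; +<+)
  import Data.Integer as ℤ
  import Data.Integer.Properties as ℤ
  open import Data.Integer.Tactic.RingSolver using (solve-∀)
  open import Data.List using (List; []; _∷_; map; cartesianProduct)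
  open import Data.List.Membership.Propositional using (_∈_)
  open import Data.List.Membership.Propositional.Properties using (∈-map⁺; ∈-map⁻; ∈-cartesianProduct⁺)
  open import Data.List.Relation.Unary.All as All using ([]; _∷_)
  open import Data.List.Relation.Unary.AllPairs using ([]; _∷_)
  open import Data.List.Relation.Unary.Any using (here; there)
  open import Data.Nat as ℕ using (ℕ; zero; suc)
  import Data.Nat.Properties as ℕ
  open import Data.Product using (∃; _×_; _,_; proj₁; proj₂)
  open import Data.Product.Properties using (≡-dec)
  open import Data.Sum using (_⊎_; inj₁; inj₂; [_,_]′)
  open import Function using (_∘_)
  open import Relation.Binary.Definitions using (tri<; tri≈; tri>)
  open import Relation.Binary.PropositionalEquality
    using (_≡_; _≢_; refl; sym; trans; cong; cong₂; subst; module ≡-Reasoning)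
  open import Relation.Nullary using (¬_)
  open import Relation.Nullary.Decidable using (_×-dec_; map′)

  antidiagonal : ∀ n → Finite {ℕ × ℕ} (λ ij → proj₁ ij ℕ.+ proj₂ ij ≡ n)
  antidiagonal zero = finite ((0 , 0) ∷ []) ([] ∷ []) (λ { (here refl) → refl }) (λ { {zero , zero} _ → here refl })
  antidiagonal (suc n) = finite ((0 , suc n) ∷ map bump (elems (antidiagonal n)))
    (All.tabulate fresh
      ∷ unique-map (elems (antidiagonal n)) (λ { _ _ refl → refl }) (unique (antidiagonal n)))
    (λ { (here refl) → refl ; (there p) → inside p })
    (λ { {zero , j} refl → here refl
       ; {suc i , j} e → there (∈-map⁺ bump (complete (antidiagonal n) (ℕ.suc-injective e))) })
    where
    bump : ℕ × ℕ → ℕ × ℕ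
    bump = λ (i , j) → suc i , j
    fresh : ∀ {z} → z ∈ map bump (elems (antidiagonal n)) → (0 , suc n) ≢ z
    fresh p e with _ , _ , refl ← ∈-map⁻ bump p | () ← e
    inside : ∀ {z} → z ∈ map bump (elems (antidiagonal n)) → proj₁ z ℕ.+ proj₂ z ≡ suc n
    inside p with _ , q , refl ← ∈-map⁻ bump p = cong suc (sound (antidiagonal n) q)

  ⊗-sum : ∀ x y n → (x ⊗ y) ! n ≡ ∑ (antidiagonal n) (λ (i , j) → x ! i * y ! j)
  ⊗-sum x y zero = sym (ℤ.+-identityʳ (x ! 0 * y ! 0))
  ⊗-sum x y (suc n) = cong (x ! 0 * y ! suc n +_) (trans (⊗-sum (tail x) y n)
    (sym (sumL-map (λ (i , j) → suc i , j) (λ (i , j) → x ! i * y ! j) (elems (antidiagonal n)))))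

  roots : ∀ n → Finite {ℤ} (λ b → b * b ≡ ℤ.+ n)
  roots n = fromList ℤ._≟_ (integers n) (λ b → b * b ℤ.≟ ℤ.+ n)
    (λ {b} e → ∈-integers b (subst (∣ b ∣ ℕ.≤_) (ℤ.+-injective (trans (sym (square-∣∣ b)) e)) (n≤n*n ∣ b ∣)))
    where
    n≤n*n : ∀ n → n ℕ.≤ n ℕ.* n
    n≤n*n zero = ℕ.z≤n
    n≤n*n (suc n) = ℕ.m≤m+n (suc n) (n ℕ.* suc n)

  φ : PS
  φ ! n = ∑ (roots n) (λ _ → 1ℤ)

  φ-0 : φ ! 0 ≡ 1ℤ
  φ-0 = ∑-reindex (roots 0) T (λ b → b) (λ b → b) {λ _ → 1ℤ} {λ _ → 1ℤ} (λ {b} → root b) (λ { refl → refl }) (λ _ → refl) (λ _ → refl) (λ _ → refl)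
    where
    T : Finite (_≡ 0ℤ)
    T = finite (0ℤ ∷ []) ([] ∷ []) (λ { (here refl) → refl }) (λ { refl → here refl })
    root : ∀ b → b * b ≡ 0ℤ → b ≡ 0ℤ
    root b e = [ (λ p → p) , (λ p → p) ]′ (ℤ.i*j≡0⇒i≡0∨j≡0 b e)

  φ-nonsquare : ∀ {n} → (∀ k → ℤ.+ n ≢ k * k) → φ ! n ≡ 0ℤ
  φ-nonsquare {n} ns = ∑-zero (roots n) (λ {b} e → ⊥-elim (ns b (sym e)))

  square-injective : ∀ m n → m ℕ.* m ≡ n ℕ.* n → m ≡ n
  square-injective m n eq with ℕ.<-cmp m n
  ... | tri< m<n _ _ = ⊥-elim (ℕ.<-irrefl eq (ℕ.*-mono-< m<n m<n))
  ... | tri≈ _ m≡n _ = m≡n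
  ... | tri> _ _ n<m = ⊥-elim (ℕ.<-irrefl (sym eq) (ℕ.*-mono-< n<m n<m))

  φ-square : ∀ k → φ ! (suc k ℕ.* suc k) ≡ ℤ.+ 2
  φ-square k = ∑-reindex (roots (suc k ℕ.* suc k)) T (λ b → b) (λ b → b) (λ {b} → root b) back (λ _ → refl) (λ _ → refl) (λ _ → refl)
    where
    T : Finite (λ b → b ≡ ℤ.+ suc k ⊎ b ≡ -[1+ k ])
    T = finite (ℤ.+ suc k ∷ -[1+ k ] ∷ []) (((λ ()) ∷ []) ∷ [] ∷ [])
      (λ { (here refl) → inj₁ refl ; (there (here refl)) → inj₂ refl })
      (λ { (inj₁ refl) → here refl ; (inj₂ refl) → there (here refl) })
    abs-root : ∀ b → b * b ≡ ℤ.+ (suc k ℕ.* suc k) → ∣ b ∣ ≡ suc k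
    abs-root b e = square-injective ∣ b ∣ (suc k) (ℤ.+-injective (trans (sym (square-∣∣ b)) e))
    root : ∀ b → b * b ≡ ℤ.+ (suc k ℕ.* suc k) → b ≡ ℤ.+ suc k ⊎ b ≡ -[1+ k ]
    root (ℤ.+ n) e = inj₁ (cong ℤ.+_ (abs-root (ℤ.+ n) e))
    root -[1+ n ] e = inj₂ (cong -[1+_] (ℕ.suc-injective (abs-root -[1+ n ] e)))
    back : ∀ {b} → b ≡ ℤ.+ suc k ⊎ b ≡ -[1+ k ] → b * b ≡ ℤ.+ (suc k ℕ.* suc k)
    back (inj₁ refl) = sym (ℤ.pos-* (suc k) (suc k))
    back (inj₂ refl) = refl

  square? : ∀ n → (∃ λ k → n ≡ k ℕ.* k) ⊎ (∀ k → ℤ.+ n ≢ k * k)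
  square? n = go (elems (roots n)) refl
    where
    go : ∀ xs → elems (roots n) ≡ xs → (∃ λ k → n ≡ k ℕ.* k) ⊎ (∀ k → ℤ.+ n ≢ k * k)
    go [] e = inj₂ (λ k p → none (subst (k ∈_) e (complete (roots n) (sym p))))
      where
      none : ∀ {k} → ¬ k ∈ []
      none ()
    go (b ∷ bs) e = inj₁ (∣ b ∣ , ℤ.+-injective (trans (sym (sound (roots n) (subst (b ∈_) (sym e) (here refl)))) (square-∣∣ b)))

  record Factors (k : ℕ) (n : ℤ) (ac : ℤ × ℤ) : Set where
    constructor factors
    field
      left>0 : 0ℤ < proj₁ ac
      right>0 : 0ℤ < proj₂ ac
      product : ℤ.+ k * (proj₁ ac * proj₂ ac) ≡ n
  open Factors

  factorizations : ∀ k .{{_ : ℕ.NonZero k}} n → Finite (Factors k (ℤ.+ n))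
  factorizations k n = fromList (≡-dec ℤ._≟_ ℤ._≟_) (cartesianProduct (integers n) (integers n))
    (λ (a , c) → map′ (λ (p , q , r) → factors p q r) (λ f → left>0 f , right>0 f , product f)
      ((0ℤ ℤ.<? a) ×-dec (0ℤ ℤ.<? c) ×-dec (ℤ.+ k * (a * c) ℤ.≟ ℤ.+ n)))
    (λ {ac} f → let p , q = bounds f in ∈-cartesianProduct⁺ (∈-integers (proj₁ ac) p) (∈-integers (proj₂ ac) q))
    where
    bounds : ∀ {ac} → Factors k (ℤ.+ n) ac → ∣ proj₁ ac ∣ ℕ.≤ n × ∣ proj₂ ac ∣ ℕ.≤ n
    bounds {ℤ.+ suc x , ℤ.+ suc y} (factors _ _ e) with ℤ.+-injective (trans (ℤ.pos-* k (suc x ℕ.* suc y)) (trans (cong (ℤ.+ k *_) (ℤ.pos-* (suc x) (suc y))) e))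
    ... | refl = ℕ.≤-trans (ℕ.m≤m*n (suc x) (suc y)) (ℕ.m≤n*m (suc x ℕ.* suc y) k)
               , ℕ.≤-trans (ℕ.m≤n*m (suc y) (suc x)) (ℕ.m≤n*m (suc x ℕ.* suc y) k)
    bounds {ℤ.+ zero , _} (factors (+<+ ()) _ _)
    bounds {ℤ.+ suc _ , ℤ.+ zero} (factors _ (+<+ ()) _)

  -- The Lambert series Σ ω(a) q^(ka) / (1 - q^(ka)); for k = 1 and the identity its coefficients
  -- are the divisor sums σ(n).
  lambert : ∀ k .{{_ : ℕ.NonZero k}} → (ℤ → ℤ) → PS
  lambert k ω ! n = ∑ (factorizations k n) (ω ∘ proj₁)

  record Split (k : ℕ) (n : ℤ) (v : Triple) : Set where
    constructor split
    field
      first>0 : 0ℤ < proj₁ v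
      third>0 : 0ℤ < proj₂ (proj₂ v)
      total : proj₁ (proj₂ v) * proj₁ (proj₂ v) + ℤ.+ k * (proj₁ v * proj₂ (proj₂ v)) ≡ n
  open Split public

  -- The product enumerates the solutions of b² + kac = n, which `u` and `w` translate into another
  -- parametrisation. The factor `g`, a function of the degree of the second series, covers the
  -- plain product (`g` constant), the Euler operator (`g` linear) and the restriction to odd
  -- degrees.
  φ⊗lambert : ∀ k .{{_ : ℕ.NonZero k}} n {Q : Triple → Set} (T : Finite Q) (u w : Triple → Triple) →
    (∀ {v} → Q v → Split k (ℤ.+ n) (u v)) → (∀ {v} → Split k (ℤ.+ n) v → Q (w v)) →
    (∀ {v} → Q v → w (u v) ≡ v) → (∀ {v} → Split k (ℤ.+ n) v → u (w v) ≡ v) →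
    (g ω : ℤ → ℤ) →
    ∑ (antidiagonal n) (λ (i , j) → g (ℤ.+ j) * (φ ! i * lambert k ω ! j)) ≡
    ∑ T (λ v → let (a , _ , c) = u v in g (ℤ.+ k * (a * c)) * ω a)
  φ⊗lambert k n {Q} T u w u∈ w∈ wu uw g ω = begin
    ∑ (antidiagonal n) (λ (i , j) → g (ℤ.+ j) * (φ ! i * lambert k ω ! j))
      ≡⟨ ∑-cong (antidiagonal n) (λ {(i , j)} _ → inner i j) ⟩
    ∑ (antidiagonal n) (λ (i , j) → ∑ (fibre (i , j)) (λ (b , a , c) → g (ℤ.+ j) * ω a))
      ≡⟨ ∑-sigma fibre (antidiagonal n) (λ ((i , j) , b , a , c) → g (ℤ.+ j) * ω a) ⟨
    ∑ (sigma fibre (antidiagonal n)) (λ ((i , j) , b , a , c) → g (ℤ.+ j) * ω a)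
      ≡⟨ ∑-reindex (sigma fibre (antidiagonal n)) T to from to∈ from∈ from-to to-from eq ⟩
    ∑ T (λ v → let (a , _ , c) = u v in g (ℤ.+ k * (a * c)) * ω a) ∎
    where
    open ≡-Reasoning
    fibre : ∀ (ij : ℕ × ℕ) → Finite (λ (bac : ℤ × ℤ × ℤ) → proj₁ bac * proj₁ bac ≡ ℤ.+ proj₁ ij × Factors k (ℤ.+ proj₂ ij) (proj₂ bac))
    fibre (i , j) = sigma (λ _ → factorizations k j) (roots i)
    inner : ∀ i j → g (ℤ.+ j) * (φ ! i * lambert k ω ! j) ≡ ∑ (fibre (i , j)) (λ (b , a , c) → g (ℤ.+ j) * ω a)
    inner i j = sym (begin
      ∑ (fibre (i , j)) (λ (b , a , c) → g (ℤ.+ j) * ω a)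
        ≡⟨ ∑-sigma (λ _ → factorizations k j) (roots i) (λ (b , a , c) → g (ℤ.+ j) * ω a) ⟩
      ∑ (roots i) (λ _ → ∑ (factorizations k j) (λ (a , c) → g (ℤ.+ j) * ω a))
        ≡⟨ ∑-cong (roots i) (λ _ → trans (sumL-* (g (ℤ.+ j)) (ω ∘ proj₁) (elems (factorizations k j))) (sym (ℤ.*-identityʳ (g (ℤ.+ j) * lambert k ω ! j)))) ⟩
      ∑ (roots i) (λ _ → g (ℤ.+ j) * lambert k ω ! j * 1ℤ)
        ≡⟨ sumL-* (g (ℤ.+ j) * lambert k ω ! j) (λ _ → 1ℤ) (elems (roots i)) ⟩
      g (ℤ.+ j) * lambert k ω ! j * φ ! i
        ≡⟨ lemma (g (ℤ.+ j)) (lambert k ω ! j) (φ ! i) ⟩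
      g (ℤ.+ j) * (φ ! i * lambert k ω ! j) ∎)
      where
      lemma : ∀ x y z → x * y * z ≡ x * (z * y)
      lemma = solve-∀
    Index : Set
    Index = (ℕ × ℕ) × ℤ × ℤ × ℤ
    P : Index → Set
    P x = proj₁ (proj₁ x) ℕ.+ proj₂ (proj₁ x) ≡ n ×
      (proj₁ (proj₂ x) * proj₁ (proj₂ x) ≡ ℤ.+ proj₁ (proj₁ x) × Factors k (ℤ.+ proj₂ (proj₁ x)) (proj₂ (proj₂ x)))
    rebuild : Triple → Index
    rebuild (a , b , c) = (∣ b ∣ ℕ.* ∣ b ∣ , k ℕ.* (∣ a ∣ ℕ.* ∣ c ∣)) , b , a , c
    to : Index → Triple
    to (_ , b , a , c) = w (a , b , c)
    from : Triple → Index
    from v = rebuild (u v)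
    P⇒Split : ∀ {i j b a c} → P ((i , j) , b , a , c) → Split k (ℤ.+ n) (a , b , c)
    P⇒Split {i} {j} (refl , e , factors p q r) = split p q (trans (cong₂ _+_ e r) (sym (ℤ.pos-+ i j)))
    nonneg : ∀ {i} → 0ℤ < i → ℤ.+ ∣ i ∣ ≡ i
    nonneg {ℤ.+ _} _ = refl
    nonneg { -[1+ _ ]} ()
    product≡ : ∀ {a b c} → Split k (ℤ.+ n) (a , b , c) → ℤ.+ (k ℕ.* (∣ a ∣ ℕ.* ∣ c ∣)) ≡ ℤ.+ k * (a * c)
    product≡ {a} {b} {c} (split p q _) = trans (ℤ.pos-* k (∣ a ∣ ℕ.* ∣ c ∣)) (cong (ℤ.+ k *_)
      (trans (ℤ.pos-* ∣ a ∣ ∣ c ∣) (cong₂ _*_ (nonneg p) (nonneg q))))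
    Split⇒P : ∀ {v} → Split k (ℤ.+ n) v → P (rebuild v)
    Split⇒P {a , b , c} s@(split p q r) =
        ℤ.+-injective (trans (ℤ.pos-+ (∣ b ∣ ℕ.* ∣ b ∣) _) (trans (cong₂ _+_ (sym (square-∣∣ b)) (product≡ s)) r))
      , square-∣∣ b , factors p q (sym (product≡ s))
    to∈ : ∀ {x} → P x → Q (to x)
    to∈ {(i , j) , b , a , c} p = w∈ (P⇒Split {i} {j} {b} {a} {c} p)
    from∈ : ∀ {v} → Q v → P (from v)
    from∈ q = Split⇒P (u∈ q)
    rebuild-P : ∀ {i j b a c} → P ((i , j) , b , a , c) → rebuild (a , b , c) ≡ ((i , j) , b , a , c)
    rebuild-P {i} {j} {b} {a} {c} p@(_ , e , f) = cong₂ (λ s t → (s , t) , b , a , c)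
      (ℤ.+-injective (trans (sym (square-∣∣ b)) e)) (ℤ.+-injective (trans (product≡ (P⇒Split {i} {j} {b} {a} {c} p)) (product f)))
    from-to : ∀ {x} → P x → from (to x) ≡ x
    from-to {(i , j) , b , a , c} p = trans (cong rebuild (uw (P⇒Split {i} {j} {b} {a} {c} p))) (rebuild-P {i} {j} {b} {a} {c} p)
    to-from : ∀ {v} → Q v → to (from v) ≡ v
    to-from q = wu q
    eq : ∀ {x : Index} → P x → g (ℤ.+ proj₂ (proj₁ x)) * ω (proj₁ (proj₂ (proj₂ x))) ≡
      g (ℤ.+ k * (proj₁ (u (to x)) * proj₂ (proj₂ (u (to x))))) * ω (proj₁ (u (to x)))
    eq {(i , j) , b , a , c} p@(_ , _ , f) = trans (cong (λ z → g z * ω a) (sym (product f)))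
      (cong (λ v → g (ℤ.+ k * (proj₁ v * proj₂ (proj₂ v))) * ω (proj₁ v)) (sym (uw (P⇒Split {i} {j} {b} {a} {c} p))))

-- Euler's recurrence for sums of two and four squares

module ThetaRecurrences where
  open FiniteSums
  open PowerSeries
  open SeriesMaps
  open IndefiniteForms
  open RiverIdentities
  open HeckeRelations
  open ThetaAndDivisorSums
  open import Data.Empty using (⊥-elim)
  open import Data.Integer using (ℤ; 0ℤ; 1ℤ; _+_; _*_; -_; _-_)
  import Data.Integer as ℤ
  import Data.Integer.Properties as ℤ
  open import Data.Integer.Tactic.RingSolver using (solve-∀)
  open import Data.Nat as ℕ using (ℕ; zero; suc)
  import Data.Nat.Properties as ℕ
  open import Data.Product using (∃; _×_; _,_; proj₁)
  open import Data.Sum using (_⊎_; inj₁; inj₂)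
  open import Function using (_∘_; id)
  open import Relation.Binary.PropositionalEquality
    using (_≡_; _≢_; refl; sym; trans; cong; cong₂; module ≡-Reasoning)

  half : ℤ → ℤ
  half i = proj₁ (parity i)

  half-2* : ∀ i → half (ℤ.+ 2 * i) ≡ i
  half-2* i = go (parity (ℤ.+ 2 * i))
    where
    lemma : ∀ i k → ℤ.+ 2 * (i - k) ≡ ℤ.+ 2 * i - ℤ.+ 2 * k
    lemma = solve-∀
    lemma₂ : ∀ k → ℤ.+ 2 * k + 1ℤ - ℤ.+ 2 * k ≡ 1ℤ
    lemma₂ = solve-∀
    go : (p : ∃ λ k → ℤ.+ 2 * i ≡ ℤ.+ 2 * k ⊎ ℤ.+ 2 * i ≡ ℤ.+ 2 * k + 1ℤ) → proj₁ p ≡ i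
    go (k , inj₁ e) = sym (ℤ.*-cancelˡ-≡ (ℤ.+ 2) i k e)
    go (k , inj₂ e) = ⊥-elim (2i≢1 (i - k) (trans (lemma i k) (trans (cong (_- ℤ.+ 2 * k) e) (lemma₂ k))))

  halve : Triple → Triple
  halve (a , b , c) = a , half b , c

  double : Triple → Triple
  double (a , b , c) = a , ℤ.+ 2 * b , c

  module _ (n : ℤ) where
    double-split : ∀ {v} → Split 1 n v → V (ℤ.+ 4 * n) (double v)
    double-split {a , b , c} (split p q refl) = form p q (lemma a b c)
      where
      lemma : ∀ a b c → ℤ.+ 2 * b * (ℤ.+ 2 * b) + ℤ.+ 4 * (a * c) ≡ ℤ.+ 4 * (b * b + 1ℤ * (a * c))
      lemma = solve-∀

    double-halve : ∀ {v} → V (ℤ.+ 4 * n) v → double (halve v) ≡ v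
    double-halve {a , b , c} v with β , refl ← V-even {n} v = cong (λ z → a , ℤ.+ 2 * z , c) (half-2* β)

    halve-double : ∀ v → halve (double v) ≡ v
    halve-double (a , b , c) = cong (λ z → a , z , c) (half-2* b)

    halve-split : ∀ {v} → V (ℤ.+ 4 * n) v → Split 1 n (halve v)
    halve-split {a , b , c} v with β , refl ← V-even {n} v = split (a>0 v) (c>0 v)
      (ℤ.*-cancelˡ-≡ (ℤ.+ 4) _ n (trans (cong (λ z → ℤ.+ 4 * (z * z + 1ℤ * (a * c))) (half-2* β)) (trans (lemma a β c) (disc v))))
      where
      lemma : ∀ a b c → ℤ.+ 4 * (b * b + 1ℤ * (a * c)) ≡ ℤ.+ 2 * b * (ℤ.+ 2 * b) + ℤ.+ 4 * (a * c)
      lemma = solve-∀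

    split₄⇒V : ∀ {v} → Split 4 n v → V n v
    split₄⇒V (split p q r) = form p q r

    V⇒split₄ : ∀ {v} → V n v → Split 4 n v
    V⇒split₄ (form p q r) = split p q r

  -- b² + ac = n is rewritten as (2b)² + 4ac = 4n; in discriminant 4n the middle coefficient is
  -- automatically even.
  weighted₁ : ∀ n (g ω : ℤ → ℤ) →
    ∑ (antidiagonal n) (λ (i , j) → g (ℤ.+ j) * (φ ! i * lambert 1 ω ! j)) ≡
    ∑ (forms (ℤ.+ 4 * ℤ.+ n)) (λ (a , _ , c) → g (1ℤ * (a * c)) * ω a)
  weighted₁ n = φ⊗lambert 1 n (forms (ℤ.+ 4 * ℤ.+ n)) halve double (halve-split (ℤ.+ n)) (double-split (ℤ.+ n))
    (double-halve (ℤ.+ n)) (λ {v} _ → halve-double (ℤ.+ n) v)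

  weighted₄ : ∀ n (g ω : ℤ → ℤ) →
    ∑ (antidiagonal n) (λ (i , j) → g (ℤ.+ j) * (φ ! i * lambert 4 ω ! j)) ≡
    ∑ (forms (ℤ.+ n)) (λ (a , _ , c) → g (ℤ.+ 4 * (a * c)) * ω a)
  weighted₄ n = φ⊗lambert 4 n (forms (ℤ.+ n)) id id (V⇒split₄ (ℤ.+ n)) (split₄⇒V (ℤ.+ n)) (λ _ → refl) (λ _ → refl)

  private
    unweighted : ∀ n x → (φ ⊗ x) ! n ≡ ∑ (antidiagonal n) (λ (i , j) → 1ℤ * (φ ! i * x ! j))
    unweighted n x = trans (⊗-sum φ x n) (∑-cong (antidiagonal n) (λ {(i , j)} _ → sym (ℤ.*-identityˡ (φ ! i * x ! j))))

  φ⊗lambert₁ : ∀ n ω → (φ ⊗ lambert 1 ω) ! n ≡ ∑ (forms (ℤ.+ 4 * ℤ.+ n)) (ω ∘ proj₁)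
  φ⊗lambert₁ n ω = trans (unweighted n (lambert 1 ω)) (trans (weighted₁ n (λ _ → 1ℤ) ω)
    (∑-cong (forms (ℤ.+ 4 * ℤ.+ n)) (λ {v} _ → ℤ.*-identityˡ (ω (proj₁ v)))))

  φ⊗lambert₄ : ∀ n ω → (φ ⊗ lambert 4 ω) ! n ≡ ∑ (forms (ℤ.+ n)) (ω ∘ proj₁)
  φ⊗lambert₄ n ω = trans (unweighted n (lambert 4 ω)) (trans (weighted₄ n (λ _ → 1ℤ) ω)
    (∑-cong (forms (ℤ.+ n)) (λ {v} _ → ℤ.*-identityˡ (ω (proj₁ v)))))

  weighted-one : ∀ n (g : ℤ → ℤ) →
    ∑ (antidiagonal n) (λ (i , j) → g (ℤ.+ j) * (φ ! i * const 1ℤ ! j)) ≡ g 0ℤ * φ ! n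
  weighted-one n g = begin
    ∑ (antidiagonal n) (λ (i , j) → g (ℤ.+ j) * (φ ! i * const 1ℤ ! j))
      ≡⟨ ∑-cong (antidiagonal n) (λ {(i , j)} _ → at-zero i j) ⟩
    ∑ (antidiagonal n) (λ (i , j) → g 0ℤ * (φ ! i * const 1ℤ ! j))
      ≡⟨ sumL-* (g 0ℤ) (λ (i , j) → φ ! i * const 1ℤ ! j) (elems (antidiagonal n)) ⟩
    g 0ℤ * ∑ (antidiagonal n) (λ (i , j) → φ ! i * const 1ℤ ! j)
      ≡⟨ cong (g 0ℤ *_) (trans (sym (⊗-sum φ (const 1ℤ) n)) (trans (mulF-comm (φ !_) (constF 1ℤ) n)
           (trans (mulF-const 1ℤ (φ !_) n) (ℤ.*-identityˡ (φ ! n))))) ⟩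
    g 0ℤ * φ ! n ∎
    where
    open ≡-Reasoning
    at-zero : ∀ i j → g (ℤ.+ j) * (φ ! i * const 1ℤ ! j) ≡ g 0ℤ * (φ ! i * const 1ℤ ! j)
    at-zero i zero = refl
    at-zero i (suc j) = trans (cong (g (ℤ.+ suc j) *_) (ℤ.*-zeroʳ (φ ! i))) (trans (ℤ.*-zeroʳ (g (ℤ.+ suc j)))
      (sym (trans (cong (g 0ℤ *_) (ℤ.*-zeroʳ (φ ! i))) (ℤ.*-zeroʳ (g 0ℤ)))))

  -- The recurrence D(R)φ = e R D(φ) characterises R = φ^e; coefficientwise it is a sum weighted by (1+e)j − en.
  euler-operator : ∀ e R n → (D R ⊗ φ) ! n - e * (R ⊗ D φ) ! n ≡
    ∑ (antidiagonal n) (λ (i , j) → ((1ℤ + e) * ℤ.+ j - e * ℤ.+ n) * (φ ! i * R ! j))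
  euler-operator e R n = begin
    (D R ⊗ φ) ! n - e * (R ⊗ D φ) ! n
      ≡⟨ cong₂ (λ s t → s - e * t) (trans (mulF-comm (D R !_) (φ !_) n) (⊗-sum φ (D R) n))
           (trans (mulF-comm (R !_) (D φ !_) n) (⊗-sum (D φ) R n)) ⟩
    ∑ A (λ (i , j) → φ ! i * (ℤ.+ j * R ! j)) - e * ∑ A (λ (i , j) → ℤ.+ i * φ ! i * R ! j)
      ≡⟨ cong (∑ A (λ (i , j) → φ ! i * (ℤ.+ j * R ! j)) +_) (trans (ℤ.neg-distribˡ-* e _)
           (sym (sumL-* (- e) (λ (i , j) → ℤ.+ i * φ ! i * R ! j) (elems A)))) ⟩
    ∑ A (λ (i , j) → φ ! i * (ℤ.+ j * R ! j)) + ∑ A (λ (i , j) → - e * (ℤ.+ i * φ ! i * R ! j))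
      ≡⟨ sumL-+ _ _ (elems A) ⟨
    ∑ A (λ (i , j) → φ ! i * (ℤ.+ j * R ! j) + - e * (ℤ.+ i * φ ! i * R ! j))
      ≡⟨ ∑-cong A (λ {(i , j)} i+j≡n → trans (lemma (φ ! i) (ℤ.+ i) (ℤ.+ j) (R ! j) e)
           (cong (λ z → ((1ℤ + e) * ℤ.+ j - e * z) * (φ ! i * R ! j)) (trans (sym (ℤ.pos-+ i j)) (cong ℤ.+_ i+j≡n)))) ⟩
    ∑ A (λ (i , j) → ((1ℤ + e) * ℤ.+ j - e * ℤ.+ n) * (φ ! i * R ! j)) ∎
    where
    open ≡-Reasoning
    A = antidiagonal n
    lemma : ∀ p i j r e → p * (j * r) + - e * (i * p * r) ≡ ((1ℤ + e) * j - e * (i + j)) * (p * r)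
    lemma = solve-∀

  -- The series of Jacobi's formulas r₂(n) = 4 Σ χ₋₄(d) and r₄(n) = 8(σ(n) - 4σ(n/4)). Their
  -- equality with φ² and φ⁴ is deduced from the recurrences in `two-squares` and `four-squares`.
  R₂ R₄ : PS
  R₂ = const 1ℤ ⊕ const (ℤ.+ 4) ⊗ lambert 1 χ
  R₄ = const 1ℤ ⊕ (const (ℤ.+ 8) ⊗ lambert 1 id ⊕ const (- ℤ.+ 32) ⊗ lambert 4 id)

  private
    Cases : (ℕ → Set) → Set
    Cases P = (∀ k → P (k ℕ.* k)) → (∀ n → (∀ k → ℤ.+ n ≢ k * k) → P n) → ∀ n → P n

    by-squares : ∀ {P} → Cases P
    by-squares {P} sq nsq n = go (square? n)
      where
      go : (∃ λ k → n ≡ k ℕ.* k) ⊎ (∀ k → ℤ.+ n ≢ k * k) → P n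
      go (inj₁ (k , refl)) = sq k
      go (inj₂ ns) = nsq n ns

    nφ-square : ∀ k → ℤ.+ (k ℕ.* k) * φ ! (k ℕ.* k) ≡ ℤ.+ 2 * (ℤ.+ k * ℤ.+ k)
    nφ-square zero = refl
    nφ-square (suc k) = trans (cong₂ _*_ (ℤ.pos-* (suc k) (suc k)) (φ-square k)) (ℤ.*-comm (ℤ.+ suc k * ℤ.+ suc k) (ℤ.+ 2))

    nφ-nonsquare : ∀ n → (∀ k → ℤ.+ n ≢ k * k) → ℤ.+ n * φ ! n ≡ 0ℤ
    nφ-nonsquare n ns = trans (cong (ℤ.+ n *_) (φ-nonsquare ns)) (ℤ.*-zeroʳ (ℤ.+ n))

  -- At nonsquare n the coefficient of φ and the sum over forms both vanish. At n = k² the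
  -- contribution -4k² of φ meets the boundary term, which by `χ-square` amounts to 4k².
  euler₂ : ∀ n → (D R₂ ⊗ φ) ! n - ℤ.+ 2 * (R₂ ⊗ D φ) ! n ≡ 0ℤ
  euler₂ n = trans (euler-operator (ℤ.+ 2) R₂ n) (begin
    ∑ A (λ (i , j) → g (ℤ.+ j) * (φ ! i * R₂ ! j))
      ≡⟨ ∑-cong A (λ {(i , j)} _ → trans (cong (λ z → g (ℤ.+ j) * (φ ! i * (const 1ℤ ! j + z))) (mulF-const (ℤ.+ 4) (lambert 1 χ !_) j))
           (lemma (g (ℤ.+ j)) (φ ! i) (const 1ℤ ! j) (lambert 1 χ ! j))) ⟩
    ∑ A (λ (i , j) → g (ℤ.+ j) * (φ ! i * const 1ℤ ! j) + ℤ.+ 4 * (g (ℤ.+ j) * (φ ! i * lambert 1 χ ! j)))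
      ≡⟨ sumL-+ (λ (i , j) → g (ℤ.+ j) * (φ ! i * const 1ℤ ! j)) (λ (i , j) → ℤ.+ 4 * (g (ℤ.+ j) * (φ ! i * lambert 1 χ ! j))) (elems A) ⟩
    ∑ A (λ (i , j) → g (ℤ.+ j) * (φ ! i * const 1ℤ ! j)) + ∑ A (λ (i , j) → ℤ.+ 4 * (g (ℤ.+ j) * (φ ! i * lambert 1 χ ! j)))
      ≡⟨ cong₂ _+_ (weighted-one n g) (trans (sumL-* (ℤ.+ 4) (λ (i , j) → g (ℤ.+ j) * (φ ! i * lambert 1 χ ! j)) (elems A)) (cong (ℤ.+ 4 *_) (weighted₁ n g χ))) ⟩
    g 0ℤ * φ ! n + ℤ.+ 4 * ∑ (forms N) (λ (a , _ , c) → g (1ℤ * (a * c)) * χ a)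
      ≡⟨ lemma₂ (ℤ.+ n) (φ ! n) (∑ (forms N) (λ (a , _ , c) → g (1ℤ * (a * c)) * χ a)) ⟩
    - ℤ.+ 2 * (ℤ.+ n * φ ! n) + ℤ.+ 2 * (ℤ.+ 2 * ∑ (forms N) (λ (a , _ , c) → g (1ℤ * (a * c)) * χ a))
      -- Doubling allows 4n to be replaced by the discriminant b² + 4ac: 2(3ac - 2n) = 6ac - 4n =
      -- -(b² - 2ac).
      ≡⟨ cong (λ z → - ℤ.+ 2 * (ℤ.+ n * φ ! n) + ℤ.+ 2 * z) (trans (sym (sumL-* (ℤ.+ 2) (λ (a , _ , c) → g (1ℤ * (a * c)) * χ a) (elems (forms N))))
           (trans (∑-cong (forms N) (λ {(a , b , c)} v → trans (lemma₃ (ℤ.+ n) a c (χ a)) (trans (cong (λ z → χ a * (ℤ.+ 6 * (a * c) - z)) (sym (disc v))) (lemma₄ (χ a) a b c))))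
             (trans (sumL-* (- 1ℤ) χW (elems (forms N))) (ℤ.-1*i≡-i (∑ (forms N) χW))))) ⟩
    - ℤ.+ 2 * (ℤ.+ n * φ ! n) + ℤ.+ 2 * - ∑ (forms N) χW
      ≡⟨ by-squares {λ n → - ℤ.+ 2 * (ℤ.+ n * φ ! n) + ℤ.+ 2 * - ∑ (forms (ℤ.+ 4 * ℤ.+ n)) χW ≡ 0ℤ}
           (λ k → trans (cong₂ (λ x y → - ℤ.+ 2 * x + ℤ.+ 2 * - y) (nφ-square k)
             (trans (cong (λ z → ∑ (forms (ℤ.+ 4 * z)) χW) (ℤ.pos-* k k)) (χ-square k))) (lemma₅ (ℤ.+ k)))
           (λ n ns → cong₂ (λ x y → - ℤ.+ 2 * x + ℤ.+ 2 * - y) (nφ-nonsquare n ns) (χ-nonsquare (ℤ.+ n) ns)) n ⟩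
    0ℤ ∎)
    where
    open ≡-Reasoning
    A = antidiagonal n
    N = ℤ.+ 4 * ℤ.+ n
    g : ℤ → ℤ
    g j = (1ℤ + ℤ.+ 2) * j - ℤ.+ 2 * ℤ.+ n
    lemma : ∀ g p o l → g * (p * (o + ℤ.+ 4 * l)) ≡ g * (p * o) + ℤ.+ 4 * (g * (p * l))
    lemma = solve-∀
    lemma₂ : ∀ n p x → ((1ℤ + ℤ.+ 2) * 0ℤ - ℤ.+ 2 * n) * p + ℤ.+ 4 * x ≡ - ℤ.+ 2 * (n * p) + ℤ.+ 2 * (ℤ.+ 2 * x)
    lemma₂ = solve-∀
    lemma₃ : ∀ n a c x → ℤ.+ 2 * (((1ℤ + ℤ.+ 2) * (1ℤ * (a * c)) - ℤ.+ 2 * n) * x) ≡ x * (ℤ.+ 6 * (a * c) - ℤ.+ 4 * n)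
    lemma₃ = solve-∀
    lemma₄ : ∀ x a b c → x * (ℤ.+ 6 * (a * c) - (b * b + ℤ.+ 4 * (a * c))) ≡ - 1ℤ * (x * (b * b - ℤ.+ 2 * (a * c)))
    lemma₄ = solve-∀
    lemma₅ : ∀ k → - ℤ.+ 2 * (ℤ.+ 2 * (k * k)) + ℤ.+ 2 * - - (ℤ.+ 2 * (k * k)) ≡ 0ℤ
    lemma₅ = solve-∀

  euler₄ : ∀ n → (D R₄ ⊗ φ) ! n - ℤ.+ 4 * (R₄ ⊗ D φ) ! n ≡ 0ℤ
  euler₄ n = trans (euler-operator (ℤ.+ 4) R₄ n) (begin
    ∑ A (λ (i , j) → g (ℤ.+ j) * (φ ! i * R₄ ! j))
      ≡⟨ ∑-cong A (λ {(i , j)} _ → trans (cong₂ (λ y z → g (ℤ.+ j) * (φ ! i * (const 1ℤ ! j + (y + z))))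
             (mulF-const (ℤ.+ 8) (lambert 1 id !_) j) (mulF-const (- ℤ.+ 32) (lambert 4 id !_) j))
           (lemma (g (ℤ.+ j)) (φ ! i) (const 1ℤ ! j) (lambert 1 id ! j) (lambert 4 id ! j))) ⟩
    ∑ A (λ ij → F₀ ij + (ℤ.+ 8 * F₁ ij + - ℤ.+ 32 * F₄ ij))
      ≡⟨ trans (sumL-+ F₀ (λ ij → ℤ.+ 8 * F₁ ij + - ℤ.+ 32 * F₄ ij) (elems A)) (cong (∑ A F₀ +_)
           (trans (sumL-+ (λ ij → ℤ.+ 8 * F₁ ij) (λ ij → - ℤ.+ 32 * F₄ ij) (elems A))
             (cong₂ _+_ (sumL-* (ℤ.+ 8) F₁ (elems A)) (sumL-* (- ℤ.+ 32) F₄ (elems A))))) ⟩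
    ∑ A F₀ + (ℤ.+ 8 * ∑ A F₁ + - ℤ.+ 32 * ∑ A F₄)
      ≡⟨ cong₂ _+_ (weighted-one n g) (cong₂ (λ x y → ℤ.+ 8 * x + - ℤ.+ 32 * y) sum₁ sum₄) ⟩
    g 0ℤ * φ ! n + (ℤ.+ 8 * - ∑ (forms N) cubicW + - ℤ.+ 32 * (- ℤ.+ 4 * ∑ (forms (ℤ.+ n)) cubicW))
      ≡⟨ by-squares {λ n → ((1ℤ + ℤ.+ 4) * 0ℤ - ℤ.+ 4 * ℤ.+ n) * φ ! n + (ℤ.+ 8 * - ∑ (forms (ℤ.+ 4 * ℤ.+ n)) cubicW + - ℤ.+ 32 * (- ℤ.+ 4 * ∑ (forms (ℤ.+ n)) cubicW)) ≡ 0ℤ}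
           square nonsquare n ⟩
    0ℤ ∎)
    where
    open ≡-Reasoning
    A = antidiagonal n
    N = ℤ.+ 4 * ℤ.+ n
    g : ℤ → ℤ
    g j = (1ℤ + ℤ.+ 4) * j - ℤ.+ 4 * ℤ.+ n
    F₀ F₁ F₄ : ℕ × ℕ → ℤ
    F₀ (i , j) = g (ℤ.+ j) * (φ ! i * const 1ℤ ! j)
    F₁ (i , j) = g (ℤ.+ j) * (φ ! i * lambert 1 id ! j)
    F₄ (i , j) = g (ℤ.+ j) * (φ ! i * lambert 4 id ! j)
    lemma : ∀ g p o x y → g * (p * (o + (ℤ.+ 8 * x + - ℤ.+ 32 * y))) ≡ g * (p * o) + (ℤ.+ 8 * (g * (p * x)) + - ℤ.+ 32 * (g * (p * y)))
    lemma = solve-∀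
    sum₁ : ∑ A F₁ ≡ - ∑ (forms N) cubicW
    sum₁ = trans (weighted₁ n g id) (trans (∑-cong (forms N) (λ {(a , b , c)} v → trans (lemma₃ (ℤ.+ n) a c)
        (trans (cong (λ z → a * (ℤ.+ 5 * (a * c) - z)) (sym (disc v))) (lemma₄ a b c))))
      (trans (sumL-* (- 1ℤ) cubicW (elems (forms N))) (ℤ.-1*i≡-i (∑ (forms N) cubicW))))
      where
      lemma₃ : ∀ n a c → ((1ℤ + ℤ.+ 4) * (1ℤ * (a * c)) - ℤ.+ 4 * n) * a ≡ a * (ℤ.+ 5 * (a * c) - ℤ.+ 4 * n)
      lemma₃ = solve-∀
      lemma₄ : ∀ a b c → a * (ℤ.+ 5 * (a * c) - (b * b + ℤ.+ 4 * (a * c))) ≡ - 1ℤ * (a * (b * b - a * c))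
      lemma₄ = solve-∀
    sum₄ : ∑ A F₄ ≡ - ℤ.+ 4 * ∑ (forms (ℤ.+ n)) cubicW
    sum₄ = trans (weighted₄ n g id) (trans (∑-cong (forms (ℤ.+ n)) (λ {(a , b , c)} v →
        trans (cong (λ z → ((1ℤ + ℤ.+ 4) * (ℤ.+ 4 * (a * c)) - ℤ.+ 4 * z) * a) (sym (disc v))) (lemma₄ a b c)))
      (sumL-* (- ℤ.+ 4) cubicW (elems (forms (ℤ.+ n)))))
      where
      lemma₄ : ∀ a b c → ((1ℤ + ℤ.+ 4) * (ℤ.+ 4 * (a * c)) - ℤ.+ 4 * (b * b + ℤ.+ 4 * (a * c))) * a ≡ - ℤ.+ 4 * (a * (b * b - a * c))
      lemma₄ = solve-∀
    Goal : ℕ → Set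
    Goal n = ((1ℤ + ℤ.+ 4) * 0ℤ - ℤ.+ 4 * ℤ.+ n) * φ ! n + (ℤ.+ 8 * - ∑ (forms (ℤ.+ 4 * ℤ.+ n)) cubicW + - ℤ.+ 32 * (- ℤ.+ 4 * ∑ (forms (ℤ.+ n)) cubicW)) ≡ 0ℤ
    nonsquare : ∀ n → (∀ k → ℤ.+ n ≢ k * k) → Goal n
    nonsquare n ns = trans (cong₂ (λ x y → ((1ℤ + ℤ.+ 4) * 0ℤ - ℤ.+ 4 * ℤ.+ n) * φ ! n + (ℤ.+ 8 * - x + - ℤ.+ 32 * (- ℤ.+ 4 * y)))
        (cubic-nonsquare (ℤ.+ 4 * ℤ.+ n) (nonsquare-4* ns)) (cubic-nonsquare (ℤ.+ n) ns))
      (trans (lemma₅ (ℤ.+ n) (φ ! n)) (trans (cong (- ℤ.+ 4 *_) (nφ-nonsquare n ns)) refl))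
      where
      lemma₅ : ∀ n p → ((1ℤ + ℤ.+ 4) * 0ℤ - ℤ.+ 4 * n) * p + (ℤ.+ 8 * - 0ℤ + - ℤ.+ 32 * (- ℤ.+ 4 * 0ℤ)) ≡ - ℤ.+ 4 * (n * p)
      lemma₅ = solve-∀
    square : ∀ k → Goal (k ℕ.* k)
    -- Multiplication by 12 makes the closed formula of `cubic-square` applicable; the discriminants
    -- are (2k)² for `lambert 1` and k² for `lambert 4`.
    square k = ℤ.*-cancelˡ-≡ (ℤ.+ 12) _ 0ℤ (trans (lemma₆ (ℤ.+ (k ℕ.* k)) (φ ! (k ℕ.* k)) (∑ (forms (ℤ.+ 4 * ℤ.+ (k ℕ.* k))) cubicW) (∑ (forms (ℤ.+ (k ℕ.* k))) cubicW))
      (trans (cong₂ _+_ (cong (- ℤ.+ 48 *_) (nφ-square k)) (cong₂ (λ x y → - ℤ.+ 8 * x + ℤ.+ 128 * y) Y₁ Y₄)) (lemma₇ (ℤ.+ k))))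
      where
      lemma₆ : ∀ n p x y → ℤ.+ 12 * (((1ℤ + ℤ.+ 4) * 0ℤ - ℤ.+ 4 * n) * p + (ℤ.+ 8 * - x + - ℤ.+ 32 * (- ℤ.+ 4 * y)))
        ≡ - ℤ.+ 48 * (n * p) + (- ℤ.+ 8 * (ℤ.+ 12 * x) + ℤ.+ 128 * (ℤ.+ 12 * y))
      lemma₆ = solve-∀
      lemma₇ : ∀ k → - ℤ.+ 48 * (ℤ.+ 2 * (k * k)) + (- ℤ.+ 8 * (ℤ.+ 2 * k * (ℤ.+ 2 * k) - ℤ.+ 2 * k * (ℤ.+ 2 * k) * (ℤ.+ 2 * k * (ℤ.+ 2 * k))) + ℤ.+ 128 * (k * k - k * k * (k * k))) ≡ 0ℤ
      lemma₇ = solve-∀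
      lemma₈ : ∀ k → ℤ.+ 4 * (k * k) ≡ ℤ.+ 2 * k * (ℤ.+ 2 * k)
      lemma₈ = solve-∀
      Y₁ : ℤ.+ 12 * ∑ (forms (ℤ.+ 4 * ℤ.+ (k ℕ.* k))) cubicW ≡ ℤ.+ 2 * ℤ.+ k * (ℤ.+ 2 * ℤ.+ k) - ℤ.+ 2 * ℤ.+ k * (ℤ.+ 2 * ℤ.+ k) * (ℤ.+ 2 * ℤ.+ k * (ℤ.+ 2 * ℤ.+ k))
      Y₁ = trans (cong (λ D → ℤ.+ 12 * ∑ (forms D) cubicW) (trans (cong (ℤ.+ 4 *_) (ℤ.pos-* k k)) (trans (lemma₈ (ℤ.+ k)) (cong₂ _*_ (sym (ℤ.pos-* 2 k)) (sym (ℤ.pos-* 2 k))))))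
        (trans (cubic-square (2 ℕ.* k)) (cong (λ z → z * z - z * z * (z * z)) (ℤ.pos-* 2 k)))
      Y₄ : ℤ.+ 12 * ∑ (forms (ℤ.+ (k ℕ.* k))) cubicW ≡ ℤ.+ k * ℤ.+ k - ℤ.+ k * ℤ.+ k * (ℤ.+ k * ℤ.+ k)
      Y₄ = trans (cong (λ D → ℤ.+ 12 * ∑ (forms D) cubicW) (ℤ.pos-* k k)) (cubic-square k)

-- Divisor sums: doubling, dissection and parity classes

module DivisorSumRelations where
  open FiniteSums
  open PowerSeries
  open SeriesMaps
  open IndefiniteForms
  open RiverIdentities
  open HeckeRelations
  open ThetaAndDivisorSums
  open ThetaRecurrences
  open import Data.Empty using (⊥-elim)
  open import Data.Integer using (ℤ; 0ℤ; 1ℤ; _+_; _*_; -_; _-_; _<_; -[1+_]; +<+)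
  import Data.Integer as ℤ
  import Data.Integer.Properties as ℤ
  open import Data.Integer.Divisibility.Signed using (_∣_; _∣?_; divides; ∣m∣n⇒∣m+n; ∣m∣n⇒∣m-n)
  open import Data.Integer.Tactic.RingSolver using (solve-∀)
  open import Data.List using (List; []; _∷_)
  open import Data.List.Membership.Propositional using (_∈_)
  open import Data.List.Relation.Unary.Any using (here; there)
  open import Data.Nat as ℕ using (ℕ; zero; suc)
  import Data.Nat.DivMod as ℕ
  import Data.Nat.Properties as ℕ
  open import Data.Nat.Primality using (Prime)
  open import Data.Product using (∃; _×_; _,_; proj₁; proj₂)
  open import Data.Sum using (_⊎_; inj₁; inj₂; [_,_]′)
  open import Function using (_∘_; id)
  open import Relation.Binary.PropositionalEquality
    using (_≡_; _≢_; refl; sym; trans; cong; cong₂; subst; module ≡-Reasoning)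
  open import Relation.Nullary using (¬_; Dec)
  open import Relation.Nullary.Decidable using (¬?)
  open Factors

  lambert-expand : ∀ k j .{{nz : ℕ.NonZero k}} .{{_ : ℕ.NonZero j}} .{{_ : ℕ.NonZero (k ℕ.* j)}} ω n →
    lambert (k ℕ.* j) ω ! n ≡ expand k (lambert j ω) ! n
  lambert-expand k j {{nz}} ω n with n ℕ.% k in e
  ... | zero = ∑-same (factorizations (k ℕ.* j) n) (factorizations j (n ℕ./ k)) to from
    where
    n≡ : ℤ.+ n ≡ ℤ.+ k * ℤ.+ (n ℕ./ k)
    n≡ = trans (cong ℤ.+_ (trans (ℕ.m≡m%n+[m/n]*n n k) (trans (cong (ℕ._+ n ℕ./ k ℕ.* k) e) (ℕ.*-comm (n ℕ./ k) k)))) (ℤ.pos-* k (n ℕ./ k))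
    kj : ∀ t → ℤ.+ (k ℕ.* j) * t ≡ ℤ.+ k * (ℤ.+ j * t)
    kj t = trans (cong (_* t) (ℤ.pos-* k j)) (ℤ.*-assoc (ℤ.+ k) (ℤ.+ j) t)
    to : ∀ {ac} → Factors (k ℕ.* j) (ℤ.+ n) ac → Factors j (ℤ.+ (n ℕ./ k)) ac
    to {a , c} (factors p q r) = factors p q (ℤ.*-cancelˡ-≡ (ℤ.+ k) (ℤ.+ j * (a * c)) (ℤ.+ (n ℕ./ k)) {{nz}} (trans (sym (kj (a * c))) (trans r n≡)))
    from : ∀ {ac} → Factors j (ℤ.+ (n ℕ./ k)) ac → Factors (k ℕ.* j) (ℤ.+ n) ac
    from {a , c} (factors p q r) = factors p q (trans (kj (a * c)) (trans (cong (ℤ.+ k *_) r) (sym n≡)))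
  ... | suc r = ∑-zero (factorizations (k ℕ.* j) n) none
    where
    nonneg : ∀ {i} → 0ℤ < i → ℤ.+ ℤ.∣ i ∣ ≡ i
    nonneg {ℤ.+ _} _ = refl
    nonneg { -[1+ _ ]} ()
    none : ∀ {ac} → Factors (k ℕ.* j) (ℤ.+ n) ac → ω (proj₁ ac) ≡ 0ℤ
    none {a , c} (factors p q r′) = ⊥-elim (ℕ.1+n≢0 (trans (sym e) (trans (cong (ℕ._% k) n≡) (ℕ.m*n%n≡0 (j ℕ.* (ℤ.∣ a ∣ ℕ.* ℤ.∣ c ∣)) k))))
      where
      n≡ : n ≡ j ℕ.* (ℤ.∣ a ∣ ℕ.* ℤ.∣ c ∣) ℕ.* k
      n≡ = trans (ℤ.+-injective (trans (sym r′) (trans (cong (ℤ.+ (k ℕ.* j) *_)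
        (trans (cong₂ _*_ (sym (nonneg p)) (sym (nonneg q))) (sym (ℤ.pos-* ℤ.∣ a ∣ ℤ.∣ c ∣)))) (sym (ℤ.pos-* (k ℕ.* j) (ℤ.∣ a ∣ ℕ.* ℤ.∣ c ∣))))))
        (trans (ℕ.*-assoc k j _) (ℕ.*-comm k _))

  0<2* : ∀ {i} → 0ℤ < i → 0ℤ < ℤ.+ 2 * i
  0<2* {ℤ.+ suc i} _ = +<+ (ℕ.s≤s ℕ.z≤n)
  0<2* {ℤ.+ zero} (+<+ ())

  0<2*⁻ : ∀ {i} → 0ℤ < ℤ.+ 2 * i → 0ℤ < i
  0<2*⁻ {ℤ.+ suc i} _ = +<+ (ℕ.s≤s ℕ.z≤n)
  0<2*⁻ {ℤ.+ zero} (+<+ ())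
  0<2*⁻ { -[1+ i ]} ()

  even-half : ∀ i → odd i ≡ 0ℤ → ℤ.+ 2 * half i ≡ i
  even-half i = go (parity i)
    where
    go : (p : ∃ λ k → i ≡ ℤ.+ 2 * k ⊎ i ≡ ℤ.+ 2 * k + 1ℤ) → odd i ≡ 0ℤ → ℤ.+ 2 * proj₁ p ≡ i
    go (k , inj₁ e) _ = sym e
    go (k , inj₂ e) o = ⊥-elim (1≢0 (trans (sym (odd-odd k)) (trans (cong odd (sym e)) o)))
      where
      1≢0 : 1ℤ ≢ 0ℤ
      1≢0 ()

  even-cofactor : ∀ {a c n} → a * c ≡ ℤ.+ 2 * n → odd a ≢ 0ℤ → odd c ≡ 0ℤ
  even-cofactor {a} {c} {n} e o = go (parity a) (parity c)
    where
    lemma : ∀ n j k → ℤ.+ 2 * (n - (ℤ.+ 2 * j * k + j + k)) ≡ ℤ.+ 2 * n - ℤ.+ 2 * (ℤ.+ 2 * j * k + j + k)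
    lemma = solve-∀
    lemma₂ : ∀ j k → (ℤ.+ 2 * j + 1ℤ) * (ℤ.+ 2 * k + 1ℤ) - ℤ.+ 2 * (ℤ.+ 2 * j * k + j + k) ≡ 1ℤ
    lemma₂ = solve-∀
    go : _ → _ → odd c ≡ 0ℤ
    go (j , inj₁ refl) _ = ⊥-elim (o (odd-even j))
    go (j , inj₂ refl) (k , inj₁ refl) = odd-even k
    go (j , inj₂ refl) (k , inj₂ refl) = ⊥-elim (2i≢1 (n - (ℤ.+ 2 * j * k + j + k))
      (trans (lemma n j k) (trans (cong (_- ℤ.+ 2 * (ℤ.+ 2 * j * k + j + k)) (sym e)) (lemma₂ j k))))

  even? : ∀ (ac : ℤ × ℤ) → Dec (odd (proj₁ ac) ≡ 0ℤ)
  even? (a , _) = odd a ℤ.≟ 0ℤ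

  even-factors : ∀ k .{{_ : ℕ.NonZero k}} .{{_ : ℕ.NonZero (2 ℕ.* k)}} n ω →
    ∑ (restrict (factorizations k n) even?) (ω ∘ proj₁) ≡ ∑ (factorizations (2 ℕ.* k) n) (λ ac → ω (ℤ.+ 2 * proj₁ ac))
  even-factors k n ω = ∑-reindex (restrict (factorizations k n) even?) (factorizations (2 ℕ.* k) n)
    (λ (a , c) → half a , c) (λ (a , c) → ℤ.+ 2 * a , c) to∈ from∈
    (λ {(a , c)} (_ , o) → cong (_, c) (even-half a o)) (λ {(a , c)} _ → cong (_, c) (half-2* a))
    (λ {(a , c)} (_ , o) → cong ω (sym (even-half a o)))
    where
    lemma : ∀ k a c → ℤ.+ 2 * k * (a * c) ≡ k * (ℤ.+ 2 * a * c)
    lemma = solve-∀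
    to∈ : ∀ {ac} → Factors k (ℤ.+ n) ac × odd (proj₁ ac) ≡ 0ℤ → Factors (2 ℕ.* k) (ℤ.+ n) (half (proj₁ ac) , proj₂ ac)
    to∈ {a , c} (factors p q r , o) = factors (0<2*⁻ {half a} (subst (0ℤ <_) (sym (even-half a o)) p)) q
      (trans (cong (_* (half a * c)) (ℤ.pos-* 2 k)) (trans (lemma (ℤ.+ k) (half a) c) (trans (cong (λ z → ℤ.+ k * (z * c)) (even-half a o)) r)))
    from∈ : ∀ {ac} → Factors (2 ℕ.* k) (ℤ.+ n) ac → Factors k (ℤ.+ n) (ℤ.+ 2 * proj₁ ac , proj₂ ac) × odd (ℤ.+ 2 * proj₁ ac) ≡ 0ℤ
    from∈ {a , c} (factors p q r) = factors (0<2* p) q (trans (sym (lemma (ℤ.+ k) a c)) (trans (cong (_* (a * c)) (sym (ℤ.pos-* 2 k))) r)) , odd-even a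

  -- In a factorization 2n = ac either a is even, and a/2 is a divisor of n, or a is odd and c must
  -- be even, so that a is an odd divisor of n. The odd divisors are then counted as all divisors
  -- minus the even ones.
  lambert-double : ∀ n ω → lambert 1 ω ! (n ℕ.* 2) ≡
    ∑ (factorizations 1 n) (λ ac → ω (ℤ.+ 2 * proj₁ ac)) + (lambert 1 ω ! n - ∑ (factorizations 2 n) (λ ac → ω (ℤ.+ 2 * proj₁ ac)))
  lambert-double n ω = begin
    ∑ F₂ₙ W
      ≡⟨ ∑-split F₂ₙ even? W ⟩
    ∑ (restrict F₂ₙ even?) W + ∑ (restrict F₂ₙ (¬? ∘ even?)) W
      ≡⟨ cong₂ _+_ (trans (even-factors 1 (n ℕ.* 2) ω) (∑-same (factorizations 2 (n ℕ.* 2)) (factorizations 1 n) halve₂ double₂)) odds ⟩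
    ∑ (factorizations 1 n) W₂ + ∑ (restrict (factorizations 1 n) (¬? ∘ even?)) W
      ≡⟨ cong (∑ (factorizations 1 n) W₂ +_) (trans (lemma (∑ (restrict (factorizations 1 n) even?) W) _)
           (cong₂ _-_ (sym (∑-split (factorizations 1 n) even? W)) (even-factors 1 n ω))) ⟩
    ∑ (factorizations 1 n) W₂ + (lambert 1 ω ! n - ∑ (factorizations 2 n) W₂) ∎
    where
    open ≡-Reasoning
    F₂ₙ = factorizations 1 (n ℕ.* 2)
    W W₂ : ℤ × ℤ → ℤ
    W = ω ∘ proj₁
    W₂ ac = ω (ℤ.+ 2 * proj₁ ac)
    lemma : ∀ i j → j ≡ i + j - i
    lemma = solve-∀
    2n : ℤ.+ (n ℕ.* 2) ≡ ℤ.+ 2 * ℤ.+ n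
    2n = trans (cong ℤ.+_ (ℕ.*-comm n 2)) (ℤ.pos-* 2 n)
    halve₂ : ∀ {ac} → Factors 2 (ℤ.+ (n ℕ.* 2)) ac → Factors 1 (ℤ.+ n) ac
    halve₂ {a , c} (factors p q r) = factors p q (trans (ℤ.*-identityˡ (a * c)) (ℤ.*-cancelˡ-≡ (ℤ.+ 2) (a * c) (ℤ.+ n) (trans r 2n)))
    double₂ : ∀ {ac} → Factors 1 (ℤ.+ n) ac → Factors 2 (ℤ.+ (n ℕ.* 2)) ac
    double₂ {a , c} (factors p q r) = factors p q (trans (cong (ℤ.+ 2 *_) (trans (sym (ℤ.*-identityˡ (a * c))) r)) (sym 2n))
    odds : ∑ (restrict F₂ₙ (¬? ∘ even?)) W ≡ ∑ (restrict (factorizations 1 n) (¬? ∘ even?)) W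
    odds = ∑-reindex (restrict F₂ₙ (¬? ∘ even?)) (restrict (factorizations 1 n) (¬? ∘ even?))
      (λ (a , c) → a , half c) (λ (a , c) → a , ℤ.+ 2 * c) to∈ from∈
      (λ {(a , c)} f → cong (a ,_) (even-half c (cofactor f))) (λ {(a , c)} _ → cong (a ,_) (half-2* c)) (λ _ → refl)
      where
      cofactor : ∀ {ac} → Factors 1 (ℤ.+ (n ℕ.* 2)) ac × odd (proj₁ ac) ≢ 0ℤ → odd (proj₂ ac) ≡ 0ℤ
      cofactor {a , c} (factors _ _ r , o) = even-cofactor {a} {c} {ℤ.+ n} (trans (sym (ℤ.*-identityˡ (a * c))) (trans r 2n)) o
      lemma₁ : ∀ a c → ℤ.+ 2 * (1ℤ * (a * c)) ≡ 1ℤ * (a * (ℤ.+ 2 * c))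
      lemma₁ = solve-∀
      to∈ : ∀ {ac} → Factors 1 (ℤ.+ (n ℕ.* 2)) ac × odd (proj₁ ac) ≢ 0ℤ → Factors 1 (ℤ.+ n) (proj₁ ac , half (proj₂ ac)) × odd (proj₁ ac) ≢ 0ℤ
      to∈ {a , c} f@(factors p q r , o) = factors p (0<2*⁻ {half c} (subst (0ℤ <_) (sym (even-half c (cofactor f))) q))
        (ℤ.*-cancelˡ-≡ (ℤ.+ 2) (1ℤ * (a * half c)) (ℤ.+ n) (trans (lemma₁ a (half c)) (trans (cong (λ z → 1ℤ * (a * z)) (even-half c (cofactor f))) (trans r 2n)))) , o
      from∈ : ∀ {ac} → Factors 1 (ℤ.+ n) ac × odd (proj₁ ac) ≢ 0ℤ → Factors 1 (ℤ.+ (n ℕ.* 2)) (proj₁ ac , ℤ.+ 2 * proj₂ ac) × odd (proj₁ ac) ≢ 0ℤ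
      from∈ {a , c} (factors p q r , o) = factors p (0<2* q) (trans (sym (lemma₁ a c)) (trans (cong (ℤ.+ 2 *_) r) (sym 2n))) , o

  χ-2* : ∀ i → χ (ℤ.+ 2 * i) ≡ 0ℤ
  χ-2* i = go (parity i)
    where
    lemma₀ : ∀ k → ℤ.+ 2 * (ℤ.+ 2 * k) ≡ 0ℤ + ℤ.+ 4 * k
    lemma₀ = solve-∀
    lemma₁ : ∀ k → ℤ.+ 2 * (ℤ.+ 2 * k + 1ℤ) ≡ ℤ.+ 2 + ℤ.+ 4 * k
    lemma₁ = solve-∀
    go : _ → χ (ℤ.+ 2 * i) ≡ 0ℤ
    go (k , inj₁ e) = trans (cong (λ z → χ (ℤ.+ 2 * z)) e) (trans (cong χ (lemma₀ k)) (χ-mod 0ℤ k))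
    go (k , inj₂ e) = trans (cong (λ z → χ (ℤ.+ 2 * z)) e) (trans (cong χ (lemma₁ k)) (χ-mod (ℤ.+ 2) k))

  χ-double : ∀ n → lambert 1 χ ! (n ℕ.* 2) ≡ lambert 1 χ ! n
  χ-double n = trans (lambert-double n χ) (trans (cong₂ (λ x y → x + (lambert 1 χ ! n - y))
    (∑-zero (factorizations 1 n) (λ {ac} _ → χ-2* (proj₁ ac))) (∑-zero (factorizations 2 n) (λ {ac} _ → χ-2* (proj₁ ac)))) (lemma (lambert 1 χ ! n)))
    where
    lemma : ∀ x → 0ℤ + (x - 0ℤ) ≡ x
    lemma = solve-∀

  σ-double : ∀ n → lambert 1 id ! (n ℕ.* 2) ≡ ℤ.+ 3 * lambert 1 id ! n - ℤ.+ 2 * lambert 2 id ! n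
  σ-double n = trans (lambert-double n id) (trans (cong₂ (λ x y → x + (lambert 1 id ! n - y))
    (sumL-* (ℤ.+ 2) proj₁ (elems (factorizations 1 n))) (sumL-* (ℤ.+ 2) proj₁ (elems (factorizations 2 n))))
    (lemma (lambert 1 id ! n) (lambert 2 id ! n)))
    where
    lemma : ∀ x y → ℤ.+ 2 * x + (x - ℤ.+ 2 * y) ≡ ℤ.+ 3 * x - ℤ.+ 2 * y
    lemma = solve-∀

  sumL-∣ : ∀ {A : Set} m (xs : List A) {F : A → ℤ} → (∀ {x} → x ∈ xs → m ∣ F x) → m ∣ sumL xs F
  sumL-∣ m [] d = divides 0ℤ refl
  sumL-∣ m (x ∷ xs) d = ∣m∣n⇒∣m+n (d (here refl)) (sumL-∣ m xs (d ∘ there))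

  module _ (m : ℕ) (m-prime : Prime m) (m≢2 : m ≢ 2) where
    open Cosets m m-prime m≢2 using (euclid; quot; quot-∣; quot-*; 0<L; L≢0; 0<-*; 0<-cancel)
    private
      M = ℤ.+ m

    -- Modulo m only the divisors prime to m count; and when m is prime to k and a, a factorization
    -- k·a·c = mn has its factor m in c.
    σ-dissect : ∀ k .{{_ : ℕ.NonZero k}} → ¬ M ∣ ℤ.+ k → ∀ n → M ∣ lambert k id ! (n ℕ.* m) - lambert k id ! n
    σ-dissect k M∤k n = subst (M ∣_) (sym difference) (∣m∣n⇒∣m-n (divisible (n ℕ.* m)) (divisible n))
      where
      open ≡-Reasoning
      d? : ∀ (ac : ℤ × ℤ) → Dec (M ∣ proj₁ ac)
      d? (a , _) = M ∣? a
      F : ∀ n → Finite (Factors k (ℤ.+ n))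
      F = factorizations k
      divisible : ∀ n → M ∣ ∑ (restrict (F n) d?) proj₁
      divisible n = sumL-∣ M (elems (restrict (F n) d?)) (λ x∈ → proj₂ (sound (restrict (F n) d?) x∈))
      nm : ℤ.+ (n ℕ.* m) ≡ ℤ.+ n * M
      nm = ℤ.pos-* n m
      M∣c : ∀ {ac} → Factors k (ℤ.+ (n ℕ.* m)) ac × ¬ M ∣ proj₁ ac → M ∣ proj₂ ac
      M∣c {a , c} (factors p q r , M∤a) = [ (λ d → ⊥-elim (M∤k d)) , (λ d → [ (λ e → ⊥-elim (M∤a e)) , (λ e → e) ]′ (euclid a c d)) ]′
        (euclid (ℤ.+ k) (a * c) (divides (ℤ.+ n) (trans r nm)))
      lemma : ∀ k a c l → k * (a * c) * l ≡ k * (a * (c * l))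
      lemma = solve-∀
      to∈ : ∀ {ac} → Factors k (ℤ.+ (n ℕ.* m)) ac × ¬ M ∣ proj₁ ac → Factors k (ℤ.+ n) (proj₁ ac , quot M (proj₂ ac)) × ¬ M ∣ proj₁ ac
      to∈ {a , c} f@(factors p q r , M∤a) = factors p (0<-cancel {quot M c} 0<L (subst (0ℤ <_) (quot-∣ (M∣c f)) q))
        (ℤ.*-cancelʳ-≡ (ℤ.+ k * (a * quot M c)) (ℤ.+ n) M (trans (lemma (ℤ.+ k) a (quot M c) M)
          (trans (cong (λ z → ℤ.+ k * (a * z)) (sym (quot-∣ (M∣c f)))) (trans r nm)))) , M∤a
      from∈ : ∀ {ac} → Factors k (ℤ.+ n) ac × ¬ M ∣ proj₁ ac → Factors k (ℤ.+ (n ℕ.* m)) (proj₁ ac , proj₂ ac * M) × ¬ M ∣ proj₁ ac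
      from∈ {a , c} (factors p q r , M∤a) = factors p (0<-* {c} 0<L q) (trans (sym (lemma (ℤ.+ k) a c M)) (trans (cong (_* M) r) (sym nm))) , M∤a
      coprime-part : ∑ (restrict (F (n ℕ.* m)) (¬? ∘ d?)) proj₁ ≡ ∑ (restrict (F n) (¬? ∘ d?)) proj₁
      coprime-part = ∑-reindex (restrict (F (n ℕ.* m)) (¬? ∘ d?)) (restrict (F n) (¬? ∘ d?))
        (λ (a , c) → a , quot M c) (λ (a , c) → a , c * M) to∈ from∈
        (λ {(a , c)} f → cong (a ,_) (sym (quot-∣ (M∣c f)))) (λ {(a , c)} _ → cong (a ,_) (quot-* M c)) (λ _ → refl)
      cancel : ∀ i j k → i + k - (j + k) ≡ i - j
      cancel = solve-∀
      difference : lambert k id ! (n ℕ.* m) - lambert k id ! n ≡ ∑ (restrict (F (n ℕ.* m)) d?) proj₁ - ∑ (restrict (F n) d?) proj₁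
      difference = trans (cong₂ _-_ (trans (∑-split (F (n ℕ.* m)) d? proj₁) (cong (∑ (restrict (F (n ℕ.* m)) d?) proj₁ +_) coprime-part)) (∑-split (F n) d? proj₁))
        (cancel (∑ (restrict (F (n ℕ.* m)) d?) proj₁) (∑ (restrict (F n) d?) proj₁) (∑ (restrict (F n) (¬? ∘ d?)) proj₁))

  -- The fourth power of Jacobi's θ₂, in the guise θ₃⁴ - θ₄⁴. It agrees with the function `c` of the
  -- later parts, while its divisor-sum coefficients give access to sums over forms.
  Θ₂⁴ : PS
  Θ₂⁴ = R₄ ⊕ ⊝ (twist R₄)

  sign-odd : ∀ n → 1ℤ + - sign n ≡ ℤ.+ 2 * odd (ℤ.+ n)
  sign-odd zero = refl
  sign-odd (suc zero) = refl
  sign-odd (suc (suc n)) = trans (cong (λ z → 1ℤ + - z) (ℤ.neg-involutive (sign n))) (sign-odd n)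

  odd-* : ∀ a c → odd (a * c) ≡ odd a * odd c
  odd-* a c = go (parity a) (parity c)
    where
    go : _ → _ → odd (a * c) ≡ odd a * odd c
    go (j , inj₁ refl) _ = trans (cong odd (ℤ.*-assoc (ℤ.+ 2) j c)) (trans (odd-even (j * c)) (sym (trans (cong (_* odd c) (odd-even j)) (ℤ.*-zeroˡ (odd c)))))
    go (j , inj₂ refl) (k , inj₁ refl) = trans (cong odd (lemma j k)) (trans (odd-even ((ℤ.+ 2 * j + 1ℤ) * k)) (sym (trans (cong (odd (ℤ.+ 2 * j + 1ℤ) *_) (odd-even k)) (ℤ.*-zeroʳ (odd (ℤ.+ 2 * j + 1ℤ))))))
      where
      lemma : ∀ j k → (ℤ.+ 2 * j + 1ℤ) * (ℤ.+ 2 * k) ≡ ℤ.+ 2 * ((ℤ.+ 2 * j + 1ℤ) * k)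
      lemma = solve-∀
    go (j , inj₂ refl) (k , inj₂ refl) = trans (cong odd (lemma j k)) (trans (odd-odd (ℤ.+ 2 * j * k + j + k)) (sym (cong₂ _*_ (odd-odd j) (odd-odd k))))
      where
      lemma : ∀ j k → (ℤ.+ 2 * j + 1ℤ) * (ℤ.+ 2 * k + 1ℤ) ≡ ℤ.+ 2 * (ℤ.+ 2 * j * k + j + k) + 1ℤ
      lemma = solve-∀

  Θ₂⁴-coefficient : ∀ n → Θ₂⁴ ! n ≡ ℤ.+ 16 * (odd (ℤ.+ n) * lambert 1 id ! n)
  Θ₂⁴-coefficient n = trans (trans (cong (λ r → r + - (sign n * r)) (cong₂ (λ x y → const 1ℤ ! n + (x + y)) (mulF-const (ℤ.+ 8) (lambert 1 id !_) n) (mulF-const (- ℤ.+ 32) (lambert 4 id !_) n)))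
    (trans (lemma (sign n) (const 1ℤ ! n) (lambert 1 id ! n) (lambert 4 id ! n)) (trans (cong (_* (const 1ℤ ! n + (ℤ.+ 8 * lambert 1 id ! n + - ℤ.+ 32 * lambert 4 id ! n))) (sign-odd n))
      (trans (lemma₂ (odd (ℤ.+ n)) (const 1ℤ ! n) (lambert 1 id ! n) (lambert 4 id ! n))
        (cong₂ (λ x y → ℤ.+ 2 * x + (ℤ.+ 16 * (odd (ℤ.+ n) * lambert 1 id ! n) + - ℤ.+ 64 * y) ) (zero-one n) zero-four))))) (lemma₃ (ℤ.+ 16 * (odd (ℤ.+ n) * lambert 1 id ! n)))
    where
    lemma : ∀ s o x y → o + (ℤ.+ 8 * x + - ℤ.+ 32 * y) + - (s * (o + (ℤ.+ 8 * x + - ℤ.+ 32 * y))) ≡ (1ℤ + - s) * (o + (ℤ.+ 8 * x + - ℤ.+ 32 * y))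
    lemma = solve-∀
    lemma₂ : ∀ t o x y → ℤ.+ 2 * t * (o + (ℤ.+ 8 * x + - ℤ.+ 32 * y)) ≡ ℤ.+ 2 * (t * o) + (ℤ.+ 16 * (t * x) + - ℤ.+ 64 * (t * y))
    lemma₂ = solve-∀
    lemma₃ : ∀ x → ℤ.+ 2 * 0ℤ + (x + - ℤ.+ 64 * 0ℤ) ≡ x
    lemma₃ = solve-∀
    zero-one : ∀ n → odd (ℤ.+ n) * const 1ℤ ! n ≡ 0ℤ
    zero-one zero = refl
    zero-one (suc n) = ℤ.*-zeroʳ (odd (ℤ.+ suc n))
    zero-four : odd (ℤ.+ n) * lambert 4 id ! n ≡ 0ℤ
    zero-four = trans (sym (sumL-* (odd (ℤ.+ n)) proj₁ (elems (factorizations 4 n)))) (∑-zero (factorizations 4 n)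
      (λ {(a , c)} f → trans (cong (_* a) (trans (cong odd (sym (product f))) (trans (cong odd (ℤ.*-assoc (ℤ.+ 2) (ℤ.+ 2) (a * c))) (odd-even (ℤ.+ 2 * (a * c)))))) (ℤ.*-zeroˡ a)))

  module _ (n : ℕ) (nonsquare : ∀ k → ℤ.+ n ≢ k * k) where
    private
      N = ℤ.+ 4 * ℤ.+ n
      O : ℤ
      O = ∑ (forms N) (λ (a , _ , c) → odd a * odd c * a)

      aEven? : ∀ (v : Triple) → Dec (odd (proj₁ v) ≡ 0ℤ)
      aEven? v = odd (proj₁ v) ℤ.≟ 0ℤ
      cEven? : ∀ (v : Triple) → Dec (odd (proj₂ (proj₂ v)) ≡ 0ℤ)
      cEven? v = odd (proj₂ (proj₂ v)) ℤ.≟ 0ℤ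

    φ⊗Θ₂⁴ : (φ ⊗ Θ₂⁴) ! n ≡ ℤ.+ 16 * O
    φ⊗Θ₂⁴ = begin
      (φ ⊗ Θ₂⁴) ! n
        ≡⟨ ⊗-sum φ Θ₂⁴ n ⟩
      ∑ (antidiagonal n) (λ (i , j) → φ ! i * Θ₂⁴ ! j)
        ≡⟨ ∑-cong (antidiagonal n) (λ {(i , j)} _ → trans (cong (φ ! i *_) (Θ₂⁴-coefficient j)) (lemma (φ ! i) (odd (ℤ.+ j)) (lambert 1 id ! j))) ⟩
      ∑ (antidiagonal n) (λ (i , j) → ℤ.+ 16 * odd (ℤ.+ j) * (φ ! i * lambert 1 id ! j))
        ≡⟨ weighted₁ n (λ j → ℤ.+ 16 * odd j) id ⟩
      ∑ (forms N) (λ (a , _ , c) → ℤ.+ 16 * odd (1ℤ * (a * c)) * a)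
        ≡⟨ ∑-cong (forms N) (λ {(a , _ , c)} _ → trans (cong (λ z → ℤ.+ 16 * z * a) (trans (cong odd (ℤ.*-identityˡ (a * c))) (odd-* a c))) (ℤ.*-assoc (ℤ.+ 16) (odd a * odd c) a)) ⟩
      ∑ (forms N) (λ (a , _ , c) → ℤ.+ 16 * (odd a * odd c * a))
        ≡⟨ sumL-* (ℤ.+ 16) (λ (a , _ , c) → odd a * odd c * a) (elems (forms N)) ⟩
      ℤ.+ 16 * O ∎
      where
      open ≡-Reasoning
      lemma : ∀ p o s → p * (ℤ.+ 16 * (o * s)) ≡ ℤ.+ 16 * o * (p * s)
      lemma = solve-∀

    private
      bit : ∀ i → odd i ≡ 0ℤ ⊎ odd i ≡ 1ℤ
      bit i = go (parity i)
        where
        go : _ → odd i ≡ 0ℤ ⊎ odd i ≡ 1ℤ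
        go (k , inj₁ e) = inj₁ (trans (cong odd e) (odd-even k))
        go (k , inj₂ e) = inj₂ (trans (cong odd e) (odd-odd k))

      even-part : ∀ {P : Triple → Set} (S : Finite P) (f : Triple → ℤ) (f? : ∀ v → Dec (odd (f v) ≡ 0ℤ)) (G : Triple → ℤ) →
        ∑ S (λ v → (1ℤ - odd (f v)) * G v) ≡ ∑ (restrict S f?) G
      even-part S f f? G = trans (∑-split S f? _) (trans (cong₂ _+_
        (∑-cong (restrict S f?) (λ {v} (_ , e) → trans (cong (λ z → (1ℤ - z) * G v) e) (ℤ.*-identityˡ (G v))))
        (∑-zero (restrict S (¬? ∘ f?)) (λ {v} (_ , e) → vanish v e (bit (f v))))) (ℤ.+-identityʳ _))
        where
        vanish : ∀ v → odd (f v) ≢ 0ℤ → odd (f v) ≡ 0ℤ ⊎ odd (f v) ≡ 1ℤ → (1ℤ - odd (f v)) * G v ≡ 0ℤ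
        vanish v e (inj₁ z) = ⊥-elim (e z)
        vanish v e (inj₂ o) = trans (cong (λ z → (1ℤ - z) * G v) o) (ℤ.*-zeroˡ (G v))

      first third : Triple → ℤ
      first v = proj₁ v
      third v = proj₂ (proj₂ v)

      -- (a, b, c) ↦ (a/2, b, 2c) keeps the discriminant and halves the weight a.
      atkin-lehner : ∑ (restrict (forms N) aEven?) proj₁ ≡ ℤ.+ 2 * ∑ (restrict (forms N) cEven?) proj₁
      atkin-lehner = trans (∑-reindex (restrict (forms N) aEven?) (restrict (forms N) cEven?)
          (λ (a , b , c) → half a , b , ℤ.+ 2 * c) (λ (a , b , c) → ℤ.+ 2 * a , b , half c) to∈ from∈
          (λ {(a , b , c)} (_ , e) → cong₂ (λ x y → x , b , y) (even-half a e) (half-2* c))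
          (λ {(a , b , c)} (_ , e) → cong₂ (λ x y → x , b , y) (half-2* a) (even-half c e))
          (λ {(a , b , c)} (_ , e) → sym (even-half a e)))
        (sumL-* (ℤ.+ 2) proj₁ (elems (restrict (forms N) cEven?)))
        where
        lemma : ∀ a b c → b * b + ℤ.+ 4 * (a * (ℤ.+ 2 * c)) ≡ b * b + ℤ.+ 4 * (ℤ.+ 2 * a * c)
        lemma = solve-∀
        to∈ : ∀ {v} → V N v × odd (first v) ≡ 0ℤ → V N (half (first v) , proj₁ (proj₂ v) , ℤ.+ 2 * third v) × odd (ℤ.+ 2 * third v) ≡ 0ℤ
        to∈ {a , b , c} (form p q r , e) = form (0<2*⁻ {half a} (subst (0ℤ <_) (sym (even-half a e)) p)) (0<2* q)
          (trans (lemma (half a) b c) (trans (cong (λ z → b * b + ℤ.+ 4 * (z * c)) (even-half a e)) r)) , odd-even c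
        from∈ : ∀ {v} → V N v × odd (third v) ≡ 0ℤ → V N (ℤ.+ 2 * first v , proj₁ (proj₂ v) , half (third v)) × odd (ℤ.+ 2 * first v) ≡ 0ℤ
        from∈ {a , b , c} (form p q r , e) = form (0<2* p) (0<2*⁻ {half c} (subst (0ℤ <_) (sym (even-half c e)) q))
          (trans (sym (lemma a b (half c))) (trans (cong (λ z → b * b + ℤ.+ 4 * (a * z)) (even-half c e)) r)) , odd-even a

      both-even : ∑ (restrict (restrict (forms N) aEven?) cEven?) proj₁ ≡ ℤ.+ 2 * Z₁ (ℤ.+ n)
      both-even = trans (∑-reindex (restrict (restrict (forms N) aEven?) cEven?) (forms (ℤ.+ n))
          (λ (a , b , c) → half a , half b , half c) (λ (a , b , c) → ℤ.+ 2 * a , ℤ.+ 2 * b , ℤ.+ 2 * c) to∈ from∈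
          (λ {(a , b , c)} ((v , e) , e′) → cong₂ _,_ (even-half a e) (cong₂ _,_ (b-even v) (even-half c e′)))
          (λ {(a , b , c)} _ → cong₂ _,_ (half-2* a) (cong₂ _,_ (half-2* b) (half-2* c)))
          (λ {(a , b , c)} ((_ , e) , _) → sym (even-half a e)))
        (sumL-* (ℤ.+ 2) proj₁ (elems (forms (ℤ.+ n))))
        where
        b-even : ∀ {v} → V N v → ℤ.+ 2 * half (proj₁ (proj₂ v)) ≡ proj₁ (proj₂ v)
        b-even {a , b , c} v with β , refl ← V-even {ℤ.+ n} v = cong (ℤ.+ 2 *_) (half-2* β)
        lemma : ∀ a b c → ℤ.+ 4 * (b * b + ℤ.+ 4 * (a * c)) ≡ ℤ.+ 2 * b * (ℤ.+ 2 * b) + ℤ.+ 4 * (ℤ.+ 2 * a * (ℤ.+ 2 * c))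
        lemma = solve-∀
        to∈ : ∀ {v} → (V N v × odd (first v) ≡ 0ℤ) × odd (third v) ≡ 0ℤ → V (ℤ.+ n) (half (first v) , half (proj₁ (proj₂ v)) , half (third v))
        to∈ {a , b , c} ((v@(form p q r) , e) , e′) = form (0<2*⁻ {half a} (subst (0ℤ <_) (sym (even-half a e)) p))
          (0<2*⁻ {half c} (subst (0ℤ <_) (sym (even-half c e′)) q))
          (ℤ.*-cancelˡ-≡ (ℤ.+ 4) (half b * half b + ℤ.+ 4 * (half a * half c)) (ℤ.+ n) (trans (lemma (half a) (half b) (half c))
            (trans (cong₂ (λ x y → x * x + ℤ.+ 4 * y) (b-even v) (cong₂ _*_ (even-half a e) (even-half c e′))) r)))
        from∈ : ∀ {v} → V (ℤ.+ n) v →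
          (V N (ℤ.+ 2 * first v , ℤ.+ 2 * proj₁ (proj₂ v) , ℤ.+ 2 * third v) × odd (ℤ.+ 2 * first v) ≡ 0ℤ) × odd (ℤ.+ 2 * third v) ≡ 0ℤ
        from∈ {a , b , c} (form p q r) = (form (0<2* p) (0<2* q) (trans (sym (lemma a b c)) (cong (ℤ.+ 4 *_) r)) , odd-even a) , odd-even c

    -- Let A, C, E, O be the totals of a over the forms of discriminant 4n with a even, c even, both
    -- even, both odd. Then A = 2C by `atkin-lehner`, E = 2 Z₁(n) by `both-even`, C + 2O = Z₁(4n) by
    -- `parity-sum`, and E + Z₁(4n) = A + C + O by inclusion and exclusion. Elimination gives 5O =
    -- 2(Z₁(4n) - Z₁(n)), which explains the factor 5.
    φ⊗Θ₂⁴-Z₁ : ℤ.+ 5 * (φ ⊗ Θ₂⁴) ! n ≡ ℤ.+ 32 * (Z₁ (ℤ.+ 4 * ℤ.+ n) - Z₁ (ℤ.+ n))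
    φ⊗Θ₂⁴-Z₁ = trans (cong (ℤ.+ 5 *_) φ⊗Θ₂⁴) (lemma O (∑ (restrict (forms N) aEven?) proj₁) (∑ (restrict (forms N) cEven?) proj₁)
        (∑ (restrict (restrict (forms N) aEven?) cEven?) proj₁) (Z₁ N) (Z₁ (ℤ.+ n)) atkin-lehner both-even relation₁ relation₂)
      where
      xs = elems (forms N)
      w₁ w₂ : Triple → ℤ
      w₁ (a , b , c) = odd a * odd c * a
      w₂ (a , b , c) = (1ℤ - odd c) * a
      relation₁ : ∑ (restrict (forms N) cEven?) proj₁ + ℤ.+ 2 * O ≡ Z₁ N
      relation₁ = trans (cong₂ _+_ (sym (even-part (forms N) third cEven? proj₁)) (sym (sumL-* (ℤ.+ 2) w₁ xs)))
        (trans (sym (sumL-+ w₂ (λ v → ℤ.+ 2 * w₁ v) xs)) (trans (∑-cong (forms N) (λ {(a , b , c)} _ → lemma₁ (odd a) (odd c) a))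
          (trans (sumL-+ proj₁ (λ v → - 1ℤ * parityW v) xs) (trans (cong (Z₁ N +_) (trans (sumL-* (- 1ℤ) parityW xs)
            (cong (- 1ℤ *_) (parity-sum (ℤ.+ n) nonsquare)))) (ℤ.+-identityʳ (Z₁ N))))))
        where
        lemma₁ : ∀ x y a → (1ℤ - y) * a + ℤ.+ 2 * (x * y * a) ≡ a + - 1ℤ * (y * (1ℤ - ℤ.+ 2 * x) * a)
        lemma₁ = solve-∀
      relation₂ : ∑ (restrict (restrict (forms N) aEven?) cEven?) proj₁ + Z₁ N ≡
        ∑ (restrict (forms N) aEven?) proj₁ + (∑ (restrict (forms N) cEven?) proj₁ + O)
      relation₂ = trans (cong (_+ Z₁ N) (trans (sym (even-part (restrict (forms N) aEven?) third cEven? proj₁)) (sym (even-part (forms N) first aEven? w₂))))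
        (trans (sym (sumL-+ (λ v → (1ℤ - odd (first v)) * w₂ v) proj₁ xs)) (trans (∑-cong (forms N) (λ {(a , b , c)} _ → lemma₂ (odd a) (odd c) a))
          (trans (sumL-+ (λ v → (1ℤ - odd (first v)) * first v) (λ v → w₂ v + w₁ v) xs) (cong₂ _+_ (even-part (forms N) first aEven? proj₁)
            (trans (sumL-+ w₂ w₁ xs) (cong (_+ O) (even-part (forms N) third cEven? proj₁)))))))
        where
        lemma₂ : ∀ x y a → (1ℤ - x) * ((1ℤ - y) * a) + a ≡ (1ℤ - x) * a + ((1ℤ - y) * a + x * y * a)
        lemma₂ = solve-∀
      lemma : ∀ o a c e z z′ → a ≡ ℤ.+ 2 * c → e ≡ ℤ.+ 2 * z′ → c + ℤ.+ 2 * o ≡ z → e + z ≡ a + (c + o) →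
        ℤ.+ 5 * (ℤ.+ 16 * o) ≡ ℤ.+ 32 * (z - z′)
      lemma o a c e z z′ refl refl refl r₂ = ℤ.i-j≡0⇒i≡j (ℤ.+ 5 * (ℤ.+ 16 * o)) (ℤ.+ 32 * (c + ℤ.+ 2 * o - z′))
        (trans (lemma₃ o c z′) (trans (cong (λ t → ℤ.+ 16 * (t - (ℤ.+ 2 * c + (c + o)))) r₂) (lemma₄ (ℤ.+ 2 * c + (c + o)))))
        where
        lemma₃ : ∀ o c z → ℤ.+ 5 * (ℤ.+ 16 * o) - ℤ.+ 32 * (c + ℤ.+ 2 * o - z) ≡ ℤ.+ 16 * (ℤ.+ 2 * z + (c + ℤ.+ 2 * o) - (ℤ.+ 2 * c + (c + o)))
        lemma₃ = solve-∀
        lemma₄ : ∀ t → ℤ.+ 16 * (t - t) ≡ 0ℤ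
        lemma₄ = solve-∀

-- Liouville's method for the convolution of divisor sums

module DivisorSumConvolution where
  open FiniteSums
  open PowerSeries
  open IndefiniteForms using (integers; ∈-integers)
  open HeckeRelations using (cube)
  open ThetaAndDivisorSums
  open Factors
  open import Data.Empty using (⊥-elim)
  open import Data.Integer using (ℤ; 0ℤ; 1ℤ; _+_; _*_; -_; _-_; _<_; -[1+_]; +<+)
  import Data.Integer as ℤ
  import Data.Integer.Properties as ℤ
  open import Data.Integer.Tactic.RingSolver using (solve-∀)
  open import Data.List using (List; downFrom; cartesianProduct)
  open import Data.List.Membership.Propositional.Properties using (∈-downFrom⁺; ∈-downFrom⁻; ∈-cartesianProduct⁺)
  import Data.List.Relation.Unary.Unique.Propositional.Properties as Unique
  open import Data.Nat as ℕ using (ℕ; zero; suc)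
  import Data.Nat.Properties as ℕ
  open import Data.Product using (_×_; _,_; proj₁; proj₂)
  open import Data.Product.Properties using (≡-dec)
  open import Function using (_∘_; id)
  open import Relation.Binary.Definitions using (tri<; tri≈; tri>)
  open import Relation.Binary.PropositionalEquality
    using (_≡_; _≢_; refl; sym; trans; cong; cong₂; subst; module ≡-Reasoning)
  open import Relation.Nullary using (¬_)
  open import Relation.Nullary.Decidable using (_×-dec_; ¬?; map′)

  Quadruple : Set
  Quadruple = (ℤ × ℤ) × (ℤ × ℤ)

  record Sum (n : ℕ) (q : Quadruple) : Set where
    constructor sum
    field
      a>0 : 0ℤ < proj₁ (proj₁ q)
      x>0 : 0ℤ < proj₂ (proj₁ q)
      b>0 : 0ℤ < proj₁ (proj₂ q)
      y>0 : 0ℤ < proj₂ (proj₂ q)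
      ax+by : proj₁ (proj₁ q) * proj₂ (proj₁ q) + proj₁ (proj₂ q) * proj₂ (proj₂ q) ≡ ℤ.+ n
  open Sum

  private
    nonneg : ∀ {i} → 0ℤ < i → ℤ.+ ℤ.∣ i ∣ ≡ i
    nonneg {ℤ.+ _} _ = refl
    nonneg { -[1+ _ ]} ()

    <-+ : ∀ {i j} → 0ℤ < i → 0ℤ < j → 0ℤ < i + j
    <-+ p q = ℤ.+-mono-< p q

    -‿> : ∀ {i j} → i < j → 0ℤ < j - i
    -‿> {i} {j} p = subst (_< j - i) (ℤ.+-inverseʳ i) (ℤ.+-monoˡ-< (- i) p)

    >‿- : ∀ {i j} → 0ℤ < j - i → i < j
    >‿- {i} {j} p = ℤ.≰⇒> (λ j≤i → ℤ.<⇒≱ p (ℤ.i≤j⇒i-j≤0 j≤i))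

    abs-sum : ∀ {n a x b y} → Sum n ((a , x) , (b , y)) → ℤ.∣ a ∣ ℕ.* ℤ.∣ x ∣ ℕ.+ ℤ.∣ b ∣ ℕ.* ℤ.∣ y ∣ ≡ n
    abs-sum {n} {a} {x} {b} {y} (sum p q r s e) = ℤ.+-injective (trans (ℤ.pos-+ (ℤ.∣ a ∣ ℕ.* ℤ.∣ x ∣) _)
      (trans (cong₂ _+_ (trans (ℤ.pos-* ℤ.∣ a ∣ ℤ.∣ x ∣) (cong₂ _*_ (nonneg p) (nonneg q)))
                        (trans (ℤ.pos-* ℤ.∣ b ∣ ℤ.∣ y ∣) (cong₂ _*_ (nonneg r) (nonneg s)))) e))

    ∣∣>0 : ∀ {i} → 0ℤ < i → ℕ.NonZero ℤ.∣ i ∣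
    ∣∣>0 {ℤ.+ suc _} _ = _
    ∣∣>0 {ℤ.+ zero} (+<+ ())

  sums : ∀ n → Finite (Sum n)
  sums n = fromList (≡-dec (≡-dec ℤ._≟_ ℤ._≟_) (≡-dec ℤ._≟_ ℤ._≟_)) (cartesianProduct box box)
    (λ ((a , x) , (b , y)) → map′ (λ (p , q , r , s , e) → sum p q r s e) (λ f → a>0 f , x>0 f , b>0 f , y>0 f , ax+by f)
      ((0ℤ ℤ.<? a) ×-dec (0ℤ ℤ.<? x) ×-dec (0ℤ ℤ.<? b) ×-dec (0ℤ ℤ.<? y) ×-dec (a * x + b * y ℤ.≟ ℤ.+ n)))
    (λ {q} f → let p₁ , p₂ , p₃ , p₄ = bounds f in
      ∈-cartesianProduct⁺ (∈-cartesianProduct⁺ (∈-integers (proj₁ (proj₁ q)) p₁) (∈-integers (proj₂ (proj₁ q)) p₂))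
                          (∈-cartesianProduct⁺ (∈-integers (proj₁ (proj₂ q)) p₃) (∈-integers (proj₂ (proj₂ q)) p₄)))
    where
    box = cartesianProduct (integers n) (integers n)
    bounds : ∀ {q} → Sum n q → ℤ.∣ proj₁ (proj₁ q) ∣ ℕ.≤ n × ℤ.∣ proj₂ (proj₁ q) ∣ ℕ.≤ n × ℤ.∣ proj₁ (proj₂ q) ∣ ℕ.≤ n × ℤ.∣ proj₂ (proj₂ q) ∣ ℕ.≤ n
    bounds {(a , x) , (b , y)} f@(sum p q r s e) =
        le (ℕ.≤-trans (ℕ.m≤m*n ℤ.∣ a ∣ ℤ.∣ x ∣ {{∣∣>0 q}}) (ℕ.m≤m+n (ℤ.∣ a ∣ ℕ.* ℤ.∣ x ∣) _))
      , le (ℕ.≤-trans (ℕ.m≤n*m ℤ.∣ x ∣ ℤ.∣ a ∣ {{∣∣>0 p}}) (ℕ.m≤m+n (ℤ.∣ a ∣ ℕ.* ℤ.∣ x ∣) _))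
      , le (ℕ.≤-trans (ℕ.m≤m*n ℤ.∣ b ∣ ℤ.∣ y ∣ {{∣∣>0 s}}) (ℕ.m≤n+m (ℤ.∣ b ∣ ℕ.* ℤ.∣ y ∣) _))
      , le (ℕ.≤-trans (ℕ.m≤n*m ℤ.∣ y ∣ ℤ.∣ b ∣ {{∣∣>0 r}}) (ℕ.m≤n+m (ℤ.∣ b ∣ ℕ.* ℤ.∣ y ∣) _))
      where
      le : ∀ {k} → k ℕ.≤ ℤ.∣ a ∣ ℕ.* ℤ.∣ x ∣ ℕ.+ ℤ.∣ b ∣ ℕ.* ℤ.∣ y ∣ → k ℕ.≤ n
      le = subst (_ ℕ.≤_) (abs-sum f)

  σ : PS
  σ = lambert 1 id

  σ⊗σ : ∀ n → (σ ⊗ σ) ! n ≡ ∑ (sums n) (λ ((a , _) , (b , _)) → a * b)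
  σ⊗σ n = begin
    (σ ⊗ σ) ! n
      ≡⟨ ⊗-sum σ σ n ⟩
    ∑ (antidiagonal n) (λ (i , j) → σ ! i * σ ! j)
      ≡⟨ ∑-cong (antidiagonal n) (λ {(i , j)} _ → inner i j) ⟩
    ∑ (antidiagonal n) (λ (i , j) → ∑ (fibre (i , j)) (λ ((a , _) , (b , _)) → a * b))
      ≡⟨ ∑-sigma fibre (antidiagonal n) (λ (_ , (a , _) , (b , _)) → a * b) ⟨
    ∑ (sigma fibre (antidiagonal n)) (λ (_ , (a , _) , (b , _)) → a * b)
      ≡⟨ ∑-reindex (sigma fibre (antidiagonal n)) (sums n) proj₂ rebuild to∈ from∈ from-to (λ _ → refl) (λ _ → refl) ⟩
    ∑ (sums n) (λ ((a , _) , (b , _)) → a * b) ∎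
    where
    open ≡-Reasoning
    fibre : ∀ (ij : ℕ × ℕ) → Finite (λ (q : Quadruple) → Factors 1 (ℤ.+ proj₁ ij) (proj₁ q) × Factors 1 (ℤ.+ proj₂ ij) (proj₂ q))
    fibre (i , j) = sigma (λ _ → factorizations 1 j) (factorizations 1 i)
    inner : ∀ i j → σ ! i * σ ! j ≡ ∑ (fibre (i , j)) (λ ((a , _) , (b , _)) → a * b)
    inner i j = sym (begin
      ∑ (fibre (i , j)) (λ ((a , _) , (b , _)) → a * b)
        ≡⟨ ∑-sigma (λ _ → factorizations 1 j) (factorizations 1 i) (λ ((a , _) , (b , _)) → a * b) ⟩
      ∑ (factorizations 1 i) (λ (a , _) → ∑ (factorizations 1 j) (λ (b , _) → a * b))
        ≡⟨ ∑-cong (factorizations 1 i) (λ {(a , _)} _ → trans (sumL-* a proj₁ (elems (factorizations 1 j))) (ℤ.*-comm a (σ ! j))) ⟩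
      ∑ (factorizations 1 i) (λ (a , _) → σ ! j * a)
        ≡⟨ sumL-* (σ ! j) proj₁ (elems (factorizations 1 i)) ⟩
      σ ! j * σ ! i
        ≡⟨ ℤ.*-comm (σ ! j) (σ ! i) ⟩
      σ ! i * σ ! j ∎)
    rebuild : Quadruple → (ℕ × ℕ) × Quadruple
    rebuild q@((a , x) , (b , y)) = (ℤ.∣ a ∣ ℕ.* ℤ.∣ x ∣ , ℤ.∣ b ∣ ℕ.* ℤ.∣ y ∣) , q
    P : (ℕ × ℕ) × Quadruple → Set
    P z = proj₁ (proj₁ z) ℕ.+ proj₂ (proj₁ z) ≡ n × (Factors 1 (ℤ.+ proj₁ (proj₁ z)) (proj₁ (proj₂ z)) × Factors 1 (ℤ.+ proj₂ (proj₁ z)) (proj₂ (proj₂ z)))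
    to∈ : ∀ {z} → P z → Sum n (proj₂ z)
    to∈ {(i , j) , (a , x) , (b , y)} (e , factors p q r , factors p′ q′ r′) = sum p q p′ q′
      (trans (cong₂ _+_ (trans (sym (ℤ.*-identityˡ (a * x))) r) (trans (sym (ℤ.*-identityˡ (b * y))) r′)) (trans (sym (ℤ.pos-+ i j)) (cong ℤ.+_ e)))
    prod : ∀ {a x} → 0ℤ < a → 0ℤ < x → 1ℤ * (a * x) ≡ ℤ.+ (ℤ.∣ a ∣ ℕ.* ℤ.∣ x ∣)
    prod {a} {x} p q = trans (ℤ.*-identityˡ (a * x)) (trans (cong₂ _*_ (sym (nonneg p)) (sym (nonneg q))) (sym (ℤ.pos-* ℤ.∣ a ∣ ℤ.∣ x ∣)))
    from∈ : ∀ {q} → Sum n q → P (rebuild q)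
    from∈ {(a , x) , (b , y)} f@(sum p q r s e) = abs-sum f , factors p q (prod p q) , factors r s (prod r s)
    from-to : ∀ {z} → P z → rebuild (proj₂ z) ≡ z
    from-to {(i , j) , (a , x) , (b , y)} (_ , factors p q r , factors p′ q′ r′) = cong₂ (λ s t → (s , t) , (a , x) , (b , y))
      (ℤ.+-injective (trans (sym (prod p q)) r)) (ℤ.+-injective (trans (sym (prod p′ q′)) r′))

  module _ (n : ℕ) where
    private
      S = sums n

    module Compare (u v : Quadruple → ℤ) where
      less = restrict S (λ q → u q ℤ.<? v q)
      rest = restrict S (λ q → ¬? (u q ℤ.<? v q))
      equal = restrict rest (λ q → u q ℤ.≟ v q)
      greater = restrict S (λ q → v q ℤ.<? u q)

      compare : ∀ F → ∑ S F ≡ ∑ less F + (∑ equal F + ∑ greater F)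
      compare F = trans (∑-split S (λ q → u q ℤ.<? v q) F) (cong (∑ less F +_)
        (trans (∑-split rest (λ q → u q ℤ.≟ v q) F) (cong (∑ equal F +_) (∑-same (restrict rest (λ q → ¬? (u q ℤ.≟ v q))) greater to from))))
        where
        to : ∀ {q} → (Sum n q × ¬ u q < v q) × u q ≢ v q → Sum n q × v q < u q
        to {q} ((s , p) , e) = s , gt (ℤ.<-cmp (u q) (v q))
          where
          gt : _ → v q < u q
          gt (tri< l _ _) = ⊥-elim (p l)
          gt (tri≈ _ m _) = ⊥-elim (e m)
          gt (tri> _ _ g) = g
        from : ∀ {q} → Sum n q × v q < u q → (Sum n q × ¬ u q < v q) × u q ≢ v q
        from (s , g) = (s , λ l → ℤ.<-asym l g) , λ e → ℤ.<-irrefl (sym e) g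

    A X B Y : Quadruple → ℤ
    A ((a , _) , _) = a
    X ((_ , x) , _) = x
    B (_ , (b , _)) = b
    Y (_ , (_ , y)) = y

    module AB = Compare A B
    module XY = Compare X Y

    swap : Quadruple → Quadruple
    swap (p , q) = q , p

    Sum-swap : ∀ {q} → Sum n q → Sum n (swap q)
    Sum-swap {(a , x) , (b , y)} (sum p q r s e) = sum r s p q (trans (ℤ.+-comm (b * y) (a * x)) e)

    ∑-AB-swap : ∀ F → (∀ q → F (swap q) ≡ F q) → ∑ AB.less F ≡ ∑ AB.greater F
    ∑-AB-swap F sym-F = ∑-reindex AB.less AB.greater swap swap (λ (s , l) → Sum-swap s , l) (λ (s , l) → Sum-swap s , l)
      (λ _ → refl) (λ _ → refl) (λ {q} _ → sym (sym-F q))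

    ∑-XY-swap : ∀ F → (∀ q → F (swap q) ≡ F q) → ∑ XY.greater F ≡ ∑ XY.less F
    ∑-XY-swap F sym-F = ∑-reindex XY.greater XY.less swap swap (λ (s , l) → Sum-swap s , l) (λ (s , l) → Sum-swap s , l)
      (λ _ → refl) (λ _ → refl) (λ {q} _ → sym (sym-F q))

    -- ax + by = (a+b)x + b(y−x)
    shear : ∀ F → ∑ XY.less F ≡ ∑ AB.greater (λ ((a , x) , (b , y)) → F ((a - b , x) , (b , x + y)))
    shear F = ∑-reindex XY.less AB.greater to from to∈ from∈
      (λ {((a , x) , (b , y))} _ → cong₂ (λ s t → (s , x) , (b , t)) (lemma₁ a b) (lemma₂ x y))
      (λ {((a , x) , (b , y))} _ → cong₂ (λ s t → (s , x) , (b , t)) (lemma₃ a b) (lemma₄ x y))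
      (λ {((a , x) , (b , y))} _ → cong F (cong₂ (λ s t → (s , x) , (b , t)) (sym (lemma₁ a b)) (sym (lemma₂ x y))))
      where
      lemma₁ : ∀ a b → a + b - b ≡ a
      lemma₁ = solve-∀
      lemma₂ : ∀ x y → x + (y - x) ≡ y
      lemma₂ = solve-∀
      lemma₃ : ∀ a b → a - b + b ≡ a
      lemma₃ = solve-∀
      lemma₄ : ∀ x y → x + y - x ≡ y
      lemma₄ = solve-∀
      lemma₅ : ∀ a x b y → (a + b) * x + b * (y - x) ≡ a * x + b * y
      lemma₅ = solve-∀
      lemma₆ : ∀ a x b y → (a - b) * x + b * (x + y) ≡ a * x + b * y
      lemma₆ = solve-∀
      to from : Quadruple → Quadruple
      to ((a , x) , (b , y)) = (a + b , x) , (b , y - x)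
      from ((a , x) , (b , y)) = (a - b , x) , (b , x + y)
      to∈ : ∀ {q} → Sum n q × X q < Y q → Sum n (to q) × B (to q) < A (to q)
      to∈ {(a , x) , (b , y)} (sum p q r s e , l) = sum (<-+ p r) q r (-‿> l) (trans (lemma₅ a x b y) e)
        , >‿- (subst (0ℤ <_) (sym (lemma₁ a b)) p)
      from∈ : ∀ {q} → Sum n q × B q < A q → Sum n (from q) × X (from q) < Y (from q)
      from∈ {(a , x) , (b , y)} (sum p q r s e , l) = sum (-‿> l) q r (<-+ q s) (trans (lemma₆ a x b y) e)
        , >‿- (subst (0ℤ <_) (sym (lemma₄ x y)) s)

    pair-product norm square₁ : Quadruple → ℤ
    pair-product ((a , _) , (b , _)) = a * b
    norm ((a , _) , (b , _)) = a * a + a * b + b * b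
    square₁ ((a , _) , _) = a * a

    -- The total of a² + ab + b² over ax + by = n is computed twice, by comparing a with b and by
    -- comparing x with y. Swapping the two products equates the strict parts of each comparison,
    -- and `shear` carries one comparison into the other. The norm form suits this purpose because
    -- it is symmetric and changes by just -2ab when a is replaced by a - b.
    ∑-product : ℤ.+ 2 * ∑ S pair-product ≡ ∑ XY.equal norm - ∑ AB.equal square₁
    ∑-product = lemma (∑ S pair-product) (∑ AB.greater pair-product) (∑ AB.equal square₁) (∑ XY.equal norm) (∑ AB.greater norm) (∑ XY.less norm) (∑ S norm)
      (trans (AB.compare pair-product) (cong₂ _+_ (∑-AB-swap pair-product (λ ((a , _) , (b , _)) → ℤ.*-comm b a))
        (cong (_+ ∑ AB.greater pair-product) (∑-cong AB.equal (λ {((a , _) , (b , _))} (_ , e) → cong (a *_) (sym e))))))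
      (trans (AB.compare norm) (cong₂ _+_ (∑-AB-swap norm (λ ((a , _) , (b , _)) → norm-sym b a))
        (cong (_+ ∑ AB.greater norm) (trans (∑-cong AB.equal (λ {((a , _) , (b , _))} (_ , e) → trans (cong (λ z → a * a + a * z + z * z) (sym e)) (norm-diag a)))
          (sumL-* (ℤ.+ 3) square₁ (elems AB.equal))))))
      (trans (XY.compare norm) (cong (λ z → ∑ XY.less norm + (∑ XY.equal norm + z)) (∑-XY-swap norm (λ ((a , _) , (b , _)) → norm-sym b a))))
      (trans (shear norm) (trans (∑-cong AB.greater (λ {((a , _) , (b , _))} _ → norm-shear a b))
        (trans (sumL-+ norm (λ q → - ℤ.+ 2 * pair-product q) (elems AB.greater)) (cong (∑ AB.greater norm +_) (sumL-* (- ℤ.+ 2) pair-product (elems AB.greater))))))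
      where
      norm-sym : ∀ a b → a * a + a * b + b * b ≡ b * b + b * a + a * a
      norm-sym = solve-∀
      norm-diag : ∀ a → a * a + a * a + a * a ≡ ℤ.+ 3 * (a * a)
      norm-diag = solve-∀
      norm-shear : ∀ a b → (a - b) * (a - b) + (a - b) * b + b * b ≡ a * a + a * b + b * b + - ℤ.+ 2 * (a * b)
      norm-shear = solve-∀
      lemma : ∀ s g d e N l T → s ≡ g + (d + g) → T ≡ N + (ℤ.+ 3 * d + N) → T ≡ l + (e + l) → l ≡ N + - ℤ.+ 2 * g → ℤ.+ 2 * s ≡ e - d
      lemma s g d e N l T refl refl e₂ refl = ℤ.i-j≡0⇒i≡j (ℤ.+ 2 * (g + (d + g))) (e - d) (trans (lemma₁ g d e N) (trans (cong (λ z → N + (ℤ.+ 3 * d + N) - z) (sym e₂)) (ℤ.+-inverseʳ (N + (ℤ.+ 3 * d + N)))))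
        where
        lemma₁ : ∀ g d e N → ℤ.+ 2 * (g + (d + g)) - (e - d) ≡ N + (ℤ.+ 3 * d + N) - (N + - ℤ.+ 2 * g + (e + (N + - ℤ.+ 2 * g)))
        lemma₁ = solve-∀

    private
      -- The index i stands for the summand i + 1 of d, which runs over 1, ..., d - 1, so that both
      -- i + 1 and d - (i + 1) are positive.
      Below : ℤ → ℕ → Set
      Below d i = suc i ℕ.< ℤ.∣ d ∣

      below : ∀ d → Finite (Below d)
      below d = finite (downFrom (ℕ.pred ℤ.∣ d ∣)) (Unique.downFrom⁺ _) (λ i∈ → up (∈-downFrom⁻ i∈)) (λ p → ∈-downFrom⁺ (down p))
        where
        up : ∀ {i k} → i ℕ.< ℕ.pred k → suc i ℕ.< k
        up {k = suc k} p = ℕ.s≤s p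
        down : ∀ {i k} → suc i ℕ.< k → i ℕ.< ℕ.pred k
        down {k = suc k} (ℕ.s≤s p) = p

      part : ℕ → ℤ
      part i = ℤ.+ suc i

      pred-suc : ∀ {a} → 0ℤ < a → part (ℕ.pred ℤ.∣ a ∣) ≡ a
      pred-suc {ℤ.+ suc _} _ = refl
      pred-suc {ℤ.+ zero} (+<+ ())

      pred-below : ∀ {a d} → 0ℤ < a → a < d → Below d (ℕ.pred ℤ.∣ a ∣)
      pred-below {ℤ.+ suc _} {ℤ.+ suc _} _ (+<+ p) = p
      pred-below {ℤ.+ zero} (+<+ ()) _
      pred-below {ℤ.+ suc _} { -[1+ _ ]} _ ()

      below-part : ∀ {d i} → 0ℤ < d → Below d i → part i < d
      below-part {ℤ.+ _} _ p = +<+ p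

      split-pairs : ∀ (F : ℤ → ℤ → ℤ) → Finite (λ (z : (ℤ × ℤ) × ℕ) → Factors 1 (ℤ.+ n) (proj₁ z) × Below (proj₁ (proj₁ z)) (proj₂ z))
      split-pairs F = sigma (λ (d , _) → below d) (factorizations 1 n)

      equal-XY : ∀ (F : ℤ → ℤ → ℤ) →
        ∑ XY.equal (λ ((a , _) , (b , _)) → F a b) ≡ ∑ (factorizations 1 n) (λ (d , _) → ∑ (below d) (λ i → F (part i) (d - part i)))
      equal-XY F = trans (∑-reindex XY.equal (split-pairs F) to from to∈ from∈ from-to to-from
          (λ {((a , x) , (b , y))} ((f , _) , _) → cong₂ F (sym (pred-suc (a>0 f))) (sym (trans (cong (λ z → a + b - z) (pred-suc (a>0 f))) (lemma₁ a b)))))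
        (∑-sigma (λ (d , _) → below d) (factorizations 1 n) (λ ((d , _) , i) → F (part i) (d - part i)))
        where
        lemma₁ : ∀ a b → a + b - a ≡ b
        lemma₁ = solve-∀
        lemma₂ : ∀ i d → i + (d - i) ≡ d
        lemma₂ = solve-∀
        to : Quadruple → (ℤ × ℤ) × ℕ
        to ((a , x) , (b , y)) = (a + b , x) , ℕ.pred ℤ.∣ a ∣
        from : (ℤ × ℤ) × ℕ → Quadruple
        from ((d , x) , i) = (part i , x) , (d - part i , x)
        lemma₃ : ∀ a b x → 1ℤ * ((a + b) * x) ≡ a * x + b * x
        lemma₃ = solve-∀
        lemma₄ : ∀ i d x → i * x + (d - i) * x ≡ 1ℤ * (d * x)
        lemma₄ = solve-∀
        to∈ : ∀ {q} → (Sum n q × ¬ X q < Y q) × X q ≡ Y q → Factors 1 (ℤ.+ n) (proj₁ (to q)) × Below (proj₁ (proj₁ (to q))) (proj₂ (to q))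
        to∈ {(a , x) , (b , y)} ((sum p q r s e , _) , refl) = factors (<-+ p r) q (trans (lemma₃ a b x) e)
          , pred-below {a} {a + b} p (>‿- {a} {a + b} (subst (0ℤ <_) (sym (lemma₁ a b)) r))
        from∈ : ∀ {z} → Factors 1 (ℤ.+ n) (proj₁ z) × Below (proj₁ (proj₁ z)) (proj₂ z) → (Sum n (from z) × ¬ X (from z) < Y (from z)) × X (from z) ≡ Y (from z)
        from∈ {(d , x) , i} (factors p q r , l) = (sum (+<+ (ℕ.s≤s ℕ.z≤n)) q (-‿> (below-part p l)) q (trans (lemma₄ (part i) d x) r) , ℤ.<-irrefl refl) , refl
        from-to : ∀ {q} → (Sum n q × ¬ X q < Y q) × X q ≡ Y q → from (to q) ≡ q
        from-to {(a , x) , (b , y)} ((f , _) , refl) = cong₂ (λ s t → (s , x) , (t , x)) (pred-suc (a>0 f)) (trans (cong (λ z → a + b - z) (pred-suc (a>0 f))) (lemma₁ a b))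
        to-from : ∀ {z} → Factors 1 (ℤ.+ n) (proj₁ z) × Below (proj₁ (proj₁ z)) (proj₂ z) → to (from z) ≡ z
        to-from {(d , x) , i} _ = cong (λ s → (s , x) , i) (lemma₂ (part i) d)

      equal-AB : ∀ (F : ℤ → ℤ) →
        ∑ AB.equal (λ ((a , _) , _) → F a) ≡ ∑ (factorizations 1 n) (λ (a , d) → ∑ (below d) (λ _ → F a))
      equal-AB F = trans (∑-reindex AB.equal T to from to∈ from∈ from-to to-from (λ _ → refl))
        (∑-sigma (λ (_ , d) → below d) (factorizations 1 n) (λ ((a , _) , _) → F a))
        where
        T : Finite (λ (z : (ℤ × ℤ) × ℕ) → Factors 1 (ℤ.+ n) (proj₁ z) × Below (proj₂ (proj₁ z)) (proj₂ z))
        T = sigma (λ (_ , d) → below d) (factorizations 1 n)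
        lemma₁ : ∀ a b → a + b - a ≡ b
        lemma₁ = solve-∀
        lemma₂ : ∀ i d → i + (d - i) ≡ d
        lemma₂ = solve-∀
        to : Quadruple → (ℤ × ℤ) × ℕ
        to ((a , x) , (b , y)) = (a , x + y) , ℕ.pred ℤ.∣ x ∣
        from : (ℤ × ℤ) × ℕ → Quadruple
        from ((a , d) , i) = (a , part i) , (a , d - part i)
        lemma₃ : ∀ a x y → 1ℤ * (a * (x + y)) ≡ a * x + a * y
        lemma₃ = solve-∀
        lemma₄ : ∀ a i d → a * i + a * (d - i) ≡ 1ℤ * (a * d)
        lemma₄ = solve-∀
        to∈ : ∀ {q} → (Sum n q × ¬ A q < B q) × A q ≡ B q → Factors 1 (ℤ.+ n) (proj₁ (to q)) × Below (proj₂ (proj₁ (to q))) (proj₂ (to q))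
        to∈ {(a , x) , (b , y)} ((sum p q r s e , _) , refl) = factors p (<-+ q s) (trans (lemma₃ a x y) e)
          , pred-below {x} {x + y} q (>‿- {x} {x + y} (subst (0ℤ <_) (sym (lemma₁ x y)) s))
        from∈ : ∀ {z} → Factors 1 (ℤ.+ n) (proj₁ z) × Below (proj₂ (proj₁ z)) (proj₂ z) → (Sum n (from z) × ¬ A (from z) < B (from z)) × A (from z) ≡ B (from z)
        from∈ {(a , d) , i} (factors p q r , l) = (sum p (+<+ (ℕ.s≤s ℕ.z≤n)) p (-‿> (below-part q l)) (trans (lemma₄ a (part i) d) r) , ℤ.<-irrefl refl) , refl
        from-to : ∀ {q} → (Sum n q × ¬ A q < B q) × A q ≡ B q → from (to q) ≡ q
        from-to {(a , x) , (b , y)} ((f , _) , refl) = cong₂ (λ s t → (a , s) , (a , t)) (pred-suc (x>0 f)) (trans (cong (λ z → x + y - z) (pred-suc (x>0 f))) (lemma₁ x y))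
        to-from : ∀ {z} → Factors 1 (ℤ.+ n) (proj₁ z) × Below (proj₂ (proj₁ z)) (proj₂ z) → to (from z) ≡ z
        to-from {(a , d) , i} _ = cong (λ s → (a , s) , i) (lemma₂ (part i) d)

      norm-below : ∀ {d} → 0ℤ < d → ℤ.+ 6 * ∑ (below d) (λ i → let a = part i ; b = d - part i in a * a + a * b + b * b) ≡ ℤ.+ 5 * cube d - ℤ.+ 6 * (d * d) + d
      norm-below {ℤ.+ zero} (+<+ ())
      norm-below {ℤ.+ suc e} _ = trans (closed e) (trans (cong (λ z → ℤ.+ 6 * ℤ.+ e * z * z - ℤ.+ 3 * z * ℤ.+ e * (ℤ.+ e + 1ℤ) + ℤ.+ e * (ℤ.+ e + 1ℤ) * (ℤ.+ 2 * ℤ.+ e + 1ℤ)) (ℤ.pos-+ 1 e))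
          (trans (lemma₁ (ℤ.+ e)) (cong (λ z → ℤ.+ 5 * cube z - ℤ.+ 6 * (z * z) + z) (sym (ℤ.pos-+ 1 e)))))
        where
        d₀ = ℤ.+ suc e
        lemma₁ : ∀ e → ℤ.+ 6 * e * (1ℤ + e) * (1ℤ + e) - ℤ.+ 3 * (1ℤ + e) * e * (e + 1ℤ) + e * (e + 1ℤ) * (ℤ.+ 2 * e + 1ℤ)
          ≡ ℤ.+ 5 * ((1ℤ + e) * (1ℤ + e) * (1ℤ + e)) - ℤ.+ 6 * ((1ℤ + e) * (1ℤ + e)) + (1ℤ + e)
        lemma₁ = solve-∀
        step : ∀ d i → ℤ.+ 6 * ((1ℤ + i) * (1ℤ + i) + (1ℤ + i) * (d - (1ℤ + i)) + (d - (1ℤ + i)) * (d - (1ℤ + i)))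
          + (ℤ.+ 6 * i * d * d - ℤ.+ 3 * d * i * (i + 1ℤ) + i * (i + 1ℤ) * (ℤ.+ 2 * i + 1ℤ))
          ≡ ℤ.+ 6 * (1ℤ + i) * d * d - ℤ.+ 3 * d * (1ℤ + i) * (1ℤ + i + 1ℤ) + (1ℤ + i) * (1ℤ + i + 1ℤ) * (ℤ.+ 2 * (1ℤ + i) + 1ℤ)
        step = solve-∀
        base : ∀ d → ℤ.+ 6 * 0ℤ ≡ ℤ.+ 6 * 0ℤ * d * d - ℤ.+ 3 * d * 0ℤ * (0ℤ + 1ℤ) + 0ℤ * (0ℤ + 1ℤ) * (ℤ.+ 2 * 0ℤ + 1ℤ)
        base = solve-∀
        f : ℕ → ℤ
        f i = part i * part i + part i * (d₀ - part i) + (d₀ - part i) * (d₀ - part i)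
        closed : ∀ k → ℤ.+ 6 * sumL (downFrom k) f ≡ ℤ.+ 6 * ℤ.+ k * d₀ * d₀ - ℤ.+ 3 * d₀ * ℤ.+ k * (ℤ.+ k + 1ℤ) + ℤ.+ k * (ℤ.+ k + 1ℤ) * (ℤ.+ 2 * ℤ.+ k + 1ℤ)
        closed zero = base d₀
        closed (suc k) = trans (ℤ.*-distribˡ-+ (ℤ.+ 6) (f k) (sumL (downFrom k) f)) (trans (cong (ℤ.+ 6 * f k +_) (closed k))
          (subst (λ z → ℤ.+ 6 * (z * z + z * (d₀ - z) + (d₀ - z) * (d₀ - z)) + (ℤ.+ 6 * ℤ.+ k * d₀ * d₀ - ℤ.+ 3 * d₀ * ℤ.+ k * (ℤ.+ k + 1ℤ) + ℤ.+ k * (ℤ.+ k + 1ℤ) * (ℤ.+ 2 * ℤ.+ k + 1ℤ))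
            ≡ ℤ.+ 6 * z * d₀ * d₀ - ℤ.+ 3 * d₀ * z * (z + 1ℤ) + z * (z + 1ℤ) * (ℤ.+ 2 * z + 1ℤ)) (sym (ℤ.pos-+ 1 k)) (step d₀ (ℤ.+ k))))

      const-below : ∀ {d} z → 0ℤ < d → ∑ (below d) (λ _ → z) ≡ (d - 1ℤ) * z
      const-below {ℤ.+ zero} z (+<+ ())
      const-below {ℤ.+ suc e} z _ = trans (closed e) (cong (_* z) (trans (lemma₁ (ℤ.+ e)) (cong (_- 1ℤ) (sym (ℤ.pos-+ 1 e)))))
        where
        lemma₁ : ∀ e → e ≡ 1ℤ + e - 1ℤ
        lemma₁ = solve-∀
        lemma₂ : ∀ z k → z + k * z ≡ (1ℤ + k) * z
        lemma₂ = solve-∀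
        closed : ∀ k → sumL (downFrom k) (λ _ → z) ≡ ℤ.+ k * z
        closed zero = sym (ℤ.*-zeroˡ z)
        closed (suc k) = trans (cong (z +_) (closed k)) (trans (lemma₂ z (ℤ.+ k)) (cong (_* z) (sym (ℤ.pos-+ 1 k))))

    -- Only diagonal terms are left by `∑-product`: x = y splits a divisor d into a + b, while a = b
    -- splits the cofactor of a. The power sums of `norm-below` and the relation ad = n reduce them
    -- to σ₃, σ and nσ, the squares of divisors cancelling. The result is Besge's formula.
    convolution : ℤ.+ 12 * (σ ⊗ σ) ! n ≡ ℤ.+ 5 * lambert 1 cube ! n + σ ! n - ℤ.+ 6 * (ℤ.+ n * σ ! n)
    convolution = begin
      ℤ.+ 12 * (σ ⊗ σ) ! n
        ≡⟨ trans (cong (ℤ.+ 12 *_) (σ⊗σ n)) (trans (ℤ.*-assoc (ℤ.+ 6) (ℤ.+ 2) (∑ S pair-product)) (cong (ℤ.+ 6 *_) ∑-product)) ⟩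
      ℤ.+ 6 * (∑ XY.equal norm - ∑ AB.equal square₁)
        ≡⟨ trans (lemma₀ (∑ XY.equal norm) (∑ AB.equal square₁)) (cong₂ (λ x y → ℤ.+ 6 * x + - ℤ.+ 6 * y)
             (equal-XY (λ a b → a * a + a * b + b * b)) (equal-AB (λ a → a * a))) ⟩
      ℤ.+ 6 * ∑ F (λ (d , _) → ∑ (below d) (λ i → let a = part i ; b = d - part i in a * a + a * b + b * b)) + - ℤ.+ 6 * ∑ F (λ (a , d) → ∑ (below d) (λ _ → a * a))
        ≡⟨ cong₂ _+_ (sym (sumL-* (ℤ.+ 6) _ (elems F))) (sym (sumL-* (- ℤ.+ 6) (λ (a , d) → ∑ (below d) (λ _ → a * a)) (elems F))) ⟩
      ∑ F (λ (d , _) → ℤ.+ 6 * ∑ (below d) (λ i → let a = part i ; b = d - part i in a * a + a * b + b * b)) + ∑ F (λ (a , d) → - ℤ.+ 6 * ∑ (below d) (λ _ → a * a))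
        ≡⟨ cong₂ _+_ (∑-cong F (λ f → norm-below (left>0 f)))
             (∑-cong F (λ {(a , d)} f → trans (cong (- ℤ.+ 6 *_) (const-below (a * a) (right>0 f))) (trans (lemma₁ a d)
               (cong (λ z → - ℤ.+ 6 * z * a + ℤ.+ 6 * (a * a)) (product f))))) ⟩
      ∑ F (λ (d , _) → ℤ.+ 5 * cube d - ℤ.+ 6 * (d * d) + d) + ∑ F (λ (a , _) → - ℤ.+ 6 * ℤ.+ n * a + ℤ.+ 6 * (a * a))
        ≡⟨ sumL-+ _ _ (elems F) ⟨
      ∑ F (λ (d , _) → ℤ.+ 5 * cube d - ℤ.+ 6 * (d * d) + d + (- ℤ.+ 6 * ℤ.+ n * d + ℤ.+ 6 * (d * d)))
        ≡⟨ ∑-cong F (λ {(d , _)} _ → lemma₂ d (cube d) (ℤ.+ n)) ⟩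
      ∑ F (λ (d , _) → ℤ.+ 5 * cube d + (1ℤ - ℤ.+ 6 * ℤ.+ n) * d)
        ≡⟨ trans (sumL-+ (λ (d , _) → ℤ.+ 5 * cube d) (λ (d , _) → (1ℤ - ℤ.+ 6 * ℤ.+ n) * d) (elems F))
             (cong₂ _+_ (sumL-* (ℤ.+ 5) (cube ∘ proj₁) (elems F)) (sumL-* (1ℤ - ℤ.+ 6 * ℤ.+ n) proj₁ (elems F))) ⟩
      ℤ.+ 5 * lambert 1 cube ! n + (1ℤ - ℤ.+ 6 * ℤ.+ n) * σ ! n
        ≡⟨ lemma₃ (lambert 1 cube ! n) (σ ! n) (ℤ.+ n) ⟩
      ℤ.+ 5 * lambert 1 cube ! n + σ ! n - ℤ.+ 6 * (ℤ.+ n * σ ! n) ∎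
      where
      open ≡-Reasoning
      F = factorizations 1 n
      lemma₀ : ∀ x y → ℤ.+ 6 * (x - y) ≡ ℤ.+ 6 * x + - ℤ.+ 6 * y
      lemma₀ = solve-∀
      lemma₁ : ∀ a d → - ℤ.+ 6 * ((d - 1ℤ) * (a * a)) ≡ - ℤ.+ 6 * (1ℤ * (a * d)) * a + ℤ.+ 6 * (a * a)
      lemma₁ = solve-∀
      lemma₂ : ∀ d c n → ℤ.+ 5 * c - ℤ.+ 6 * (d * d) + d + (- ℤ.+ 6 * n * d + ℤ.+ 6 * (d * d)) ≡ ℤ.+ 5 * c + (1ℤ - ℤ.+ 6 * n) * d
      lemma₂ = solve-∀
      lemma₃ : ∀ x s n → ℤ.+ 5 * x + (1ℤ - ℤ.+ 6 * n) * s ≡ ℤ.+ 5 * x + s - ℤ.+ 6 * (n * s)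
      lemma₃ = solve-∀

-- Gauss's identity for the overpartition series

module GaussIdentity where
  open PowerSeries
  open SeriesMaps
  open ThetaAndDivisorSums using (φ; φ-0; φ-square; φ-nonsquare; square?; square-injective)
  open Mod 0
  open import Data.Bool using (true; false; T; if_then_else_)
  open import Data.Empty using (⊥-elim)
  open import Data.Integer using (ℤ; 0ℤ; 1ℤ; _+_; _*_; -_; _-_)
  import Data.Integer as ℤ
  import Data.Integer.Properties as ℤ
  open import Data.Integer.Divisibility.Signed using (_∣_; divides)
  open import Data.Integer.Tactic.RingSolver using (solve-∀)
  open import Data.Nat as ℕ using (ℕ; zero; suc; _<ᵇ_)
  open import Data.Nat.Induction using (<-rec)
  import Data.Nat.Properties as ℕ
  open import Data.Product using (_,_)
  open import Data.Sum using (inj₁; inj₂)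
  open import Function using (_∘_)
  open import Relation.Binary.PropositionalEquality
    using (_≡_; _≢_; refl; sym; trans; cong; cong₂; subst; module ≡-Reasoning)
  open import Relation.Nullary using (yes; no)
  import Relation.Binary.Reasoning.Setoid setoid as ≈

  ≈⇒≡ : ∀ {x y} → x ≈ y → ∀ n → x ! n ≡ y ! n
  ≈⇒≡ {x} {y} p n = ℤ.i-j≡0⇒i≡j (x ! n) (y ! n) (zero-divides (at p n))
    where
    zero-divides : ∀ {i} → 0ℤ ∣ i → i ≡ 0ℤ
    zero-divides (divides q e) = trans e (ℤ.*-zeroʳ q)

  -- With constant term 1, the coefficient of z y at n is y(n) plus terms in earlier coefficients of
  -- y, so these vanish successively.
  unit-cancel : ∀ z {y} → z ! 0 ≡ 1ℤ → z ⊗ y ≈ const 0ℤ → y ≈ const 0ℤ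
  unit-cancel z {y} z0 zy = pointwise λ n → trans (vanish n) (sym (const0 n))
    where
    const0 : ∀ n → const 0ℤ ! n ≡ 0ℤ
    const0 zero = refl
    const0 (suc _) = refl
    lower : ∀ x (w : ℕ → ℤ) n → (∀ i → i ℕ.≤ n → w i ≡ 0ℤ) → mulF x w n ≡ 0ℤ
    lower x w n p = trans (mulF-cong n (λ _ _ → refl) p) (trans (mulF-comm x (λ _ → 0ℤ) n) (mulF-zeroˡ x n))
    vanish : ∀ n → y ! n ≡ 0ℤ
    vanish = <-rec _ step
      where
      step : ∀ n → (∀ {i} → i ℕ.< n → y ! i ≡ 0ℤ) → y ! n ≡ 0ℤ
      step zero _ = trans (sym (ℤ.*-identityˡ (y ! 0))) (trans (cong (_* y ! 0) (sym z0)) (≈⇒≡ zy 0))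
      step (suc n) ih = begin
        y ! suc n                      ≡⟨ ℤ.*-identityˡ (y ! suc n) ⟨
        1ℤ * y ! suc n                 ≡⟨ cong (_* y ! suc n) z0 ⟨
        z ! 0 * y ! suc n              ≡⟨ ℤ.+-identityʳ _ ⟨
        z ! 0 * y ! suc n + 0ℤ         ≡⟨ cong (z ! 0 * y ! suc n +_) (lower (tailF (z !_)) (y !_) n (λ i i≤n → ih (ℕ.s≤s i≤n))) ⟨
        (z ⊗ y) ! suc n                ≡⟨ ≈⇒≡ zy (suc n) ⟩
        0ℤ                             ∎
        where open ≡-Reasoning

  cancelˡ : ∀ z {x y} → z ! 0 ≡ 1ℤ → z ⊗ x ≈ z ⊗ y → x ≈ y
  cancelˡ z {x} {y} z0 e = ≈-trans (solve 2 (λ x y → x := (x :- y) :+ y) ≈-refl x y)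
    (≈-trans (⊕-cong (unit-cancel z z0 (≈-trans (solve 3 (λ z x y → z :* (x :+ :- y) := z :* x :+ :- (z :* y)) ≈-refl z x y)
      (≈-trans (⊕-cong e ≈-refl) (solve 1 (λ w → w :+ :- w := con 0ℤ) ≈-refl (z ⊗ y))))) ≈-refl)
      (solve 1 (λ y → con 0ℤ :+ y := y) ≈-refl y))

  q : PS
  q = shift (const 1ℤ)

  1s : PS
  1s = const 1ℤ

  q⊗ : ∀ x → q ⊗ x ≈ shift x
  q⊗ x = pointwise λ { zero → ℤ.*-zeroˡ (x ! 0) ; (suc n) → trans (shift-⊗ (const 1ℤ) x (suc n)) (trans (mulF-const 1ℤ (x !_) n) (ℤ.*-identityˡ _)) }

  q^⊗ : ∀ k x → q ^ k ⊗ x ≈ shiftBy k x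
  q^⊗ zero x = solve 1 (λ x → con 1ℤ :* x := x) ≈-refl x
  q^⊗ (suc k) x = ≈-trans (solve 3 (λ q r x → q :* r :* x := q :* (r :* x)) ≈-refl q (q ^ k) x)
    (≈-trans (⊗-cong ≈-refl (q^⊗ k x)) (q⊗ (shiftBy k x)))

  fromℕ : (ℕ → ℕ) → PS
  fromℕ a ! n = ℤ.+ a n

  <ᵇ-true : ∀ {j k} → j ℕ.< k → (j <ᵇ k) ≡ true
  <ᵇ-true {j} {k} p with j <ᵇ k | ℕ.<⇒<ᵇ p
  ... | true | _ = refl

  <ᵇ-false : ∀ {j k} → k ℕ.≤ j → (j <ᵇ k) ≡ false
  <ᵇ-false {j} {k} p with j <ᵇ k in e
  ... | false = refl
  ... | true = ⊥-elim (ℕ.<⇒≱ (ℕ.<ᵇ⇒< j k (subst T (sym e) _)) p)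

  -- Each step lowers the degree by at least 1, and at degree 0 the comparison with `suc k` ends the
  -- recursion; fuel not less than the degree therefore never runs out early.
  geomSum-fuel : ∀ k f f′ a j → j ℕ.≤ f → j ℕ.≤ f′ → geomSum (suc k) f a j ≡ geomSum (suc k) f′ a j
  geomSum-fuel k zero zero a j p p′ = refl
  geomSum-fuel k zero (suc f′) a zero p p′ = refl
  geomSum-fuel k (suc f) zero a zero p p′ = refl
  geomSum-fuel k (suc f) (suc f′) a zero p p′ = refl
  geomSum-fuel k (suc f) (suc f′) a (suc j) (ℕ.s≤s p) (ℕ.s≤s p′) =
    cong (λ t → if suc j <ᵇ suc k then a (suc j) else a (suc j) ℕ.+ t)
      (geomSum-fuel k f f′ a (j ℕ.∸ k) (ℕ.≤-trans (ℕ.m∸n≤m j k) p) (ℕ.≤-trans (ℕ.m∸n≤m j k) p′))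

  shiftBy-split : ∀ k (x y z : ℕ → ℕ) → (∀ n → n ℕ.< k → x n ≡ y n) → (∀ n → k ℕ.≤ n → x n ≡ y n ℕ.+ z (n ℕ.∸ k)) →
    fromℕ x ≈ fromℕ y ⊕ shiftBy k (fromℕ z)
  shiftBy-split k x y z lo hi = pointwise go
    where
    go : ∀ n → ℤ.+ x n ≡ ℤ.+ y n + shiftBy k (fromℕ z) ! n
    go n with n ℕ.<? k
    ... | yes n<k = trans (cong ℤ.+_ (lo n n<k)) (sym (trans (cong (ℤ.+ y n +_) (shiftBy-< (fromℕ z) n<k)) (ℤ.+-identityʳ _)))
    ... | no n≮k with o , refl ← ℕ.m≤n⇒∃[o]m+o≡n (ℕ.≮⇒≥ n≮k) =
      trans (cong ℤ.+_ (hi (k ℕ.+ o) (ℕ.m≤m+n k o))) (trans (ℤ.pos-+ (y (k ℕ.+ o)) _)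
        (cong (ℤ.+ y (k ℕ.+ o) +_) (sym (trans (shiftBy-+ k o (fromℕ z)) (cong (λ i → ℤ.+ z i) (sym (ℕ.m+n∸m≡n k o)))))))

  mul1+-series : ∀ k a → fromℕ (mul1+ k a) ≈ (1s ⊕ q ^ k) ⊗ fromℕ a
  mul1+-series k a = ≈-trans (shiftBy-split k (mul1+ k a) a a
      (λ n p → cong (λ b → if b then a n else a n ℕ.+ a (n ℕ.∸ k)) (<ᵇ-true p))
      (λ n p → cong (λ b → if b then a n else a n ℕ.+ a (n ℕ.∸ k)) (<ᵇ-false p)))
    (≈-trans (⊕-cong ≈-refl (≈-sym (q^⊗ k (fromℕ a)))) (solve 2 (λ a r → a :+ r :* a := (con 1ℤ :+ r) :* a) ≈-refl (fromℕ a) (q ^ k)))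

  mul1/1--series : ∀ k a → (1s ⊕ ⊝ (q ^ suc k)) ⊗ fromℕ (mul1/1- (suc k) a) ≈ fromℕ a
  mul1/1--series k a = ≈-trans (solve 2 (λ r y → (con 1ℤ :+ :- r) :* y := y :+ :- (r :* y)) ≈-refl (q ^ suc k) y)
    (≈-trans (⊕-cong step (⊝-cong (q^⊗ (suc k) y))) (solve 2 (λ a t → a :+ t :+ :- t := a) ≈-refl (fromℕ a) (shiftBy (suc k) y)))
    where
    y = fromℕ (mul1/1- (suc k) a)
    step : y ≈ fromℕ a ⊕ shiftBy (suc k) y
    step = shiftBy-split (suc k) (mul1/1- (suc k) a) a (mul1/1- (suc k) a) lo hi
      where
      lo : ∀ n → n ℕ.< suc k → mul1/1- (suc k) a n ≡ a n
      lo zero p = refl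
      lo (suc n) p = cong (λ b → if b then a (suc n) else a (suc n) ℕ.+ geomSum (suc k) n a (n ℕ.∸ k)) (<ᵇ-true p)
      hi : ∀ n → suc k ℕ.≤ n → mul1/1- (suc k) a n ≡ a n ℕ.+ mul1/1- (suc k) a (n ℕ.∸ suc k)
      hi (suc n) p = trans (cong (λ b → if b then a (suc n) else a (suc n) ℕ.+ geomSum (suc k) n a (n ℕ.∸ k)) (<ᵇ-false p))
        (cong (a (suc n) ℕ.+_) (geomSum-fuel k n (n ℕ.∸ k) a (n ℕ.∸ k) (ℕ.m∸n≤m n k) ℕ.≤-refl))

  P : ℕ → PS
  P n = fromℕ (partialProd n)

  P-step : ∀ n → (1s ⊕ ⊝ (q ^ suc n)) ⊗ P (suc n) ≈ (1s ⊕ q ^ suc n) ⊗ P n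
  P-step n = ≈-trans (mul1/1--series n (mul1+ (suc n) (partialProd n))) (mul1+-series (suc n) (partialProd n))

  P-zero : P 0 ≈ 1s
  P-zero = pointwise λ { zero → refl ; (suc _) → refl }

  -- t n = 2 (−1)^(n+1) P n / (1 − q^(n+1)), the correction terms in Shanks' finite form of Gauss's identity.
  t : ℕ → PS
  t n = const (ℤ.+ 2 * sign (suc n)) ⊗ fromℕ (mul1/1- (suc n) (partialProd n))

  t-minus : ∀ n → (1s ⊕ ⊝ (q ^ suc n)) ⊗ t n ≈ const (ℤ.+ 2 * sign (suc n)) ⊗ P n
  t-minus n = ≈-trans (solve 3 (λ r c y → r :* (c :* y) := c :* (r :* y)) ≈-refl (1s ⊕ ⊝ (q ^ suc n)) (const (ℤ.+ 2 * sign (suc n))) (fromℕ (mul1/1- (suc n) (partialProd n))))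
    (⊗-cong ≈-refl (mul1/1--series n (partialProd n)))

  unit-minus : ∀ n → (1s ⊕ ⊝ (q ^ suc n)) ! 0 ≡ 1ℤ
  unit-minus n = cong (λ z → 1ℤ + - z) (≈⇒≡ (q⊗ (q ^ n)) 0)

  t-plus : ∀ n → (1s ⊕ q ^ suc n) ⊗ t n ≈ const (ℤ.+ 2 * sign (suc n)) ⊗ P (suc n)
  t-plus n = cancelˡ (1s ⊕ ⊝ (q ^ suc n)) (unit-minus n)
    (≈-trans (solve 3 (λ x y z → x :* (y :* z) := y :* (x :* z)) ≈-refl (1s ⊕ ⊝ (q ^ suc n)) (1s ⊕ q ^ suc n) (t n))
      (≈-trans (⊗-cong ≈-refl (t-minus n)) (≈-trans (solve 3 (λ x c p → x :* (c :* p) := c :* (x :* p)) ≈-refl (1s ⊕ q ^ suc n) (const (ℤ.+ 2 * sign (suc n))) (P n))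
        (≈-trans (⊗-cong ≈-refl (≈-sym (P-step n))) (solve 3 (λ x c p → c :* (x :* p) := x :* (c :* p)) ≈-refl (1s ⊕ ⊝ (q ^ suc n)) (const (ℤ.+ 2 * sign (suc n))) (P (suc n)))))))

  S : ℕ → PS
  S zero = 1s
  S (suc n) = S n ⊕ const (ℤ.+ 2 * sign (suc n)) ⊗ q ^ (suc n ℕ.* suc n)

  -- B k r is 1 + Σ q^(j(r+1)) t(j-1) over 1 ≤ j ≤ k. Only the diagonal k = r occurs in the finite
  -- identity, but its induction compares r = m with r = m + 1 at the same k.
  B : ℕ → ℕ → PS
  B zero r = 1s
  B (suc k) r = B k r ⊕ q ^ (suc k ℕ.* suc r) ⊗ t k

  open import Algebra.Properties.Semiring.Exp semiring using (^-homo-*)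

  q^+ : ∀ i j → q ^ (i ℕ.+ j) ≈ q ^ i ⊗ q ^ j
  q^+ = ^-homo-* q

  ≡⇒≈ : ∀ {x y : PS} → x ≡ y → x ≈ y
  ≡⇒≈ refl = ≈-refl

  private
    c_ : ℕ → PS
    c n = const (ℤ.+ 2 * sign n)

    w : ℕ → ℕ → PS
    w n k = c (suc k) ⊗ (q ^ (suc k ℕ.* n) ⊗ P k)

    flip-sign : ∀ n → c (suc n) ≈ ⊝ (c n)
    flip-sign n = pointwise λ { zero → lemma (sign n) ; (suc _) → refl }
      where
      lemma : ∀ s → ℤ.+ 2 * - s ≡ - (ℤ.+ 2 * s)
      lemma = solve-∀

    c-1 : c 1 ≈ ⊝ (1s ⊕ 1s)
    c-1 = pointwise λ { zero → refl ; (suc _) → refl }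

    *-suc-exponent : ∀ k n → q ^ (k ℕ.* suc n) ≈ q ^ (k ℕ.* n) ⊗ q ^ k
    *-suc-exponent k n = ≈-trans (≡⇒≈ (cong (q ^_) (trans (ℕ.*-suc k n) (ℕ.+-comm k (k ℕ.* n))))) (q^+ (k ℕ.* n) k)

    suc-*-exponent : ∀ k n → q ^ (suc k ℕ.* n) ≈ q ^ (k ℕ.* n) ⊗ q ^ n
    suc-*-exponent k n = ≈-trans (≡⇒≈ (cong (q ^_) (ℕ.+-comm n (k ℕ.* n)))) (q^+ (k ℕ.* n) n)

    E : ℕ → ℕ → PS
    E m k = (1s ⊕ ⊝ (q ^ suc m)) ⊗ B k (suc m) ⊕ ⊝ ((1s ⊕ q ^ suc m) ⊗ B k m)

    -- `E m k` measures how far B is from following, in r, the recurrence of the partial products.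
    -- By `t-minus` and `t-plus` each new summand of B cancels the previous remainder and leaves one
    -- of the same shape.
    telescope : ∀ m k → E m k ≈ w (suc m) k
    telescope m zero = ≈-trans (solve 1 (λ r → (con 1ℤ :+ :- r) :* con 1ℤ :+ :- ((con 1ℤ :+ r) :* con 1ℤ) := :- (con 1ℤ :+ con 1ℤ) :* (r :* con 1ℤ)) ≈-refl (q ^ suc m))
      (⊗-cong (≈-sym c-1) (⊗-cong (≡⇒≈ (cong (q ^_) (sym (ℕ.+-identityʳ (suc m))))) (≈-sym P-zero)))
    telescope m (suc k) = begin
      (1s ⊕ ⊝ W) ⊗ (B k (suc m) ⊕ q ^ (suc k ℕ.* suc (suc m)) ⊗ t k) ⊕ ⊝ ((1s ⊕ W) ⊗ (B k m ⊕ u ⊗ t k))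
        ≈⟨ ⊕-cong (⊗-cong ≈-refl (⊕-cong ≈-refl (⊗-cong (*-suc-exponent (suc k) (suc m)) ≈-refl))) ≈-refl ⟩
      (1s ⊕ ⊝ W) ⊗ (B k (suc m) ⊕ u ⊗ v ⊗ t k) ⊕ ⊝ ((1s ⊕ W) ⊗ (B k m ⊕ u ⊗ t k))
        ≈⟨ solve 6 (λ W b b′ u v t → (con 1ℤ :+ :- W) :* (b :+ u :* v :* t) :+ :- ((con 1ℤ :+ W) :* (b′ :+ u :* t))
             := ((con 1ℤ :+ :- W) :* b :+ :- ((con 1ℤ :+ W) :* b′)) :+ :- (u :* ((con 1ℤ :+ :- v) :* t)) :+ :- (u :* W :* ((con 1ℤ :+ v) :* t)))
             ≈-refl W (B k (suc m)) (B k m) u v (t k) ⟩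
      E m k ⊕ ⊝ (u ⊗ ((1s ⊕ ⊝ v) ⊗ t k)) ⊕ ⊝ (u ⊗ W ⊗ ((1s ⊕ v) ⊗ t k))
        ≈⟨ ⊕-cong (⊕-cong (telescope m k) (⊝-cong (⊗-cong ≈-refl (t-minus k)))) (⊝-cong (⊗-cong ≈-refl (t-plus k))) ⟩
      c (suc k) ⊗ (u ⊗ P k) ⊕ ⊝ (u ⊗ (c (suc k) ⊗ P k)) ⊕ ⊝ (u ⊗ W ⊗ (c (suc k) ⊗ P (suc k)))
        ≈⟨ solve 5 (λ c u p W p′ → c :* (u :* p) :+ :- (u :* (c :* p)) :+ :- (u :* W :* (c :* p′)) := :- c :* (u :* W :* p′))
             ≈-refl (c (suc k)) u (P k) W (P (suc k)) ⟩
      ⊝ (c (suc k)) ⊗ (u ⊗ W ⊗ P (suc k))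
        ≈⟨ ⊗-cong (≈-sym (flip-sign (suc k))) (⊗-cong (≈-sym (suc-*-exponent (suc k) (suc m))) ≈-refl) ⟩
      w (suc m) (suc k) ∎
      where
      open ≈
      W u v : PS
      W = q ^ suc m
      u = q ^ (suc k ℕ.* suc m)
      v = q ^ suc k

  -- After multiplication by 1 - q^(m+1) the recurrence `P-step` applies. The new theta term then
  -- splits in two: one part is the remainder of `telescope`, the other is the new summand of `B`.
  shanks : ∀ n → S n ⊗ P n ≈ B n n
  shanks zero = ≈-trans (⊗-cong ≈-refl P-zero) (solve 0 (con 1ℤ :* con 1ℤ := con 1ℤ) ≈-refl)
  shanks (suc m) = cancelˡ (1s ⊕ ⊝ W) (unit-minus m) (begin
    (1s ⊕ ⊝ W) ⊗ ((S m ⊕ c (suc m) ⊗ u) ⊗ P (suc m))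
      ≈⟨ solve 3 (λ r s p → r :* (s :* p) := s :* (r :* p)) ≈-refl (1s ⊕ ⊝ W) (S m ⊕ c (suc m) ⊗ u) (P (suc m)) ⟩
    (S m ⊕ c (suc m) ⊗ u) ⊗ ((1s ⊕ ⊝ W) ⊗ P (suc m))
      ≈⟨ ⊗-cong ≈-refl (P-step m) ⟩
    (S m ⊕ c (suc m) ⊗ u) ⊗ ((1s ⊕ W) ⊗ P m)
      ≈⟨ solve 5 (λ s c u W p → (s :+ c :* u) :* ((con 1ℤ :+ W) :* p) := c :* (u :* p) :+ (con 1ℤ :+ W) :* (s :* p) :+ u :* W :* (c :* p))
           ≈-refl (S m) (c (suc m)) u W (P m) ⟩
    w (suc m) m ⊕ (1s ⊕ W) ⊗ (S m ⊗ P m) ⊕ u ⊗ W ⊗ (c (suc m) ⊗ P m)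
      ≈⟨ ⊕-cong (⊕-cong (≈-sym (telescope m m)) (⊗-cong ≈-refl (shanks m))) (⊗-cong (≈-sym (*-suc-exponent (suc m) (suc m))) (≈-sym (t-minus m))) ⟩
    E m m ⊕ (1s ⊕ W) ⊗ B m m ⊕ q ^ (suc m ℕ.* suc (suc m)) ⊗ ((1s ⊕ ⊝ W) ⊗ t m)
      ≈⟨ solve 5 (λ W b b′ v t → ((con 1ℤ :+ :- W) :* b :+ :- ((con 1ℤ :+ W) :* b′)) :+ (con 1ℤ :+ W) :* b′ :+ v :* ((con 1ℤ :+ :- W) :* t)
           := (con 1ℤ :+ :- W) :* (b :+ v :* t)) ≈-refl W (B m (suc m)) (B m m) (q ^ (suc m ℕ.* suc (suc m))) (t m) ⟩
    (1s ⊕ ⊝ W) ⊗ (B m (suc m) ⊕ q ^ (suc m ℕ.* suc (suc m)) ⊗ t m) ∎)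
    where
    open ≈
    W u : PS
    W = q ^ suc m
    u = q ^ (suc m ℕ.* suc m)

  B-low : ∀ k r j → j ℕ.≤ r → B k r ! j ≡ 1s ! j
  B-low zero r j p = refl
  B-low (suc k) r j p = trans (cong₂ _+_ (B-low k r j p) (trans (≈⇒≡ (q^⊗ (suc k ℕ.* suc r) (t k)) j)
    (shiftBy-< (t k) (ℕ.≤-trans (ℕ.s≤s p) (ℕ.m≤m+n (suc r) (k ℕ.* suc r)))))) (ℤ.+-identityʳ _)

  partialProd-stable : ∀ n k i → i ℕ.≤ n → partialProd (k ℕ.+ n) i ≡ partialProd n i
  partialProd-stable n zero i p = refl
  partialProd-stable n (suc k) i p = trans (step (k ℕ.+ n) i (ℕ.≤-trans p (ℕ.m≤n+m n k))) (partialProd-stable n k i p)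
    where
    mul1+-low : ∀ m a i → i ℕ.≤ m → mul1+ (suc m) a i ≡ a i
    mul1+-low m a i p = cong (λ b → if b then a i else a i ℕ.+ a (i ℕ.∸ suc m)) (<ᵇ-true (ℕ.s≤s p))
    step : ∀ m i → i ℕ.≤ m → partialProd (suc m) i ≡ partialProd m i
    step m zero p = mul1+-low m (partialProd m) zero p
    step m (suc i) p = trans (cong (λ b → if b then a (suc i) else a (suc i) ℕ.+ geomSum (suc m) i a (i ℕ.∸ m)) (<ᵇ-true (ℕ.s≤s p)))
      (mul1+-low m (partialProd m) (suc i) p)
      where a = mul1+ (suc m) (partialProd m)

  sign-square : ∀ k → sign (k ℕ.* k) ≡ sign k
  sign-square k = trans (sign-* k k) (power k)
    where
    sign-+ : ∀ i j → sign (i ℕ.+ j) ≡ sign i * sign j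
    sign-+ zero j = sym (ℤ.*-identityˡ _)
    sign-+ (suc i) j = trans (cong -_ (sign-+ i j)) (ℤ.neg-distribˡ-* (sign i) (sign j))
    iterate : ℕ → ℤ → ℤ
    iterate zero s = 1ℤ
    iterate (suc i) s = s * iterate i s
    sign-* : ∀ i j → sign (i ℕ.* j) ≡ iterate i (sign j)
    sign-* zero j = refl
    sign-* (suc i) j = trans (sign-+ j (i ℕ.* j)) (cong (sign j *_) (sign-* i j))
    power : ∀ k → iterate k (sign k) ≡ sign k
    power k = go k (sign²-cases k) 
      where
      open import Data.Sum using (_⊎_)
      sign²-cases : ∀ k → sign k ≡ 1ℤ ⊎ sign k ≡ - 1ℤ
      sign²-cases zero = inj₁ refl
      sign²-cases (suc k) with sign²-cases k
      ... | inj₁ e = inj₂ (cong -_ e)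
      ... | inj₂ e = inj₁ (cong -_ e)
      ones : ∀ n → iterate n 1ℤ ≡ 1ℤ
      ones zero = refl
      ones (suc n) = trans (ℤ.*-identityˡ (iterate n 1ℤ)) (ones n)
      alternating : ∀ n → iterate n (- 1ℤ) ≡ sign n
      alternating zero = refl
      alternating (suc n) = trans (ℤ.-1*i≡-i (iterate n (- 1ℤ))) (cong -_ (alternating n))
      go : ∀ k → sign k ≡ 1ℤ ⊎ sign k ≡ - 1ℤ → iterate k (sign k) ≡ sign k
      go k (inj₁ e) = trans (cong (iterate k) e) (trans (ones k) (sym e))
      go k (inj₂ e) = trans (cong (iterate k) e) (alternating k)

  mono-same : ∀ k → (q ^ k) ! k ≡ 1ℤ
  mono-same k = trans (≈⇒≡ (≈-trans (solve 1 (λ x → x := x :* con 1ℤ) ≈-refl (q ^ k)) (q^⊗ k 1s)) k)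
    (trans (cong (shiftBy k 1s !_) (sym (ℕ.+-identityʳ k))) (shiftBy-+ k 0 1s))

  mono-other : ∀ k i → i ≢ k → (q ^ k) ! i ≡ 0ℤ
  mono-other k i i≢k = trans (≈⇒≡ (≈-trans (solve 1 (λ x → x := x :* con 1ℤ) ≈-refl (q ^ k)) (q^⊗ k 1s)) i) (go k i i≢k)
    where
    go : ∀ k i → i ≢ k → shiftBy k 1s ! i ≡ 0ℤ
    go zero zero p = ⊥-elim (p refl)
    go zero (suc i) p = refl
    go (suc k) zero p = refl
    go (suc k) (suc i) p = go k i (p ∘ cong suc)

  S-zero : ∀ n → S n ! 0 ≡ 1ℤ
  S-zero zero = refl
  S-zero (suc n) = trans (cong₂ _+_ (S-zero n) (trans (mulF-const (ℤ.+ 2 * sign (suc n)) ((q ^ (suc n ℕ.* suc n)) !_) 0)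
    (trans (cong (ℤ.+ 2 * sign (suc n) *_) (mono-other (suc n ℕ.* suc n) 0 (λ ()))) (ℤ.*-zeroʳ (ℤ.+ 2 * sign (suc n)))))) (ℤ.+-identityʳ _)

  S-skip : ∀ n i → (suc n ℕ.* suc n ≢ i) → S (suc n) ! i ≡ S n ! i
  S-skip n i p = trans (cong (S n ! i +_) (trans (mulF-const (ℤ.+ 2 * sign (suc n)) ((q ^ (suc n ℕ.* suc n)) !_) i)
    (trans (cong (ℤ.+ 2 * sign (suc n) *_) (mono-other (suc n ℕ.* suc n) i (p ∘ sym))) (ℤ.*-zeroʳ (ℤ.+ 2 * sign (suc n)))))) (ℤ.+-identityʳ _)

  S-before : ∀ n k → n ℕ.< suc k → S n ! (suc k ℕ.* suc k) ≡ 0ℤ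
  S-before zero k p = refl
  S-before (suc n) k p = trans (S-skip n (suc k ℕ.* suc k) (λ e → ℕ.<-irrefl (square-injective (suc n) (suc k) e) p)) (S-before n k (ℕ.<-trans (ℕ.n<1+n n) p))

  S-square : ∀ n k → suc k ℕ.≤ n → S n ! (suc k ℕ.* suc k) ≡ ℤ.+ 2 * sign (suc k)
  S-square (suc n) k p with ℕ.m≤n⇒m<n∨m≡n p
  ... | inj₁ (ℕ.s≤s k<n) = trans (S-skip n (suc k ℕ.* suc k) (λ e → ℕ.<-irrefl (sym (square-injective (suc n) (suc k) e)) (ℕ.s≤s k<n))) (S-square n k k<n)
  ... | inj₂ refl = trans (cong₂ _+_ (S-before n n ℕ.≤-refl) (trans (mulF-const (ℤ.+ 2 * sign (suc n)) ((q ^ (suc n ℕ.* suc n)) !_) (suc n ℕ.* suc n))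
          (trans (cong (ℤ.+ 2 * sign (suc n) *_) (mono-same (suc n ℕ.* suc n))) (ℤ.*-identityʳ (ℤ.+ 2 * sign (suc n)))))) (ℤ.+-identityˡ _)

  S-nonsquare : ∀ n i → (∀ k → i ≢ k ℕ.* k) → S n ! i ≡ 0ℤ
  S-nonsquare zero zero p = ⊥-elim (p 0 refl)
  S-nonsquare zero (suc i) p = refl
  S-nonsquare (suc n) i p = trans (S-skip n i (λ e → p (suc n) (sym e))) (S-nonsquare n i p)

  S-theta : ∀ n i → i ℕ.≤ n → S n ! i ≡ twist φ ! i
  S-theta n i p with square? i
  ... | inj₁ (zero , refl) = trans (S-zero n) (sym (trans (ℤ.*-identityˡ (φ ! 0)) φ-0))
  ... | inj₁ (suc k , refl) = trans (S-square n k (ℕ.≤-trans (ℕ.m≤m*n (suc k) (suc k)) p))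
        (sym (trans (cong₂ _*_ (sign-square (suc k)) (φ-square k)) (ℤ.*-comm (sign (suc k)) (ℤ.+ 2))))
  ... | inj₂ ns = trans (S-nonsquare n i (λ k e → ns (ℤ.+ k) (trans (cong ℤ.+_ e) (ℤ.pos-* k k))))
        (sym (trans (cong (sign i *_) (φ-nonsquare ns)) (ℤ.*-zeroʳ (sign i))))

  -- The corrections in `B n n` begin beyond degree n, so at degree n the finite identity with n
  -- factors and n theta terms already gives the coefficient of the infinite one.
  gauss : twist φ ⊗ fromℕ overpartition ≈ 1s
  gauss = pointwise λ n → trans
    (sym (mulF-cong n (λ i i≤n → S-theta n i i≤n)
      (λ i i≤n → cong ℤ.+_ (trans (cong (λ m → partialProd m i) (sym (ℕ.m∸n+n≡m i≤n))) (partialProd-stable i (n ℕ.∸ i) i ℕ.≤-refl)))))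
    (trans (≈⇒≡ (shanks n) n) (B-low n n n ℕ.≤-refl))

  h : PS
  h = twist (fromℕ overpartition)

  hφ : h ⊗ φ ≈ 1s
  hφ = begin
    h ⊗ φ                                        ≈⟨ ⊗-cong ≈-refl (≈-sym (pointwise (twist-twist φ))) ⟩
    h ⊗ twist (twist φ)                          ≈⟨ ⊗-comm h (twist (twist φ)) ⟩
    twist (twist φ) ⊗ twist (fromℕ overpartition) ≈⟨ pointwise (twist-⊗ (twist φ) (fromℕ overpartition)) ⟨
    twist (twist φ ⊗ fromℕ overpartition)         ≈⟨ pointwise (λ n → cong (sign n *_) (≈⇒≡ gauss n)) ⟩
    twist 1s                                     ≈⟨ pointwise (λ { zero → refl ; (suc n) → ℤ.*-zeroʳ (sign (suc n)) }) ⟩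
    1s                                           ∎
    where open ≈

-- Series maps modulo m and descent along q ↦ q²

module SeriesMapsMod (m : Data.Nat.ℕ) where
  open PowerSeries
  open SeriesMaps
  open Mod m
  open import Data.Integer using (ℤ; 0ℤ; _+_; _*_; -_; _-_)
  import Data.Integer as ℤ
  import Data.Integer.Properties as ℤ
  open import Data.Integer.Divisibility.Signed using (_∣_; divides; ∣n⇒∣m*n; ∣m∣n⇒∣m+n)
  open import Data.Integer.Tactic.RingSolver using (solve-∀)
  open import Data.Nat as ℕ using (ℕ; zero; suc)
  import Data.Nat.DivMod as ℕ
  open import Data.Nat.Induction using (<-rec)
  import Data.Nat.Properties as ℕ
  open import Data.Product using (∃; _,_)
  open import Data.Sum using (_⊎_; inj₁; inj₂)
  open import Relation.Binary.PropositionalEquality using (_≡_; refl; sym; trans; cong; cong₂; subst)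

  exact : ∀ {x y} → Mod._≈_ 0 x y → x ≈ y
  exact p = pointwise (GaussIdentity.≈⇒≡ p)


  private
    factor : ∀ s x y → s * (x - y) ≡ s * x - s * y
    factor = solve-∀

  D-cong : ∀ {x y} → x ≈ y → D x ≈ D y
  D-cong {x} {y} p = mk≈ λ n → subst (ℤ.+ m ∣_) (factor (ℤ.+ n) (x ! n) (y ! n)) (∣n⇒∣m*n (ℤ.+ n) (at p n))

  twist-cong : ∀ {x y} → x ≈ y → twist x ≈ twist y
  twist-cong {x} {y} p = mk≈ λ n → subst (ℤ.+ m ∣_) (factor (sign n) (x ! n) (y ! n)) (∣n⇒∣m*n (sign n) (at p n))

  expand-≈ : ∀ k .{{_ : ℕ.NonZero k}} {x y} → x ≈ y → expand k x ≈ expand k y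
  expand-≈ k {x} {y} p = mk≈ go
    where
    go : ∀ n → ℤ.+ m ∣ expand k x ! n - expand k y ! n
    go n with n ℕ.% k
    ... | zero = at p (n ℕ./ k)
    ... | suc _ = divides 0ℤ refl

  dissect-≈ : ∀ k {x y} → x ≈ y → dissect k x ≈ dissect k y
  dissect-≈ k p = mk≈ λ n → at p (n ℕ.* k)

  D-product : ∀ x y → D (x ⊗ y) ≈ D x ⊗ y ⊕ x ⊗ D y
  D-product x y = pointwise (D-⊗ x y)

  D-⊕ : ∀ x y → D (x ⊕ y) ≈ D x ⊕ D y
  D-⊕ x y = pointwise λ n → ℤ.*-distribˡ-+ (ℤ.+ n) (x ! n) (y ! n)

  D-⊝ : ∀ x → D (⊝ x) ≈ ⊝ (D x)
  D-⊝ x = pointwise λ n → sym (ℤ.neg-distribʳ-* (ℤ.+ n) (x ! n))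

  D-const : ∀ k → D (const k) ≈ const 0ℤ
  D-const k = pointwise λ { zero → ℤ.*-zeroˡ k ; (suc n) → ℤ.*-zeroʳ (ℤ.+ suc n) }

  D-scale : ∀ k x → D (const k ⊗ x) ≈ const k ⊗ D x
  D-scale k x = ≈-trans (D-product (const k) x) (≈-trans (⊕-cong (⊗-cong (D-const k) ≈-refl) ≈-refl)
    (solve 2 (λ x y → con 0ℤ :* x :+ y := y) ≈-refl x (const k ⊗ D x)))

  expand-product : ∀ k .{{_ : ℕ.NonZero k}} x y → expand k (x ⊗ y) ≈ expand k x ⊗ expand k y
  expand-product k x y = pointwise (expand-⊗ k x y)

  expand-sum : ∀ k .{{_ : ℕ.NonZero k}} x y → expand k (x ⊕ y) ≈ expand k x ⊕ expand k y
  expand-sum k x y = pointwise (expand-⊕ k x y)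

  expand-constant : ∀ k .{{_ : ℕ.NonZero k}} c → expand k (const c) ≈ const c
  expand-constant k c = pointwise (expand-const k c)

  expand-neg : ∀ k .{{_ : ℕ.NonZero k}} x → expand k (⊝ x) ≈ ⊝ (expand k x)
  expand-neg k x = pointwise go
    where
    go : ∀ n → expand k (⊝ x) ! n ≡ - (expand k x ! n)
    go n with n ℕ.% k
    ... | zero = refl
    ... | suc _ = refl

  halves : ∀ n → ∃ λ k → n ≡ k ℕ.* 2 ⊎ n ≡ suc (k ℕ.* 2)
  halves zero = 0 , inj₁ refl
  halves (suc n) with halves n
  ... | k , inj₁ refl = k , inj₂ refl
  ... | k , inj₂ refl = suc k , inj₁ refl

  expand₂-even : ∀ x k → expand 2 x ! (k ℕ.* 2) ≡ x ! k
  expand₂-even = expand-* 2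

  expand₂-odd : ∀ x k → expand 2 x ! suc (k ℕ.* 2) ≡ 0ℤ
  expand₂-odd x zero = refl
  expand₂-odd x (suc k) = trans (expand-+ 2 x (suc (k ℕ.* 2))) (expand₂-odd (tail x) k)

  D-expand₂ : ∀ x → D (expand 2 x) ≈ const (ℤ.+ 2) ⊗ expand 2 (D x)
  D-expand₂ x = pointwise λ n → trans (go n (halves n)) (sym (scale (ℤ.+ 2) (expand 2 (D x)) n))
    where
    go : ∀ n → (∃ λ k → n ≡ k ℕ.* 2 ⊎ n ≡ suc (k ℕ.* 2)) → ℤ.+ n * expand 2 x ! n ≡ ℤ.+ 2 * expand 2 (D x) ! n
    go n (k , inj₁ refl) = trans (cong₂ _*_ (ℤ.pos-* k 2) (expand₂-even x k)) (trans (lemma (ℤ.+ k) (x ! k)) (cong (ℤ.+ 2 *_) (sym (expand₂-even (D x) k))))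
      where
      lemma : ∀ k x → k * ℤ.+ 2 * x ≡ ℤ.+ 2 * (k * x)
      lemma = solve-∀
    go n (k , inj₂ refl) = trans (cong (ℤ.+ suc (k ℕ.* 2) *_) (expand₂-odd x k)) (trans (ℤ.*-zeroʳ (ℤ.+ suc (k ℕ.* 2))) (cong (ℤ.+ 2 *_) (sym (expand₂-odd (D x) k))))

  by-parity : ∀ {x y} → (∀ k → x ! (k ℕ.* 2) ≡ y ! (k ℕ.* 2)) → (∀ k → x ! suc (k ℕ.* 2) ≡ y ! suc (k ℕ.* 2)) → x ≈ y
  by-parity {x} {y} even odd = pointwise λ n → go n (halves n)
    where
    go : ∀ n → (∃ λ k → n ≡ k ℕ.* 2 ⊎ n ≡ suc (k ℕ.* 2)) → x ! n ≡ y ! n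
    go n (k , inj₁ refl) = even k
    go n (k , inj₂ refl) = odd k

  -- The odd coefficients of x(q²) vanish and its coefficient at 2k is that of x at k, which is
  -- earlier for k > 0. Everything is thus forced by the constant term. Several defects of theta
  -- identities and the Hasse invariant are treated in this way.
  expand₂-fixed : ∀ c x → x ≈ const c ⊗ expand 2 x → ℤ.+ m ∣ x ! 0 → x ≈ const 0ℤ
  expand₂-fixed c x fixed x₀ = mk≈ λ n → subst (ℤ.+ m ∣_) (minus-zero n) (vanish n)
    where
    minus-zero : ∀ n → x ! n ≡ x ! n - const 0ℤ ! n
    minus-zero zero = sym (ℤ.+-identityʳ _)
    minus-zero (suc n) = sym (ℤ.+-identityʳ _)
    reduce : ∀ n → ℤ.+ m ∣ expand 2 x ! n → ℤ.+ m ∣ x ! n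
    reduce n d = subst (ℤ.+ m ∣_) (lemma (x ! n) (c * expand 2 x ! n)) (∣m∣n⇒∣m+n
      (subst (λ z → ℤ.+ m ∣ x ! n - z) (scale c (expand 2 x) n) (at fixed n)) (∣n⇒∣m*n c d))
      where
      lemma : ∀ i j → i - j + j ≡ i
      lemma = solve-∀
    vanish : ∀ n → ℤ.+ m ∣ x ! n
    vanish = <-rec _ step
      where
      step : ∀ n → (∀ {i} → i ℕ.< n → ℤ.+ m ∣ x ! i) → ℤ.+ m ∣ x ! n
      step zero _ = x₀
      step n@(suc _) ih = go (halves n)
        where
        go : (∃ λ k → n ≡ k ℕ.* 2 ⊎ n ≡ suc (k ℕ.* 2)) → ℤ.+ m ∣ x ! n
        go (k , inj₁ e) = reduce n (subst (ℤ.+ m ∣_) (sym (trans (cong (expand 2 x !_) e) (expand₂-even x k))) (ih (subst (k ℕ.<_) (sym e) (smaller k e))))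
          where
          smaller : ∀ k → n ≡ k ℕ.* 2 → k ℕ.< k ℕ.* 2
          smaller (suc k) _ = ℕ.m<m*n (suc k) 2 (ℕ.s≤s (ℕ.s≤s ℕ.z≤n))
        go (k , inj₂ e) = reduce n (divides 0ℤ (trans (cong (expand 2 x !_) e) (expand₂-odd x k)))

-- Jacobi's formulas for φ² and φ⁴

module ThetaFunctions where
  open PowerSeries
  open SeriesMaps
  open ThetaAndDivisorSums using (φ; φ-0)
  open ThetaRecurrences using (R₂; R₄; euler₂; euler₄)
  open DivisorSumRelations
  open GaussIdentity using (h; hφ; ≈⇒≡; 1s)
  open import Data.Integer using (ℤ; 0ℤ; 1ℤ; _+_; _*_; -_; _-_)
  import Data.Integer as ℤ
  import Data.Integer.Properties as ℤ
  open import Data.Nat as ℕ using (zero; suc)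
  open import Relation.Binary.PropositionalEquality using (_≡_; refl; sym; trans; cong; cong₂)
  open Mod 0
  open SeriesMapsMod 0
  open import Relation.Binary.Reasoning.Setoid setoid

  two : PS
  two = const (ℤ.+ 2)

  ∇≈0⇒≈ : ∀ {x} → D x ≈ const 0ℤ → x ! 0 ≡ 1ℤ → x ≈ 1s
  ∇≈0⇒≈ {x} Dx x0 = pointwise λ { zero → x0 ; (suc n) → ℤ.*-cancelˡ-≡ (ℤ.+ suc n) (x ! suc n) 0ℤ
    (trans (≈⇒≡ Dx (suc n)) (sym (ℤ.*-zeroʳ (ℤ.+ suc n)))) }

  -- With g = 1/f the recurrence says that R g² has derivative 0, and an integral series with
  -- derivative 0 is constant. The lemma serves for f = φ and then for f = φ².
  euler-unique : ∀ R f g → g ⊗ f ≈ 1s → R ! 0 ≡ 1ℤ → g ! 0 ≡ 1ℤ → D R ⊗ f ≈ two ⊗ (R ⊗ D f) → R ≈ f ⊗ f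
  euler-unique R f g gf R0 g0 rec = begin
    R                          ≈⟨ solve 1 (λ r → r := r :* (con 1ℤ :* con 1ℤ)) ≈-refl R ⟩
    R ⊗ (1s ⊗ 1s)              ≈⟨ ⊗-cong ≈-refl (⊗-cong gf gf) ⟨
    R ⊗ ((g ⊗ f) ⊗ (g ⊗ f))    ≈⟨ solve 3 (λ r f g → r :* ((g :* f) :* (g :* f)) := (r :* (g :* g)) :* (f :* f)) ≈-refl R f g ⟩
    (R ⊗ (g ⊗ g)) ⊗ (f ⊗ f)    ≈⟨ ⊗-cong quotient≈1 ≈-refl ⟩
    1s ⊗ (f ⊗ f)               ≈⟨ solve 1 (λ x → con 1ℤ :* x := x) ≈-refl (f ⊗ f) ⟩
    f ⊗ f                      ∎
    where
    Dgf : D g ⊗ f ⊕ g ⊗ D f ≈ const 0ℤ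
    Dgf = ≈-trans (≈-sym (D-product g f)) (≈-trans (D-cong gf) (D-const 1ℤ))
    Dg : D g ≈ ⊝ (g ⊗ g ⊗ D f)
    Dg = begin
      D g                                       ≈⟨ solve 1 (λ x → x := x :* con 1ℤ) ≈-refl (D g) ⟩
      D g ⊗ 1s                                  ≈⟨ ⊗-cong ≈-refl gf ⟨
      D g ⊗ (g ⊗ f)                             ≈⟨ solve 4 (λ d g f e → d :* (g :* f) := g :* (d :* f :+ g :* e) :+ :- (g :* g :* e)) ≈-refl (D g) g f (D f) ⟩
      g ⊗ (D g ⊗ f ⊕ g ⊗ D f) ⊕ ⊝ (g ⊗ g ⊗ D f) ≈⟨ ⊕-cong (⊗-cong ≈-refl Dgf) ≈-refl ⟩
      g ⊗ const 0ℤ ⊕ ⊝ (g ⊗ g ⊗ D f)            ≈⟨ solve 2 (λ g x → g :* con 0ℤ :+ :- x := :- x) ≈-refl g (g ⊗ g ⊗ D f) ⟩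
      ⊝ (g ⊗ g ⊗ D f)                           ∎
    DR : D R ≈ g ⊗ (two ⊗ (R ⊗ D f))
    DR = begin
      D R                       ≈⟨ solve 1 (λ x → x := con 1ℤ :* x) ≈-refl (D R) ⟩
      1s ⊗ D R                  ≈⟨ ⊗-cong gf ≈-refl ⟨
      g ⊗ f ⊗ D R               ≈⟨ solve 3 (λ g f x → g :* f :* x := g :* (x :* f)) ≈-refl g f (D R) ⟩
      g ⊗ (D R ⊗ f)             ≈⟨ ⊗-cong ≈-refl rec ⟩
      g ⊗ (two ⊗ (R ⊗ D f))     ∎
    quotient≈1 : R ⊗ (g ⊗ g) ≈ 1s
    quotient≈1 = ∇≈0⇒≈ (begin
      D (R ⊗ (g ⊗ g))                              ≈⟨ D-product R (g ⊗ g) ⟩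
      D R ⊗ (g ⊗ g) ⊕ R ⊗ D (g ⊗ g)                ≈⟨ ⊕-cong (⊗-cong DR ≈-refl) (⊗-cong ≈-refl (≈-trans (D-product g g) (⊕-cong (⊗-cong Dg ≈-refl) (⊗-cong ≈-refl Dg)))) ⟩
      g ⊗ (two ⊗ (R ⊗ D f)) ⊗ (g ⊗ g) ⊕ R ⊗ (⊝ (g ⊗ g ⊗ D f) ⊗ g ⊕ g ⊗ ⊝ (g ⊗ g ⊗ D f))
        ≈⟨ solve 3 (λ g r d → g :* (con (ℤ.+ 2) :* (r :* d)) :* (g :* g) :+ r :* ((:- (g :* g :* d)) :* g :+ g :* (:- (g :* g :* d))) := con 0ℤ) ≈-refl g R (D f) ⟩
      const 0ℤ ∎)
      (trans (cong₂ _*_ R0 (cong₂ _*_ g0 g0)) refl)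

  -- In Jacobi's notation u = θ₃², v = θ₄², a = θ₃⁴, b = θ₄⁴ and c = θ₂⁴; the quotient c/a is the
  -- modular function λ.
  u v a b c : PS
  u = R₂
  v = twist u
  a = u ⊗ u
  b = v ⊗ v
  c = a ⊕ ⊝ b

  h-0 : h ! 0 ≡ 1ℤ
  h-0 = trans (sym (ℤ.*-identityʳ (h ! 0))) (trans (cong (h ! 0 *_) (sym φ-0)) (≈⇒≡ hφ 0))

  two-squares : u ≈ φ ⊗ φ
  two-squares = euler-unique u φ h hφ refl h-0 (pointwise λ n → ℤ.i-j≡0⇒i≡j _ _
    (trans (cong (λ z → (D u ⊗ φ) ! n - z) (scale (ℤ.+ 2) (u ⊗ D φ) n)) (euler₂ n)))

  four-squares : R₄ ≈ a
  four-squares = euler-unique R₄ u (h ⊗ h) (begin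
      h ⊗ h ⊗ u             ≈⟨ ⊗-cong ≈-refl two-squares ⟩
      h ⊗ h ⊗ (φ ⊗ φ)       ≈⟨ solve 2 (λ h f → h :* h :* (f :* f) := (h :* f) :* (h :* f)) ≈-refl h φ ⟩
      (h ⊗ φ) ⊗ (h ⊗ φ)     ≈⟨ ⊗-cong hφ hφ ⟩
      1s ⊗ 1s               ≈⟨ solve 0 (con 1ℤ :* con 1ℤ := con 1ℤ) ≈-refl ⟩
      1s                    ∎)
    refl (cong₂ _*_ h-0 h-0) (begin
      D R₄ ⊗ u                              ≈⟨ ⊗-cong ≈-refl two-squares ⟩
      D R₄ ⊗ (φ ⊗ φ)                        ≈⟨ solve 2 (λ x f → x :* (f :* f) := x :* f :* f) ≈-refl (D R₄) φ ⟩
      D R₄ ⊗ φ ⊗ φ                          ≈⟨ ⊗-cong rec ≈-refl ⟩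
      const (ℤ.+ 4) ⊗ (R₄ ⊗ D φ) ⊗ φ        ≈⟨ solve 3 (λ r f d → con (ℤ.+ 4) :* (r :* d) :* f := con (ℤ.+ 2) :* (r :* (d :* f :+ f :* d))) ≈-refl R₄ φ (D φ) ⟩
      two ⊗ (R₄ ⊗ (D φ ⊗ φ ⊕ φ ⊗ D φ))      ≈⟨ ⊗-cong ≈-refl (⊗-cong ≈-refl (≈-trans (D-cong two-squares) (D-product φ φ))) ⟨
      two ⊗ (R₄ ⊗ D u)                      ∎)
    where
    rec : D R₄ ⊗ φ ≈ const (ℤ.+ 4) ⊗ (R₄ ⊗ D φ)
    rec = pointwise λ n → ℤ.i-j≡0⇒i≡j _ _ (trans (cong (λ z → (D R₄ ⊗ φ) ! n - z) (scale (ℤ.+ 4) (R₄ ⊗ D φ) n)) (euler₄ n))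

-- Landen's transformation and Jacobi's derivative formula

module LandenTransformation where
  open PowerSeries
  open SeriesMaps
  open ThetaAndDivisorSums using (lambert)
  open ThetaRecurrences using (R₄)
  open DivisorSumRelations
  open GaussIdentity using (≈⇒≡)
  open RiverIdentities using (χ)
  open import Data.Integer using (ℤ; 0ℤ; 1ℤ; _+_; _*_; -_; _-_)
  import Data.Integer as ℤ
  import Data.Integer.Properties as ℤ
  open import Data.Integer.Tactic.RingSolver using (solve-∀)
  open import Data.Nat as ℕ using (ℕ; zero; suc)
  open import Data.Nat.Induction using (<-rec)
  import Data.Nat.Properties as ℕ
  open import Data.Product using (∃; _,_)
  open import Data.Sum using (_⊎_; inj₁; inj₂)
  open import Function using (id)
  open import Relation.Binary.PropositionalEquality using (_≡_; refl; sym; trans; cong; cong₂)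
  open Mod 0
  open SeriesMapsMod 0
  open ThetaFunctions
  open import Relation.Binary.Reasoning.Setoid setoid

  S V : PS
  S = expand 2 u
  V = expand 2 v

  sign-even : ∀ k → sign (k ℕ.* 2) ≡ 1ℤ
  sign-even zero = refl
  sign-even (suc k) = trans (ℤ.neg-involutive _) (sign-even k)

  const-even : ∀ z k → const z ! (k ℕ.* 2) ≡ const z ! k
  const-even z zero = refl
  const-even z (suc k) = refl

  u-even : ∀ k → u ! (k ℕ.* 2) ≡ u ! k
  u-even k = cong₂ _+_ (const-even 1ℤ k) (trans (mulF-const (ℤ.+ 4) (lambert 1 χ !_) (k ℕ.* 2))
    (trans (cong (ℤ.+ 4 *_) (χ-double k)) (sym (mulF-const (ℤ.+ 4) (lambert 1 χ !_) k))))

  -- The even coefficients satisfy r₂(2n) = r₂(n), by `χ-double`. Together with `geometric-mean`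
  -- this says that q ↦ q² performs one step of the arithmetic-geometric mean on (u, v).
  landen : u ⊕ v ≈ two ⊗ S
  landen = by-parity
    (λ k → trans (trans (cong (λ s → u ! (k ℕ.* 2) + s * u ! (k ℕ.* 2)) (sign-even k)) (trans (lemma (u ! (k ℕ.* 2))) (cong (ℤ.+ 2 *_) (trans (u-even k) (sym (expand₂-even u k))))))
      (sym (scale (ℤ.+ 2) S (k ℕ.* 2))))
    (λ k → trans (trans (cong (λ s → u ! suc (k ℕ.* 2) + - s * u ! suc (k ℕ.* 2)) (sign-even k)) (lemma₂ (u ! suc (k ℕ.* 2))))
      (sym (trans (scale (ℤ.+ 2) S (suc (k ℕ.* 2))) (cong (ℤ.+ 2 *_) (expand₂-odd u k)))))
    where
    lemma : ∀ x → x + 1ℤ * x ≡ ℤ.+ 2 * x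
    lemma = solve-∀
    lemma₂ : ∀ x → x + - 1ℤ * x ≡ ℤ.+ 2 * 0ℤ
    lemma₂ = solve-∀

  private
    l₁ l₂ l₄ : ℕ → ℤ
    l₁ n = lambert 1 id ! n
    l₂ n = lambert 2 id ! n
    l₄ n = lambert 4 id ! n

  R₄-coefficient : ∀ n → R₄ ! n ≡ const 1ℤ ! n + (ℤ.+ 8 * l₁ n + - ℤ.+ 32 * l₄ n)
  R₄-coefficient n = cong (const 1ℤ ! n +_) (cong₂ _+_ (mulF-const (ℤ.+ 8) (lambert 1 id !_) n) (mulF-const (- ℤ.+ 32) (lambert 4 id !_) n))

  l₂-even : ∀ k → l₂ (k ℕ.* 2) ≡ l₁ k
  l₂-even k = trans (lambert-expand 2 1 id (k ℕ.* 2)) (expand₂-even (lambert 1 id) k)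
  l₄-even : ∀ k → l₄ (k ℕ.* 2) ≡ l₂ k
  l₄-even k = trans (lambert-expand 2 2 id (k ℕ.* 2)) (expand₂-even (lambert 2 id) k)
  l₂-odd : ∀ k → l₂ (suc (k ℕ.* 2)) ≡ 0ℤ
  l₂-odd k = trans (lambert-expand 2 1 id (suc (k ℕ.* 2))) (expand₂-odd (lambert 1 id) k)
  l₄-odd : ∀ k → l₄ (suc (k ℕ.* 2)) ≡ 0ℤ
  l₄-odd k = trans (lambert-expand 2 2 id (suc (k ℕ.* 2))) (expand₂-odd (lambert 2 id) k)

  R₄-even : ∀ k → R₄ ! (k ℕ.* 2) ≡ const 1ℤ ! k + (ℤ.+ 8 * (ℤ.+ 3 * l₁ k - ℤ.+ 2 * l₂ k) + - ℤ.+ 32 * l₂ k)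
  R₄-even k = trans (R₄-coefficient (k ℕ.* 2)) (cong₂ _+_ (const-even 1ℤ k) (cong₂ (λ x y → ℤ.+ 8 * x + - ℤ.+ 32 * y) (σ-double k) (l₄-even k)))

  -- The factor 2 - (-1)^k is 3 for odd k, where σ(2k) = 3σ(k) is all that counts, and 1 for even k,
  -- where the terms σ(k/2) and σ(k/4) intervene.
  R₄-even-sign : ∀ k → R₄ ! (k ℕ.* 2) ≡ ℤ.+ 2 * R₄ ! k - sign k * R₄ ! k
  R₄-even-sign k = trans (R₄-even k) (go (halves k))
    where
    go : (∃ λ j → k ≡ j ℕ.* 2 ⊎ k ≡ suc (j ℕ.* 2)) →
      const 1ℤ ! k + (ℤ.+ 8 * (ℤ.+ 3 * l₁ k - ℤ.+ 2 * l₂ k) + - ℤ.+ 32 * l₂ k) ≡ ℤ.+ 2 * R₄ ! k - sign k * R₄ ! k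
    go (j , inj₁ refl) = trans (cong₂ _+_ (const-even 1ℤ j) (cong₂ (λ x y → ℤ.+ 8 * (ℤ.+ 3 * x - ℤ.+ 2 * y) + - ℤ.+ 32 * y) (σ-double j) (l₂-even j)))
      (trans (lemma (const 1ℤ ! j) (l₁ j) (l₂ j)) (cong₂ (λ r s → ℤ.+ 2 * r - s * r) (sym (R₄-even j)) (sym (sign-even j))))
      where
      lemma : ∀ o x y → o + (ℤ.+ 8 * (ℤ.+ 3 * (ℤ.+ 3 * x - ℤ.+ 2 * y) - ℤ.+ 2 * x) + - ℤ.+ 32 * x)
        ≡ ℤ.+ 2 * (o + (ℤ.+ 8 * (ℤ.+ 3 * x - ℤ.+ 2 * y) + - ℤ.+ 32 * y)) - 1ℤ * (o + (ℤ.+ 8 * (ℤ.+ 3 * x - ℤ.+ 2 * y) + - ℤ.+ 32 * y))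
      lemma = solve-∀
    go (j , inj₂ refl) = trans (cong (λ y → 0ℤ + (ℤ.+ 8 * (ℤ.+ 3 * l₁ k - ℤ.+ 2 * y) + - ℤ.+ 32 * y)) (l₂-odd j))
      (trans (lemma (l₁ k)) (cong₂ (λ r s → ℤ.+ 2 * r - - s * r) (sym (trans (R₄-coefficient k) (cong (λ y → 0ℤ + (ℤ.+ 8 * l₁ k + - ℤ.+ 32 * y)) (l₄-odd j)))) (sym (sign-even j))))
      where
      lemma : ∀ x → 0ℤ + (ℤ.+ 8 * (ℤ.+ 3 * x - ℤ.+ 2 * 0ℤ) + - ℤ.+ 32 * 0ℤ) ≡ ℤ.+ 2 * (0ℤ + (ℤ.+ 8 * x + - ℤ.+ 32 * 0ℤ)) - - 1ℤ * (0ℤ + (ℤ.+ 8 * x + - ℤ.+ 32 * 0ℤ))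
      lemma = solve-∀

  b-twist : b ≈ twist R₄
  b-twist = ≈-trans (≈-sym (pointwise (twist-⊗ u u))) (twist-cong (≈-sym four-squares))

  -- a + b is twice the even part of a, which `R₄-even-sign` describes; the sign (-1)^k in that rule
  -- is the twist and accounts for the term in b(q²).
  even-part-a : a ⊕ b ≈ const (ℤ.+ 4) ⊗ expand 2 a ⊕ ⊝ (two ⊗ expand 2 b)
  even-part-a = ≈-trans (⊕-cong (≈-sym four-squares) b-twist) (≈-trans (by-parity even odd)
    (⊕-cong (⊗-cong ≈-refl (expand-≈ 2 four-squares)) (⊝-cong (⊗-cong ≈-refl (expand-≈ 2 (≈-sym b-twist))))))
    where
    rhs : ∀ n → (const (ℤ.+ 4) ⊗ expand 2 R₄ ⊕ ⊝ (two ⊗ expand 2 (twist R₄))) ! n ≡ ℤ.+ 4 * expand 2 R₄ ! n - ℤ.+ 2 * expand 2 (twist R₄) ! n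
    rhs n = cong₂ _-_ (scale (ℤ.+ 4) (expand 2 R₄) n) (scale (ℤ.+ 2) (expand 2 (twist R₄)) n)
    even : ∀ k → R₄ ! (k ℕ.* 2) + sign (k ℕ.* 2) * R₄ ! (k ℕ.* 2) ≡ _
    even k = trans (cong₂ (λ r s → r + s * r) (R₄-even-sign k) (sign-even k)) (trans (lemma (R₄ ! k) (sign k))
      (sym (trans (rhs (k ℕ.* 2)) (cong₂ (λ x y → ℤ.+ 4 * x - ℤ.+ 2 * y) (expand₂-even R₄ k) (expand₂-even (twist R₄) k)))))
      where
      lemma : ∀ r s → ℤ.+ 2 * r - s * r + 1ℤ * (ℤ.+ 2 * r - s * r) ≡ ℤ.+ 4 * r - ℤ.+ 2 * (s * r)
      lemma = solve-∀
    odd : ∀ k → R₄ ! suc (k ℕ.* 2) + sign (suc (k ℕ.* 2)) * R₄ ! suc (k ℕ.* 2) ≡ _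
    odd k = trans (cong (λ s → R₄ ! suc (k ℕ.* 2) + - s * R₄ ! suc (k ℕ.* 2)) (sign-even k)) (trans (lemma (R₄ ! suc (k ℕ.* 2)))
      (sym (trans (rhs (suc (k ℕ.* 2))) (cong₂ (λ x y → ℤ.+ 4 * x - ℤ.+ 2 * y) (expand₂-odd R₄ k) (expand₂-odd (twist R₄) k)))))
      where
      lemma : ∀ r → r + - 1ℤ * r ≡ ℤ.+ 4 * 0ℤ - ℤ.+ 2 * 0ℤ
      lemma = solve-∀

  cancel-two : ∀ {x y} → two ⊗ x ≈ two ⊗ y → x ≈ y
  cancel-two {x} {y} e = pointwise λ n → ℤ.*-cancelˡ-≡ (ℤ.+ 2) (x ! n) (y ! n)
    (trans (sym (scale (ℤ.+ 2) x n)) (trans (≈⇒≡ e n) (scale (ℤ.+ 2) y n)))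

  VV : expand 2 b ≈ V ⊗ V
  VV = expand-product 2 v v

  -- By polarisation 2uv = (u + v)² - (u² + v²); the first square is known from `landen`, the second
  -- sum from `even-part-a`.
  geometric-mean : u ⊗ v ≈ V ⊗ V
  geometric-mean = ≈-trans (cancel-two (begin
    two ⊗ (u ⊗ v)
      ≈⟨ solve 2 (λ u v → con (ℤ.+ 2) :* (u :* v) := (u :+ v) :* (u :+ v) :+ :- (u :* u :+ v :* v)) ≈-refl u v ⟩
    (u ⊕ v) ⊗ (u ⊕ v) ⊕ ⊝ (a ⊕ b)
      ≈⟨ ⊕-cong (⊗-cong landen landen) (⊝-cong even-part-a) ⟩
    two ⊗ S ⊗ (two ⊗ S) ⊕ ⊝ (const (ℤ.+ 4) ⊗ expand 2 a ⊕ ⊝ (two ⊗ expand 2 b))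
      ≈⟨ ⊕-cong ≈-refl (⊝-cong (⊕-cong (⊗-cong ≈-refl (expand-product 2 u u)) ≈-refl)) ⟩
    two ⊗ S ⊗ (two ⊗ S) ⊕ ⊝ (const (ℤ.+ 4) ⊗ (S ⊗ S) ⊕ ⊝ (two ⊗ expand 2 b))
      ≈⟨ solve 2 (λ s x → con (ℤ.+ 2) :* s :* (con (ℤ.+ 2) :* s) :+ :- (con (ℤ.+ 4) :* (s :* s) :+ :- (con (ℤ.+ 2) :* x)) := con (ℤ.+ 2) :* x) ≈-refl S (expand 2 b) ⟩
    two ⊗ expand 2 b ∎)) VV

  -- The defect of D log(u/v) = c/2, cleared of denominators.
  e : PS
  e = two ⊗ (v ⊗ D u ⊕ ⊝ (u ⊗ D v)) ⊕ ⊝ (u ⊗ v ⊗ (a ⊕ ⊝ b))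

  private
    U′ V′ : PS
    U′ = expand 2 (D u)
    V′ = expand 2 (D v)

    D-landen : D u ⊕ D v ≈ const (ℤ.+ 4) ⊗ U′
    D-landen = begin
      D u ⊕ D v                      ≈⟨ D-⊕ u v ⟨
      D (u ⊕ v)                      ≈⟨ D-cong landen ⟩
      D (two ⊗ S)                    ≈⟨ D-scale (ℤ.+ 2) S ⟩
      two ⊗ D S                      ≈⟨ ⊗-cong ≈-refl (D-expand₂ u) ⟩
      two ⊗ (two ⊗ U′)               ≈⟨ solve 1 (λ x → con (ℤ.+ 2) :* (con (ℤ.+ 2) :* x) := con (ℤ.+ 4) :* x) ≈-refl U′ ⟩
      const (ℤ.+ 4) ⊗ U′             ∎

    D-geometric : D u ⊗ v ⊕ u ⊗ D v ≈ const (ℤ.+ 4) ⊗ (V ⊗ V′)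
    D-geometric = begin
      D u ⊗ v ⊕ u ⊗ D v              ≈⟨ D-product u v ⟨
      D (u ⊗ v)                      ≈⟨ D-cong geometric-mean ⟩
      D (V ⊗ V)                      ≈⟨ D-product V V ⟩
      D V ⊗ V ⊕ V ⊗ D V              ≈⟨ ⊕-cong (⊗-cong (D-expand₂ v) ≈-refl) (⊗-cong ≈-refl (D-expand₂ v)) ⟩
      two ⊗ V′ ⊗ V ⊕ V ⊗ (two ⊗ V′)  ≈⟨ solve 2 (λ x y → con (ℤ.+ 2) :* y :* x :+ x :* (con (ℤ.+ 2) :* y) := con (ℤ.+ 4) :* (x :* y)) ≈-refl V V′ ⟩
      const (ℤ.+ 4) ⊗ (V ⊗ V′)       ∎

    expand-e : expand 2 e ≈ two ⊗ (V ⊗ U′ ⊕ ⊝ (S ⊗ V′)) ⊕ ⊝ (S ⊗ V ⊗ (S ⊗ S ⊕ ⊝ (V ⊗ V)))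
    expand-e = ≈-trans (expand-sum 2 _ _) (⊕-cong
      (≈-trans (expand-product 2 two _) (⊗-cong (expand-constant 2 (ℤ.+ 2)) (≈-trans (expand-sum 2 _ _) (⊕-cong (expand-product 2 v (D u)) (≈-trans (expand-neg 2 _) (⊝-cong (expand-product 2 u (D v))))))))
      (≈-trans (expand-neg 2 _) (⊝-cong (≈-trans (expand-product 2 (u ⊗ v) _) (⊗-cong (expand-product 2 u v)
        (≈-trans (expand-sum 2 a (⊝ b)) (⊕-cong (expand-product 2 u u) (≈-trans (expand-neg 2 b) (⊝-cong VV)))))))))

  -- Differentiating both relations of the arithmetic-geometric mean expresses e(q²) through u, v
  -- and their derivatives. Since u - v begins with 8q, the coefficient of degree n + 1 determines e
  -- at n from its values at most at (n + 1)/2, which are earlier once n is at least 2.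
  descent : (u ⊕ ⊝ v) ⊗ e ≈ const (ℤ.+ 8) ⊗ (V ⊗ expand 2 e)
  descent = ≈-sym (begin
    const (ℤ.+ 8) ⊗ (V ⊗ expand 2 e)
      ≈⟨ ⊗-cong ≈-refl (⊗-cong ≈-refl expand-e) ⟩
    const (ℤ.+ 8) ⊗ (V ⊗ (two ⊗ (V ⊗ U′ ⊕ ⊝ (S ⊗ V′)) ⊕ ⊝ (S ⊗ V ⊗ (S ⊗ S ⊕ ⊝ (V ⊗ V)))))
      ≈⟨ solve 4 (λ s v x y → con (ℤ.+ 8) :* (v :* (con (ℤ.+ 2) :* (v :* x :+ :- (s :* y)) :+ :- (s :* v :* (s :* s :+ :- (v :* v)))))
           := con (ℤ.+ 4) :* (v :* v) :* (con (ℤ.+ 4) :* x) :+ :- (con (ℤ.+ 2) :* (con (ℤ.+ 2) :* s) :* (con (ℤ.+ 4) :* (v :* y)))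
              :+ :- ((con (ℤ.+ 2) :* s) :* (v :* v) :* ((con (ℤ.+ 2) :* s) :* (con (ℤ.+ 2) :* s) :+ :- (con (ℤ.+ 4) :* (v :* v))))) ≈-refl S V U′ V′ ⟩
    const (ℤ.+ 4) ⊗ (V ⊗ V) ⊗ (const (ℤ.+ 4) ⊗ U′) ⊕ ⊝ (two ⊗ (two ⊗ S) ⊗ (const (ℤ.+ 4) ⊗ (V ⊗ V′)))
      ⊕ ⊝ (two ⊗ S ⊗ (V ⊗ V) ⊗ (two ⊗ S ⊗ (two ⊗ S) ⊕ ⊝ (const (ℤ.+ 4) ⊗ (V ⊗ V))))
      ≈⟨ ⊕-cong (⊕-cong (⊗-cong (⊗-cong ≈-refl geometric-mean) D-landen) (⊝-cong (⊗-cong (⊗-cong ≈-refl landen) D-geometric)))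
           (⊝-cong (⊗-cong (⊗-cong landen geometric-mean) (⊕-cong (⊗-cong landen landen) (⊝-cong (⊗-cong ≈-refl geometric-mean))))) ⟨
    const (ℤ.+ 4) ⊗ (u ⊗ v) ⊗ (D u ⊕ D v) ⊕ ⊝ (two ⊗ (u ⊕ v) ⊗ (D u ⊗ v ⊕ u ⊗ D v))
      ⊕ ⊝ ((u ⊕ v) ⊗ (u ⊗ v) ⊗ ((u ⊕ v) ⊗ (u ⊕ v) ⊕ ⊝ (const (ℤ.+ 4) ⊗ (u ⊗ v))))
      ≈⟨ solve 4 (λ u v x y → con (ℤ.+ 4) :* (u :* v) :* (x :+ y) :+ :- (con (ℤ.+ 2) :* (u :+ v) :* (x :* v :+ u :* y))
           :+ :- ((u :+ v) :* (u :* v) :* ((u :+ v) :* (u :+ v) :+ :- (con (ℤ.+ 4) :* (u :* v))))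
           := (u :+ :- v) :* (con (ℤ.+ 2) :* (v :* x :+ :- (u :* y)) :+ :- (u :* v :* (u :* u :+ :- (v :* v))))) ≈-refl u v (D u) (D v) ⟩
    (u ⊕ ⊝ v) ⊗ e ∎)

  private
    lower : ∀ x (w : ℕ → ℤ) n → (∀ i → i ℕ.≤ n → w i ≡ 0ℤ) → mulF x w n ≡ 0ℤ
    lower x w n p = trans (mulF-cong n (λ _ _ → refl) p) (trans (mulF-comm x (λ _ → 0ℤ) n) (mulF-zeroˡ x n))

    top : ∀ x (w : ℕ → ℤ) n → (∀ i → i ℕ.< n → w i ≡ 0ℤ) → mulF x w n ≡ x 0 * w n
    top x w zero p = refl
    top x w (suc n) p = trans (cong (x 0 * w (suc n) +_) (lower (tailF x) w n (λ i i≤n → p i (ℕ.s≤s i≤n)))) (ℤ.+-identityʳ _)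

  -- Jacobi's derivative formula: by descent along q ↦ q² every coefficient of e vanishes.
  jacobi-derivative : e ≈ const 0ℤ
  jacobi-derivative = pointwise λ n → trans (vanish n) (sym (zeros n))
    where
    zeros : ∀ n → const 0ℤ ! n ≡ 0ℤ
    zeros zero = refl
    zeros (suc _) = refl
    w : PS
    w = u ⊕ ⊝ v
    vanish : ∀ n → e ! n ≡ 0ℤ
    vanish = <-rec _ step
      where
      step : ∀ n → (∀ {i} → i ℕ.< n → e ! i ≡ 0ℤ) → e ! n ≡ 0ℤ
      step 0 _ = refl
      step 1 _ = refl
      step n@(suc (suc k)) ih = ℤ.*-cancelˡ-≡ (ℤ.+ 8) (e ! n) 0ℤ (trans (sym (trans (ℤ.+-identityˡ _)
          (top (tailF (w !_)) (e !_) n (λ i i<n → ih i<n))))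
        (trans (≈⇒≡ descent (suc n)) (trans (scale (ℤ.+ 8) (V ⊗ expand 2 e) (suc n)) (cong (ℤ.+ 8 *_) (lower (V !_) (expand 2 e !_) (suc n) early)))))
        where
        early : ∀ i → i ℕ.≤ suc n → expand 2 e ! i ≡ 0ℤ
        early i p = go (halves i)
          where
          go : (∃ λ j → i ≡ j ℕ.* 2 ⊎ i ≡ suc (j ℕ.* 2)) → expand 2 e ! i ≡ 0ℤ
          go (j , inj₁ refl) = trans (expand₂-even e j) (ih (bound j p))
            where
            bound : ∀ j → j ℕ.* 2 ℕ.≤ suc (suc (suc k)) → j ℕ.< suc (suc k)
            bound zero _ = ℕ.s≤s ℕ.z≤n
            bound (suc zero) _ = ℕ.s≤s (ℕ.s≤s ℕ.z≤n)
            bound (suc (suc j)) (ℕ.s≤s (ℕ.s≤s (ℕ.s≤s q))) = ℕ.s≤s (ℕ.s≤s (ℕ.≤-trans (ℕ.s≤s (ℕ.m≤m*n j 2)) q))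
          go (j , inj₂ refl) = expand₂-odd e j

  wronskian : two ⊗ (v ⊗ D u ⊕ ⊝ (u ⊗ D v)) ≈ u ⊗ v ⊗ (a ⊕ ⊝ b)
  wronskian = begin
    two ⊗ (v ⊗ D u ⊕ ⊝ (u ⊗ D v))
      ≈⟨ solve 2 (λ x y → x := (x :+ :- y) :+ y) ≈-refl (two ⊗ (v ⊗ D u ⊕ ⊝ (u ⊗ D v))) (u ⊗ v ⊗ (a ⊕ ⊝ b)) ⟩
    e ⊕ u ⊗ v ⊗ (a ⊕ ⊝ b)
      ≈⟨ ⊕-cong jacobi-derivative ≈-refl ⟩
    const 0ℤ ⊕ u ⊗ v ⊗ (a ⊕ ⊝ b)
      ≈⟨ solve 1 (λ y → con 0ℤ :+ y := y) ≈-refl (u ⊗ v ⊗ (a ⊕ ⊝ b)) ⟩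
    u ⊗ v ⊗ (a ⊕ ⊝ b) ∎

  -- Equivalent to Dλ = bλ for λ = c/a. This relation is what makes q d/dq computable on monomials
  -- in u and c.
  D-c : u ⊗ D c ≈ two ⊗ c ⊗ D u ⊕ u ⊗ b ⊗ c
  D-c = begin
    u ⊗ D c
      ≈⟨ ⊗-cong ≈-refl (≈-trans (D-⊕ a (⊝ b)) (⊕-cong (D-product u u) (≈-trans (D-⊝ b) (⊝-cong (D-product v v))))) ⟩
    u ⊗ (D u ⊗ u ⊕ u ⊗ D u ⊕ ⊝ (D v ⊗ v ⊕ v ⊗ D v))
      ≈⟨ solve 4 (λ u v x y → u :* (x :* u :+ u :* x :+ :- (y :* v :+ v :* y)) := con (ℤ.+ 2) :* (u :* u :+ :- (v :* v)) :* x :+ v :* (con (ℤ.+ 2) :* (v :* x :+ :- (u :* y)))) ≈-refl u v (D u) (D v) ⟩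
    two ⊗ c ⊗ D u ⊕ v ⊗ (two ⊗ (v ⊗ D u ⊕ ⊝ (u ⊗ D v)))
      ≈⟨ ⊕-cong ≈-refl (⊗-cong ≈-refl wronskian) ⟩
    two ⊗ c ⊗ D u ⊕ v ⊗ (u ⊗ v ⊗ (a ⊕ ⊝ b))
      ≈⟨ solve 4 (λ x u v c → x :+ v :* (u :* v :* c) := x :+ u :* (v :* v) :* c) ≈-refl (two ⊗ c ⊗ D u) u v c ⟩
    two ⊗ c ⊗ D u ⊕ u ⊗ b ⊗ c ∎

-- E₂ and E₄ in terms of theta functions

module EisensteinSeries where
  open PowerSeries
  open SeriesMaps
  open HeckeRelations using (cube)
  open ThetaAndDivisorSums using (lambert)
  open ThetaRecurrences using (R₄)
  open DivisorSumRelations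
  open DivisorSumConvolution using (σ; convolution)
  open GaussIdentity using (h; hφ; cancelˡ; 1s)
  open import Data.Integer using (ℤ; 0ℤ; 1ℤ; _+_; _*_; -_; _-_)
  import Data.Integer as ℤ
  import Data.Integer.Properties as ℤ
  open import Data.Integer.Divisibility.Signed using (divides)
  open import Data.Integer.Tactic.RingSolver using (solve-∀)
  open import Data.Nat as ℕ using (ℕ; suc)
  open import Function using (id)
  open import Relation.Binary.PropositionalEquality using (_≡_; refl; sym; trans; cong; cong₂)
  open Mod 0
  open SeriesMapsMod 0
  open ThetaFunctions
  open LandenTransformation
  open import Relation.Binary.Reasoning.Setoid setoid

  cancel-u : ∀ {x y} → u ⊗ x ≈ u ⊗ y → x ≈ y
  cancel-u = cancelˡ u refl

  1/u : PS
  1/u = h ⊗ h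

  u/u : u ⊗ 1/u ≈ 1s
  u/u = begin
    u ⊗ (h ⊗ h)           ≈⟨ ⊗-cong two-squares ≈-refl ⟩
    ThetaAndDivisorSums.φ ⊗ ThetaAndDivisorSums.φ ⊗ (h ⊗ h)
      ≈⟨ solve 2 (λ f h → f :* f :* (h :* h) := (h :* f) :* (h :* f)) ≈-refl ThetaAndDivisorSums.φ h ⟩
    (h ⊗ ThetaAndDivisorSums.φ) ⊗ (h ⊗ ThetaAndDivisorSums.φ) ≈⟨ ⊗-cong hφ hφ ⟩
    1s ⊗ 1s               ≈⟨ solve 0 (con 1ℤ :* con 1ℤ := con 1ℤ) ≈-refl ⟩
    1s                    ∎

  -- The logarithmic derivative of φ⁴.
  A A₂ : PS
  A = two ⊗ (D u ⊗ 1/u)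
  A₂ = expand 2 A

  uA : u ⊗ A ≈ two ⊗ D u
  uA = begin
    u ⊗ (two ⊗ (D u ⊗ 1/u))     ≈⟨ solve 3 (λ u d g → u :* (con (ℤ.+ 2) :* (d :* g)) := (u :* g) :* (con (ℤ.+ 2) :* d)) ≈-refl u (D u) 1/u ⟩
    (u ⊗ 1/u) ⊗ (two ⊗ D u)     ≈⟨ ⊗-cong u/u ≈-refl ⟩
    1s ⊗ (two ⊗ D u)            ≈⟨ solve 1 (λ x → con 1ℤ :* x := x) ≈-refl (two ⊗ D u) ⟩
    two ⊗ D u                   ∎

  D-a : D a ≈ a ⊗ A
  D-a = begin
    D a                      ≈⟨ D-product u u ⟩
    D u ⊗ u ⊕ u ⊗ D u        ≈⟨ solve 2 (λ u d → d :* u :+ u :* d := u :* (con (ℤ.+ 2) :* d)) ≈-refl u (D u) ⟩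
    u ⊗ (two ⊗ D u)          ≈⟨ ⊗-cong ≈-refl uA ⟨
    u ⊗ (u ⊗ A)              ≈⟨ solve 2 (λ u x → u :* (u :* x) := u :* u :* x) ≈-refl u A ⟩
    a ⊗ A                    ∎

  D-c′ : D c ≈ c ⊗ (A ⊕ b)
  D-c′ = cancel-u (begin
    u ⊗ D c                            ≈⟨ D-c ⟩
    two ⊗ c ⊗ D u ⊕ u ⊗ b ⊗ c          ≈⟨ solve 4 (λ u b c d → con (ℤ.+ 2) :* c :* d :+ u :* b :* c := c :* (con (ℤ.+ 2) :* d) :+ u :* b :* c) ≈-refl u b c (D u) ⟩
    c ⊗ (two ⊗ D u) ⊕ u ⊗ b ⊗ c        ≈⟨ ⊕-cong (⊗-cong ≈-refl uA) ≈-refl ⟨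
    c ⊗ (u ⊗ A) ⊕ u ⊗ b ⊗ c            ≈⟨ solve 4 (λ u b c x → c :* (u :* x) :+ u :* b :* c := u :* (c :* (x :+ b))) ≈-refl u b c A ⟩
    u ⊗ (c ⊗ (A ⊕ b))                  ∎)

  twoDv : two ⊗ D v ≈ v ⊗ A ⊕ ⊝ (v ⊗ c)
  twoDv = cancel-u (begin
    u ⊗ (two ⊗ D v)
      ≈⟨ solve 4 (λ u v x y → u :* (con (ℤ.+ 2) :* y) := v :* (con (ℤ.+ 2) :* x) :+ :- (con (ℤ.+ 2) :* (v :* x :+ :- (u :* y)))) ≈-refl u v (D u) (D v) ⟩
    v ⊗ (two ⊗ D u) ⊕ ⊝ (two ⊗ (v ⊗ D u ⊕ ⊝ (u ⊗ D v)))
      ≈⟨ ⊕-cong (⊗-cong ≈-refl (≈-sym uA)) (⊝-cong wronskian) ⟩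
    v ⊗ (u ⊗ A) ⊕ ⊝ (u ⊗ v ⊗ c)
      ≈⟨ solve 4 (λ u v x c → v :* (u :* x) :+ :- (u :* v :* c) := u :* (v :* x :+ :- (v :* c))) ≈-refl u v A c ⟩
    u ⊗ (v ⊗ A ⊕ ⊝ (v ⊗ c)) ∎)

  S-0 : S ! 0 ≡ 1ℤ
  S-0 = refl

  -- The logarithmic derivative of `landen`, with D v eliminated by the derivative formula.
  A-landen : two ⊗ A₂ ≈ A ⊕ ⊝ (u ⊗ v) ⊕ b
  A-landen = cancelˡ S S-0 (cancel-two (begin
    two ⊗ (S ⊗ (two ⊗ A₂))
      ≈⟨ solve 2 (λ s x → con (ℤ.+ 2) :* (s :* (con (ℤ.+ 2) :* x)) := con (ℤ.+ 4) :* (s :* x)) ≈-refl S A₂ ⟩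
    const (ℤ.+ 4) ⊗ (S ⊗ A₂)
      ≈⟨ ⊗-cong ≈-refl (≈-trans (≈-sym (expand-product 2 u A)) (≈-trans (expand-≈ 2 uA) (≈-trans (expand-product 2 two (D u)) (⊗-cong (expand-constant 2 (ℤ.+ 2)) ≈-refl)))) ⟩
    const (ℤ.+ 4) ⊗ (two ⊗ expand 2 (D u))
      ≈⟨ ⊗-cong ≈-refl (≈-sym (D-expand₂ u)) ⟩
    const (ℤ.+ 4) ⊗ D S
      ≈⟨ solve 1 (λ x → con (ℤ.+ 4) :* x := con (ℤ.+ 2) :* (con (ℤ.+ 2) :* x)) ≈-refl (D S) ⟩
    two ⊗ (two ⊗ D S)
      ≈⟨ ⊗-cong ≈-refl (≈-trans (≈-sym (D-scale (ℤ.+ 2) S)) (≈-trans (D-cong (≈-sym landen)) (D-⊕ u v))) ⟩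
    two ⊗ (D u ⊕ D v)
      ≈⟨ solve 2 (λ x y → con (ℤ.+ 2) :* (x :+ y) := con (ℤ.+ 2) :* x :+ con (ℤ.+ 2) :* y) ≈-refl (D u) (D v) ⟩
    two ⊗ D u ⊕ two ⊗ D v
      ≈⟨ ⊕-cong (≈-sym uA) twoDv ⟩
    u ⊗ A ⊕ (v ⊗ A ⊕ ⊝ (v ⊗ c))
      ≈⟨ solve 3 (λ u v x → u :* x :+ (v :* x :+ :- (v :* (u :* u :+ :- (v :* v)))) := (u :+ v) :* (x :+ :- (u :* v) :+ v :* v)) ≈-refl u v A ⟩
    (u ⊕ v) ⊗ (A ⊕ ⊝ (u ⊗ v) ⊕ b)
      ≈⟨ ⊗-cong landen ≈-refl ⟩
    two ⊗ S ⊗ (A ⊕ ⊝ (u ⊗ v) ⊕ b)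
      ≈⟨ solve 2 (λ s x → con (ℤ.+ 2) :* s :* x := con (ℤ.+ 2) :* (s :* x)) ≈-refl S (A ⊕ ⊝ (u ⊗ v) ⊕ b) ⟩
    two ⊗ (S ⊗ (A ⊕ ⊝ (u ⊗ v) ⊕ b)) ∎))

  A≈ : A ≈ two ⊗ A₂ ⊕ (u ⊗ v ⊕ ⊝ b)
  A≈ = ≈-trans (solve 3 (λ x w b → x := (x :+ :- w :+ b) :+ (w :+ :- b)) ≈-refl A (u ⊗ v) b) (⊕-cong (≈-sym A-landen) ≈-refl)

  ε : PS
  ε = two ⊗ D A ⊕ ⊝ (A ⊗ A ⊕ b ⊗ c)

  private
    c₂ : const (ℤ.+ 4) ⊗ expand 2 c ≈ (u ⊕ ⊝ v) ⊗ (u ⊕ ⊝ v)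
    c₂ = begin
      const (ℤ.+ 4) ⊗ expand 2 c
        ≈⟨ ⊗-cong ≈-refl (≈-trans (expand-sum 2 a (⊝ b)) (⊕-cong (expand-product 2 u u) (≈-trans (expand-neg 2 b) (⊝-cong (≈-trans VV (≈-sym geometric-mean)))))) ⟩
      const (ℤ.+ 4) ⊗ (S ⊗ S ⊕ ⊝ (u ⊗ v))
        ≈⟨ solve 2 (λ s w → con (ℤ.+ 4) :* (s :* s :+ :- w) := con (ℤ.+ 2) :* s :* (con (ℤ.+ 2) :* s) :+ :- (con (ℤ.+ 4) :* w)) ≈-refl S (u ⊗ v) ⟩
      two ⊗ S ⊗ (two ⊗ S) ⊕ ⊝ (const (ℤ.+ 4) ⊗ (u ⊗ v))
        ≈⟨ ⊕-cong (⊗-cong landen landen) ≈-refl ⟨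
      (u ⊕ v) ⊗ (u ⊕ v) ⊕ ⊝ (const (ℤ.+ 4) ⊗ (u ⊗ v))
        ≈⟨ solve 2 (λ u v → (u :+ v) :* (u :+ v) :+ :- (con (ℤ.+ 4) :* (u :* v)) := (u :+ :- v) :* (u :+ :- v)) ≈-refl u v ⟩
      (u ⊕ ⊝ v) ⊗ (u ⊕ ⊝ v) ∎

    DA : two ⊗ D A ≈ const (ℤ.+ 8) ⊗ expand 2 (D A) ⊕ (v ⊗ (two ⊗ D u) ⊕ u ⊗ (two ⊗ D v) ⊕ ⊝ (two ⊗ (v ⊗ (two ⊗ D v))))
    DA = begin
      two ⊗ D A
        ≈⟨ ⊗-cong ≈-refl (≈-trans (D-cong A≈) (≈-trans (D-⊕ (two ⊗ A₂) (u ⊗ v ⊕ ⊝ b)) (⊕-cong (≈-trans (D-scale (ℤ.+ 2) A₂) (⊗-cong ≈-refl (D-expand₂ A)))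
             (≈-trans (D-⊕ (u ⊗ v) (⊝ b)) (⊕-cong (D-product u v) (≈-trans (D-⊝ b) (⊝-cong (D-product v v)))))))) ⟩
      two ⊗ (two ⊗ (two ⊗ expand 2 (D A)) ⊕ (D u ⊗ v ⊕ u ⊗ D v ⊕ ⊝ (D v ⊗ v ⊕ v ⊗ D v)))
        ≈⟨ solve 5 (λ z u v x y → con (ℤ.+ 2) :* (con (ℤ.+ 2) :* (con (ℤ.+ 2) :* z) :+ (x :* v :+ u :* y :+ :- (y :* v :+ v :* y)))
             := con (ℤ.+ 8) :* z :+ (v :* (con (ℤ.+ 2) :* x) :+ u :* (con (ℤ.+ 2) :* y) :+ :- (con (ℤ.+ 2) :* (v :* (con (ℤ.+ 2) :* y))))) ≈-refl (expand 2 (D A)) u v (D u) (D v) ⟩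
      const (ℤ.+ 8) ⊗ expand 2 (D A) ⊕ (v ⊗ (two ⊗ D u) ⊕ u ⊗ (two ⊗ D v) ⊕ ⊝ (two ⊗ (v ⊗ (two ⊗ D v)))) ∎

    expand-ε : const (ℤ.+ 4) ⊗ expand 2 ε ≈ const (ℤ.+ 8) ⊗ expand 2 (D A) ⊕ ⊝ (two ⊗ A₂ ⊗ (two ⊗ A₂) ⊕ u ⊗ v ⊗ (const (ℤ.+ 4) ⊗ expand 2 c))
    expand-ε = ≈-trans (⊗-cong ≈-refl (≈-trans (expand-sum 2 (two ⊗ D A) (⊝ (A ⊗ A ⊕ b ⊗ c))) (⊕-cong (≈-trans (expand-product 2 two (D A)) (⊗-cong (expand-constant 2 (ℤ.+ 2)) ≈-refl))
        (≈-trans (expand-neg 2 (A ⊗ A ⊕ b ⊗ c)) (⊝-cong (≈-trans (expand-sum 2 (A ⊗ A) (b ⊗ c)) (⊕-cong (expand-product 2 A A) (≈-trans (expand-product 2 b c) (⊗-cong (≈-trans VV (≈-sym geometric-mean)) ≈-refl)))))))))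
      (solve 4 (λ z x w c → con (ℤ.+ 4) :* (con (ℤ.+ 2) :* z :+ :- (x :* x :+ w :* c)) := con (ℤ.+ 8) :* z :+ :- (con (ℤ.+ 2) :* x :* (con (ℤ.+ 2) :* x) :+ w :* (con (ℤ.+ 4) :* c)))
        ≈-refl (expand 2 (D A)) A₂ (u ⊗ v) (expand 2 c))

  -- Write A through A(q²) by `A-landen` and use 4c(q²) = (u - v)² and b(q²) = uv: the expression at
  -- q turns into four times the one at q².
  ε-descent : ε ≈ const (ℤ.+ 4) ⊗ expand 2 ε
  ε-descent = begin
    two ⊗ D A ⊕ ⊝ (A ⊗ A ⊕ b ⊗ c)
      ≈⟨ ⊕-cong (≈-trans DA (⊕-cong ≈-refl (⊕-cong (⊕-cong (⊗-cong ≈-refl (≈-sym uA)) (⊗-cong ≈-refl twoDv)) (⊝-cong (⊗-cong ≈-refl (⊗-cong ≈-refl twoDv)))))) ≈-refl ⟩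
    const (ℤ.+ 8) ⊗ Z ⊕ (v ⊗ (u ⊗ A) ⊕ u ⊗ (v ⊗ A ⊕ ⊝ (v ⊗ c)) ⊕ ⊝ (two ⊗ (v ⊗ (v ⊗ A ⊕ ⊝ (v ⊗ c))))) ⊕ ⊝ (A ⊗ A ⊕ b ⊗ c)
      ≈⟨ solve 4 (λ z u v x → con (ℤ.+ 8) :* z :+ (v :* (u :* x) :+ u :* (v :* x :+ :- (v :* (u :* u :+ :- (v :* v)))) :+ :- (con (ℤ.+ 2) :* (v :* (v :* x :+ :- (v :* (u :* u :+ :- (v :* v))))))) :+ :- (x :* x :+ v :* v :* (u :* u :+ :- (v :* v)))
           := con (ℤ.+ 8) :* z :+ :- ((x :+ :- (u :* v) :+ v :* v) :* (x :+ :- (u :* v) :+ v :* v) :+ u :* v :* ((u :+ :- v) :* (u :+ :- v)))) ≈-refl Z u v A ⟩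
    const (ℤ.+ 8) ⊗ Z ⊕ ⊝ ((A ⊕ ⊝ (u ⊗ v) ⊕ b) ⊗ (A ⊕ ⊝ (u ⊗ v) ⊕ b) ⊕ u ⊗ v ⊗ ((u ⊕ ⊝ v) ⊗ (u ⊕ ⊝ v)))
      ≈⟨ ⊕-cong ≈-refl (⊝-cong (⊕-cong (⊗-cong A-landen A-landen) (⊗-cong ≈-refl c₂))) ⟨
    const (ℤ.+ 8) ⊗ Z ⊕ ⊝ (two ⊗ A₂ ⊗ (two ⊗ A₂) ⊕ u ⊗ v ⊗ (const (ℤ.+ 4) ⊗ expand 2 c))
      ≈⟨ expand-ε ⟨
    const (ℤ.+ 4) ⊗ expand 2 ε ∎
    where
    Z = expand 2 (D A)

  A-0 : A ! 0 ≡ 0ℤ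
  A-0 = trans (scale (ℤ.+ 2) (D u ⊗ 1/u) 0) (trans (cong (ℤ.+ 2 *_) (ℤ.*-zeroˡ (1/u ! 0))) refl)

  -- An equation of the Darboux-Halphen system for the logarithmic derivatives of theta constants.
  -- With `D-a` and `D-c′` it closes the ring generated by A, a and c under D.
  darboux-halphen : two ⊗ D A ≈ A ⊗ A ⊕ b ⊗ c
  darboux-halphen = ≈-trans (solve 2 (λ x y → x := (x :+ :- y) :+ y) ≈-refl (two ⊗ D A) (A ⊗ A ⊕ b ⊗ c))
    (≈-trans (⊕-cong (expand₂-fixed (ℤ.+ 4) ε ε-descent (divides 0ℤ ε-0)) ≈-refl) (solve 1 (λ y → con 0ℤ :+ y := y) ≈-refl (A ⊗ A ⊕ b ⊗ c)))
    where
    ε-0 : ε ! 0 ≡ 0ℤ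
    ε-0 = cong₂ (λ x y → x + - (y + 0ℤ)) (trans (scale (ℤ.+ 2) (D A) 0) (cong (ℤ.+ 2 *_) (ℤ.*-zeroˡ (A ! 0)))) (cong₂ _*_ A-0 A-0)

  P : PS
  P = const 1ℤ ⊕ const (- ℤ.+ 24) ⊗ σ

  private
    P-coefficient : ∀ n → P ! n ≡ const 1ℤ ! n + - ℤ.+ 24 * σ ! n
    P-coefficient n = cong (const 1ℤ ! n +_) (mulF-const (- ℤ.+ 24) (σ !_) n)

  -- At odd degrees the terms -24σ and 3·8σ cancel; at even degrees the rules for σ(2n) and r₄(2n)
  -- apply.
  P-descent : P ⊕ const (ℤ.+ 3) ⊗ a ⊕ two ⊗ expand 2 b ≈ two ⊗ expand 2 P ⊕ const (ℤ.+ 4) ⊗ expand 2 a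
  P-descent = ≈-trans (⊕-cong (⊕-cong ≈-refl (⊗-cong ≈-refl (≈-sym four-squares))) (⊗-cong ≈-refl (expand-≈ 2 b-twist)))
    (≈-trans (by-parity even odd) (⊕-cong ≈-refl (⊗-cong ≈-refl (expand-≈ 2 four-squares))))
    where
    lhs : ∀ n → (P ⊕ const (ℤ.+ 3) ⊗ R₄ ⊕ two ⊗ expand 2 (twist R₄)) ! n ≡ const 1ℤ ! n + - ℤ.+ 24 * σ ! n + ℤ.+ 3 * R₄ ! n + ℤ.+ 2 * expand 2 (twist R₄) ! n
    lhs n = cong₂ _+_ (cong₂ _+_ (P-coefficient n) (scale (ℤ.+ 3) R₄ n)) (scale (ℤ.+ 2) (expand 2 (twist R₄)) n)
    rhs : ∀ n → (two ⊗ expand 2 P ⊕ const (ℤ.+ 4) ⊗ expand 2 R₄) ! n ≡ ℤ.+ 2 * expand 2 P ! n + ℤ.+ 4 * expand 2 R₄ ! n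
    rhs n = cong₂ _+_ (scale (ℤ.+ 2) (expand 2 P) n) (scale (ℤ.+ 4) (expand 2 R₄) n)
    even : ∀ k → (P ⊕ const (ℤ.+ 3) ⊗ R₄ ⊕ two ⊗ expand 2 (twist R₄)) ! (k ℕ.* 2) ≡ (two ⊗ expand 2 P ⊕ const (ℤ.+ 4) ⊗ expand 2 R₄) ! (k ℕ.* 2)
    even k = trans (lhs (k ℕ.* 2)) (trans (cong₂ (λ p q → p + ℤ.+ 3 * R₄ ! (k ℕ.* 2) + ℤ.+ 2 * q) (cong₂ (λ o s → o + - ℤ.+ 24 * s) (const-even 1ℤ k) (σ-double k)) (expand₂-even (twist R₄) k))
      (trans (lemma (const 1ℤ ! k) (lambert 1 id ! k) (lambert 2 id ! k) (R₄ ! (k ℕ.* 2)) (R₄ ! k) (sign k) (R₄-even-sign k) (R₄-even k))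
        (sym (trans (rhs (k ℕ.* 2)) (cong₂ (λ x y → ℤ.+ 2 * x + ℤ.+ 4 * y) (trans (expand₂-even P k) (P-coefficient k)) (expand₂-even R₄ k))))))
      where
      lemma : ∀ o x y r₂ r s → r₂ ≡ ℤ.+ 2 * r - s * r → r₂ ≡ o + (ℤ.+ 8 * (ℤ.+ 3 * x - ℤ.+ 2 * y) + - ℤ.+ 32 * y) →
        o + - ℤ.+ 24 * (ℤ.+ 3 * x - ℤ.+ 2 * y) + ℤ.+ 3 * r₂ + ℤ.+ 2 * (s * r) ≡ ℤ.+ 2 * (o + - ℤ.+ 24 * x) + ℤ.+ 4 * r
      lemma o x y r₂ r s e₁ e₂ = trans (lemma₁ o x y r₂ r s) (trans (cong₂ (λ i j → o + - ℤ.+ 24 * (ℤ.+ 3 * x - ℤ.+ 2 * y) + (i + ℤ.+ 2 * j) + ℤ.+ 2 * (s * r)) e₂ e₁) (lemma₂ o x y r s))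
        where
        lemma₁ : ∀ o x y r₂ r s → o + - ℤ.+ 24 * (ℤ.+ 3 * x - ℤ.+ 2 * y) + ℤ.+ 3 * r₂ + ℤ.+ 2 * (s * r) ≡ o + - ℤ.+ 24 * (ℤ.+ 3 * x - ℤ.+ 2 * y) + (r₂ + ℤ.+ 2 * r₂) + ℤ.+ 2 * (s * r)
        lemma₁ = solve-∀
        lemma₂ : ∀ o x y r s → o + - ℤ.+ 24 * (ℤ.+ 3 * x - ℤ.+ 2 * y) + (o + (ℤ.+ 8 * (ℤ.+ 3 * x - ℤ.+ 2 * y) + - ℤ.+ 32 * y) + ℤ.+ 2 * (ℤ.+ 2 * r - s * r)) + ℤ.+ 2 * (s * r)
          ≡ ℤ.+ 2 * (o + - ℤ.+ 24 * x) + ℤ.+ 4 * r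
        lemma₂ = solve-∀
    odd : ∀ k → (P ⊕ const (ℤ.+ 3) ⊗ R₄ ⊕ two ⊗ expand 2 (twist R₄)) ! suc (k ℕ.* 2) ≡ (two ⊗ expand 2 P ⊕ const (ℤ.+ 4) ⊗ expand 2 R₄) ! suc (k ℕ.* 2)
    odd k = trans (lhs (suc (k ℕ.* 2))) (trans (cong₂ (λ r q → 0ℤ + - ℤ.+ 24 * σ ! suc (k ℕ.* 2) + ℤ.+ 3 * r + ℤ.+ 2 * q)
        (trans (R₄-coefficient (suc (k ℕ.* 2))) (cong (λ y → 0ℤ + (ℤ.+ 8 * σ ! suc (k ℕ.* 2) + - ℤ.+ 32 * y)) (l₄-odd k))) (expand₂-odd (twist R₄) k))
      (trans (lemma (σ ! suc (k ℕ.* 2))) (sym (trans (rhs (suc (k ℕ.* 2))) (cong₂ (λ x y → ℤ.+ 2 * x + ℤ.+ 4 * y) (expand₂-odd P k) (expand₂-odd R₄ k))))))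
      where
      lemma : ∀ x → 0ℤ + - ℤ.+ 24 * x + ℤ.+ 3 * (0ℤ + (ℤ.+ 8 * x + - ℤ.+ 32 * 0ℤ)) + ℤ.+ 2 * 0ℤ ≡ ℤ.+ 2 * 0ℤ + ℤ.+ 4 * 0ℤ
      lemma = solve-∀

  -- P and 6A have the same quasimodular part, so their difference is a combination of a and c; the
  -- coefficients 1 and -5 are read off from the first two terms of the series. The difference Δ of
  -- the two sides satisfies Δ(q) = 2Δ(q²) and is killed by descent.
  P≈ : P ≈ const (ℤ.+ 6) ⊗ A ⊕ a ⊕ ⊝ (const (ℤ.+ 5) ⊗ c)
  P≈ = ≈-trans (solve 4 (λ p x a c → p := (p :+ :- (con (ℤ.+ 6) :* x) :+ :- a :+ con (ℤ.+ 5) :* c) :+ (con (ℤ.+ 6) :* x :+ a :+ :- (con (ℤ.+ 5) :* c))) ≈-refl P A a c)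
    (≈-trans (⊕-cong (expand₂-fixed (ℤ.+ 2) Δ Δ-descent (divides 0ℤ Δ-0)) ≈-refl) (solve 1 (λ y → con 0ℤ :+ y := y) ≈-refl (const (ℤ.+ 6) ⊗ A ⊕ a ⊕ ⊝ (const (ℤ.+ 5) ⊗ c))))
    where
    Δ : PS
    Δ = P ⊕ ⊝ (const (ℤ.+ 6) ⊗ A) ⊕ ⊝ a ⊕ const (ℤ.+ 5) ⊗ c
    Δ-0 : Δ ! 0 ≡ 0ℤ
    Δ-0 = cong (λ x → P ! 0 + - x + - (a ! 0) + (const (ℤ.+ 5) ⊗ c) ! 0) (trans (scale (ℤ.+ 6) A 0) (cong (ℤ.+ 6 *_) A-0))
    expand-Δ : expand 2 Δ ≈ expand 2 P ⊕ ⊝ (const (ℤ.+ 6) ⊗ A₂) ⊕ ⊝ (expand 2 a) ⊕ const (ℤ.+ 5) ⊗ (expand 2 a ⊕ ⊝ (expand 2 b))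
    expand-Δ = ≈-trans (expand-sum 2 _ _) (⊕-cong (≈-trans (expand-sum 2 _ _) (⊕-cong (≈-trans (expand-sum 2 _ _) (⊕-cong ≈-refl
        (≈-trans (expand-neg 2 _) (⊝-cong (≈-trans (expand-product 2 _ A) (⊗-cong (expand-constant 2 (ℤ.+ 6)) ≈-refl)))))) (expand-neg 2 a)))
      (≈-trans (expand-product 2 _ c) (⊗-cong (expand-constant 2 (ℤ.+ 5)) (≈-trans (expand-sum 2 a (⊝ b)) (⊕-cong ≈-refl (expand-neg 2 b))))))
    Δ-descent : Δ ≈ two ⊗ expand 2 Δ
    Δ-descent = begin
      P ⊕ ⊝ (const (ℤ.+ 6) ⊗ A) ⊕ ⊝ a ⊕ const (ℤ.+ 5) ⊗ c
        ≈⟨ solve 5 (λ p x a b y → p :+ :- (con (ℤ.+ 6) :* x) :+ :- a :+ con (ℤ.+ 5) :* (a :+ :- b)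
             := (p :+ con (ℤ.+ 3) :* a :+ con (ℤ.+ 2) :* y) :+ (a :+ b) :+ :- (con (ℤ.+ 6) :* x) :+ :- (con (ℤ.+ 6) :* b) :+ :- (con (ℤ.+ 2) :* y)) ≈-refl P A a b (expand 2 b) ⟩
      (P ⊕ const (ℤ.+ 3) ⊗ a ⊕ two ⊗ expand 2 b) ⊕ (a ⊕ b) ⊕ ⊝ (const (ℤ.+ 6) ⊗ A) ⊕ ⊝ (const (ℤ.+ 6) ⊗ b) ⊕ ⊝ (two ⊗ expand 2 b)
        ≈⟨ ⊕-cong (⊕-cong (⊕-cong (⊕-cong P-descent even-part-a) (⊝-cong (⊗-cong ≈-refl (≈-trans A≈ (⊕-cong ≈-refl (⊕-cong (≈-trans geometric-mean (≈-sym VV)) ≈-refl)))))) ≈-refl) ≈-refl ⟩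
      (two ⊗ expand 2 P ⊕ const (ℤ.+ 4) ⊗ expand 2 a) ⊕ (const (ℤ.+ 4) ⊗ expand 2 a ⊕ ⊝ (two ⊗ expand 2 b)) ⊕ ⊝ (const (ℤ.+ 6) ⊗ (two ⊗ A₂ ⊕ (expand 2 b ⊕ ⊝ b))) ⊕ ⊝ (const (ℤ.+ 6) ⊗ b) ⊕ ⊝ (two ⊗ expand 2 b)
        ≈⟨ solve 5 (λ p a₂ b₂ x b → (con (ℤ.+ 2) :* p :+ con (ℤ.+ 4) :* a₂) :+ (con (ℤ.+ 4) :* a₂ :+ :- (con (ℤ.+ 2) :* b₂)) :+ :- (con (ℤ.+ 6) :* (con (ℤ.+ 2) :* x :+ (b₂ :+ :- b))) :+ :- (con (ℤ.+ 6) :* b) :+ :- (con (ℤ.+ 2) :* b₂)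
             := con (ℤ.+ 2) :* (p :+ :- (con (ℤ.+ 6) :* x) :+ :- a₂ :+ con (ℤ.+ 5) :* (a₂ :+ :- b₂))) ≈-refl (expand 2 P) (expand 2 a) (expand 2 b) A₂ b ⟩
      two ⊗ (expand 2 P ⊕ ⊝ (const (ℤ.+ 6) ⊗ A₂) ⊕ ⊝ (expand 2 a) ⊕ const (ℤ.+ 5) ⊗ (expand 2 a ⊕ ⊝ (expand 2 b)))
        ≈⟨ ⊗-cong ≈-refl expand-Δ ⟨
      two ⊗ expand 2 Δ ∎

  E₄ : PS
  E₄ = const 1ℤ ⊕ const (ℤ.+ 240) ⊗ lambert 1 cube

  -- This is `convolution` multiplied by 48 and written for generating series.
  ramanujan : E₄ ≈ P ⊗ P ⊕ ⊝ (const (ℤ.+ 12) ⊗ D P)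
  ramanujan = ≈-sym (begin
    P ⊗ P ⊕ ⊝ (const (ℤ.+ 12) ⊗ D P)
      ≈⟨ ⊕-cong ≈-refl (⊝-cong (⊗-cong ≈-refl (≈-trans (D-⊕ (const 1ℤ) (const (- ℤ.+ 24) ⊗ σ)) (⊕-cong (D-const 1ℤ) (D-scale (- ℤ.+ 24) σ))))) ⟩
    P ⊗ P ⊕ ⊝ (const (ℤ.+ 12) ⊗ (const 0ℤ ⊕ const (- ℤ.+ 24) ⊗ D σ))
      ≈⟨ solve 2 (λ s d → (con 1ℤ :+ con (- ℤ.+ 24) :* s) :* (con 1ℤ :+ con (- ℤ.+ 24) :* s) :+ :- (con (ℤ.+ 12) :* (con 0ℤ :+ con (- ℤ.+ 24) :* d))
           := con 1ℤ :+ (con (- ℤ.+ 48) :* s :+ con (ℤ.+ 48) :* (con (ℤ.+ 12) :* (s :* s)) :+ con (ℤ.+ 288) :* d)) ≈-refl σ (D σ) ⟩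
    const 1ℤ ⊕ (const (- ℤ.+ 48) ⊗ σ ⊕ const (ℤ.+ 48) ⊗ (const (ℤ.+ 12) ⊗ (σ ⊗ σ)) ⊕ const (ℤ.+ 288) ⊗ D σ)
      ≈⟨ ⊕-cong ≈-refl (⊕-cong (⊕-cong ≈-refl (⊗-cong ≈-refl conv)) ≈-refl) ⟩
    const 1ℤ ⊕ (const (- ℤ.+ 48) ⊗ σ ⊕ const (ℤ.+ 48) ⊗ (const (ℤ.+ 5) ⊗ lambert 1 cube ⊕ σ ⊕ ⊝ (const (ℤ.+ 6) ⊗ D σ)) ⊕ const (ℤ.+ 288) ⊗ D σ)
      ≈⟨ solve 3 (λ s d x → con 1ℤ :+ (con (- ℤ.+ 48) :* s :+ con (ℤ.+ 48) :* (con (ℤ.+ 5) :* x :+ s :+ :- (con (ℤ.+ 6) :* d)) :+ con (ℤ.+ 288) :* d)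
           := con 1ℤ :+ con (ℤ.+ 240) :* x) ≈-refl σ (D σ) (lambert 1 cube) ⟩
    E₄ ∎)
    where
    conv : const (ℤ.+ 12) ⊗ (σ ⊗ σ) ≈ const (ℤ.+ 5) ⊗ lambert 1 cube ⊕ σ ⊕ ⊝ (const (ℤ.+ 6) ⊗ D σ)
    conv = pointwise λ n → trans (scale (ℤ.+ 12) (σ ⊗ σ) n) (trans (convolution n)
      (sym (cong₂ (λ x y → x + σ ! n - y) (scale (ℤ.+ 5) (lambert 1 cube) n) (scale (ℤ.+ 6) (D σ) n))))

  -- `P≈` is inserted into Ramanujan's equation and D A is eliminated by `darboux-halphen`; all
  -- terms in A cancel, and what remains is a polynomial in a and c.
  E₄-theta : E₄ ≈ a ⊗ a ⊕ const (ℤ.+ 14) ⊗ (a ⊗ c) ⊕ c ⊗ c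
  E₄-theta = begin
    E₄
      ≈⟨ ramanujan ⟩
    P ⊗ P ⊕ ⊝ (const (ℤ.+ 12) ⊗ D P)
      ≈⟨ ⊕-cong (⊗-cong P≈ P≈) (⊝-cong (⊗-cong ≈-refl (≈-trans (D-cong P≈) (≈-trans (D-⊕ _ _) (⊕-cong (≈-trans (D-⊕ _ _) (⊕-cong (D-scale (ℤ.+ 6) A) D-a))
           (≈-trans (D-⊝ _) (⊝-cong (≈-trans (D-scale (ℤ.+ 5) c) (⊗-cong ≈-refl D-c′))))))))) ⟩
    Q ⊗ Q ⊕ ⊝ (const (ℤ.+ 12) ⊗ (const (ℤ.+ 6) ⊗ D A ⊕ a ⊗ A ⊕ ⊝ (const (ℤ.+ 5) ⊗ (c ⊗ (A ⊕ b)))))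
      ≈⟨ solve 5 (λ x a b c d → (con (ℤ.+ 6) :* x :+ a :+ :- (con (ℤ.+ 5) :* c)) :* (con (ℤ.+ 6) :* x :+ a :+ :- (con (ℤ.+ 5) :* c))
             :+ :- (con (ℤ.+ 12) :* (con (ℤ.+ 6) :* d :+ a :* x :+ :- (con (ℤ.+ 5) :* (c :* (x :+ b)))))
           := :- (con (ℤ.+ 36) :* (con (ℤ.+ 2) :* d)) :+ (con (ℤ.+ 36) :* (x :* x) :+ (a :+ :- (con (ℤ.+ 5) :* c)) :* (a :+ :- (con (ℤ.+ 5) :* c)) :+ con (ℤ.+ 60) :* (c :* b))) ≈-refl A a b c (D A) ⟩
    ⊝ (const (ℤ.+ 36) ⊗ (two ⊗ D A)) ⊕ (const (ℤ.+ 36) ⊗ (A ⊗ A) ⊕ (a ⊕ ⊝ (const (ℤ.+ 5) ⊗ c)) ⊗ (a ⊕ ⊝ (const (ℤ.+ 5) ⊗ c)) ⊕ const (ℤ.+ 60) ⊗ (c ⊗ b))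
      ≈⟨ ⊕-cong (⊝-cong (⊗-cong ≈-refl darboux-halphen)) ≈-refl ⟩
    ⊝ (const (ℤ.+ 36) ⊗ (A ⊗ A ⊕ b ⊗ c)) ⊕ (const (ℤ.+ 36) ⊗ (A ⊗ A) ⊕ (a ⊕ ⊝ (const (ℤ.+ 5) ⊗ c)) ⊗ (a ⊕ ⊝ (const (ℤ.+ 5) ⊗ c)) ⊕ const (ℤ.+ 60) ⊗ (c ⊗ b))
      ≈⟨ solve 3 (λ x a b → :- (con (ℤ.+ 36) :* (x :* x :+ b :* (a :+ :- b))) :+ (con (ℤ.+ 36) :* (x :* x) :+ (a :+ :- (con (ℤ.+ 5) :* (a :+ :- b))) :* (a :+ :- (con (ℤ.+ 5) :* (a :+ :- b))) :+ con (ℤ.+ 60) :* ((a :+ :- b) :* b))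
           := a :* a :+ con (ℤ.+ 14) :* (a :* (a :+ :- b)) :+ (a :+ :- b) :* (a :+ :- b)) ≈-refl A a b ⟩
    a ⊗ a ⊕ const (ℤ.+ 14) ⊗ (a ⊗ c) ⊕ c ⊗ c ∎
    where
    Q = const (ℤ.+ 6) ⊗ A ⊕ a ⊕ ⊝ (const (ℤ.+ 5) ⊗ c)

-- The Cartier operator on theta functions modulo m

module CartierOperator
  (m : Data.Nat.ℕ) {{m≢0 : Data.Nat.NonZero m}} (m-prime : Data.Nat.Primality.Prime m) (m≢2 : m ≢ 2)
  (sign-m : PowerSeries.sign m ≡ Data.Integer.- Data.Integer.1ℤ)
  (m∤4 : Data.Nat.zero ≢ 4 Data.Nat.% m)
  (freshman : Homogeneous.Freshman m)
  where
  open PowerSeries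
  open Homogeneous m
  open SeriesMaps
  open ThetaAndDivisorSums using (φ; lambert)
  open ThetaRecurrences using (R₄)
  open DivisorSumRelations using (σ-dissect)
  open GaussIdentity using (h; hφ)
  open ThetaFunctions using (u; v; a; b; c; two; two-squares)
  open import Data.Empty using (⊥-elim)
  open import Data.Integer using (ℤ; 0ℤ; 1ℤ; _+_; _*_; -_; _-_)
  import Data.Integer as ℤ
  import Data.Integer.Properties as ℤ
  open import Data.Integer.Divisibility.Signed using (_∣_; divides; ∣n⇒∣m*n; ∣m∣n⇒∣m+n; ∣⇒∣ᵤ; ∣m⇒∣m*n)
  open import Data.Integer.Tactic.RingSolver using (solve-∀)
  open import Data.Nat as ℕ using (ℕ; zero; suc; NonZero)
  import Data.Nat.Divisibility as ℕ
  import Data.Nat.DivMod as ℕ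
  open import Data.Nat.Induction using (<-rec)
  import Data.Nat.Properties as ℕ
  open import Data.Product using (∃; _,_)
  open import Data.Sum using ([_,_]′)
  open import Data.Vec using ([]; _∷_)
  open import Function using (id)
  open import Relation.Binary.PropositionalEquality using (refl; sym; trans; cong; cong₂; subst)
  open import Relation.Nullary using (¬_; yes; no)
  open Mod m
  open SeriesMapsMod m
  open Cosets m m-prime m≢2 using (euclid)
  open import Algebra.Bundles using (CommutativeRing)
  open import Algebra.Properties.Semiring.Exp semiring using (^-homo-*; ^-assocʳ)
  open import Algebra.Properties.CommutativeSemiring.Exp (CommutativeRing.commutativeSemiring ring) using (^-distrib-*)
  open import Relation.Binary.Reasoning.Setoid setoid

  private
    M = ℤ.+ m

  ∣⇒≈0 : ∀ {k} → M ∣ k → const k ≈ const 0ℤ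
  ∣⇒≈0 {k} d = mk≈ λ { zero → subst (M ∣_) (sym (ℤ.+-identityʳ k)) d ; (suc _) → divides 0ℤ refl }

  const-homo-+ : ∀ i j → const (i + j) ≈ const i ⊕ const j
  const-homo-+ i j = pointwise λ { zero → refl ; (suc _) → refl }

  ≡⇒≈ : ∀ {x y : PS} → x ≡ y → x ≈ y
  ≡⇒≈ refl = ≈-refl

  freshman-≈ : ∀ x y → (x ⊕ y) ^ m ≈ x ^ m ⊕ y ^ m
  freshman-≈ x y = form-≈ ((X ⊞ Y) ⊠^ m) (X ⊠^ m ⊞ Y ⊠^ m) x y freshman

  one^ : ∀ n → const 1ℤ ^ n ≈ const 1ℤ
  one^ zero = ≈-refl
  one^ (suc n) = ≈-trans (⊗-cong ≈-refl (one^ n)) (solve 0 (con 1ℤ :* con 1ℤ := con 1ℤ) ≈-refl)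

  zero^ : ∀ n .{{_ : NonZero n}} → const 0ℤ ^ n ≈ const 0ℤ
  zero^ (suc n) = solve 1 (λ x → con 0ℤ :* x := con 0ℤ) ≈-refl (const 0ℤ ^ n)

  fermatℕ : ∀ n → const (ℤ.+ n) ^ m ≈ const (ℤ.+ n)
  fermatℕ zero = zero^ m
  fermatℕ (suc n) = begin
    const (ℤ.+ suc n) ^ m                   ≈⟨ ^-congˡ m (≈-trans (≡⇒≈ (cong const (ℤ.pos-+ 1 n))) (const-homo-+ 1ℤ (ℤ.+ n))) ⟩
    (const 1ℤ ⊕ const (ℤ.+ n)) ^ m          ≈⟨ freshman-≈ (const 1ℤ) (const (ℤ.+ n)) ⟩
    const 1ℤ ^ m ⊕ const (ℤ.+ n) ^ m        ≈⟨ ⊕-cong (one^ m) (fermatℕ n) ⟩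
    const 1ℤ ⊕ const (ℤ.+ n)                ≈⟨ ≈-trans (≡⇒≈ (cong const (ℤ.pos-+ 1 n))) (const-homo-+ 1ℤ (ℤ.+ n)) ⟨
    const (ℤ.+ suc n)                       ∎

  neg^ : ∀ x → (⊝ x) ^ m ≈ ⊝ (x ^ m)
  neg^ x = begin
    (⊝ x) ^ m                        ≈⟨ solve 2 (λ y z → z := (y :+ z) :+ :- y) ≈-refl (x ^ m) ((⊝ x) ^ m) ⟩
    x ^ m ⊕ (⊝ x) ^ m ⊕ ⊝ (x ^ m)    ≈⟨ ⊕-cong (≈-trans (≈-sym (freshman-≈ x (⊝ x))) (≈-trans (^-congˡ m (solve 1 (λ x → x :+ :- x := con 0ℤ) ≈-refl x)) (zero^ m))) ≈-refl ⟩
    const 0ℤ ⊕ ⊝ (x ^ m)             ≈⟨ solve 1 (λ x → con 0ℤ :+ x := x) ≈-refl (⊝ (x ^ m)) ⟩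
    ⊝ (x ^ m)                        ∎

  fermat : ∀ i → const i ^ m ≈ const i
  fermat (ℤ.+ n) = fermatℕ n
  fermat ℤ.-[1+ n ] = begin
    const ℤ.-[1+ n ] ^ m             ≈⟨ ^-congˡ m minus ⟩
    (⊝ (const (ℤ.+ suc n))) ^ m      ≈⟨ neg^ (const (ℤ.+ suc n)) ⟩
    ⊝ (const (ℤ.+ suc n) ^ m)        ≈⟨ ⊝-cong (fermatℕ (suc n)) ⟩
    ⊝ (const (ℤ.+ suc n))            ≈⟨ minus ⟨
    const ℤ.-[1+ n ]                 ∎
    where
    minus : const ℤ.-[1+ n ] ≈ ⊝ (const (ℤ.+ suc n))
    minus = pointwise λ { zero → refl ; (suc _) → refl }

  shift-≈ : ∀ {x y} → x ≈ y → shift x ≈ shift y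
  shift-≈ p = mk≈ λ { zero → divides 0ℤ refl ; (suc n) → at p n }

  ⊗-shiftBy : ∀ k x y → x ⊗ shiftBy k y ≈ shiftBy k (x ⊗ y)
  ⊗-shiftBy k x y = ≈-trans (⊗-comm x (shiftBy k y)) (≈-trans (pointwise (shiftBy-⊗ k y x)) (shiftBy-≈ k (⊗-comm y x)))
    where
    shiftBy-≈ : ∀ k {x y} → x ≈ y → shiftBy k x ≈ shiftBy k y
    shiftBy-≈ zero p = p
    shiftBy-≈ (suc k) p = shift-≈ (shiftBy-≈ k p)

  shift^ : ∀ n y → shift y ^ n ≈ shiftBy n (y ^ n)
  shift^ zero y = ≈-refl
  shift^ (suc n) y = ≈-trans (⊗-cong ≈-refl (shift^ n y)) (≈-trans (pointwise (shift-⊗ y (shiftBy n (y ^ n)))) (shift-≈ (⊗-shiftBy n y (y ^ n))))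

  -- The freshman identity separates the constant term, where Fermat's little theorem applies, from
  -- the tail, where induction on the degree does.
  frobenius : ∀ x → x ^ m ≈ expand m x
  frobenius x = mk≈ λ n → <-rec (λ n → ∀ x → M ∣ (x ^ m) ! n - expand m x ! n) step n x
    where
    power : ∀ x → x ^ m ≈ const (x ! 0) ⊕ shiftBy m (tail x ^ m)
    power x = ≈-trans (^-congˡ m (pointwise (split-head x))) (≈-trans (freshman-≈ (const (x ! 0)) (shift (tail x))) (⊕-cong (fermat (x ! 0)) (shift^ m (tail x))))
    lemma : ∀ p k s t → p - (k + s) + (k + s - (k + t)) ≡ p - (k + t)
    lemma = solve-∀
    lemma₂ : ∀ k s t → s - t ≡ k + s - (k + t)
    lemma₂ = solve-∀
    step : ∀ n → (∀ {i} → i ℕ.< n → ∀ x → M ∣ (x ^ m) ! i - expand m x ! i) → ∀ x → M ∣ (x ^ m) ! n - expand m x ! n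
    step n ih x = subst (M ∣_) (trans (lemma ((x ^ m) ! n) (const (x ! 0) ! n) (shiftBy m (tail x ^ m) ! n) (shiftBy m (expand m (tail x)) ! n))
        (cong ((x ^ m) ! n +_) (cong -_ (sym (expand-head m x n)))))
      (∣m∣n⇒∣m+n (at (power x) n) (subst (M ∣_) (lemma₂ (const (x ! 0) ! n) _ _) (shifted (n ℕ.<? m))))
      where
      shifted : _ → M ∣ shiftBy m (tail x ^ m) ! n - shiftBy m (expand m (tail x)) ! n
      shifted (yes n<m) = ≡⇒∣ (trans (shiftBy-< (tail x ^ m) n<m) (sym (shiftBy-< (expand m (tail x)) n<m)))
      shifted (no n≮m) = go (ℕ.m≤n⇒∃[o]m+o≡n (ℕ.≮⇒≥ n≮m))
        where
        go : (∃ λ o → m ℕ.+ o ≡ n) → _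
        go (o , refl) = subst (M ∣_) (cong₂ _-_ (sym (shiftBy-+ m o (tail x ^ m))) (sym (shiftBy-+ m o (expand m (tail x)))))
          (ih (ℕ.m<n+m o (ℕ.>-nonZero⁻¹ m)) (tail x))

  U : PS → PS
  U = dissect m

  U-⊕ : ∀ x y → U (x ⊕ y) ≈ U x ⊕ U y
  U-⊕ x y = pointwise λ _ → refl

  U-scale : ∀ k x → U (const k ⊗ x) ≈ const k ⊗ U x
  U-scale k x = pointwise λ n → trans (scale k x (n ℕ.* m)) (sym (scale k (U x) n))

  U-power : ∀ x y → U (x ^ m ⊗ y) ≈ x ⊗ U y
  U-power x y = ≈-trans (dissect-≈ m (⊗-cong (frobenius x) ≈-refl)) (pointwise (dissect-expand m x y))

  U-D : ∀ x → U (D x) ≈ const 0ℤ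
  U-D x = mk≈ λ n → subst (M ∣_) (minus-zero n) (∣m⇒∣m*n (x ! (n ℕ.* m)) (divides (ℤ.+ n) (ℤ.pos-* n m)))
    where
    minus-zero : ∀ n → U (D x) ! n ≡ U (D x) ! n - const 0ℤ ! n
    minus-zero zero = sym (ℤ.+-identityʳ _)
    minus-zero (suc n) = sym (ℤ.+-identityʳ _)

  -- b is an Eisenstein series of weight 2: its divisor sums at mn and at n agree modulo m, and m,
  -- being odd, preserves the signs of the twist.
  U-b : U b ≈ b
  U-b = ≈-trans (dissect-≈ m (exact LandenTransformation.b-twist)) (≈-trans (mk≈ coefficient) (exact (Mod.≈-sym 0 LandenTransformation.b-twist)))
    where
    sign-+ : ∀ i j → sign (i ℕ.+ j) ≡ sign i * sign j
    sign-+ zero j = sym (ℤ.*-identityˡ _)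
    sign-+ (suc i) j = trans (cong -_ (sign-+ i j)) (ℤ.neg-distribˡ-* (sign i) (sign j))
    sign-* : ∀ n → sign (n ℕ.* m) ≡ sign n
    sign-* zero = refl
    sign-* (suc n) = trans (sign-+ m (n ℕ.* m)) (trans (cong₂ _*_ sign-m (sign-* n)) (ℤ.-1*i≡-i (sign n)))
    const-multiple : ∀ n → const 1ℤ ! (n ℕ.* m) ≡ const 1ℤ ! n
    const-multiple zero = refl
    const-multiple (suc n) = go m
      where
      go : ∀ m {{_ : NonZero m}} → const 1ℤ ! (suc n ℕ.* m) ≡ 0ℤ
      go (suc _) = refl
    ∤1 : ¬ M ∣ ℤ.+ 1
    ∤1 d = ℕ.>⇒∤ (ℕ.nonTrivial⇒n>1 m {{Data.Nat.Primality.prime⇒nonTrivial m-prime}}) (∣⇒∣ᵤ d)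
    ∤4 : ¬ M ∣ ℤ.+ 4
    ∤4 d = m∤4 (sym (ℕ.n∣m⇒m%n≡0 4 m (∣⇒∣ᵤ d)))
    lemma : ∀ s o x y x′ y′ → s * (ℤ.+ 8 * (x - x′) + - ℤ.+ 32 * (y - y′)) ≡ s * (o + (ℤ.+ 8 * x + - ℤ.+ 32 * y)) - s * (o + (ℤ.+ 8 * x′ + - ℤ.+ 32 * y′))
    lemma = solve-∀
    coefficient : ∀ n → M ∣ twist R₄ ! (n ℕ.* m) - twist R₄ ! n
    coefficient n = subst (M ∣_) (trans (lemma (sign n) (const 1ℤ ! n) (lambert 1 id ! (n ℕ.* m)) (lambert 4 id ! (n ℕ.* m)) (lambert 1 id ! n) (lambert 4 id ! n))
        (cong₂ _-_ (cong₂ _*_ (sym (sign-* n)) (sym (trans (LandenTransformation.R₄-coefficient (n ℕ.* m)) (cong (λ z → z + (ℤ.+ 8 * lambert 1 id ! (n ℕ.* m) + - ℤ.+ 32 * lambert 4 id ! (n ℕ.* m))) (const-multiple n)))))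
          (cong (sign n *_) (sym (LandenTransformation.R₄-coefficient n)))))
      (∣n⇒∣m*n (sign n) (∣m∣n⇒∣m+n (∣n⇒∣m*n (ℤ.+ 8) (σ-dissect m m-prime m≢2 1 ∤1 n)) (∣n⇒∣m*n (- ℤ.+ 32) (σ-dissect m m-prime m≢2 4 ∤4 n))))

  cancel-u : ∀ {x y} → u ⊗ x ≈ u ⊗ y → x ≈ y
  cancel-u {x} {y} eq = ≈-trans (back x) (≈-trans (⊗-cong ≈-refl eq) (≈-sym (back y)))
    where
    back : ∀ z → z ≈ (h ⊗ h) ⊗ (u ⊗ z)
    back z = ≈-trans (solve 1 (λ z → z := con 1ℤ :* z) ≈-refl z) (≈-trans (⊗-cong (≈-sym (exact EisensteinSeries.u/u)) ≈-refl)
      (solve 3 (λ u g z → u :* g :* z := g :* (u :* z)) ≈-refl u (h ⊗ h) z))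

  D-c : u ⊗ D c ≈ two ⊗ c ⊗ D u ⊕ u ⊗ b ⊗ c
  D-c = exact LandenTransformation.D-c

  private
    const-suc : ∀ n → const (ℤ.+ suc n) ≈ const 1ℤ ⊕ const (ℤ.+ n)
    const-suc n = ≈-trans (≡⇒≈ (cong const (ℤ.pos-+ 1 n))) (const-homo-+ 1ℤ (ℤ.+ n))

  D-c^ : ∀ k → u ⊗ D (c ^ k) ≈ const (ℤ.+ k) ⊗ (two ⊗ (c ^ k ⊗ D u)) ⊕ const (ℤ.+ k) ⊗ (u ⊗ (c ^ k ⊗ b))
  D-c^ zero = ≈-trans (⊗-cong ≈-refl (D-const 1ℤ)) (solve 3 (λ u x y → u :* con 0ℤ := con 0ℤ :* x :+ con 0ℤ :* y) ≈-refl u (two ⊗ (const 1ℤ ⊗ D u)) (u ⊗ (const 1ℤ ⊗ b)))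
  D-c^ (suc k) = begin
    u ⊗ D (c ⊗ c ^ k)
      ≈⟨ ⊗-cong ≈-refl (D-product c (c ^ k)) ⟩
    u ⊗ (D c ⊗ c ^ k ⊕ c ⊗ D (c ^ k))
      ≈⟨ solve 5 (λ u dc ck c dck → u :* (dc :* ck :+ c :* dck) := (u :* dc) :* ck :+ c :* (u :* dck)) ≈-refl u (D c) (c ^ k) c (D (c ^ k)) ⟩
    (u ⊗ D c) ⊗ c ^ k ⊕ c ⊗ (u ⊗ D (c ^ k))
      ≈⟨ ⊕-cong (⊗-cong D-c ≈-refl) (⊗-cong ≈-refl (D-c^ k)) ⟩
    (two ⊗ c ⊗ D u ⊕ u ⊗ b ⊗ c) ⊗ c ^ k ⊕ c ⊗ (const (ℤ.+ k) ⊗ (two ⊗ (c ^ k ⊗ D u)) ⊕ const (ℤ.+ k) ⊗ (u ⊗ (c ^ k ⊗ b)))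
      ≈⟨ solve 6 (λ u b c ck du k → (con (ℤ.+ 2) :* c :* du :+ u :* b :* c) :* ck :+ c :* (k :* (con (ℤ.+ 2) :* (ck :* du)) :+ k :* (u :* (ck :* b)))
           := (con 1ℤ :+ k) :* (con (ℤ.+ 2) :* (c :* ck :* du)) :+ (con 1ℤ :+ k) :* (u :* (c :* ck :* b))) ≈-refl u b c (c ^ k) (D u) (const (ℤ.+ k)) ⟩
    (const 1ℤ ⊕ const (ℤ.+ k)) ⊗ (two ⊗ (c ^ suc k ⊗ D u)) ⊕ (const 1ℤ ⊕ const (ℤ.+ k)) ⊗ (u ⊗ (c ^ suc k ⊗ b))
      ≈⟨ ⊕-cong (⊗-cong (const-suc k) ≈-refl) (⊗-cong (const-suc k) ≈-refl) ⟨
    const (ℤ.+ suc k) ⊗ (two ⊗ (c ^ suc k ⊗ D u)) ⊕ const (ℤ.+ suc k) ⊗ (u ⊗ (c ^ suc k ⊗ b)) ∎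

  -- The term in D u, which is only quasimodular, carries the weight i + 2k as a factor and so
  -- disappears when the weight is a multiple of m.
  D-monomial : ∀ i k → u ⊗ D (u ^ i ⊗ c ^ k) ≈
    const (ℤ.+ (i ℕ.+ (k ℕ.+ k))) ⊗ (u ^ i ⊗ c ^ k ⊗ D u) ⊕ u ⊗ (const (ℤ.+ k) ⊗ (u ^ i ⊗ c ^ k ⊗ b))
  D-monomial zero k = begin
    u ⊗ D (const 1ℤ ⊗ c ^ k)
      ≈⟨ ⊗-cong ≈-refl (D-cong (solve 1 (λ x → con 1ℤ :* x := x) ≈-refl (c ^ k))) ⟩
    u ⊗ D (c ^ k)
      ≈⟨ D-c^ k ⟩
    const (ℤ.+ k) ⊗ (two ⊗ (c ^ k ⊗ D u)) ⊕ const (ℤ.+ k) ⊗ (u ⊗ (c ^ k ⊗ b))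
      ≈⟨ solve 5 (λ k ck du u b → k :* (con (ℤ.+ 2) :* (ck :* du)) :+ k :* (u :* (ck :* b)) := (k :+ k) :* (con 1ℤ :* ck :* du) :+ u :* (k :* (con 1ℤ :* ck :* b))) ≈-refl
           (const (ℤ.+ k)) (c ^ k) (D u) u b ⟩
    (const (ℤ.+ k) ⊕ const (ℤ.+ k)) ⊗ (const 1ℤ ⊗ c ^ k ⊗ D u) ⊕ u ⊗ (const (ℤ.+ k) ⊗ (const 1ℤ ⊗ c ^ k ⊗ b))
      ≈⟨ ⊕-cong (⊗-cong (≈-trans (≡⇒≈ (cong const (ℤ.pos-+ k k))) (const-homo-+ (ℤ.+ k) (ℤ.+ k))) ≈-refl) ≈-refl ⟨
    const (ℤ.+ (k ℕ.+ k)) ⊗ (const 1ℤ ⊗ c ^ k ⊗ D u) ⊕ u ⊗ (const (ℤ.+ k) ⊗ (const 1ℤ ⊗ c ^ k ⊗ b)) ∎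
  D-monomial (suc i) k = begin
    u ⊗ D (u ⊗ u ^ i ⊗ c ^ k)
      ≈⟨ ⊗-cong ≈-refl (≈-trans (D-cong (solve 3 (λ x y z → x :* y :* z := x :* (y :* z)) ≈-refl u (u ^ i) (c ^ k))) (D-product u (u ^ i ⊗ c ^ k))) ⟩
    u ⊗ (D u ⊗ (u ^ i ⊗ c ^ k) ⊕ u ⊗ D (u ^ i ⊗ c ^ k))
      ≈⟨ solve 4 (λ u du w dw → u :* (du :* w :+ u :* dw) := u :* (du :* w) :+ u :* (u :* dw)) ≈-refl u (D u) (u ^ i ⊗ c ^ k) (D (u ^ i ⊗ c ^ k)) ⟩
    u ⊗ (D u ⊗ (u ^ i ⊗ c ^ k)) ⊕ u ⊗ (u ⊗ D (u ^ i ⊗ c ^ k))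
      ≈⟨ ⊕-cong ≈-refl (⊗-cong ≈-refl (D-monomial i k)) ⟩
    u ⊗ (D u ⊗ (u ^ i ⊗ c ^ k)) ⊕ u ⊗ (const N ⊗ (u ^ i ⊗ c ^ k ⊗ D u) ⊕ u ⊗ (const (ℤ.+ k) ⊗ (u ^ i ⊗ c ^ k ⊗ b)))
      ≈⟨ solve 7 (λ u ui ck du n k b → u :* (du :* (ui :* ck)) :+ u :* (n :* (ui :* ck :* du) :+ u :* (k :* (ui :* ck :* b)))
           := (con 1ℤ :+ n) :* (u :* ui :* ck :* du) :+ u :* (k :* (u :* ui :* ck :* b))) ≈-refl u (u ^ i) (c ^ k) (D u) (const N) (const (ℤ.+ k)) b ⟩
    (const 1ℤ ⊕ const N) ⊗ (u ^ suc i ⊗ c ^ k ⊗ D u) ⊕ u ⊗ (const (ℤ.+ k) ⊗ (u ^ suc i ⊗ c ^ k ⊗ b))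
      ≈⟨ ⊕-cong (⊗-cong (const-suc (i ℕ.+ (k ℕ.+ k))) ≈-refl) ≈-refl ⟨
    const (ℤ.+ suc (i ℕ.+ (k ℕ.+ k))) ⊗ (u ^ suc i ⊗ c ^ k ⊗ D u) ⊕ u ⊗ (const (ℤ.+ k) ⊗ (u ^ suc i ⊗ c ^ k ⊗ b)) ∎
    where
    N = ℤ.+ (i ℕ.+ (k ℕ.+ k))

  -- With λ = c/a one has D λ = bλ, so for weight divisible by m the monomial times kb is itself a derivative.
  U-vanish : ∀ i k t → i ℕ.+ (k ℕ.+ k) ≡ m ℕ.* t → ¬ m ℕ.∣ k → U (u ^ i ⊗ c ^ k ⊗ b) ≈ const 0ℤ
  U-vanish i k t weight m∤k = mk≈ λ n → subst (M ∣_) (minus-zero n) (divide n (at scaled n))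
    where
    minus-zero : ∀ n → U (u ^ i ⊗ c ^ k ⊗ b) ! n ≡ U (u ^ i ⊗ c ^ k ⊗ b) ! n - const 0ℤ ! n
    minus-zero zero = sym (ℤ.+-identityʳ _)
    minus-zero (suc n) = sym (ℤ.+-identityʳ _)
    derivative : D (u ^ i ⊗ c ^ k) ≈ const (ℤ.+ k) ⊗ (u ^ i ⊗ c ^ k ⊗ b)
    derivative = cancel-u (≈-trans (D-monomial i k) (≈-trans (⊕-cong (⊗-cong (∣⇒≈0 (divides (ℤ.+ t) (trans (cong ℤ.+_ (trans weight (ℕ.*-comm m t))) (ℤ.pos-* t m)))) ≈-refl) ≈-refl)
      (solve 2 (λ x y → con 0ℤ :* x :+ y := y) ≈-refl (u ^ i ⊗ c ^ k ⊗ D u) (u ⊗ (const (ℤ.+ k) ⊗ (u ^ i ⊗ c ^ k ⊗ b))))))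
    scaled : const (ℤ.+ k) ⊗ U (u ^ i ⊗ c ^ k ⊗ b) ≈ const 0ℤ
    scaled = ≈-trans (≈-sym (U-scale (ℤ.+ k) (u ^ i ⊗ c ^ k ⊗ b))) (≈-trans (dissect-≈ m (≈-sym derivative)) (U-D (u ^ i ⊗ c ^ k)))
    zero-coefficient : ∀ n → const 0ℤ ! n ≡ 0ℤ
    zero-coefficient zero = refl
    zero-coefficient (suc _) = refl
    divide : ∀ n → M ∣ (const (ℤ.+ k) ⊗ U (u ^ i ⊗ c ^ k ⊗ b)) ! n - const 0ℤ ! n → M ∣ U (u ^ i ⊗ c ^ k ⊗ b) ! n
    divide n d = [ (λ e → ⊥-elim (m∤k (∣⇒∣ᵤ e))) , (λ e → e) ]′ (euclid (ℤ.+ k) (U (u ^ i ⊗ c ^ k ⊗ b) ! n)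
      (subst (M ∣_) (trans (cong₂ _-_ (scale (ℤ.+ k) (U (u ^ i ⊗ c ^ k ⊗ b)) n) (zero-coefficient n)) (ℤ.+-identityʳ _)) d))

  -- An m-th power passes through U as its root, by `U-power`, and U fixes b.
  U-survive : ∀ i k → U (u ^ (i ℕ.* m) ⊗ c ^ (k ℕ.* m) ⊗ b) ≈ u ^ i ⊗ c ^ k ⊗ b
  U-survive i k = begin
    U (u ^ (i ℕ.* m) ⊗ c ^ (k ℕ.* m) ⊗ b)    ≈⟨ dissect-≈ m (⊗-cong (⊗-cong (^-assocʳ u i m) (^-assocʳ c k m)) ≈-refl) ⟨
    U ((u ^ i) ^ m ⊗ (c ^ k) ^ m ⊗ b)        ≈⟨ dissect-≈ m (⊗-cong (^-distrib-* (u ^ i) (c ^ k) m) ≈-refl) ⟨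
    U ((u ^ i ⊗ c ^ k) ^ m ⊗ b)              ≈⟨ U-power (u ^ i ⊗ c ^ k) b ⟩
    u ^ i ⊗ c ^ k ⊗ U b                      ≈⟨ ⊗-cong ≈-refl U-b ⟩
    u ^ i ⊗ c ^ k ⊗ b                        ∎

  term : ℕ → ℕ → ℕ → PS
  term t k j = const (ℤ.+ k) ⊗ (u ^ (t ℕ.∸ (j ℕ.+ j)) ⊗ c ^ j)

  -- The effect of U on a form in a and c of total weight mt, multiplied by b: only the powers c^j
  -- with m | j survive, and u^(mt-2j) c^j becomes u^(t-2j/m) c^(j/m). The last argument counts the
  -- powers of c already split off.
  collect : ∀ {d} → ℕ → Coeffs d → ℕ → PS
  collect {zero} t (k ∷ []) j with j ℕ.% m
  ... | zero = term t k (j ℕ./ m)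
  ... | suc _ = const 0ℤ
  collect {suc d} t (k ∷ ks) j with j ℕ.% m
  ... | zero = term t k (j ℕ./ m) ⊕ collect t ks (suc j)
  ... | suc _ = collect t ks (suc j)

  private
    m∣⇒ : ∀ j → j ℕ.% m ≡ 0 → j ≡ j ℕ./ m ℕ.* m
    m∣⇒ j e = trans (ℕ.m≡m%n+[m/n]*n j m) (cong (ℕ._+ j ℕ./ m ℕ.* m) e)

    survive-term : ∀ t k i j → i ℕ.+ (j ℕ.+ j) ≡ m ℕ.* t → j ℕ.% m ≡ 0 →
      U (const (ℤ.+ k) ⊗ (u ^ i ⊗ c ^ j ⊗ b)) ≈ term t k (j ℕ./ m) ⊗ b
    survive-term t k i j weight e = ≈-trans (U-scale (ℤ.+ k) (u ^ i ⊗ c ^ j ⊗ b)) (≈-trans (⊗-cong ≈-refl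
        (≈-trans (≡⇒≈ (cong₂ (λ x y → U (u ^ x ⊗ c ^ y ⊗ b)) i≡ (m∣⇒ j e))) (U-survive (t ℕ.∸ (j′ ℕ.+ j′)) j′)))
        (solve 4 (λ k x y b → k :* (x :* y :* b) := k :* (x :* y) :* b) ≈-refl (const (ℤ.+ k)) (u ^ (t ℕ.∸ (j′ ℕ.+ j′))) (c ^ j′) b))
      where
      j′ = j ℕ./ m
      i≡ : i ≡ (t ℕ.∸ (j′ ℕ.+ j′)) ℕ.* m
      i≡ = trans (sym (ℕ.m+n∸n≡m i (j ℕ.+ j))) (trans (cong₂ ℕ._∸_ (trans weight (ℕ.*-comm m t))
        (trans (cong₂ ℕ._+_ (m∣⇒ j e) (m∣⇒ j e)) (sym (ℕ.*-distribʳ-+ m j′ j′)))) (sym (ℕ.*-distribʳ-∸ m t (j′ ℕ.+ j′))))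

    vanish-term : ∀ t k i j {r} → i ℕ.+ (j ℕ.+ j) ≡ m ℕ.* t → j ℕ.% m ≡ suc r →
      U (const (ℤ.+ k) ⊗ (u ^ i ⊗ c ^ j ⊗ b)) ≈ const 0ℤ
    vanish-term t k i j weight e = ≈-trans (U-scale (ℤ.+ k) (u ^ i ⊗ c ^ j ⊗ b)) (≈-trans (⊗-cong ≈-refl
        (U-vanish i j t weight (λ d → ℕ.1+n≢0 (trans (sym e) (ℕ.n∣m⇒m%n≡0 j m d)))))
      (solve 1 (λ k → k :* con 0ℤ := con 0ℤ) ≈-refl (const (ℤ.+ k))))

    a^ : ∀ d → a ^ d ≈ u ^ (d ℕ.+ d)
    a^ d = ≈-trans (^-distrib-* u u d) (≈-sym (^-homo-* u d d))

  -- Each monomial is decided by the exponent of c, through `U-survive` or `U-vanish`. The weight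
  -- equation is what `U-vanish` requires, and for m | j it also makes the exponent of u a multiple
  -- of m.
  collect-correct : ∀ {d} t (ks : Coeffs d) j e → e ℕ.+ (d ℕ.+ d) ℕ.+ (j ℕ.+ j) ≡ m ℕ.* t →
    U (u ^ e ⊗ c ^ j ⊗ b ⊗ eval ks a c) ≈ collect t ks j ⊗ b
  collect-correct {zero} t (k ∷ []) j e weight = ≈-trans
      (dissect-≈ m (solve 4 (λ x y b k → x :* y :* b :* k := k :* (x :* y :* b)) ≈-refl (u ^ e) (c ^ j) b (const (ℤ.+ k)))) last
    where
    weight′ : e ℕ.+ (j ℕ.+ j) ≡ m ℕ.* t
    weight′ = trans (cong (ℕ._+ (j ℕ.+ j)) (sym (ℕ.+-identityʳ e))) weight
    last : U (const (ℤ.+ k) ⊗ (u ^ e ⊗ c ^ j ⊗ b)) ≈ collect t (k ∷ []) j ⊗ b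
    last with j ℕ.% m in eq
    ... | zero = survive-term t k e j weight′ eq
    ... | suc _ = ≈-trans (vanish-term t k e j weight′ eq) (solve 1 (λ b → con 0ℤ := con 0ℤ :* b) ≈-refl b)
  collect-correct {suc d} t (k ∷ ks) j e weight = ≈-trans (dissect-≈ m split)
      (≈-trans (U-⊕ (const (ℤ.+ k) ⊗ (u ^ i ⊗ c ^ j ⊗ b)) (u ^ e ⊗ c ^ suc j ⊗ b ⊗ eval ks a c)) (head-case rest))
    where
    i = e ℕ.+ (suc d ℕ.+ suc d)
    split : u ^ e ⊗ c ^ j ⊗ b ⊗ (const (ℤ.+ k) ⊗ a ^ suc d ⊕ c ⊗ eval ks a c) ≈
      const (ℤ.+ k) ⊗ (u ^ i ⊗ c ^ j ⊗ b) ⊕ u ^ e ⊗ c ^ suc j ⊗ b ⊗ eval ks a c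
    split = begin
      u ^ e ⊗ c ^ j ⊗ b ⊗ (const (ℤ.+ k) ⊗ a ^ suc d ⊕ c ⊗ eval ks a c)
        ≈⟨ solve 7 (λ x y b k z c w → x :* y :* b :* (k :* z :+ c :* w) := k :* (x :* z :* y :* b) :+ x :* (c :* y) :* b :* w) ≈-refl
             (u ^ e) (c ^ j) b (const (ℤ.+ k)) (a ^ suc d) c (eval ks a c) ⟩
      const (ℤ.+ k) ⊗ (u ^ e ⊗ a ^ suc d ⊗ c ^ j ⊗ b) ⊕ u ^ e ⊗ c ^ suc j ⊗ b ⊗ eval ks a c
        ≈⟨ ⊕-cong (⊗-cong ≈-refl (⊗-cong (⊗-cong (≈-trans (⊗-cong ≈-refl (a^ (suc d))) (≈-sym (^-homo-* u e (suc d ℕ.+ suc d)))) ≈-refl) ≈-refl)) ≈-refl ⟩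
      const (ℤ.+ k) ⊗ (u ^ i ⊗ c ^ j ⊗ b) ⊕ u ^ e ⊗ c ^ suc j ⊗ b ⊗ eval ks a c ∎
    weight′ : e ℕ.+ (d ℕ.+ d) ℕ.+ (suc j ℕ.+ suc j) ≡ m ℕ.* t
    weight′ = trans (shuffle e d j) weight
      where
      open import Data.Nat.Tactic.RingSolver using () renaming (solve-∀ to solve-∀ℕ)
      shuffle : ∀ e d j → e ℕ.+ (d ℕ.+ d) ℕ.+ (suc j ℕ.+ suc j) ≡ e ℕ.+ (suc d ℕ.+ suc d) ℕ.+ (j ℕ.+ j)
      shuffle = solve-∀ℕ
    rest : U (u ^ e ⊗ c ^ suc j ⊗ b ⊗ eval ks a c) ≈ collect t ks (suc j) ⊗ b
    rest = collect-correct t ks (suc j) e weight′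
    head-case : U (u ^ e ⊗ c ^ suc j ⊗ b ⊗ eval ks a c) ≈ collect t ks (suc j) ⊗ b →
      U (const (ℤ.+ k) ⊗ (u ^ i ⊗ c ^ j ⊗ b)) ⊕ U (u ^ e ⊗ c ^ suc j ⊗ b ⊗ eval ks a c) ≈ collect t (k ∷ ks) j ⊗ b
    head-case r with j ℕ.% m in eq
    ... | zero = ≈-trans (⊕-cong (survive-term t k i j weight eq) r)
          (solve 3 (λ x y b → x :* b :+ y :* b := (x :+ y) :* b) ≈-refl (term t k (j ℕ./ m)) (collect t ks (suc j)) b)
    ... | suc _ = ≈-trans (⊕-cong (vanish-term t k i j weight eq) r) (solve 1 (λ x → con 0ℤ :+ x := x) ≈-refl (collect t ks (suc j) ⊗ b))

  -- Coefficients are natural numbers, so -1 is represented by m - 1.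
  minus : ∀ {d} → Form d → Form d
  minus e = cst (ℕ.pred m) ⊠ e

  minus-≈ : ∀ x → const (ℤ.+ ℕ.pred m) ⊗ x ≈ ⊝ x
  minus-≈ x = ≈-trans (solve 2 (λ k x → k :* x := (con 1ℤ :+ k) :* x :+ :- x) ≈-refl (const (ℤ.+ ℕ.pred m)) x)
    (≈-trans (⊕-cong (⊗-cong (≈-trans (≈-sym (const-suc (ℕ.pred m))) (∣⇒≈0 (divides 1ℤ (trans (cong ℤ.+_ (ℕ.suc-pred m)) (sym (ℤ.*-identityˡ M)))))) ≈-refl) ≈-refl)
      (solve 1 (λ x → con 0ℤ :* x :+ :- x := :- x) ≈-refl x))

  eval-cong : ∀ {d} (ks : Coeffs d) {x x′ y y′} → x ≈ x′ → y ≈ y′ → eval ks x y ≈ eval ks x′ y′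
  eval-cong {zero} (k ∷ []) p q = ≈-refl
  eval-cong {suc d} (k ∷ ks) p q = ⊕-cong (⊗-cong ≈-refl (^-congˡ (suc d) p)) (⊗-cong q (eval-cong ks p q))

  expand-^ : ∀ x k → expand 2 (x ^ k) ≈ expand 2 x ^ k
  expand-^ x zero = expand-constant 2 1ℤ
  expand-^ x (suc k) = ≈-trans (expand-product 2 x (x ^ k)) (⊗-cong ≈-refl (expand-^ x k))

  expand-eval : ∀ {d} (ks : Coeffs d) x y → expand 2 (eval ks x y) ≈ eval ks (expand 2 x) (expand 2 y)
  expand-eval {zero} (k ∷ []) x y = expand-constant 2 (ℤ.+ k)
  expand-eval {suc d} (k ∷ ks) x y = ≈-trans (expand-sum 2 _ _) (⊕-cong
    (≈-trans (expand-product 2 _ _) (⊗-cong (expand-constant 2 (ℤ.+ k)) (expand-^ x (suc d))))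
    (≈-trans (expand-product 2 y _) (⊗-cong ≈-refl (expand-eval ks x y))))

  b₂ : expand 2 b ≈ u ⊗ v
  b₂ = exact (Mod.≈-trans 0 LandenTransformation.VV (Mod.≈-sym 0 LandenTransformation.geometric-mean))

  aF cF : Form 2
  aF = X ⊠ X
  cF = X ⊠ X ⊞ minus (Y ⊠ Y)

  eval-ac : ∀ {d} (ks : Coeffs d) → eval ks a c ≈ ⟪ compose ks aF cF ⟫ u v
  eval-ac ks = ≈-trans (eval-cong ks ≈-refl (⊕-cong ≈-refl (≈-sym (minus-≈ b)))) (≡⇒≈ (sym (eval-compose ks aF cF u v)))

  module _ (¼ : ℕ) (quarter : (¼ ℕ.* 4) ℕ.% m ≡ 1) where
    -- The images of a and c under q ↦ q²: the arithmetic-geometric mean gives ((u + v)/2)² and ((u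
    -- - v)/2)².
    a₂F c₂F : Form 2
    a₂F = cst ¼ ⊠ ((X ⊞ Y) ⊠ (X ⊞ Y))
    c₂F = cst ¼ ⊠ ((X ⊞ minus Y) ⊠ (X ⊞ minus Y))

    private
      divide-4 : ∀ {x y} → const (ℤ.+ 4) ⊗ x ≈ y → x ≈ const (ℤ.+ ¼) ⊗ y
      divide-4 {x} {y} p = begin
        x                                          ≈⟨ solve 1 (λ x → x := con 1ℤ :* x) ≈-refl x ⟩
        const 1ℤ ⊗ x                               ≈⟨ ⊗-cong (≡⇒≈ (cong (λ i → const (ℤ.+ i)) quarter)) ≈-refl ⟨
        const (ℤ.+ ((¼ ℕ.* 4) ℕ.% m)) ⊗ x          ≈⟨ ⊗-cong (const-* ¼ 4) ≈-refl ⟩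
        const (ℤ.+ ¼) ⊗ const (ℤ.+ 4) ⊗ x          ≈⟨ solve 3 (λ i j x → i :* j :* x := i :* (j :* x)) ≈-refl (const (ℤ.+ ¼)) (const (ℤ.+ 4)) x ⟩
        const (ℤ.+ ¼) ⊗ (const (ℤ.+ 4) ⊗ x)        ≈⟨ ⊗-cong ≈-refl p ⟩
        const (ℤ.+ ¼) ⊗ y                          ∎

      4a₂ : const (ℤ.+ 4) ⊗ expand 2 a ≈ (u ⊕ v) ⊗ (u ⊕ v)
      4a₂ = begin
        const (ℤ.+ 4) ⊗ expand 2 a                      ≈⟨ ⊗-cong ≈-refl (expand-product 2 u u) ⟩
        const (ℤ.+ 4) ⊗ (expand 2 u ⊗ expand 2 u)       ≈⟨ solve 1 (λ s → con (ℤ.+ 4) :* (s :* s) := con (ℤ.+ 2) :* s :* (con (ℤ.+ 2) :* s)) ≈-refl (expand 2 u) ⟩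
        two ⊗ expand 2 u ⊗ (two ⊗ expand 2 u)           ≈⟨ ⊗-cong (exact LandenTransformation.landen) (exact LandenTransformation.landen) ⟨
        (u ⊕ v) ⊗ (u ⊕ v)                               ∎

    a₂ : expand 2 a ≈ ⟪ a₂F ⟫ u v
    a₂ = divide-4 4a₂

    c₂ : expand 2 c ≈ ⟪ c₂F ⟫ u v
    c₂ = ≈-trans (divide-4 (begin
      const (ℤ.+ 4) ⊗ expand 2 c
        ≈⟨ ⊗-cong ≈-refl (≈-trans (expand-sum 2 a (⊝ b)) (⊕-cong ≈-refl (expand-neg 2 b))) ⟩
      const (ℤ.+ 4) ⊗ (expand 2 a ⊕ ⊝ (expand 2 b))
        ≈⟨ solve 2 (λ x y → con (ℤ.+ 4) :* (x :+ :- y) := con (ℤ.+ 4) :* x :+ :- (con (ℤ.+ 4) :* y)) ≈-refl (expand 2 a) (expand 2 b) ⟩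
      const (ℤ.+ 4) ⊗ expand 2 a ⊕ ⊝ (const (ℤ.+ 4) ⊗ expand 2 b)
        ≈⟨ ⊕-cong 4a₂ (⊝-cong (⊗-cong ≈-refl b₂)) ⟩
      (u ⊕ v) ⊗ (u ⊕ v) ⊕ ⊝ (const (ℤ.+ 4) ⊗ (u ⊗ v))
        ≈⟨ solve 2 (λ u v → (u :+ v) :* (u :+ v) :+ :- (con (ℤ.+ 4) :* (u :* v)) := (u :+ :- v) :* (u :+ :- v)) ≈-refl u v ⟩
      (u ⊕ ⊝ v) ⊗ (u ⊕ ⊝ v) ∎)) (⊗-cong ≈-refl (⊗-cong (⊕-cong ≈-refl (≈-sym (minus-≈ v))) (⊕-cong ≈-refl (≈-sym (minus-≈ v)))))

    expand-eval-ac : ∀ {d} (ks : Coeffs d) → expand 2 (eval ks a c) ≈ ⟪ compose ks a₂F c₂F ⟫ u v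
    expand-eval-ac ks = ≈-trans (expand-eval ks a c) (≈-trans (eval-cong ks a₂ c₂) (≡⇒≈ (sym (eval-compose ks a₂F c₂F u v))))

  -- hs are the coefficients of the Hasse invariant of the Legendre family in λ = c/a; ¼ is an inverse of 4.
  module Hasse {n} (hs : Coeffs n) (¼ : ℕ) (quarter : (¼ ℕ.* 4) ℕ.% m ≡ 1) (leading : eval hs a c ! 0 ≡ 1ℤ)
    (agm : coeffs (compose hs aF cF) ≡ coeffs (compose hs (a₂F ¼ quarter) (c₂F ¼ quarter)))
    where
    E : PS
    E = eval hs a c

    -- A step of the arithmetic-geometric mean is a 2-isogeny of Legendre curves, and the Hasse
    -- invariant is preserved by it; `agm` verifies this as an identity of binary forms in u and v.
    E-descent : E ≈ expand 2 E
    E-descent = begin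
      E                                                             ≈⟨ eval-ac hs ⟩
      ⟪ compose hs aF cF ⟫ u v                                      ≈⟨ form-≈ (compose hs aF cF) (compose hs (a₂F ¼ quarter) (c₂F ¼ quarter)) u v agm ⟩
      ⟪ compose hs (a₂F ¼ quarter) (c₂F ¼ quarter) ⟫ u v            ≈⟨ expand-eval-ac ¼ quarter hs ⟨
      expand 2 E                                                    ∎

    E≈1 : E ≈ const 1ℤ
    E≈1 = ≈-trans (solve 1 (λ x → x := (x :+ :- con 1ℤ) :+ con 1ℤ) ≈-refl E) (≈-trans (⊕-cong (expand₂-fixed 1ℤ (E ⊕ ⊝ (const 1ℤ)) descent
        (divides 0ℤ (cong (λ z → z + - 1ℤ) leading))) ≈-refl) (solve 0 (con 0ℤ :+ con 1ℤ := con 1ℤ) ≈-refl))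
      where
      descent : E ⊕ ⊝ (const 1ℤ) ≈ const 1ℤ ⊗ expand 2 (E ⊕ ⊝ (const 1ℤ))
      descent = ≈-trans (⊕-cong E-descent (⊝-cong (≈-sym (expand-constant 2 1ℤ)))) (≈-trans (⊕-cong ≈-refl (≈-sym (expand-neg 2 (const 1ℤ))))
        (≈-trans (≈-sym (expand-sum 2 E (⊝ (const 1ℤ)))) (solve 1 (λ x → x := con 1ℤ :* x) ≈-refl (expand 2 (E ⊕ ⊝ (const 1ℤ))))))

    module _ (σ s t : ℕ) where
      -- The factor inserted next to u^s: b^(m-1), which together with one further b is an m-th
      -- power, and σ copies of the Hasse invariant, which bring the weight to a multiple of m.
      reducer : Form _
      reducer = (X ⊞ minus Y) ⊠^ ℕ.pred m ⊠ compose hs X Y ⊠^ σ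

      -- Exactness controls only monomials multiplied by b. A factor b is therefore carried into U
      -- as b^m, by `U-power`, one b is kept apart for `collect-correct`, and at the end b is
      -- cancelled, being a unit.
      U-u^ : s ℕ.+ (ℕ.pred m ℕ.* 1 ℕ.+ σ ℕ.* (n ℕ.* 1) ℕ.+ (ℕ.pred m ℕ.* 1 ℕ.+ σ ℕ.* (n ℕ.* 1))) ℕ.+ 0 ≡ m ℕ.* t →
        U (u ^ s) ≈ collect t (coeffs reducer) 0
      U-u^ weight = cancel-b (begin
        b ⊗ U (u ^ s)
          ≈⟨ U-power b (u ^ s) ⟨
        U (b ^ m ⊗ u ^ s)
          ≈⟨ dissect-≈ m (≈-trans (⊗-cong (≡⇒≈ (cong (b ^_) (sym (ℕ.suc-pred m)))) ≈-refl)
               (solve 3 (λ b r x → b :* r :* x := x :* con 1ℤ :* b :* (r :* con 1ℤ)) ≈-refl b (b ^ ℕ.pred m) (u ^ s))) ⟩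
        U (u ^ s ⊗ const 1ℤ ⊗ b ⊗ (b ^ ℕ.pred m ⊗ const 1ℤ))
          ≈⟨ dissect-≈ m (⊗-cong ≈-refl (⊗-cong (^-congˡ (ℕ.pred m) b≈) (≈-trans (≈-sym (one^ σ)) (^-congˡ σ (≈-sym (≈-trans (≡⇒≈ (eval-compose hs X Y a c)) E≈1)))))) ⟩
        U (u ^ s ⊗ const 1ℤ ⊗ b ⊗ ⟪ reducer ⟫ a c)
          ≈⟨ dissect-≈ m (⊗-cong ≈-refl (eval-coeffs reducer a c)) ⟩
        U (u ^ s ⊗ const 1ℤ ⊗ b ⊗ eval (coeffs reducer) a c)
          ≈⟨ collect-correct t (coeffs reducer) 0 s weight ⟩
        collect t (coeffs reducer) 0 ⊗ b
          ≈⟨ ⊗-comm (collect t (coeffs reducer) 0) b ⟩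
        b ⊗ collect t (coeffs reducer) 0 ∎)
        where
        b≈ : b ≈ a ⊕ const (ℤ.+ ℕ.pred m) ⊗ c
        b≈ = ≈-trans (solve 2 (λ a b → b := a :+ :- (a :+ :- b)) ≈-refl a b) (⊕-cong ≈-refl (≈-sym (minus-≈ c)))
        1/v : PS
        1/v = twist (h ⊗ h)
        v/v : v ⊗ 1/v ≈ const 1ℤ
        v/v = ≈-trans (≈-sym (pointwise (twist-⊗ u (h ⊗ h)))) (≈-trans (twist-cong (exact EisensteinSeries.u/u))
          (pointwise λ { zero → refl ; (suc n) → ℤ.*-zeroʳ (sign (suc n)) }))
        cancel-b : ∀ {x y} → b ⊗ x ≈ b ⊗ y → x ≈ y
        cancel-b {x} {y} p = ≈-trans (back x) (≈-trans (⊗-cong ≈-refl p) (≈-sym (back y)))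
          where
          back : ∀ z → z ≈ (1/v ⊗ 1/v) ⊗ (b ⊗ z)
          back z = ≈-trans (solve 1 (λ z → z := con 1ℤ :* con 1ℤ :* z) ≈-refl z) (≈-trans (⊗-cong (⊗-cong (≈-sym v/v) (≈-sym v/v)) ≈-refl)
            (solve 3 (λ v w z → (v :* w) :* (v :* w) :* z := (w :* w) :* ((v :* v) :* z)) ≈-refl v 1/v z))

  U-h : ∀ s f → m ≡ suc (s ℕ.+ s) → U (u ^ s) ≈ φ ⊗ f → U h ≈ f
  U-h s f m≡ eq = begin
    U h                        ≈⟨ unit (U h) ⟩
    h ⊗ (φ ⊗ U h)              ≈⟨ ⊗-cong ≈-refl (U-power φ h) ⟨
    h ⊗ U (φ ^ m ⊗ h)          ≈⟨ ⊗-cong ≈-refl (dissect-≈ m φ^m) ⟩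
    h ⊗ U (u ^ s)              ≈⟨ ⊗-cong ≈-refl eq ⟩
    h ⊗ (φ ⊗ f)                ≈⟨ unit f ⟨
    f                          ∎
    where
    unit : ∀ x → x ≈ h ⊗ (φ ⊗ x)
    unit x = ≈-trans (solve 1 (λ x → x := con 1ℤ :* x) ≈-refl x) (≈-trans (⊗-cong (≈-sym (exact hφ)) ≈-refl)
      (solve 3 (λ h f x → h :* f :* x := h :* (f :* x)) ≈-refl h φ x))
    φ^m : φ ^ m ⊗ h ≈ u ^ s
    φ^m = begin
      φ ^ m ⊗ h                      ≈⟨ ⊗-cong (≡⇒≈ (cong (φ ^_) m≡)) ≈-refl ⟩
      φ ⊗ φ ^ (s ℕ.+ s) ⊗ h          ≈⟨ solve 3 (λ f x h → f :* x :* h := h :* (f :* x)) ≈-refl φ (φ ^ (s ℕ.+ s)) h ⟩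
      h ⊗ (φ ⊗ φ ^ (s ℕ.+ s))        ≈⟨ unit (φ ^ (s ℕ.+ s)) ⟨
      φ ^ (s ℕ.+ s)                  ≈⟨ ^-homo-* φ s s ⟩
      φ ^ s ⊗ φ ^ s                  ≈⟨ ^-distrib-* φ φ s ⟨
      (φ ⊗ φ) ^ s                    ≈⟨ ^-congˡ s (exact two-squares) ⟨
      u ^ s                          ∎

  -- h differs from the overpartition series only by signs, which do not affect divisibility.
  congruence : ∀ {f} N → U h ≈ f → M ∣ f ! N → m ℕ.∣ overpartition (N ℕ.* m)
  congruence {f} N eq d = subst (m ℕ.∣_) (trans (ℤ.abs-* (sign (N ℕ.* m)) (ℤ.+ overpartition (N ℕ.* m)))
      (trans (cong (ℕ._* overpartition (N ℕ.* m)) (∣sign∣ (N ℕ.* m))) (ℕ.*-identityˡ _)))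
    (∣⇒∣ᵤ (subst (M ∣_) (lemma (h ! (N ℕ.* m)) (f ! N)) (∣m∣n⇒∣m+n (at eq N) d)))
    where
    lemma : ∀ x y → x - y + y ≡ x
    lemma = solve-∀
    ∣sign∣ : ∀ n → ℤ.∣ sign n ∣ ≡ 1
    ∣sign∣ zero = refl
    ∣sign∣ (suc n) = trans (ℤ.∣-i∣≡∣i∣ (sign n)) (∣sign∣ n)

-- Coefficients of φ times an Eisenstein series

module ThetaCoefficients where
  open PowerSeries
  open ThetaAndDivisorSums using (φ; φ-nonsquare; lambert)
  open ThetaRecurrences using (R₂; R₄; φ⊗lambert₁; φ⊗lambert₄)
  open HeckeRelations using (Z₁; Zχ)
  open DivisorSumRelations using (Θ₂⁴; φ⊗Θ₂⁴-Z₁)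
  open GaussIdentity using (≈⇒≡)
  open RiverIdentities using (χ)
  open FiniteSums using (∑)
  open IndefiniteForms using (forms)
  open import Data.Product using (proj₁)
  open import Data.Integer using (ℤ; _+_; _*_; -_; _-_)
  import Data.Integer as ℤ
  import Data.Integer.Properties as ℤ
  open import Data.Integer.Tactic.RingSolver using (solve-∀)
  open import Function using (id; _∘_)
  open import Relation.Binary.PropositionalEquality using (trans; cong; cong₂)
  open Mod 0

  φ⊗-⊕ : ∀ x y n → (φ ⊗ (x ⊕ y)) ! n ≡ (φ ⊗ x) ! n + (φ ⊗ y) ! n
  φ⊗-⊕ x y = ≈⇒≡ (solve 3 (λ f x y → f :* (x :+ y) := f :* x :+ f :* y) ≈-refl φ x y)

  φ⊗-scale : ∀ k x n → (φ ⊗ (const k ⊗ x)) ! n ≡ k * (φ ⊗ x) ! n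
  φ⊗-scale k x n = trans (≈⇒≡ (solve 3 (λ f k x → f :* (k :* x) := k :* (f :* x)) ≈-refl φ (const k) x) n) (scale k (φ ⊗ x) n)

  module _ (n : ℕ) (nonsquare : ∀ k → ℤ.+ n ≢ k * k) where
    -- The constant contributes a multiple of the coefficient of φ at n, which is 0 at a nonsquare.
    φ⊗-const : ∀ k x → (φ ⊗ (const k ⊕ x)) ! n ≡ (φ ⊗ x) ! n
    φ⊗-const k x = trans (φ⊗-⊕ (const k) x n) (trans (cong (_+ (φ ⊗ x) ! n)
      (trans (≈⇒≡ (⊗-comm φ (const k)) n) (trans (scale k φ n) (trans (cong (k *_) (φ-nonsquare nonsquare)) (ℤ.*-zeroʳ k))))) (ℤ.+-identityˡ _))

    φ⊗-eisenstein : ∀ k i j ω → (φ ⊗ (const k ⊕ (const i ⊗ lambert 1 ω ⊕ const j ⊗ lambert 4 ω))) ! n ≡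
      i * ∑ (forms (ℤ.+ 4 * ℤ.+ n)) (ω ∘ proj₁) + j * ∑ (forms (ℤ.+ n)) (ω ∘ proj₁)
    φ⊗-eisenstein k i j ω = trans (φ⊗-const k (const i ⊗ lambert 1 ω ⊕ const j ⊗ lambert 4 ω)) (trans (φ⊗-⊕ (const i ⊗ lambert 1 ω) (const j ⊗ lambert 4 ω) n)
      (cong₂ _+_ (trans (φ⊗-scale i (lambert 1 ω) n) (cong (i *_) (φ⊗lambert₁ n ω))) (trans (φ⊗-scale j (lambert 4 ω) n) (cong (j *_) (φ⊗lambert₄ n ω)))))

    φ⊗R₂ : (φ ⊗ R₂) ! n ≡ ℤ.+ 4 * Zχ (ℤ.+ 4 * ℤ.+ n)
    φ⊗R₂ = trans (φ⊗-const ℤ.1ℤ (const (ℤ.+ 4) ⊗ lambert 1 χ)) (trans (φ⊗-scale (ℤ.+ 4) (lambert 1 χ) n) (cong (ℤ.+ 4 *_) (φ⊗lambert₁ n χ)))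

    φ⊗R₄ : (φ ⊗ R₄) ! n ≡ ℤ.+ 8 * Z₁ (ℤ.+ 4 * ℤ.+ n) + - ℤ.+ 32 * Z₁ (ℤ.+ n)
    φ⊗R₄ = φ⊗-eisenstein ℤ.1ℤ (ℤ.+ 8) (- ℤ.+ 32) id

    φ⊗[R₄+5Θ₂⁴] : (φ ⊗ (R₄ ⊕ const (ℤ.+ 5) ⊗ Θ₂⁴)) ! n ≡ ℤ.+ 40 * Z₁ (ℤ.+ 4 * ℤ.+ n) + - ℤ.+ 64 * Z₁ (ℤ.+ n)
    φ⊗[R₄+5Θ₂⁴] = trans (φ⊗-⊕ R₄ (const (ℤ.+ 5) ⊗ Θ₂⁴) n) (trans (cong₂ _+_ φ⊗R₄ (trans (φ⊗-scale (ℤ.+ 5) Θ₂⁴ n) (φ⊗Θ₂⁴-Z₁ n nonsquare)))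
      (lemma (Z₁ (ℤ.+ 4 * ℤ.+ n)) (Z₁ (ℤ.+ n))))
      where
      lemma : ∀ x y → ℤ.+ 8 * x + - ℤ.+ 32 * y + ℤ.+ 32 * (x - y) ≡ ℤ.+ 40 * x + - ℤ.+ 64 * y
      lemma = solve-∀

-- Divisibility of the form sums at ℓ³n

module HeckeDivisibility (ℓ : ℕ) (ℓ-prime : Prime ℓ) (ℓ≢2 : ℓ ≢ 2) (n : ℕ) (n⊥ℓ : Coprime n ℓ) where
  open HeckeRelations using (cube; Z₁; Z₃; Zχ; hecke₁; hecke₃; heckeχ)
  open Cosets ℓ ℓ-prime ℓ≢2 using (euclid; euclid-square; ∤2; D-nonsquare; cancelL)
  open import Data.Integer using (ℤ; 1ℤ; _+_; _*_)
  import Data.Integer as ℤ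
  import Data.Integer.Properties as ℤ
  import Data.Integer.Divisibility.Signed as ℤ
  open import Data.Integer.Tactic.RingSolver using (solve-∀)
  import Data.Nat as ℕ
  import Data.Nat.Divisibility as ℕ
  import Data.Nat.Properties as ℕ
  open import Data.Product using (_,_)
  open import Data.Sum using ([_,_]′)
  open import Function using (_∘_)
  open import Relation.Binary.PropositionalEquality using (sym; trans; cong; cong₂; subst)
  open import Relation.Nullary using (¬_)
  private
    L = ℤ.+ ℓ

  N : ℕ
  N = ℓ ℕ.* ℓ ℕ.* (ℓ ℕ.* n)

  N≡ : ℤ.+ N ≡ L * L * (L * ℤ.+ n)
  N≡ = trans (ℤ.pos-* (ℓ ℕ.* ℓ) (ℓ ℕ.* n)) (cong₂ _*_ (ℤ.pos-* ℓ ℓ) (ℤ.pos-* ℓ n))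

  4N≡ : ℤ.+ 4 * ℤ.+ N ≡ L * L * (L * (ℤ.+ 4 * ℤ.+ n))
  4N≡ = trans (cong (ℤ.+ 4 *_) N≡) (lemma L (ℤ.+ n))
    where
    lemma : ∀ l n → ℤ.+ 4 * (l * l * (l * n)) ≡ l * l * (l * (ℤ.+ 4 * n))
    lemma = solve-∀

  ∤n : ¬ L ℤ.∣ ℤ.+ n
  ∤n d = ℕ.nonTrivial⇒≢1 {{Data.Nat.Primality.prime⇒nonTrivial ℓ-prime}} (n⊥ℓ (ℤ.∣⇒∣ᵤ d , ℕ.∣-refl))

  ∤4n : ¬ L ℤ.∣ ℤ.+ 4 * ℤ.+ n
  ∤4n d = [ ∤2 ∘ euclid-square (ℤ.+ 2) , ∤n ]′ (euclid (ℤ.+ 4) (ℤ.+ n) d)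

  -- ℓ divides N exactly three times. A square root of N would be divisible by ℓ, and removing ℓ²
  -- leaves ℓn, which `D-nonsquare` excludes.
  nonsquare : ∀ k → ℤ.+ N ≢ k * k
  nonsquare k eq = go (euclid-square k (ℤ.divides (L * (L * ℤ.+ n)) (trans (sym eq) (trans N≡ (lemma L (ℤ.+ n))))))
    where
    lemma : ∀ l n → l * l * (l * n) ≡ l * (l * n) * l
    lemma = solve-∀
    lemma₂ : ∀ l n → l * n * l * l ≡ l * l * (l * n)
    lemma₂ = solve-∀
    lemma₃ : ∀ q l → q * l * (q * l) ≡ q * q * l * l
    lemma₃ = solve-∀
    go : ¬ L ℤ.∣ k
    go (ℤ.divides q k≡) = D-nonsquare (ℤ.+ n) ∤n q (cancelL {L * ℤ.+ n} {q * q} (cancelL {L * ℤ.+ n * L} {q * q * L}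
      (trans (lemma₂ L (ℤ.+ n)) (trans (sym N≡) (trans eq (trans (cong₂ _*_ k≡ k≡) (lemma₃ q L)))))))

  module _ (m : ℤ) where
    Z₁-∣ : m ℤ.∣ 1ℤ + cube L → ∀ i j → m ℤ.∣ i * Z₁ (ℤ.+ 4 * ℤ.+ N) + j * Z₁ (ℤ.+ N)
    Z₁-∣ d i j = ℤ.∣m∣n⇒∣m+n
      (ℤ.∣n⇒∣m*n i (subst (m ℤ.∣_) (sym (trans (cong Z₁ 4N≡) (hecke₁ ℓ ℓ-prime ℓ≢2 (ℤ.+ 4 * ℤ.+ n) ∤4n))) (ℤ.∣m⇒∣m*n (Z₁ (L * (ℤ.+ 4 * ℤ.+ n))) d)))
      (ℤ.∣n⇒∣m*n j (subst (m ℤ.∣_) (sym (trans (cong Z₁ N≡) (hecke₁ ℓ ℓ-prime ℓ≢2 (ℤ.+ n) ∤n))) (ℤ.∣m⇒∣m*n (Z₁ (L * ℤ.+ n)) d)))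

    Z₃-∣ : m ℤ.∣ 1ℤ + L * (cube L * cube L) → ∀ i j → m ℤ.∣ i * Z₃ (ℤ.+ 4 * ℤ.+ N) + j * Z₃ (ℤ.+ N)
    Z₃-∣ d i j = ℤ.∣m∣n⇒∣m+n
      (ℤ.∣n⇒∣m*n i (subst (m ℤ.∣_) (sym (trans (cong Z₃ 4N≡) (hecke₃ ℓ ℓ-prime ℓ≢2 (ℤ.+ 4 * ℤ.+ n) ∤4n))) (ℤ.∣m⇒∣m*n (Z₃ (L * (ℤ.+ 4 * ℤ.+ n))) d)))
      (ℤ.∣n⇒∣m*n j (subst (m ℤ.∣_) (sym (trans (cong Z₃ N≡) (hecke₃ ℓ ℓ-prime ℓ≢2 (ℤ.+ n) ∤n))) (ℤ.∣m⇒∣m*n (Z₃ (L * ℤ.+ n)) d)))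

    Zχ-∣ : m ℤ.∣ 1ℤ + L → ∀ i → m ℤ.∣ i * Zχ (ℤ.+ 4 * ℤ.+ N)
    Zχ-∣ d i = ℤ.∣n⇒∣m*n i (subst (m ℤ.∣_) (sym (trans (cong Zχ 4N≡) (heckeχ ℓ ℓ-prime ℓ≢2 (ℤ.+ n) ∤4n)))
      (ℤ.∣m⇒∣m*n (Zχ (L * (ℤ.+ 4 * ℤ.+ n))) d))

-- The series U(h) modulo 3, 5, 7 and 11

module Reductions where
  open PowerSeries
  open ThetaAndDivisorSums using (φ; lambert)
  open ThetaRecurrences using (R₂; R₄)
  open HeckeRelations using (cube)
  open DivisorSumRelations using (Θ₂⁴; lambert-expand)
  open GaussIdentity using (h)
  open ThetaFunctions using (u; v; a; b; c; two-squares; four-squares)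
  open LandenTransformation using (b-twist)
  open EisensteinSeries using (E₄; E₄-theta)
  open import Data.Integer using (1ℤ)
  import Data.Integer as ℤ
  open import Data.Nat.Primality using (prime?)
  open import Data.Vec using ([]; _∷_)
  open import Relation.Binary.PropositionalEquality using (refl; sym)
  open import Relation.Nullary.Decidable using (from-yes)

  module Modulo3 where
    open CartierOperator 3 (from-yes (prime? 3)) (λ ()) refl (λ ()) refl public
    -- The list holds the squares of the binomial coefficients of (m - 1)/2, reduced modulo m: the
    -- Hasse polynomial of the Legendre family in λ = c/a. The number after it is the inverse of 4
    -- modulo m.
    open Hasse (1 ∷ 1 ∷ []) 1 refl refl refl
    open Mod 3
    open SeriesMapsMod 3
    open import Relation.Binary.Reasoning.Setoid setoid

    f : PS
    f = φ ⊗ R₄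

    U-h-f : U h ≈ f
    U-h-f = U-h 1 f refl (begin
      -- The weight s + 2(m - 1) + σ(m - 1), with s = (m - 1)/2, has to equal mt. This amounts to 2σ
      -- ≡ -5 modulo m, and the least solution is taken: here σ = 2 and 1 + 4 + 4 = 9 = 3·3.
      U (u ^ 1)          ≈⟨ U-u^ 2 1 3 refl ⟩
      const 1ℤ ⊗ (u ^ 3 ⊗ c ^ 0) ⊕ (const ℤ.0ℤ ⊗ (u ^ 1 ⊗ c ^ 1) ⊕ const ℤ.0ℤ)
        ≈⟨ solve 2 (λ u c → con 1ℤ :* (u :^ 3 :* c :^ 0) :+ (con ℤ.0ℤ :* (u :^ 1 :* c :^ 1) :+ con ℤ.0ℤ) := u :* (u :* u)) ≈-refl u c ⟩
      u ⊗ a              ≈⟨ ⊗-cong (exact two-squares) (≈-sym (exact four-squares)) ⟩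
      φ ⊗ φ ⊗ R₄         ≈⟨ solve 2 (λ f r → f :* f :* r := f :* (f :* r)) ≈-refl φ R₄ ⟩
      φ ⊗ (φ ⊗ R₄)       ∎)

  module Modulo5 where
    open CartierOperator 5 (from-yes (prime? 5)) (λ ()) refl (λ ()) refl public
    -- A constant form of degree 0, in accordance with σ = 0: u² b⁴ has weight 2 + 8 = 10, already a
    -- multiple of 5.
    open Hasse (1 ∷ []) 4 refl refl refl
    open Mod 5
    open SeriesMapsMod 5
    open import Relation.Binary.Reasoning.Setoid setoid

    f : PS
    f = φ ⊗ R₂

    U-h-f : U h ≈ f
    U-h-f = U-h 2 f refl (begin
      U (u ^ 2)          ≈⟨ U-u^ 0 2 2 refl ⟩
      const 1ℤ ⊗ (u ^ 2 ⊗ c ^ 0) ⊕ const ℤ.0ℤ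
        ≈⟨ solve 2 (λ u c → con 1ℤ :* (u :^ 2 :* c :^ 0) :+ con ℤ.0ℤ := u :* u) ≈-refl u c ⟩
      u ⊗ u              ≈⟨ ⊗-cong (exact two-squares) ≈-refl ⟩
      φ ⊗ φ ⊗ R₂         ≈⟨ solve 2 (λ f r → f :* f :* r := f :* (f :* r)) ≈-refl φ R₂ ⟩
      φ ⊗ (φ ⊗ R₂)       ∎)

  module Modulo7 where
    open CartierOperator 7 (from-yes (prime? 7)) (λ ()) refl (λ ()) refl public
    -- 1, 9, 9, 1 modulo 7, the squares of the binomial coefficients of 3.
    open Hasse (1 ∷ 2 ∷ 2 ∷ 1 ∷ []) 2 refl refl refl
    open Mod 7
    open SeriesMapsMod 7
    open import Relation.Binary.Reasoning.Setoid setoid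

    f : PS
    f = φ ⊗ (R₄ ⊕ const (ℤ.+ 5) ⊗ Θ₂⁴)

    U-h-f : U h ≈ f
    U-h-f = U-h 3 f refl (begin
      U (u ^ 3)          ≈⟨ U-u^ 1 3 3 refl ⟩
      -- The value of `collect`. Modulo 7 all coefficients of (a - c)⁶ are 1, so in its product with
      -- the Hasse form the coefficient of c⁷ is 2 + 2 + 1 = 5.
      const 1ℤ ⊗ (u ^ 3 ⊗ c ^ 0) ⊕ (const (ℤ.+ 5) ⊗ (u ^ 1 ⊗ c ^ 1) ⊕ const ℤ.0ℤ)
        ≈⟨ solve 2 (λ u c → con 1ℤ :* (u :^ 3 :* c :^ 0) :+ (con (ℤ.+ 5) :* (u :^ 1 :* c :^ 1) :+ con ℤ.0ℤ) := u :* (u :* u :+ con (ℤ.+ 5) :* c)) ≈-refl u c ⟩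
      u ⊗ (a ⊕ const (ℤ.+ 5) ⊗ c)
        ≈⟨ ⊗-cong (exact two-squares) (⊕-cong (exact a≈) (⊗-cong ≈-refl (⊕-cong (exact a≈) (⊝-cong (exact b-twist))))) ⟩
      φ ⊗ φ ⊗ (R₄ ⊕ const (ℤ.+ 5) ⊗ Θ₂⁴)
        ≈⟨ solve 2 (λ f r → f :* f :* r := f :* (f :* r)) ≈-refl φ (R₄ ⊕ const (ℤ.+ 5) ⊗ Θ₂⁴) ⟩
      φ ⊗ (φ ⊗ (R₄ ⊕ const (ℤ.+ 5) ⊗ Θ₂⁴)) ∎)
      where
      a≈ = Mod.≈-sym 0 four-squares

  module Modulo11 where
    open CartierOperator 11 (from-yes (prime? 11)) (λ ()) refl (λ ()) refl public
    -- 1, 25, 100, 100, 25, 1 modulo 11, the squares of the binomial coefficients of 5.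
    open Hasse (1 ∷ 3 ∷ 1 ∷ 1 ∷ 3 ∷ 1 ∷ []) 3 refl refl refl
    open Mod 11
    open SeriesMapsMod 11
    open Homogeneous 11
    open import Relation.Binary.Reasoning.Setoid setoid

    -- 8 E₄(q) + 4 E₄(q⁴) written out: 12 = 8 + 4, 1920 = 8·240 and 960 = 4·240. Modulo 11 the two
    -- series are a² + 3ac + c² and a² - ac + 9c², and (8, 4) solves the linear system for a² + 9ac,
    -- the form that U produces.
    e : PS
    e = const (ℤ.+ 12) ⊕ (const (ℤ.+ 1920) ⊗ lambert 1 cube ⊕ const (ℤ.+ 960) ⊗ lambert 4 cube)

    f : PS
    f = φ ⊗ e

    -- E₄(q) = a² + 14ac + c² and E₄(q²) = a² - ab + b², reduced modulo 11.
    E₄-ac E₄-ab : Coeffs 2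
    E₄-ac = 1 ∷ 3 ∷ 1 ∷ []
    E₄-ab = 1 ∷ 10 ∷ 1 ∷ []

    E₄≈ : E₄ ≈ eval E₄-ac a c
    E₄≈ = ≈-trans (exact E₄-theta) (≈-trans (⊕-cong (⊕-cong ≈-refl (⊗-cong (≈-sym (const-% 14)) ≈-refl)) ≈-refl)
      (solve 2 (λ a c → a :* a :+ con (ℤ.+ 3) :* (a :* c) :+ c :* c := con 1ℤ :* (a :* (a :* con 1ℤ)) :+ c :* (con (ℤ.+ 3) :* (a :* con 1ℤ) :+ c :* con 1ℤ)) ≈-refl a c))

    E₄₂ : expand 2 E₄ ≈ eval E₄-ab a b
    E₄₂ = begin
      expand 2 E₄                              ≈⟨ expand-≈ 2 E₄≈ ⟩
      expand 2 (eval E₄-ac a c)                ≈⟨ expand-eval-ac 3 refl E₄-ac ⟩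
      ⟪ compose E₄-ac (a₂F 3 refl) (c₂F 3 refl) ⟫ u v
        ≈⟨ form-≈ (compose E₄-ac (a₂F 3 refl) (c₂F 3 refl)) (compose E₄-ab (X ⊠ X) (Y ⊠ Y)) u v refl ⟩
      ⟪ compose E₄-ab (X ⊠ X) (Y ⊠ Y) ⟫ u v    ≈⟨ ≡⇒≈ (eval-compose E₄-ab (X ⊠ X) (Y ⊠ Y) u v) ⟩
      eval E₄-ab a b                           ∎

    -- A second step q ↦ q², now on a form in a and b, where a(q²) = ((u + v)/2)² and b(q²) = uv.
    -- Over the rationals the result is a² - ac + c²/16.
    E₄₄ : expand 2 (expand 2 E₄) ≈ ⟪ compose E₄-ab (a₂F 3 refl) (X ⊠ Y) ⟫ u v
    E₄₄ = ≈-trans (expand-≈ 2 E₄₂) (≈-trans (expand-eval E₄-ab a b) (≈-trans (eval-cong E₄-ab (a₂ 3 refl) b₂)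
      (≡⇒≈ (sym (eval-compose E₄-ab (a₂F 3 refl) (X ⊠ Y) u v)))))

    lambert₄ : expand 2 (expand 2 E₄) ≈ const 1ℤ ⊕ const (ℤ.+ 240) ⊗ lambert 4 cube
    lambert₄ = ≈-trans (expand-≈ 2 (step (lambert 1 cube))) (≈-trans (step (expand 2 (lambert 1 cube)))
      (⊕-cong ≈-refl (⊗-cong ≈-refl (≈-trans (expand-≈ 2 (≈-sym (pointwise (lambert-expand 2 1 cube)))) (≈-sym (pointwise (lambert-expand 2 2 cube)))))))
      where
      step : ∀ x → expand 2 (const 1ℤ ⊕ const (ℤ.+ 240) ⊗ x) ≈ const 1ℤ ⊕ const (ℤ.+ 240) ⊗ expand 2 x
      step x = ≈-trans (expand-sum 2 (const 1ℤ) (const (ℤ.+ 240) ⊗ x)) (⊕-cong (expand-constant 2 1ℤ)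
        (≈-trans (expand-product 2 (const (ℤ.+ 240)) x) (⊗-cong (expand-constant 2 (ℤ.+ 240)) ≈-refl)))

    target : Coeffs 2
    target = 1 ∷ 9 ∷ 0 ∷ []

    e≈ : e ≈ eval target a c
    e≈ = begin
      e
        ≈⟨ solve 2 (λ x y → con (ℤ.+ 12) :+ (con (ℤ.+ 1920) :* x :+ con (ℤ.+ 960) :* y)
             := con (ℤ.+ 8) :* (con 1ℤ :+ con (ℤ.+ 240) :* x) :+ con (ℤ.+ 4) :* (con 1ℤ :+ con (ℤ.+ 240) :* y)) ≈-refl (lambert 1 cube) (lambert 4 cube) ⟩
      const (ℤ.+ 8) ⊗ E₄ ⊕ const (ℤ.+ 4) ⊗ (const 1ℤ ⊕ const (ℤ.+ 240) ⊗ lambert 4 cube)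
        ≈⟨ ⊕-cong (⊗-cong ≈-refl (≈-trans E₄≈ (eval-ac E₄-ac))) (⊗-cong ≈-refl (≈-trans (≈-sym lambert₄) E₄₄)) ⟩
      ⟪ cst 8 ⊠ compose E₄-ac aF cF ⊞ cst 4 ⊠ compose E₄-ab (a₂F 3 refl) (X ⊠ Y) ⟫ u v
        ≈⟨ form-≈ (cst 8 ⊠ compose E₄-ac aF cF ⊞ cst 4 ⊠ compose E₄-ab (a₂F 3 refl) (X ⊠ Y)) (compose target aF cF) u v refl ⟩
      ⟪ compose target aF cF ⟫ u v
        ≈⟨ eval-ac target ⟨
      eval target a c ∎

    U-h-f : U h ≈ f
    U-h-f = U-h 5 f refl (begin
      U (u ^ 5)          ≈⟨ U-u^ 3 5 5 refl ⟩
      const 1ℤ ⊗ (u ^ 5 ⊗ c ^ 0) ⊕ (const (ℤ.+ 9) ⊗ (u ^ 3 ⊗ c ^ 1) ⊕ (const ℤ.0ℤ ⊗ (u ^ 1 ⊗ c ^ 2) ⊕ const ℤ.0ℤ))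
        ≈⟨ solve 2 (λ u c → con 1ℤ :* (u :^ 5 :* c :^ 0) :+ (con (ℤ.+ 9) :* (u :^ 3 :* c :^ 1) :+ (con ℤ.0ℤ :* (u :^ 1 :* c :^ 2) :+ con ℤ.0ℤ))
             := u :* (con 1ℤ :* (u :* u :* (u :* u :* con 1ℤ)) :+ c :* (con (ℤ.+ 9) :* (u :* u :* con 1ℤ) :+ c :* con ℤ.0ℤ))) ≈-refl u c ⟩
      u ⊗ eval target a c
        ≈⟨ ⊗-cong (exact two-squares) (≈-sym e≈) ⟩
      φ ⊗ φ ⊗ e
        ≈⟨ solve 2 (λ f r → f :* f :* r := f :* (f :* r)) ≈-refl φ e ⟩
      φ ⊗ (φ ⊗ e) ∎)

-- The four congruences

module OverpartitionCongruences (ℓ : ℕ) (ℓ-prime : Prime ℓ) (ℓ≢2 : ℓ ≢ 2) (n : ℕ) (n⊥ℓ : Coprime n ℓ) where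
  open HeckeDivisibility ℓ ℓ-prime ℓ≢2 n n⊥ℓ
  open HeckeRelations using (cube)
  open ThetaCoefficients
  open Reductions
  open import Data.Integer using (1ℤ)
  import Data.Integer as ℤ
  import Data.Integer.Divisibility.Signed as ℤ
  import Data.Integer.Properties as ℤ
  open import Data.Integer.Tactic.RingSolver using () renaming (solve-∀ to solveℤ-∀)
  open import Data.Nat using (zero; suc; _+_; _*_; _^_)
  open import Data.Nat.Divisibility using (_∣_)
  open import Data.Nat.Tactic.RingSolver using (solve-∀)
  open import Relation.Binary.PropositionalEquality using (refl; sym; trans; cong; subst)

  private
    L = ℤ.+ ℓ

    pos-^ : ∀ k → ℤ.+ (ℓ ^ k) ≡ L ℤ.^ k
    pos-^ zero = refl
    pos-^ (suc k) = trans (ℤ.pos-* ℓ (ℓ ^ k)) (cong (L ℤ.*_) (pos-^ k))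

    signed : ∀ {m} k {x} → L ℤ.^ k ℤ.+ 1ℤ ≡ x → m ∣ ℓ ^ k + 1 → ℤ.+ m ℤ.∣ x
    signed {m} k eq d = subst (ℤ.+ m ℤ.∣_) (trans (ℤ.pos-+ (ℓ ^ k) 1) (trans (cong (ℤ._+ 1ℤ) (pos-^ k)) eq)) (ℤ.∣ᵤ⇒∣ d)

    at-N : ∀ m → m ∣ overpartition (N * m) → m ∣ overpartition (m * ℓ ^ 3 * n)
    at-N m = subst (λ i → m ∣ overpartition i) (lemma ℓ n m)
      where
      lemma : ∀ l n m → l * l * (l * n) * m ≡ m * (l * (l * (l * 1))) * n
      lemma = solve-∀

    cubic : L ℤ.^ 3 ℤ.+ 1ℤ ≡ 1ℤ ℤ.+ cube L
    cubic = lemma L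
      where
      lemma : ∀ l → l ℤ.* (l ℤ.* (l ℤ.* 1ℤ)) ℤ.+ 1ℤ ≡ 1ℤ ℤ.+ l ℤ.* l ℤ.* l
      lemma = solveℤ-∀

    linear : L ℤ.^ 1 ℤ.+ 1ℤ ≡ 1ℤ ℤ.+ L
    linear = lemma L
      where
      lemma : ∀ l → l ℤ.* 1ℤ ℤ.+ 1ℤ ≡ 1ℤ ℤ.+ l
      lemma = solveℤ-∀

    septic : L ℤ.^ 7 ℤ.+ 1ℤ ≡ 1ℤ ℤ.+ L ℤ.* (cube L ℤ.* cube L)
    septic = lemma L
      where
      lemma : ∀ l → l ℤ.* (l ℤ.* (l ℤ.* (l ℤ.* (l ℤ.* (l ℤ.* (l ℤ.* 1ℤ)))))) ℤ.+ 1ℤ ≡ 1ℤ ℤ.+ l ℤ.* (l ℤ.* l ℤ.* l ℤ.* (l ℤ.* l ℤ.* l))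
      lemma = solveℤ-∀

  -- The exponent `kOf m ∸ 2` is 3, 1, 3, 7 for m = 3, 5, 7, 11. It is the exponent of ℓ in the
  -- Hecke factor 1 + ℓκ(ℓ) belonging to the sums in the coefficients of U(h): `Z₁`, `Zχ`, `Z₁` and
  -- `Z₃` respectively.
  modulo-3 : 3 ∣ ℓ ^ 3 + 1 → 3 ∣ overpartition (3 * ℓ ^ 3 * n)
  modulo-3 d = at-N 3 (Modulo3.congruence N Modulo3.U-h-f
    (subst (ℤ.+ 3 ℤ.∣_) (sym (φ⊗R₄ N nonsquare)) (Z₁-∣ (ℤ.+ 3) (signed 3 cubic d) (ℤ.+ 8) (ℤ.- ℤ.+ 32))))

  modulo-5 : 5 ∣ ℓ ^ 1 + 1 → 5 ∣ overpartition (5 * ℓ ^ 3 * n)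
  modulo-5 d = at-N 5 (Modulo5.congruence N Modulo5.U-h-f
    (subst (ℤ.+ 5 ℤ.∣_) (sym (φ⊗R₂ N nonsquare)) (Zχ-∣ (ℤ.+ 5) (signed 1 linear d) (ℤ.+ 4))))

  modulo-7 : 7 ∣ ℓ ^ 3 + 1 → 7 ∣ overpartition (7 * ℓ ^ 3 * n)
  modulo-7 d = at-N 7 (Modulo7.congruence N Modulo7.U-h-f
    (subst (ℤ.+ 7 ℤ.∣_) (sym (φ⊗[R₄+5Θ₂⁴] N nonsquare)) (Z₁-∣ (ℤ.+ 7) (signed 3 cubic d) (ℤ.+ 40) (ℤ.- ℤ.+ 64))))

  modulo-11 : 11 ∣ ℓ ^ 7 + 1 → 11 ∣ overpartition (11 * ℓ ^ 3 * n)
  modulo-11 d = at-N 11 (Modulo11.congruence N Modulo11.U-h-f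
    (subst (ℤ.+ 11 ℤ.∣_) (sym (φ⊗-eisenstein N nonsquare (ℤ.+ 12) (ℤ.+ 1920) (ℤ.+ 960) cube)) (Z₃-∣ (ℤ.+ 11) (signed 7 septic d) (ℤ.+ 1920) (ℤ.+ 960))))

open import Defs
open import Data.Nat using (_+_; _*_; _∸_; _^_; _<_)
open import Data.Nat.Divisibility using (_∣_)
open import Data.Sum using (_⊎_; inj₁; inj₂)
open import Relation.Binary.PropositionalEquality using (refl)

theorem1p2 : (m ℓ : ℕ) →
    (m ≡ 3 ⊎ m ≡ 5 ⊎ m ≡ 7 ⊎ m ≡ 11) →
    Prime ℓ → ℓ ≢ 2 →
    m ∣ (ℓ ^ (kOf m ∸ 2) + 1) →
    (n : ℕ) → 0 < n → Coprime n ℓ →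
    m ∣ overpartition (m * ℓ ^ 3 * n)
theorem1p2 _ ℓ (inj₁ refl) ℓ-prime ℓ≢2 m∣ n _ n⊥ℓ = OverpartitionCongruences.modulo-3 ℓ ℓ-prime ℓ≢2 n n⊥ℓ m∣
theorem1p2 _ ℓ (inj₂ (inj₁ refl)) ℓ-prime ℓ≢2 m∣ n _ n⊥ℓ = OverpartitionCongruences.modulo-5 ℓ ℓ-prime ℓ≢2 n n⊥ℓ m∣
theorem1p2 _ ℓ (inj₂ (inj₂ (inj₁ refl))) ℓ-prime ℓ≢2 m∣ n _ n⊥ℓ = OverpartitionCongruences.modulo-7 ℓ ℓ-prime ℓ≢2 n n⊥ℓ m∣
theorem1p2 _ ℓ (inj₂ (inj₂ (inj₂ refl))) ℓ-prime ℓ≢2 m∣ n _ n⊥ℓ = OverpartitionCongruences.modulo-11 ℓ ℓ-prime ℓ≢2 n n⊥ℓ m∣
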